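{- Let $q$ be a power of $3$ and let $G=PGL_2(q)$, so $|G|=q^3-q$. The set of (projective) binary quartic forms $f$ over $\mathbb{F}_q$ with $\Delta(f)\neq 0$ has $q^4-q^2$ elements and decomposes into exactly $2q+2$ $G$-orbits, described as follows. (i) For each $i\in\{1,2,4\}$ and each $r\in J_i$, there are exactly $i$ $G$-orbits of forms with $\Delta(f)\neq0$ and $\jmath(f)=r$, and each of them has size $|G|/i$. For $i\in\{2,4\}$, exactly one of these $i$ orbits is contained in $\mathcal{F}_i$ and the remaining $i-1$ orbits are contained in $\mathcal{F}_i'$. (ii) There are exactly five $G$-orbits of forms with $\Delta(f)\ne 0$ and $\jmath(f)=0$: one contained in each of $\mathcal{F}_1,\mathcal{F}_2,\mathcal{F}_4,\mathcal{F}_2',\mathcal{F}_4'$. Their sizes are: one orbit of size $|G|/3$, two orbits of size $|G|/4$, one of size $|G|/8$ and one of size $|G|/24$. There are no other orbits.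
   Context: A binary quartic form over $\mathbb{F}_q$ is $f(X,Y)=z_0X^4+z_1X^3Y+z_2X^2Y^2+z_3XY^3+z_4Y^4$ with $z_i\in\mathbb{F}_q$ not all zero; forms are considered up to nonzero scalar multiples (points of the projective space of quartic forms). For $g=\begin{pmatrix} a&b\\ c&d\end{pmatrix}\in GL_2(\mathbb{F}_q)$ set $g\cdot f(X,Y)=\det(g)^{ -4}f(dX-bY,aY-cX)$; this induces an action of $G=PGL_2(q)$ on projective quartic forms. The discriminant is $\Delta(f)=(z_0z_4-z_1z_3)^3+(z_0z_4-z_1z_3)^2z_2^2-z_2^3(z_0z_3^2+z_4z_1^2-z_0z_2z_4)$; it vanishes iff $f$ has a repeated factor over $\overline{\mathbb{F}_q}$. For $\Delta(f)\neq0$ the $\jmath$-invariant is $\jmath(f)=z_2^6/\Delta(f)$. Forms with $\Delta(f)\ne0$ are partitioned according to their factorization into irreducible factors over $\mathbb{F}_q$: $\mathcal{F}_4$: four linear factors; $\mathcal{F}_2$: two linear factors and an irreducible quadratic; $\mathcal{F}_1$: one linear factor and an irreducible cubic; $\mathcal{F}_4'$: two irreducible quadratics; $\mathcal{F}_2'$: $f$ irreducible. The sets $J_i\subset\mathbb{F}_q^\times$ are: $J_2=\{r\in\mathbb{F}_q^\times: r$ is a non-square$\}$; $J_4=\{r\in\mathbb{F}_q^\times: r$ is a square and $\mathrm{Tr}_{\mathbb{F}_q/\mathbb{F}_3}(1/\sqrt r)=0\}$; $J_1=\{r\in\mathbb{F}_q^\times: r$ is a square and $\mathrm{Tr}_{\mathbb{F}_q/\mathbb{F}_3}(1/\sqrt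 r)\neq0\}$ (the condition does not depend on the choice of $\sqrt r$). -}

module Defs where

open import Level using (0ℓ)
open import Data.Nat as ℕ using (ℕ; zero; suc)
open import Data.Product using (Σ; Σ-syntax; ∃; ∃-syntax; _×_; _,_)
open import Data.List as List using (List; []; _∷_; length)
open import Data.List.Relation.Unary.All using (All)
open import Data.List.Relation.Unary.Any using (Any)
open import Data.List.Relation.Unary.AllPairs using (AllPairs)
open import Data.List.Relation.Unary.Unique.Propositional using (Unique)
open import Data.List.Membership.Propositional using (_∈_)
open import Data.Vec as Vec using (Vec; _∷_; [])
open import Relation.Nullary using (¬_)
open import Relation.Binary.PropositionalEquality using (_≡_; _≢_)
open import Relation.Binary.Definitions using (DecidableEquality)
open import Algebra.Structures using (IsCommutativeRing)

-- Fields (equality is propositional equality).  _⁻¹ is a total function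
-- whose value at 0 is irrelevant; it is a two-sided inverse on nonzero x.

record Field : Set₁ where
  infixl 6 _+_
  infixl 7 _*_
  field
    Carrier : Set
    _+_ _*_ : Carrier → Carrier → Carrier
    -_      : Carrier → Carrier
    _⁻¹     : Carrier → Carrier
    0# 1#   : Carrier
    isCommutativeRing : IsCommutativeRing _≡_ _+_ _*_ -_ 0# 1#
    0≢1     : 0# ≢ 1#
    ⁻¹-inverse : ∀ x → x ≢ 0# → x * (x ⁻¹) ≡ 1#
    _≟_     : DecidableEquality Carrier

HasSize : Field → ℕ → Set
HasSize F q = Σ[ xs ∈ List (Field.Carrier F) ]
  (Unique xs × (∀ x → x ∈ xs) × length xs ≡ q)

ClassReps : {A : Set} → (A → A → Set) → (A → Set) → List A → Set
ClassReps R P reps =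
  All P reps × AllPairs (λ x y → ¬ R x y) reps × (∀ x → P x → Any (R x) reps)

ClassCount : {A : Set} → (A → A → Set) → (A → Set) → ℕ → Set
ClassCount R P k = Σ[ reps ∈ _ ] (ClassReps R P reps × length reps ≡ k)

∣PGL₂∣ : ℕ → ℕ
∣PGL₂∣ q = q ℕ.^ 3 ℕ.∸ q

module Theory (F : Field) where
  open Field F

  infixl 6 _-_
  infixr 8 _^ᶠ_
  _-_ : Carrier → Carrier → Carrier
  x - y = x + (- y)

  _^ᶠ_ : Carrier → ℕ → Carrier
  x ^ᶠ zero  = 1#
  x ^ᶠ suc k = x * (x ^ᶠ k)

  -- Tr_{F_{3^n}/F_3}(x) = x + x^3 + ... + x^(3^(n-1))
  Tr : ℕ → Carrier → Carrier
  Tr zero    x = 0#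
  Tr (suc k) x = Tr k x + x ^ᶠ (3 ℕ.^ k)

  IsSquare : Carrier → Set
  IsSquare r = ∃[ s ] s * s ≡ r

  J₂ : Carrier → Set
  J₂ r = r ≢ 0# × ¬ IsSquare r

  -- n with q = 3^n
  J₄ : ℕ → Carrier → Set
  J₄ n r = r ≢ 0# × ∃[ s ] (s * s ≡ r × Tr n (s ⁻¹) ≡ 0#)

  J₁ : ℕ → Carrier → Set
  J₁ n r = r ≢ 0# × ∃[ s ] (s * s ≡ r × Tr n (s ⁻¹) ≢ 0#)

  -- Binary forms of degree d as coefficient lists [c₀,…,c_d], where cᵢ is
  -- the coefficient of X^(d-i) Y^i.  Product = convolution.

  addL : List Carrier → List Carrier → List Carrier
  addL []       ys       = ys
  addL (x ∷ xs) []       = x ∷ xs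
  addL (x ∷ xs) (y ∷ ys) = (x + y) ∷ addL xs ys

  scaleL : Carrier → List Carrier → List Carrier
  scaleL c = List.map (c *_)

  _⊗_ : List Carrier → List Carrier → List Carrier
  []      ⊗ q = []
  (a ∷ p) ⊗ q = addL (scaleL a q) (0# ∷ (p ⊗ q))

  powL : List Carrier → ℕ → List Carrier
  powL p zero    = 1# ∷ []
  powL p (suc k) = p ⊗ powL p k

  Irreducible : ℕ → List Carrier → Set
  Irreducible d p =
    length p ≡ suc d × ¬ All (_≡ 0#) p ×
    (∀ a b (g h : List Carrier) → 1 ℕ.≤ a → 1 ℕ.≤ b → a ℕ.+ b ≡ d →
       length g ≡ suc a → length h ≡ suc b → g ⊗ h ≢ p)

  -- Binary quartic forms z₀X⁴+z₁X³Y+z₂X²Y²+z₃XY³+z₄Y⁴ as (z₀,…,z₄)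

  Quartic : Set
  Quartic = Vec Carrier 5

  coeffs : Quartic → List Carrier
  coeffs = Vec.toList

  Nonzero : Quartic → Set
  Nonzero f = ¬ All (_≡ 0#) (coeffs f)

  Δ : Quartic → Carrier
  Δ (z0 ∷ z1 ∷ z2 ∷ z3 ∷ z4 ∷ []) =
    ((z0 * z4 - z1 * z3) ^ᶠ 3) + ((z0 * z4 - z1 * z3) ^ᶠ 2) * (z2 ^ᶠ 2)
    - (z2 ^ᶠ 3) * (z0 * (z3 ^ᶠ 2) + z4 * (z1 ^ᶠ 2) - z0 * z2 * z4)

  ȷ : Quartic → Carrier
  ȷ f@(z0 ∷ z1 ∷ z2 ∷ z3 ∷ z4 ∷ []) = (z2 ^ᶠ 6) * (Δ f ⁻¹)

  NonDeg : Quartic → Set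
  NonDeg f = Δ f ≢ 0#

  _≈ₚ_ : Quartic → Quartic → Set
  f ≈ₚ h = ∃[ λ' ] (λ' ≢ 0# × f ≡ Vec.map (λ' *_) h)

  -- GL₂ action: g = (a b ; c d),
  -- g·f(X,Y) = det(g)^(-4) f(dX - bY, aY - cX)

  record Mat : Set where
    constructor mat
    field a b c d : Carrier

  det : Mat → Carrier
  det (mat a b c d) = a * d - b * c

  act : Mat → Quartic → List Carrier
  act (mat a b c d) (z0 ∷ z1 ∷ z2 ∷ z3 ∷ z4 ∷ []) =
      scaleL ((det (mat a b c d) ⁻¹) ^ᶠ 4)
        (List.foldr addL [] (term 0 z0 ∷ term 1 z1 ∷ term 2 z2 ∷ term 3 z3 ∷ term 4 z4 ∷ []))
    where
      L₁ L₂ : List Carrier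
      L₁ = d ∷ (- b) ∷ []
      L₂ = (- c) ∷ a ∷ []
      term : ℕ → Carrier → List Carrier
      term i z = scaleL z (powL L₁ (4 ℕ.∸ i) ⊗ powL L₂ i)

  -- h lies in the G-orbit of the projective point [f]  (G = PGL₂(q) acting
  -- through GL₂(q)): g·f is a nonzero multiple of h for some invertible g
  _∼_ : Quartic → Quartic → Set
  f ∼ h = ∃[ g ] (det g ≢ 0# × ∃[ λ' ] (λ' ≢ 0# × act g f ≡ coeffs (Vec.map (λ' *_) h)))

  OrbitSize : Quartic → ℕ → Set
  OrbitSize f s = ClassCount _≈ₚ_ (λ h → Nonzero h × f ∼ h) s

  OrbitSizeDiv : ℕ → Quartic → ℕ → Set
  OrbitSizeDiv q f i = ∃[ s ] (OrbitSize f s × i ℕ.* s ≡ ∣PGL₂∣ q)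

  OrbitIn : (Quartic → Set) → Quartic → Set
  OrbitIn C f = ∀ h → f ∼ h → C h

  𝓕₄ : Quartic → Set
  𝓕₄ f = ∃[ l₁ ] ∃[ l₂ ] ∃[ l₃ ] ∃[ l₄ ]
    (Irreducible 1 l₁ × Irreducible 1 l₂ × Irreducible 1 l₃ × Irreducible 1 l₄ ×
     coeffs f ≡ l₁ ⊗ (l₂ ⊗ (l₃ ⊗ l₄)))

  𝓕₂ : Quartic → Set
  𝓕₂ f = ∃[ l₁ ] ∃[ l₂ ] ∃[ p ]
    (Irreducible 1 l₁ × Irreducible 1 l₂ × Irreducible 2 p × coeffs f ≡ l₁ ⊗ (l₂ ⊗ p))

  𝓕₁ : Quartic → Set
  𝓕₁ f = ∃[ l ] ∃[ p ] (Irreducible 1 l × Irreducible 3 p × coeffs f ≡ l ⊗ p)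

  𝓕₄′ : Quartic → Set
  𝓕₄′ f = ∃[ p₁ ] ∃[ p₂ ] (Irreducible 2 p₁ × Irreducible 2 p₂ × coeffs f ≡ p₁ ⊗ p₂)

  𝓕₂′ : Quartic → Set
  𝓕₂′ f = Irreducible 4 (coeffs f)

{-# OPTIONS --safe #-}

-- Orbits are not sized through stabilisers.  Each orbit is singled out by invariant
-- conditions, shown to be a single orbit by reduction to a normal form, and its
-- vectors are counted directly.
--
-- A form with a root is Y times a cubic; inverting the variable turns the cubic into
-- an additive polynomial, so for r = ȷ(f) ≠ 0 there is one such orbit, and the number
-- of roots is governed by w³ - w = 1/√r, that is, by the trace of 1/√r.  The orbit is
-- sized by counting flags (root, form).
--
-- In characteristic 3 the coefficient z₂ of p₁p₂ is the polar form D₁₂ of the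
-- discriminant, so μ = D₁₂²/(D₁₁D₂₂) gives ȷ = μ³/(μ - 1)².  When p₁ and p₂ are
-- irreducible, Hilbert 90 for the torus fixing p₁ shows that μ determines the orbit,
-- which is sized by counting flags (factor, form).
--
-- A form without roots whose discriminant is a nonsquare is irreducible.  Its resolvent
-- cubic has a root, which supplies an involution fixing the form and hence a torus
-- normal form.  For given ȷ there are at most two orbits of such normal forms, one for
-- each type of torus, and the forms with a root occupy one of them.  Comparing with the
-- number of all forms of given ȷ sizes this orbit and shows that nothing else is left.
module Submission where

open import Defs
open import Algebra.Bundles using (CommutativeMonoid; CommutativeRing)
import Algebra.Properties.Monoid.Mult
import Algebra.Properties.Ring
import Algebra.Properties.Semiring.Mult
import Algebra.Solver.Ring.NaturalCoefficients.Default as NatSolver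
open import Algebra.Structures using (IsCommutativeMonoid; module IsCommutativeRing)
open import Data.Bool using (Bool; true; false; _∧_) renaming (T to IsTrue)
open import Data.Empty using (⊥; ⊥-elim)
open import Data.Fin using (Fin; zero; suc)
open import Data.List as List using (List; []; _∷_; _++_; length; foldr; filter; deduplicate)
open import Data.List.Membership.Propositional using (_∈_; find; lose)
open import Data.List.Membership.Propositional.Properties
open import Data.List.Membership.Propositional.Properties.WithK using (unique∧set⇒bag)
import Data.List.Properties as List
open import Data.List.Relation.Binary.BagAndSetEquality using (∼bag⇒↭)
open import Data.List.Relation.Binary.Permutation.Propositional using (_↭_; ↭-refl; ↭⇒↭ₛ)
import Data.List.Relation.Binary.Permutation.Setoid.Properties as Permₛ
open import Data.List.Relation.Binary.Pointwise using (Pointwise; []; _∷_)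
open import Data.List.Relation.Unary.All as All using (All; []; _∷_)
import Data.List.Relation.Unary.All.Properties as All
open import Data.List.Relation.Unary.AllPairs as AllPairs using (AllPairs; []; _∷_)
import Data.List.Relation.Unary.AllPairs.Properties as AllPairs
open import Data.List.Relation.Unary.Any as Any using (Any; here; there)
import Data.List.Relation.Unary.Any.Properties as Any
open import Data.List.Relation.Unary.Unique.Propositional using (Unique)
open import Data.Maybe as Maybe using (Maybe; just; nothing)
open import Data.Nat as ℕ using (ℕ; zero; suc)
import Data.Nat.Properties as ℕ
open import Data.Nat.Solver using (module +-*-Solver)
open import Data.Product using (Σ-syntax; ∃; ∃-syntax; _×_; _,_; proj₁; proj₂)
import Data.Product.Properties as Product
open import Data.Sum as Sum using (_⊎_; inj₁; inj₂; [_,_]′)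
open import Data.Unit using (⊤; tt)
open import Data.Vec as Vec using (Vec; []; _∷_)
open import Data.Vec.N-ary using (N-ary; _$ⁿ_)
import Data.Vec.Properties as Vec
open import Function using (_∘_; id; case_of_; mk⇔)
open import Relation.Binary.Definitions using (DecidableEquality)
open import Relation.Binary.PropositionalEquality hiding (J)
open import Relation.Nullary using (¬_; Dec; yes; no; ¬?)
open import Relation.Unary using (Decidable)

-- No extension of F_q is constructed. An element z of F_q(√δ) is a pair (x, y) with norm
-- `nrm δ x y`, and multiplication and conjugation are written in coordinates; with δ = 1 the same
-- formulas describe the split torus, so both types are treated at once. Characteristic 3 decides
-- the shape of the argument: w ↦ w³ - νw is additive, hence bijective for a nonsquare ν, and this
-- is how roots of cubics are found; most minus signs in the formulas are factors 2. An irreducible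
-- form has neither a root nor a factor over F_q to serve as a flag. Its class can be counted only
-- as a complement, so that it is a single orbit must be shown without knowing its size.
-- Completeness is an equation between sizes. For each ȷ ≠ 0 there are (q - 1)|G| vectors, filled by
-- the shares 1, or 1/2 + 1/2, or 4 times 1/4. For ȷ = 0 there are as many, half of them with square
-- discriminant: 1/24 + 1/3 + 1/8 = 1/2, and 1/4 + 1/4 = 1/2 for the others.

infix 4 _:≡_
_:≡_ : {A : Set} → A → A → A × A
_:≡_ = _,_

pattern ⟨_,_⟩₂ a b = a ∷ b ∷ []
pattern ⟨_,_,_⟩₃ a b c = a ∷ b ∷ c ∷ []
pattern ⟨_,_,_,_⟩₄ a b c d = a ∷ b ∷ c ∷ d ∷ []
pattern ⟨_,_,_,_,_⟩ a b c d e = a ∷ b ∷ c ∷ d ∷ e ∷ []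

-- Binary forms, substitutions and invariants as formulas over raw operations

module Formulas {A : Set} (_+_ _*_ : A → A → A) (-_ : A → A) (0# 1# : A) where
  infixl 6 _+′_ _-′_
  infixl 7 _*′_
  infixr 8 _^_
  private
    _+′_ _*′_ _-′_ : A → A → A
    _+′_ = _+_
    _*′_ = _*_
    a -′ b = a + (- b)

  _^_ : A → ℕ → A
  x ^ zero  = 1#
  x ^ suc k = x * (x ^ k)

  disc : Vec A 5 → A
  disc ⟨ z0 , z1 , z2 , z3 , z4 ⟩ =
    (z0 *′ z4 -′ z1 *′ z3) ^ 3 +′ (z0 *′ z4 -′ z1 *′ z3) ^ 2 *′ z2 ^ 2
    -′ z2 ^ 3 *′ (z0 *′ z3 ^ 2 +′ z4 *′ z1 ^ 2 -′ z0 *′ z2 *′ z4)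

  mid : Vec A 5 → A
  mid ⟨ _ , _ , z2 , _ , _ ⟩ = z2

  -- f(pX + qY, rX + sY) in characteristic 3
  sub : A → A → A → A → Vec A 5 → Vec A 5
  sub p q r s ⟨ z0 , z1 , z2 , z3 , z4 ⟩ =
    ⟨ z0 *′ p ^ 4 +′ z1 *′ (p ^ 3 *′ r) +′ z2 *′ (p ^ 2 *′ r ^ 2) +′ z3 *′ (p *′ r ^ 3) +′ z4 *′ r ^ 4
    , z0 *′ (p ^ 3 *′ q) +′ z1 *′ (p ^ 3 *′ s) -′ z2 *′ (p *′ r *′ (p *′ s +′ q *′ r)) +′ z3 *′ (q *′ r ^ 3) +′ z4 *′ (r ^ 3 *′ s)
    , z2 *′ (p *′ s -′ q *′ r) ^ 2
    , z0 *′ (p *′ q ^ 3) +′ z1 *′ (q ^ 3 *′ r) -′ z2 *′ (q *′ s *′ (p *′ s +′ q *′ r)) +′ z3 *′ (p *′ s ^ 3) +′ z4 *′ (r *′ s ^ 3)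
    , z0 *′ q ^ 4 +′ z1 *′ (q ^ 3 *′ s) +′ z2 *′ (q ^ 2 *′ s ^ 2) +′ z3 *′ (q *′ s ^ 3) +′ z4 *′ s ^ 4 ⟩

  -- f(X + tY, Y), f(X, uY) and kf. In `tr` the binomial coefficients are reduced modulo 3: 4 = 1, 6
  -- = 3 = 0 and 2 = -1.
  tr dg sc : A → Vec A 5 → Vec A 5
  tr t ⟨ z0 , z1 , z2 , z3 , z4 ⟩ =
    ⟨ z0 , z0 *′ t +′ z1 , z2 , z0 *′ t ^ 3 -′ z2 *′ t +′ z3
    , z0 *′ t ^ 4 +′ z1 *′ t ^ 3 +′ z2 *′ t ^ 2 +′ z3 *′ t +′ z4 ⟩
  dg u ⟨ z0 , z1 , z2 , z3 , z4 ⟩ = ⟨ z0 , u *′ z1 , u ^ 2 *′ z2 , u ^ 3 *′ z3 , u ^ 4 *′ z4 ⟩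
  sc k = Vec.map (k *_)

  sw : Vec A 5 → Vec A 5
  sw ⟨ z0 , z1 , z2 , z3 , z4 ⟩ = ⟨ z4 , z3 , z2 , z1 , z0 ⟩

  ev : Vec A 5 → A → A
  ev ⟨ z0 , z1 , z2 , z3 , z4 ⟩ t = z0 *′ t ^ 4 +′ z1 *′ t ^ 3 +′ z2 *′ t ^ 2 +′ z3 *′ t +′ z4

  addL : List A → List A → List A
  addL []       ys       = ys
  addL (x ∷ xs) []       = x ∷ xs
  addL (x ∷ xs) (y ∷ ys) = (x + y) ∷ addL xs ys

  scaleL : A → List A → List A
  scaleL c = List.map (c *_)

  _⊗_ : List A → List A → List A
  []      ⊗ q = []
  (a ∷ p) ⊗ q = addL (scaleL a q) (0# ∷ (p ⊗ q))

  powL : List A → ℕ → List A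
  powL p zero    = 1# ∷ []
  powL p (suc k) = p ⊗ powL p k

  -- the action of (a b ; c d), with κ in place of the inverse determinant
  actL : A → A → A → A → A → Vec A 5 → List A
  actL κ a b c d ⟨ z0 , z1 , z2 , z3 , z4 ⟩ =
    scaleL (κ ^ 4) (List.foldr addL [] (term 0 z0 ∷ term 1 z1 ∷ term 2 z2 ∷ term 3 z3 ∷ term 4 z4 ∷ []))
    where
    term : ℕ → A → List A
    term i z = scaleL z (powL (d ∷ - b ∷ []) (4 ℕ.∸ i) ⊗ powL (- c ∷ a ∷ []) i)

  tr₂ dg₂ : A → Vec A 3 → Vec A 3
  tr₂ t ⟨ u , v , w ⟩₃ = ⟨ u , v -′ u *′ t , u *′ t ^ 2 +′ v *′ t +′ w ⟩₃
  dg₂ k ⟨ u , v , w ⟩₃ = ⟨ u , k *′ v , k ^ 2 *′ w ⟩₃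

  sw₂ : Vec A 3 → Vec A 3
  sw₂ ⟨ u , v , w ⟩₃ = ⟨ w , v , u ⟩₃

  -- The usual v² - 4uw, as 4 = 1. The bilinear form `polar` below is normalised so that `polar p p`
  -- is `disc₂ p`.
  disc₂ : Vec A 3 → A
  disc₂ ⟨ u , v , w ⟩₃ = v *′ v -′ u *′ w

  polar : Vec A 3 → Vec A 3 → A
  polar ⟨ u , v , w ⟩₃ ⟨ u′ , v′ , w′ ⟩₃ = v *′ v′ +′ u *′ w′ +′ w *′ u′

  _⊙_ : Vec A 3 → Vec A 3 → Vec A 5
  ⟨ u , v , w ⟩₃ ⊙ ⟨ u′ , v′ , w′ ⟩₃ =
    ⟨ u *′ u′ , u *′ v′ +′ v *′ u′ , u *′ w′ +′ v *′ v′ +′ w *′ u′ , v *′ w′ +′ w *′ v′ , w *′ w′ ⟩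

  -- zu⁴ + δ²k u²v² + z̄v⁴ and its conjugates, where u = X + √δ Y, v = X - √δ Y, z = x + √δ y
  torus : A → A → A → A → Vec A 5
  torus δ x y k = ⟨ k -′ x , - (δ *′ y) , δ *′ k , - (δ *′ δ *′ y) , δ *′ δ *′ (k -′ x) ⟩

  nrm : A → A → A → A
  nrm δ x y = x *′ x -′ δ *′ (y *′ y)

  -- zu² + c uv + z̄v², in the notation of torus
  conic : A → A → A → A → Vec A 3
  conic δ x y c = ⟨ c -′ x , δ *′ y , - (δ *′ (x +′ c)) ⟩₃

  -- X² - εe²Y² translated by t
  quad : A → A → A → Vec A 3
  quad ε t e = ⟨ 1# , - t , t *′ t -′ ε *′ (e *′ e) ⟩₃

  -- values at X = x + √ε y, Y = 1
  re₂ im₂ : A → A → A → Vec A 3 → A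
  re₂ ε x y ⟨ u , v , w ⟩₃ = u *′ (x *′ x +′ ε *′ (y *′ y)) +′ v *′ x +′ w
  im₂ ε x y ⟨ u , v , w ⟩₃ = - (u *′ (x *′ y)) +′ v *′ y

  re₄ im₄ : A → A → A → Vec A 5 → A
  re₄ ε x y ⟨ z0 , z1 , z2 , z3 , z4 ⟩ =
    z0 *′ (x ^ 4 +′ ε *′ ε *′ y ^ 4) +′ z1 *′ x ^ 3 +′ z2 *′ (x *′ x +′ ε *′ (y *′ y)) +′ z3 *′ x +′ z4
  im₄ ε x y ⟨ z0 , z1 , z2 , z3 , z4 ⟩ =
    z0 *′ (x ^ 3 *′ y +′ ε *′ (x *′ y ^ 3)) +′ z1 *′ (ε *′ y ^ 3) -′ z2 *′ (x *′ y) +′ z3 *′ y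

  sc₂ : A → Vec A 3 → Vec A 3
  sc₂ k = Vec.map (k *_)

  ev₂ : Vec A 3 → A → A
  ev₂ ⟨ u , v , w ⟩₃ t = u *′ (t *′ t) +′ v *′ t +′ w

-- A decision procedure for polynomial identities over 𝔽₃

module Syntax where
  -- Coefficients lie in 𝔽₃ and not in ℤ because most identities below hold only modulo 3.
  data 𝔽₃ : Set where
    o i j : 𝔽₃

  _⊞_ _⊠_ : 𝔽₃ → 𝔽₃ → 𝔽₃
  o ⊞ y = y
  i ⊞ o = i
  i ⊞ i = j
  i ⊞ j = o
  j ⊞ o = j
  j ⊞ i = o
  j ⊞ j = i
  o ⊠ y = o
  i ⊠ y = y
  j ⊠ o = o
  j ⊠ i = j
  j ⊠ j = i

  ⊟_ : 𝔽₃ → 𝔽₃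
  ⊟ o = o
  ⊟ i = j
  ⊟ j = i

  infixl 6 _:+_ _:-_
  infixl 7 _:*_
  infix 8 :-_
  data Expr (n : ℕ) : Set where
    con : 𝔽₃ → Expr n
    var : Fin n → Expr n
    _:+_ _:*_ : Expr n → Expr n → Expr n
    :-_ : Expr n → Expr n

  _:-_ : ∀ {n} → Expr n → Expr n → Expr n
  a :- b = a :+ :- b

  :0 :1 : ∀ {n} → Expr n
  :0 = con o
  :1 = con i

  -- Dense recursive polynomials; no normalisation of zeros, since equality is
  -- tested by checking that every coefficient of a difference vanishes.
  Poly : ℕ → Set
  Poly zero    = 𝔽₃
  Poly (suc n) = List (Poly n)

  constant : ∀ n → 𝔽₃ → Poly n
  constant zero    c = c
  constant (suc n) c = constant n c ∷ []

  variableP : ∀ {n} → Fin n → Poly n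
  variableP {suc n} zero    = constant n o ∷ constant n i ∷ []
  variableP {suc n} (suc k) = variableP k ∷ []

  add : ∀ n → Poly n → Poly n → Poly n
  add zero    a b = a ⊞ b
  add (suc n) [] q = q
  add (suc n) (a ∷ p) [] = a ∷ p
  add (suc n) (a ∷ p) (b ∷ q) = add n a b ∷ add (suc n) p q

  neg : ∀ n → Poly n → Poly n
  neg zero    a = ⊟ a
  neg (suc n) [] = []
  neg (suc n) (a ∷ p) = neg n a ∷ neg (suc n) p

  shift : ∀ n → Poly (suc n) → Poly (suc n)
  shift n []      = []
  shift n (a ∷ p) = constant n o ∷ a ∷ p

  mul : ∀ n → Poly n → Poly n → Poly n
  scale : ∀ n → Poly n → Poly (suc n) → Poly (suc n)
  mul zero    a b = a ⊠ b
  mul (suc n) [] q = []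
  mul (suc n) (a ∷ p) q = add (suc n) (scale n a q) (shift n (mul (suc n) p q))
  scale n a []      = []
  scale n a (b ∷ q) = mul n a b ∷ scale n a q

  isZero : ∀ n → Poly n → Bool
  isZero zero    o = true
  isZero zero    _ = false
  isZero (suc n) [] = true
  isZero (suc n) (a ∷ p) = isZero n a ∧ isZero (suc n) p

  norm : ∀ {n} → Expr n → Poly n
  norm {n} (con c)  = constant n c
  norm     (var x)  = variableP x
  norm {n} (a :+ b) = add n (norm a) (norm b)
  norm {n} (a :* b) = mul n (norm a) (norm b)
  norm {n} (:- a)   = neg n (norm a)

  vars : ∀ n → Vec (Expr n) n
  vars n = Vec.map var (Vec.allFin n)

open Syntax using (Expr; _:+_; _:*_; :-_; _:-_; :0; :1) public

module FieldProps (F : Field) where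
  open Field F public
  open Theory F using (_-_) public

  commutativeRing : CommutativeRing _ _
  commutativeRing = record { isCommutativeRing = isCommutativeRing }
  open CommutativeRing commutativeRing public
    using (+-assoc; +-comm; +-identityˡ; +-identityʳ; -‿inverseˡ; -‿inverseʳ;
           *-assoc; *-comm; *-identityˡ; *-identityʳ; distribˡ; distribʳ; zeroˡ; zeroʳ;
           ring; commutativeSemiring)
  open Algebra.Properties.Ring ring public using (-‿distribˡ-*; -‿distribʳ-*; -‿involutive; -0#≈0#; -‿+-comm; -1*x≈-x)

  x-x≡0 : ∀ {a b} → a ≡ b → a - b ≡ 0#
  x-x≡0 {a} refl = -‿inverseʳ a

  -≡0⇒≡ : ∀ {a b} → a - b ≡ 0# → a ≡ b
  -≡0⇒≡ {a} {b} h = begin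
    a                 ≡⟨ sym (+-identityʳ a) ⟩
    a + 0#            ≡⟨ cong (a +_) (sym (-‿inverseˡ b)) ⟩
    a + (- b + b)     ≡⟨ sym (+-assoc a (- b) b) ⟩
    (a - b) + b       ≡⟨ cong (_+ b) h ⟩
    0# + b            ≡⟨ +-identityˡ b ⟩
    b                 ∎ where open ≡-Reasoning

  module ℕS = NatSolver commutativeSemiring

module RingSolver (F : Field) 
  (3≡0 : Field._+_ F (Field.1# F) (Field._+_ F (Field.1# F) (Field.1# F)) ≡ Field.0# F) where
  open FieldProps F
  open Syntax

  ⟦_⟧₃ : 𝔽₃ → Carrier
  ⟦ o ⟧₃ = 0#
  ⟦ i ⟧₃ = 1#
  ⟦ j ⟧₃ = - 1#

  ⟦_⟧ : ∀ {n} → Expr n → Vec Carrier n → Carrier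
  ⟦ con c ⟧  ρ = ⟦ c ⟧₃
  ⟦ var x ⟧  ρ = Vec.lookup ρ x
  ⟦ a :+ b ⟧ ρ = ⟦ a ⟧ ρ + ⟦ b ⟧ ρ
  ⟦ a :* b ⟧ ρ = ⟦ a ⟧ ρ * ⟦ b ⟧ ρ
  ⟦ :- a ⟧   ρ = - ⟦ a ⟧ ρ

  private
    1+1≡-1 : 1# + 1# ≡ - 1#
    1+1≡-1 = -≡0⇒≡ (trans (cong (1# + 1# +_) (-‿involutive 1#)) (trans (+-assoc _ _ _) 3≡0))

    -1-1≡1 : - 1# + - 1# ≡ 1#
    -1-1≡1 = trans (-‿+-comm 1# 1#) (trans (cong -_ 1+1≡-1) (-‿involutive 1#))

    ⊞-hom : ∀ a b → ⟦ a ⊞ b ⟧₃ ≡ ⟦ a ⟧₃ + ⟦ b ⟧₃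
    ⊞-hom o b = sym (+-identityˡ _)
    ⊞-hom i o = sym (+-identityʳ _)
    ⊞-hom i i = sym 1+1≡-1
    ⊞-hom i j = sym (-‿inverseʳ _)
    ⊞-hom j o = sym (+-identityʳ _)
    ⊞-hom j i = sym (-‿inverseˡ _)
    ⊞-hom j j = sym -1-1≡1

    ⊠-hom : ∀ a b → ⟦ a ⊠ b ⟧₃ ≡ ⟦ a ⟧₃ * ⟦ b ⟧₃
    ⊠-hom o b = sym (zeroˡ _)
    ⊠-hom i b = sym (*-identityˡ _)
    ⊠-hom j o = sym (zeroʳ _)
    ⊠-hom j i = sym (*-identityʳ _)
    ⊠-hom j j = sym (trans (-1*x≈-x _) (-‿involutive 1#))

    ⊟-hom : ∀ a → ⟦ ⊟ a ⟧₃ ≡ - ⟦ a ⟧₃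
    ⊟-hom o = sym -0#≈0#
    ⊟-hom i = refl
    ⊟-hom j = sym (-‿involutive 1#)

  eval : ∀ n → Poly n → Vec Carrier n → Carrier
  eval zero    c ρ = ⟦ c ⟧₃
  eval (suc n) [] ρ = 0#
  eval (suc n) (a ∷ p) (x ∷ ρ) = eval n a ρ + x * eval (suc n) p (x ∷ ρ)

  private
    constant-hom : ∀ n c ρ → eval n (constant n c) ρ ≡ ⟦ c ⟧₃
    constant-hom zero    c ρ = refl
    constant-hom (suc n) c (x ∷ ρ) = trans (cong₂ _+_ (constant-hom n c ρ) (zeroʳ x)) (+-identityʳ _)

    variable-hom : ∀ {n} (k : Fin n) ρ → eval n (variableP k) ρ ≡ Vec.lookup ρ k
    variable-hom {suc n} zero (x ∷ ρ) = begin
      eval n (constant n o) ρ + x * (eval n (constant n i) ρ + x * 0#)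
        ≡⟨ cong₂ (λ u v → u + x * (v + x * 0#)) (constant-hom n o ρ) (constant-hom n i ρ) ⟩
      0# + x * (1# + x * 0#)
        ≡⟨ ℕS.solve 1 (λ x → ℕS.con 0 ℕS.:+ x ℕS.:* (ℕS.con 1 ℕS.:+ x ℕS.:* ℕS.con 0) ℕS.:= x) refl x ⟩
      x ∎ where open ≡-Reasoning
    variable-hom {suc n} (suc k) (x ∷ ρ) = trans (cong₂ _+_ (variable-hom k ρ) (zeroʳ x)) (+-identityʳ _)

    add-hom : ∀ n p q ρ → eval n (add n p q) ρ ≡ eval n p ρ + eval n q ρ
    add-hom zero    a b ρ = ⊞-hom a b
    add-hom (suc n) [] q ρ = sym (+-identityˡ _)
    add-hom (suc n) (a ∷ p) [] (x ∷ ρ) = sym (+-identityʳ _)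
    add-hom (suc n) (a ∷ p) (b ∷ q) (x ∷ ρ) = trans
      (cong₂ (λ u v → u + x * v) (add-hom n a b ρ) (add-hom (suc n) p q (x ∷ ρ)))
      (ℕS.solve 5 (λ x a b p q → (a ℕS.:+ b) ℕS.:+ x ℕS.:* (p ℕS.:+ q)
                     ℕS.:= (a ℕS.:+ x ℕS.:* p) ℕS.:+ (b ℕS.:+ x ℕS.:* q)) refl x _ _ _ _)

    neg-hom : ∀ n p ρ → eval n (neg n p) ρ ≡ - eval n p ρ
    neg-hom zero    a ρ = ⊟-hom a
    neg-hom (suc n) [] ρ = sym -0#≈0#
    neg-hom (suc n) (a ∷ p) (x ∷ ρ) = trans
      (cong₂ (λ u v → u + x * v) (neg-hom n a ρ) (neg-hom (suc n) p (x ∷ ρ)))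
      (trans (cong (- eval n a ρ +_) (sym (-‿distribʳ-* x (eval (suc n) p (x ∷ ρ))))) (-‿+-comm _ _))

    shift-hom : ∀ n p x ρ → eval (suc n) (shift n p) (x ∷ ρ) ≡ x * eval (suc n) p (x ∷ ρ)
    shift-hom n []      x ρ = sym (zeroʳ x)
    shift-hom n (a ∷ p) x ρ = trans (cong (_+ x * eval (suc n) (a ∷ p) (x ∷ ρ)) (constant-hom n o ρ)) (+-identityˡ _)

    mul-hom : ∀ n p q ρ → eval n (mul n p q) ρ ≡ eval n p ρ * eval n q ρ
    scale-hom : ∀ n a q x ρ → eval (suc n) (scale n a q) (x ∷ ρ) ≡ eval n a ρ * eval (suc n) q (x ∷ ρ)
    mul-hom zero    a b ρ = ⊠-hom a b
    mul-hom (suc n) [] q ρ = sym (zeroˡ _)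
    mul-hom (suc n) (a ∷ p) q (x ∷ ρ) = begin
      eval (suc n) (add (suc n) (scale n a q) (shift n (mul (suc n) p q))) (x ∷ ρ)
        ≡⟨ add-hom (suc n) (scale n a q) _ (x ∷ ρ) ⟩
      _ ≡⟨ cong₂ _+_ (scale-hom n a q x ρ)
             (trans (shift-hom n (mul (suc n) p q) x ρ) (cong (x *_) (mul-hom (suc n) p q (x ∷ ρ)))) ⟩
      _ ≡⟨ ℕS.solve 4 (λ x a p q → a ℕS.:* q ℕS.:+ x ℕS.:* (p ℕS.:* q)
                          ℕS.:= (a ℕS.:+ x ℕS.:* p) ℕS.:* q) refl x _ _ _ ⟩
      _ ∎ where open ≡-Reasoning
    scale-hom n a []      x ρ = sym (zeroʳ _)
    scale-hom n a (b ∷ q) x ρ = trans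
      (cong₂ (λ u v → u + x * v) (mul-hom n a b ρ) (scale-hom n a q x ρ))
      (ℕS.solve 4 (λ x a b q → a ℕS.:* b ℕS.:+ x ℕS.:* (a ℕS.:* q)
                     ℕS.:= a ℕS.:* (b ℕS.:+ x ℕS.:* q)) refl x _ _ _)

    norm-hom : ∀ {n} (e : Expr n) ρ → eval n (norm e) ρ ≡ ⟦ e ⟧ ρ
    norm-hom {n} (con c) ρ  = constant-hom n c ρ
    norm-hom (var x) ρ      = variable-hom x ρ
    norm-hom {n} (a :+ b) ρ = trans (add-hom n (norm a) (norm b) ρ) (cong₂ _+_ (norm-hom a ρ) (norm-hom b ρ))
    norm-hom {n} (a :* b) ρ = trans (mul-hom n (norm a) (norm b) ρ) (cong₂ _*_ (norm-hom a ρ) (norm-hom b ρ))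
    norm-hom {n} (:- a) ρ   = trans (neg-hom n (norm a) ρ) (cong -_ (norm-hom a ρ))

    isZero-sound : ∀ n p ρ → IsTrue (isZero n p) → eval n p ρ ≡ 0#
    isZero-sound zero    o ρ _ = refl
    isZero-sound (suc n) [] ρ _ = refl
    isZero-sound (suc n) (a ∷ p) (x ∷ ρ) h with isZero n a in eq
    ... | true = trans (cong₂ (λ u v → u + x * v) (isZero-sound n a ρ (subst IsTrue (sym eq) _)) (isZero-sound (suc n) p (x ∷ ρ) h))
                   (trans (cong (0# +_) (zeroʳ x)) (+-identityˡ 0#))

  provable : ∀ {n} → Expr n × Expr n → Bool
  provable {n} (a , b) = isZero n (norm (a :- b))

  provableᵥ : ∀ {n k} → Vec (Expr n) k → Vec (Expr n) k → Bool
  provableᵥ [] [] = true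
  provableᵥ (a ∷ as) (b ∷ bs) = provable (a , b) ∧ provableᵥ as bs

  provableₗ : ∀ {n} → List (Expr n) → List (Expr n) → Bool
  provableₗ [] [] = true
  provableₗ (a ∷ as) (b ∷ bs) = provable (a , b) ∧ provableₗ as bs
  provableₗ _ _ = false

  opaque
    solution : ∀ {n} (a b : Expr n) ρ → IsTrue (provable (a , b)) → ⟦ a ⟧ ρ ≡ ⟦ b ⟧ ρ
    solution {n} a b ρ t = -≡0⇒≡ (trans (sym (norm-hom (a :- b) ρ)) (isZero-sound n (norm (a :- b)) ρ t))

    -- The implicit argument computes to the unit type when the difference of both sides normalises
    -- to zero coefficients, so it is inferred; a false identity does not type-check.
    solve : ∀ {n} (ρ : Vec Carrier n) (f : N-ary n (Expr n) (Expr n × Expr n)) →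
            let e = f $ⁿ vars n in {_ : IsTrue (provable e)} → ⟦ proj₁ e ⟧ ρ ≡ ⟦ proj₂ e ⟧ ρ
    solve {n} ρ f {t} with f $ⁿ vars n
    ... | a , b = solution a b ρ t

    solveᵥ : ∀ {n k} (ρ : Vec Carrier n) (f : N-ary n (Expr n) (Vec (Expr n) k × Vec (Expr n) k)) →
             let e = f $ⁿ vars n in {_ : IsTrue (provableᵥ (proj₁ e) (proj₂ e))} →
             Vec.map (λ a → ⟦ a ⟧ ρ) (proj₁ e) ≡ Vec.map (λ a → ⟦ a ⟧ ρ) (proj₂ e)
    solveᵥ {n} ρ f {t} with f $ⁿ vars n
    ... | a , b = sound a b t
      where
      sound : ∀ {k} (a b : Vec (Expr n) k) → IsTrue (provableᵥ a b) → Vec.map (λ e → ⟦ e ⟧ ρ) a ≡ Vec.map (λ e → ⟦ e ⟧ ρ) b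
      sound [] [] _ = refl
      sound (a ∷ as) (b ∷ bs) t with provable (a , b) in eq
      ... | true = cong₂ _∷_ (solution a b ρ (subst IsTrue (sym eq) _)) (sound as bs t)

    solveₗ : ∀ {n} (ρ : Vec Carrier n) (f : N-ary n (Expr n) (List (Expr n) × List (Expr n))) →
             let e = f $ⁿ vars n in {_ : IsTrue (provableₗ (proj₁ e) (proj₂ e))} →
             List.map (λ a → ⟦ a ⟧ ρ) (proj₁ e) ≡ List.map (λ a → ⟦ a ⟧ ρ) (proj₂ e)
    solveₗ {n} ρ f {t} with f $ⁿ vars n
    ... | a , b = sound a b t
      where
      sound : ∀ (a b : List (Expr n)) → IsTrue (provableₗ a b) → List.map (λ e → ⟦ e ⟧ ρ) a ≡ List.map (λ e → ⟦ e ⟧ ρ) b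
      sound [] [] _ = refl
      sound (a ∷ as) (b ∷ bs) t with provable (a , b) in eq
      ... | true = cong₂ _∷_ (solution a b ρ (subst IsTrue (sym eq) _)) (sound as bs t)

    -- Certificates of ideal membership: an equation follows from hypotheses once its difference of
    -- sides is written as a combination of theirs with explicit cofactors. The combination is an
    -- unconditional identity and is left to `solve`. All later long cofactors are of this kind.
    lin₁ : ∀ c {u v a b} → u ≡ v → a - b ≡ c * (u - v) → a ≡ b
    lin₁ c h e = -≡0⇒≡ (trans e (trans (cong (c *_) (x-x≡0 h)) (zeroʳ c)))

    lin₂ : ∀ c c′ {u v u′ v′ a b} → u ≡ v → u′ ≡ v′ → a - b ≡ c * (u - v) + c′ * (u′ - v′) → a ≡ b
    lin₂ c c′ h h′ e = -≡0⇒≡ (trans e (trans (cong₂ (λ x y → c * x + c′ * y) (x-x≡0 h) (x-x≡0 h′))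
      (trans (cong₂ _+_ (zeroʳ c) (zeroʳ c′)) (+-identityˡ 0#))))

    lin₃ : ∀ c c′ c″ {u v u′ v′ u″ v″ a b} → u ≡ v → u′ ≡ v′ → u″ ≡ v″ →
           a - b ≡ c * (u - v) + c′ * (u′ - v′) + c″ * (u″ - v″) → a ≡ b
    lin₃ c c′ c″ {u} {v} {u′} {v′} h h′ h″ e = lin₂ c c′ h h′
      (trans e (trans (cong (λ x → c * (u - v) + c′ * (u′ - v′) + c″ * x) (x-x≡0 h″))
        (trans (cong (c * (u - v) + c′ * (u′ - v′) +_) (zeroʳ c″)) (+-identityʳ _))))

-- The formulas are instantiated a second time, at expressions. Evaluating such an expression
-- computes to the instance at field elements, so identities proved for syntax apply to the field
-- formulas as they are.
module ExprFormulas {n : ℕ} = Formulas {Expr n} _:+_ _:*_ :-_ :0 :1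

-- Counting finite sets given by predicates

record Card {A : Set} (P : A → Set) (N : ℕ) : Set where
  constructor card
  field
    elems    : List A
    unique   : Unique elems
    sound    : ∀ {x} → x ∈ elems → P x
    complete : ∀ {x} → P x → x ∈ elems
    size     : length elems ≡ N

open Card

module _ {A : Set} where

  remove : ∀ {x : A} {ys} → x ∈ ys → Σ[ zs ∈ List A ] (length ys ≡ suc (length zs) ×
             (∀ {y} → y ∈ ys → y ≢ x → y ∈ zs))
  remove {ys = _ ∷ ys} (here refl) = ys , refl , λ { (here e) y≢x → ⊥-elim (y≢x e) ; (there y∈) _ → y∈ }
  remove {ys = y ∷ ys} (there x∈) with remove x∈
  ... | zs , l , f = y ∷ zs , cong suc l , λ { (here e) _ → here e ; (there y∈) y≢x → there (f y∈ y≢x) }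

  unique-⊆⇒length≤ : ∀ {xs ys : List A} → Unique xs → (∀ {x} → x ∈ xs → x ∈ ys) → length xs ℕ.≤ length ys
  unique-⊆⇒length≤ {[]} u sub = ℕ.z≤n
  unique-⊆⇒length≤ {x ∷ xs} (x∉ ∷ u) sub with remove (sub (here refl))
  ... | zs , l , f rewrite l = ℕ.s≤s (unique-⊆⇒length≤ u λ y∈ → f (sub (there y∈)) λ { refl → All.lookup x∉ y∈ refl })

  card-≤ : ∀ {P Q : A → Set} {M N} → Card P M → Card Q N → (∀ {x} → P x → Q x) → M ℕ.≤ N
  card-≤ p q P⊆Q = subst₂ ℕ._≤_ (size p) (size q) (unique-⊆⇒length≤ (unique p) (complete q ∘ P⊆Q ∘ sound p))

  card-unique : ∀ {P Q : A → Set} {M N} → Card P M → Card Q N → (∀ {x} → P x → Q x) → (∀ {x} → Q x → P x) → M ≡ N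
  card-unique p q f g = ℕ.≤-antisym (card-≤ p q f) (card-≤ q p g)

  card-⇔ : ∀ {P Q : A → Set} {N} → (∀ {x} → P x → Q x) → (∀ {x} → Q x → P x) → Card P N → Card Q N
  card-⇔ f g (card xs u s c l) = card xs u (f ∘ s) (c ∘ g) l

  card-⊎ : ∀ {P Q : A → Set} {M N} → Card P M → Card Q N → (∀ {x} → P x → Q x → ⊥) → Card (λ x → P x ⊎ Q x) (M ℕ.+ N)
  card-⊎ p q disj = card (elems p ++ elems q)
    (AllPairs.++⁺ (unique p) (unique q) (All.tabulate λ x∈ → All.tabulate λ y∈ → λ { refl → disj (sound p x∈) (sound q y∈) }))
    (λ x∈ → case ∈-++⁻ (elems p) x∈ of λ { (inj₁ a) → inj₁ (sound p a) ; (inj₂ a) → inj₂ (sound q a) })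
    (λ { (inj₁ a) → ∈-++⁺ˡ (complete p a) ; (inj₂ a) → ∈-++⁺ʳ (elems p) (complete q a) })
    (trans (List.length-++ (elems p)) (cong₂ ℕ._+_ (size p) (size q)))

  card-filter : ∀ {P Q : A → Set} {N} → Card P N → Decidable Q → ∃[ M ] Card (λ x → P x × Q x) M
  card-filter {Q = Q} p Q? = _ , card (filter Q? (elems p)) (AllPairs.filter⁺ Q? (unique p))
    (λ x∈ → let a , b = ∈-filter⁻ Q? x∈ in sound p a , b) (λ (a , b) → ∈-filter⁺ Q? (complete p a) b) refl

  card-∅ : ∀ {P : A → Set} → (∀ {x} → ¬ P x) → Card P 0
  card-∅ h = card [] [] (λ ()) (⊥-elim ∘ h) refl

  card-single : ∀ (a : A) → Card (_≡ a) 1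
  card-single a = card (a ∷ []) ([] ∷ []) (λ { (here e) → e }) here refl

  card-member : ∀ {P : A → Set} {N} → Card P (suc N) → ∃ P
  card-member (card (x ∷ xs) u s c l) = x , s (here refl)

  card-zero : ∀ {P : A → Set} → Card P 0 → ∀ {x} → ¬ P x
  card-zero (card [] u s c l) p = case c p of λ ()

  module _ (_≟_ : DecidableEquality A) where
    open import Data.List.Membership.DecPropositional _≟_ using (_∈?_)

    card-∈? : ∀ {P : A → Set} {N} → Card P N → Decidable P
    card-∈? p x with x ∈? elems p
    ... | yes x∈ = yes (sound p x∈)
    ... | no x∉ = no (x∉ ∘ complete p)

    -- The exhaustion principle. An element of `Q` outside `P` could be put in front of the list of
    -- `P`, giving a repetition-free list inside `Q` that is too long.
    card-⊆-≡ : ∀ {P Q : A → Set} {N} → Card P N → Card Q N → (∀ {x} → P x → Q x) → ∀ {x} → Q x → P x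
    card-⊆-≡ p q P⊆Q {x} Qx with x ∈? elems p
    ... | yes x∈ = sound p x∈
    ... | no x∉ = ⊥-elim (ℕ.<-irrefl (trans (size p) (sym (size q)))
          (unique-⊆⇒length≤ {x ∷ elems p} (All.tabulate (λ { y∈ refl → x∉ y∈ }) ∷ unique p)
             λ { (here refl) → complete q Qx ; (there y∈) → complete q (P⊆Q (sound p y∈)) }))

    card-∖ : ∀ {P Q : A → Set} {M N} → Card P M → Card Q N → (∀ {x} → Q x → P x) → ∃[ K ] (Card (λ x → P x × ¬ Q x) K × K ℕ.+ N ≡ M)
    card-∖ p q Q⊆P with card-filter p (λ x → ¬? (card-∈? q x))
    ... | K , r = K , r , card-unique (card-⊎ r q (λ (_ , nq) → nq)) p [ proj₁ , Q⊆P ]′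
                    (λ {x} Px → case card-∈? q x of λ { (yes Qx) → inj₂ Qx ; (no nq) → inj₁ (Px , nq) })

module _ {A B : Set} where

  private
    map-unique : (f : A → B) {xs : List A} → (∀ {x y} → x ∈ xs → y ∈ xs → f x ≡ f y → x ≡ y) → Unique xs → Unique (List.map f xs)
    map-unique f {[]} inj [] = []
    map-unique f {x ∷ xs} inj (x∉ ∷ u) =
      All.map⁺ (All.tabulate λ y∈ e → All.lookup x∉ y∈ (inj (here refl) (there y∈) e)) ∷
      map-unique f (λ a b → inj (there a) (there b)) u

  card-bij : ∀ {P : A → Set} {Q : B → Set} {N} (f : A → B) → Card P N →
             (∀ {x} → P x → Q (f x)) → (∀ {x y} → P x → P y → f x ≡ f y → x ≡ y) →
             (∀ {y} → Q y → Σ[ x ∈ A ] (P x × f x ≡ y)) → Card Q N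
  card-bij {Q = Q} f p to inj onto = card (List.map f (elems p))
    (map-unique f (λ a b → inj (sound p a) (sound p b)) (unique p))
    (λ y∈ → let x , x∈ , e = ∈-map⁻ f y∈ in subst Q (sym e) (to (sound p x∈)))
    (λ Qy → let x , Px , e = onto Qy in subst (_∈ List.map f (elems p)) e (∈-map⁺ f (complete p Px)))
    (trans (List.length-map f (elems p)) (size p))

  card-inverse : ∀ {P : A → Set} {Q : B → Set} {N} (f : A → B) (g : B → A) → Card P N →
                 (∀ {x} → P x → Q (f x)) → (∀ {y} → Q y → P (g y)) →
                 (∀ {x} → P x → g (f x) ≡ x) → (∀ {y} → Q y → f (g y) ≡ y) → Card Q N
  card-inverse f g p to from gf fg = card-bij f p to
    (λ {x} {y} Px Py e → trans (sym (gf Px)) (trans (cong g e) (gf Py))) (λ {y} Qy → g y , from Qy , fg Qy)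

  -- The image has as many elements as the domain, so inside a target of that size it leaves nothing
  -- out.
  card-inj⇒surj : DecidableEquality B → ∀ {P : A → Set} {Q : B → Set} {N} (f : A → B) → Card P N → Card Q N →
                  (∀ {x} → P x → Q (f x)) → (∀ {x y} → P x → P y → f x ≡ f y → x ≡ y) →
                  ∀ {y} → Q y → Σ[ x ∈ A ] (P x × f x ≡ y)
  card-inj⇒surj _≟_ {P} f p q to inj = card-⊆-≡ _≟_
    (card-bij {Q = λ y → Σ[ x ∈ A ] (P x × f x ≡ y)} f p (λ Px → _ , Px , refl) inj id)
    q (λ { (x , Px , refl) → to Px })

  card-image : DecidableEquality B → ∀ {P : A → Set} {M} (f : A → B) → Card P M → ∃[ K ] Card (λ y → Σ[ x ∈ A ] (P x × f x ≡ y)) K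
  card-image _≟_ {P} f p = _ , card (deduplicate _≟_ (List.map f (elems p)))
    (deduplicate-! (List.map f (elems p)))
    (λ y∈ → let x , x∈ , e = ∈-map⁻ f (∈-deduplicate⁻ _≟_ (List.map f (elems p)) y∈) in x , sound p x∈ , sym e)
    (λ { (x , Px , refl) → ∈-deduplicate⁺ _≟_ (∈-map⁺ f (complete p Px)) }) refl
    where open import Data.List.Relation.Unary.Unique.DecPropositional.Properties _≟_ using (deduplicate-!)

module _ {A B : Set} where

  card-Σ : ∀ {P : A → Set} {Q : A → B → Set} {M N} → Card P M → (∀ {x} → P x → Card (Q x) N) →
           Card {A × B} (λ (x , y) → P x × Q x y) (M ℕ.* N)
  card-Σ {P} {Q} {N = N} p q = subst (Card _) (cong (ℕ._* N) (size p))
    (card-⇔ (λ (x∈ , b) → sound p x∈ , b) (λ (Px , b) → complete p Px , b) (go (elems p) (unique p) (sound p)))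
    where
    go : ∀ xs → Unique xs → (∀ {x} → x ∈ xs → P x) → Card {A × B} (λ (x , y) → x ∈ xs × Q x y) (length xs ℕ.* N)
    go [] [] s = card-∅ λ ()
    go (x ∷ xs) (x∉ ∷ u) s = card-⇔
      [ (λ { (refl , b) → here refl , b }) , (λ (a , b) → there a , b) ]′
      (λ { (here refl , b) → inj₁ (refl , b) ; (there a , b) → inj₂ (a , b) })
      (card-⊎ (card-bij {Q = λ (x′ , y) → x′ ≡ x × Q x′ y} (x ,_) (q (s (here refl))) (λ b → refl , b) (λ _ _ → cong proj₂) (λ { (refl , b) → _ , b , refl }))
              (go xs u (s ∘ there)) λ { (refl , _) (x∈ , _) → All.lookup x∉ x∈ refl })

module _ {A B : Set} where

  -- Double counting: the pairs related by R, fibred over the second component.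
  card-fibres : DecidableEquality B → ∀ {R : A → B → Set} {Q : B → Set} {T N} → Card {A × B} (λ (x , y) → R x y) T →
                (∀ {x y} → R x y → Q y) → (∀ {y} → Q y → ∃[ x ] R x y) →
                (∀ {y} → Q y → Card (λ x → R x y) N) → ∃[ K ] (Card Q K × K ℕ.* N ≡ T)
  card-fibres _≟_ {R} {Q} t to onto fib with card-image _≟_ proj₂ t
  ... | K , im = K , q , card-unique (card-Σ {Q = λ y x → R x y} q fib) (card-bij (λ (x , y) → y , x) t
           (λ r → to r , r) (λ { _ _ refl → refl }) (λ { (_ , r) → _ , r , refl })) id id
    where
    q : Card Q K
    q = card-⇔ (λ { ((x , y) , r , refl) → to r }) (λ Qy → let x , r = onto Qy in (x , _) , r , refl) im

module _ {A : Set} {_∙_ : A → A → A} {ε : A} (isCM : IsCommutativeMonoid _≡_ _∙_ ε) where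
  private
    M : CommutativeMonoid _ _
    M = record { isCommutativeMonoid = isCM }
    open CommutativeMonoid M using (monoid; assoc; identityˡ; comm)
    open Algebra.Properties.Monoid.Mult monoid using () renaming (_×_ to _⋆_)

  -- Translation by `a` permutes the set, so the product over the set absorbs a factor `a` for every
  -- element. Additively this yields the characteristic, multiplicatively Fermat's theorem.
  fold-translate : ∀ {P : A → Set} {N} (a : A) (p : Card P N) → (∀ {x} → P x → P (a ∙ x)) →
                   (∀ {x y} → a ∙ x ≡ a ∙ y → x ≡ y) → (∀ {y} → P y → Σ[ x ∈ A ] (P x × a ∙ x ≡ y)) →
                   foldr _∙_ ε (elems p) ≡ (N ⋆ a) ∙ foldr _∙_ ε (elems p)
  fold-translate {P} a p to inj onto = begin
    foldr _∙_ ε xs                   ≡⟨ Permₛ.foldr-commMonoid (setoid A) isCM (↭⇒↭ₛ perm) ⟩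
    foldr _∙_ ε (List.map (a ∙_) xs) ≡⟨ go xs ⟩
    (length xs ⋆ a) ∙ foldr _∙_ ε xs ≡⟨ cong (λ k → (k ⋆ a) ∙ foldr _∙_ ε xs) (size p) ⟩
    _                                ∎
    where
    open ≡-Reasoning
    xs = elems p
    p′ : Card P _
    p′ = card-bij (a ∙_) p to (λ _ _ → inj) onto
    perm : xs ↭ List.map (a ∙_) xs
    perm = ∼bag⇒↭ (unique∧set⇒bag (unique p) (unique p′)
      (mk⇔ (complete p′ ∘ sound p) (complete p ∘ sound p′)))
    go : ∀ ys → foldr _∙_ ε (List.map (a ∙_) ys) ≡ (length ys ⋆ a) ∙ foldr _∙_ ε ys
    go [] = sym (identityˡ ε)
    go (y ∷ ys) = begin
      (a ∙ y) ∙ foldr _∙_ ε (List.map (a ∙_) ys)       ≡⟨ cong ((a ∙ y) ∙_) (go ys) ⟩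
      (a ∙ y) ∙ ((length ys ⋆ a) ∙ foldr _∙_ ε ys)     ≡⟨ assoc a y _ ⟩
      a ∙ (y ∙ ((length ys ⋆ a) ∙ foldr _∙_ ε ys))     ≡⟨ cong (a ∙_) (sym (assoc y _ _)) ⟩
      a ∙ ((y ∙ (length ys ⋆ a)) ∙ foldr _∙_ ε ys)     ≡⟨ cong (λ u → a ∙ (u ∙ foldr _∙_ ε ys)) (comm y _) ⟩
      a ∙ (((length ys ⋆ a) ∙ y) ∙ foldr _∙_ ε ys)     ≡⟨ cong (a ∙_) (assoc _ y _) ⟩
      a ∙ ((length ys ⋆ a) ∙ (y ∙ foldr _∙_ ε ys))     ≡⟨ sym (assoc a _ _) ⟩
      (a ∙ (length ys ⋆ a)) ∙ (y ∙ foldr _∙_ ε ys)     ∎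

-- Integral domains and the number of roots of a polynomial

module DomainProps (F : Field) where
  open FieldProps F public
  open Theory F using (_^ᶠ_) public
  open Field F using () renaming (_≟_ to infix 4 _≟ᶠ_) public

  inverseʳ : ∀ {x} → x ≢ 0# → x * x ⁻¹ ≡ 1#
  inverseʳ = ⁻¹-inverse _

  inverseˡ : ∀ {x} → x ≢ 0# → x ⁻¹ * x ≡ 1#
  inverseˡ {x} h = trans (*-comm _ x) (inverseʳ h)

  *-cancelˡ : ∀ {x y z} → x ≢ 0# → x * y ≡ x * z → y ≡ z
  *-cancelˡ {x} {y} {z} h e = begin
    y              ≡⟨ sym (*-identityˡ y) ⟩
    1# * y         ≡⟨ cong (_* y) (sym (inverseˡ h)) ⟩
    x ⁻¹ * x * y   ≡⟨ *-assoc _ x y ⟩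
    x ⁻¹ * (x * y) ≡⟨ cong (x ⁻¹ *_) e ⟩
    x ⁻¹ * (x * z) ≡⟨ sym (*-assoc _ x z) ⟩
    x ⁻¹ * x * z   ≡⟨ cong (_* z) (inverseˡ h) ⟩
    1# * z         ≡⟨ *-identityˡ z ⟩
    z              ∎ where open ≡-Reasoning

  *-zero-split : ∀ {x y} → x * y ≡ 0# → x ≡ 0# ⊎ y ≡ 0#
  *-zero-split {x} {y} e with x ≟ᶠ 0#
  ... | yes h = inj₁ h
  ... | no h = inj₂ (*-cancelˡ h (trans e (sym (zeroʳ x))))

  *-≢0 : ∀ {x y} → x ≢ 0# → y ≢ 0# → x * y ≢ 0#
  *-≢0 hx hy e = [ hx , hy ]′ (*-zero-split e)

  ≢0-left : ∀ {x y} → x * y ≢ 0# → x ≢ 0#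
  ≢0-left h refl = h (zeroˡ _)

  ≢0-right : ∀ {x y} → x * y ≢ 0# → y ≢ 0#
  ≢0-right h refl = h (zeroʳ _)

  ^-≢0 : ∀ {x} k → x ≢ 0# → x ^ᶠ k ≢ 0#
  ^-≢0 zero    h e = 0≢1 (sym e)
  ^-≢0 (suc k) h = *-≢0 h (^-≢0 k h)

  ^-≡0 : ∀ {x} k → x ^ᶠ k ≡ 0# → x ≡ 0#
  ^-≡0 {x} k e with x ≟ᶠ 0#
  ... | yes h = h
  ... | no h = ⊥-elim (^-≢0 k h e)

  ⁻¹-≢0 : ∀ {x} → x ≢ 0# → x ⁻¹ ≢ 0#
  ⁻¹-≢0 {x} h e = 0≢1 (trans (sym (zeroʳ x)) (trans (cong (x *_) (sym e)) (inverseʳ h)))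

  -‿≢0 : ∀ {x} → x ≢ 0# → - x ≢ 0#
  -‿≢0 {x} h e = h (trans (sym (-‿involutive x)) (trans (cong -_ e) -0#≈0#))

  ^-+ : ∀ x k l → x ^ᶠ (k ℕ.+ l) ≡ x ^ᶠ k * x ^ᶠ l
  ^-+ x zero    l = sym (*-identityˡ _)
  ^-+ x (suc k) l = trans (cong (x *_) (^-+ x k l)) (sym (*-assoc x _ _))

  -- monic x^d + … with low-order coefficients first
  monic plain : ∀ {d} → Vec Carrier d → Carrier → Carrier
  monic []       x = 1#
  monic (c ∷ cs) x = c + x * monic cs x
  plain []       x = 0#
  plain (c ∷ cs) x = c + x * plain cs x

  monic-plain : ∀ {d} (cs : Vec Carrier d) x → monic cs x ≡ plain cs x + x ^ᶠ d
  monic-plain []       x = sym (+-identityˡ 1#)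
  monic-plain (c ∷ cs) x = trans (cong (λ u → c + x * u) (monic-plain cs x))
    (trans (cong (c +_) (distribˡ x _ _)) (sym (+-assoc c _ _)))

  private
    combine : ∀ {d} (a : Carrier) (p : Vec Carrier (suc d)) (s : Vec Carrier d) →
              Σ[ r ∈ Vec Carrier (suc d) ] ∀ x → monic r x ≡ monic p x + a * monic s x
    combine a (c ∷ []) [] = (c + a) ∷ [] , λ x →
      ℕS.solve 3 (λ c a x → (c ℕS.:+ a) ℕS.:+ x ℕS.:* ℕS.con 1 ℕS.:= (c ℕS.:+ x ℕS.:* ℕS.con 1) ℕS.:+ a ℕS.:* ℕS.con 1) refl c a x
    combine a (c ∷ p) (d ∷ s) = let r , h = combine a p s in (c + a * d) ∷ r , λ x →
      trans (cong (λ u → c + a * d + x * u) (h x))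
        (ℕS.solve 6 (λ c a d x p s → (c ℕS.:+ a ℕS.:* d) ℕS.:+ x ℕS.:* (p ℕS.:+ a ℕS.:* s)
            ℕS.:= (c ℕS.:+ x ℕS.:* p) ℕS.:+ a ℕS.:* (d ℕS.:+ x ℕS.:* s)) refl c a d x (monic p x) (monic s x))

  -- Division by x - a, written without subtraction so that a semiring solver suffices. If s is the
  -- quotient for p, then p + as is the one for c + xp, since xp(x) - ap(a) = (x - a)p(x) + a(p(x) -
  -- p(a)).
  divide : ∀ {d} (p : Vec Carrier (suc d)) (a : Carrier) →
           Σ[ s ∈ Vec Carrier d ] ∀ x → monic p x + a * monic s x ≡ monic p a + x * monic s x
  divide (c ∷ []) a = [] , λ x →
    ℕS.solve 3 (λ c a x → (c ℕS.:+ x ℕS.:* ℕS.con 1) ℕS.:+ a ℕS.:* ℕS.con 1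
       ℕS.:= (c ℕS.:+ a ℕS.:* ℕS.con 1) ℕS.:+ x ℕS.:* ℕS.con 1) refl c a x
  divide (c ∷ p@(_ ∷ _)) a =
    let s , h = divide p a
        r , g = combine a p s
    in r , λ x → begin
      c + x * monic p x + a * monic r x
        ≡⟨ cong (λ u → c + x * monic p x + a * u) (trans (g x) (h x)) ⟩
      c + x * monic p x + a * (monic p a + x * monic s x)
        ≡⟨ ℕS.solve 6 (λ c x a p pa s → (c ℕS.:+ x ℕS.:* p) ℕS.:+ a ℕS.:* (pa ℕS.:+ x ℕS.:* s)
             ℕS.:= (c ℕS.:+ a ℕS.:* pa) ℕS.:+ x ℕS.:* (p ℕS.:+ a ℕS.:* s)) refl c x a (monic p x) (monic p a) (monic s x) ⟩
      c + a * monic p a + x * (monic p x + a * monic s x)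
        ≡⟨ cong (λ u → c + a * monic p a + x * u) (sym (g x)) ⟩
      c + a * monic p a + x * monic r x ∎
    where open ≡-Reasoning

  roots-≤-degree : ∀ {d} (p : Vec Carrier d) {xs} → Unique xs → All (λ x → monic p x ≡ 0#) xs → length xs ℕ.≤ d
  roots-≤-degree p  {[]} _ _ = ℕ.z≤n
  roots-≤-degree [] {_ ∷ _} _ (h ∷ _) = ⊥-elim (0≢1 (sym h))
  roots-≤-degree p@(_ ∷ _) {a ∷ xs} (a∉ ∷ u) (h ∷ hs) =
    let s , e = divide p a
        root : ∀ {x} → a ≢ x × monic p x ≡ 0# → monic s x ≡ 0#
        root {x} (a≢x , hx) = case monic s x ≟ᶠ 0# of λ
          { (yes z) → z
          ; (no z) → ⊥-elim (a≢x (*-cancelˡ z (begin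
              monic s x * a               ≡⟨ *-comm _ a ⟩
              a * monic s x               ≡⟨ sym (+-identityˡ _) ⟩
              0# + a * monic s x          ≡⟨ cong (_+ a * monic s x) (sym hx) ⟩
              monic p x + a * monic s x   ≡⟨ e x ⟩
              monic p a + x * monic s x   ≡⟨ cong (_+ x * monic s x) h ⟩
              0# + x * monic s x          ≡⟨ +-identityˡ _ ⟩
              x * monic s x               ≡⟨ *-comm x _ ⟩
              monic s x * x               ∎))) }
    in ℕ.s≤s (roots-≤-degree s u (All.zipWith root (a∉ , hs)))
    where open ≡-Reasoning

-- Characteristic, trace and squares in a field of 3ⁿ elements

module FiniteField (F : Field) (n : ℕ) (hs : HasSize F (3 ℕ.^ n)) where
  private
    q : ℕ
    q = 3 ℕ.^ n

  all : Card (λ (_ : Field.Carrier F) → ⊤) q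
  all = let xs , u , c , l = hs in card xs u _ (λ _ → c _) l

  opaque
    -- Adding 1 permutes the field, so the sum S of all elements satisfies S = q·1 + S. Hence (3·1)ⁿ
    -- = q·1 = 0, and a domain has no nilpotent elements. The ring solver over 𝔽₃ takes this as its
    -- hypothesis.
    characteristic : let open Field F in 1# + (1# + 1#) ≡ 0#
    characteristic = trans (cong (λ u → 1# + (1# + u)) (sym (+-identityʳ 1#))) (power≡0 n (trans (sym (power n)) q·1≡0))
      where
      open DomainProps F
      open IsCommutativeRing isCommutativeRing using (+-isCommutativeMonoid)
      open Algebra.Properties.Semiring.Mult (CommutativeRing.semiring commutativeRing)
        using (×1-homo-*) renaming (_×_ to _⋆_)
      +-cancel : ∀ {a x y} → a + x ≡ a + y → x ≡ y
      +-cancel {a} {x} {y} e = trans (step x) (trans (cong (- a +_) e) (sym (step y)))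
        where
        step : ∀ z → z ≡ - a + (a + z)
        step z = trans (sym (+-identityˡ z)) (trans (cong (_+ z) (sym (-‿inverseˡ a))) (+-assoc _ _ _))
      S : Carrier
      S = foldr _+_ 0# (Card.elems all)
      q·1≡0 : q ⋆ 1# ≡ 0#
      q·1≡0 = +-cancel {S} (trans (+-comm S _) (trans (sym (fold-translate +-isCommutativeMonoid 1# all _ +-cancel
        λ {y} _ → - 1# + y , tt , trans (sym (+-assoc _ _ _)) (trans (cong (_+ y) (-‿inverseʳ 1#)) (+-identityˡ y)))) (sym (+-identityʳ S))))
      power : ∀ k → (3 ℕ.^ k) ⋆ 1# ≡ (3 ⋆ 1#) ^ᶠ k
      power zero    = +-identityʳ 1#
      power (suc k) = trans (×1-homo-* 3 (3 ℕ.^ k)) (cong (3 ⋆ 1# *_) (power k))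
      power≡0 : ∀ k → (3 ⋆ 1#) ^ᶠ k ≡ 0# → 3 ⋆ 1# ≡ 0#
      power≡0 k = ^-≡0 k

module FiniteFieldFacts (F : Field) (n : ℕ) (hs : HasSize F (3 ℕ.^ n)) where
  open DomainProps F public
  open FiniteField F n hs public
  open RingSolver F characteristic public
  open Formulas _+_ _*_ -_ 0# 1# public
  open Theory F public using (IsSquare; Tr)
  module E {n} = ExprFormulas {n}

  order : ℕ
  order = 3 ℕ.^ n

  ∃? : {P : Carrier → Set} → Decidable P → Dec (∃ P)
  ∃? P? with Any.any? P? (elems all)
  ... | yes h = let x , _ , p = find h in yes (x , p)
  ... | no h = no λ (x , p) → h (lose (complete all tt) p)

  square? : Decidable IsSquare
  square? r = ∃? λ s → s * s ≟ᶠ r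

  opaque
    units∃ : ∃[ m ] (Card (_≢ 0#) m × m ℕ.+ 1 ≡ order)
    units∃ = let m , c , e = card-∖ _≟ᶠ_ all (card-single 0#) _ in m , card-⇔ proj₂ (tt ,_) c , e

    m : ℕ
    m = proj₁ units∃

    units : Card (_≢ 0#) m
    units = proj₁ (proj₂ units∃)

    m≢0 : m ≢ 0
    m≢0 e = card-zero (subst (Card (_≢ 0#)) e units) (λ z → 0≢1 (sym z))

    order≡m+1 : order ≡ suc m
    order≡m+1 = trans (sym (proj₂ (proj₂ units∃))) (ℕ.+-comm m 1)

  1≢0 : 1# ≢ 0#
  1≢0 = 0≢1 ∘ sym

  -- For n = 0 there would be no units, but 1 is one. The predecessor of n is needed to state the
  -- degree of the trace.
  n-positive : ∃[ k ] n ≡ suc k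
  n-positive = go n refl
    where
    go : ∀ k → n ≡ k → ∃[ k ] n ≡ suc k
    go (suc k) e = k , e
    go zero e = ⊥-elim (card-zero (subst (Card (_≢ 0#)) (ℕ.suc-injective (trans (sym order≡m+1) (cong (3 ℕ.^_) e))) units) 1≢0)

  private
    -- Multiplication by x permutes the units, so their product P satisfies P = xᵐP.
    x^m≡1 : ∀ {x} → x ≢ 0# → x ^ᶠ m ≡ 1#
    x^m≡1 {x} h = sym (*-cancelˡ P≢0 (begin
      P * 1#       ≡⟨ *-identityʳ P ⟩
      P            ≡⟨ fold-translate *-isCommutativeMonoid x units (*-≢0 h) (*-cancelˡ h)
                        (λ {y} y≢0 → x ⁻¹ * y , *-≢0 (⁻¹-≢0 h) y≢0 ,
                           trans (sym (*-assoc x _ y)) (trans (cong (_* y) (inverseʳ h)) (*-identityˡ y))) ⟩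
      (m ⋆ x) * P  ≡⟨ cong (_* P) (power m) ⟩
      x ^ᶠ m * P   ≡⟨ *-comm _ P ⟩
      P * x ^ᶠ m   ∎))
      where
      open ≡-Reasoning
      open IsCommutativeRing isCommutativeRing using (*-isCommutativeMonoid)
      open Algebra.Properties.Monoid.Mult (CommutativeRing.*-monoid commutativeRing) using () renaming (_×_ to _⋆_)
      P : Carrier
      P = foldr _*_ 1# (elems units)
      power : ∀ k → k ⋆ x ≡ x ^ᶠ k
      power zero    = refl
      power (suc k) = cong (x *_) (power k)
      product≢0 : ∀ {xs} → All (_≢ 0#) xs → foldr _*_ 1# xs ≢ 0#
      product≢0 []       = 1≢0
      product≢0 (h ∷ hs) = *-≢0 h (product≢0 hs)
      P≢0 : P ≢ 0#
      P≢0 = product≢0 (All.tabulate (sound units))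

  opaque
    fermat : ∀ x → x ^ᶠ order ≡ x
    fermat x with x ≟ᶠ 0#
    ... | yes refl = trans (cong (0# ^ᶠ_) order≡m+1) (zeroˡ _)
    ... | no h = trans (cong (x ^ᶠ_) order≡m+1) (trans (cong (x *_) (x^m≡1 h)) (*-identityʳ x))

  cube-step : ∀ k x → x ^ᶠ (3 ℕ.^ suc k) ≡ (x ^ᶠ (3 ℕ.^ k)) ^ 3
  cube-step k x = trans (^-+ x (3 ℕ.^ k) _) (cong (x ^ᶠ (3 ℕ.^ k) *_)
    (trans (^-+ x (3 ℕ.^ k) _) (cong (x ^ᶠ (3 ℕ.^ k) *_) (^-+ x (3 ℕ.^ k) 0))))

  cube-+ : ∀ a b → (a + b) ^ 3 ≡ a ^ 3 + b ^ 3
  cube-+ a b = solve (a ∷ b ∷ []) λ a b → (a :+ b) E.^ 3 :≡ a E.^ 3 :+ b E.^ 3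

  frobenius-+ : ∀ k x y → (x + y) ^ᶠ (3 ℕ.^ k) ≡ x ^ᶠ (3 ℕ.^ k) + y ^ᶠ (3 ℕ.^ k)
  frobenius-+ zero    x y = distribʳ 1# x y
  frobenius-+ (suc k) x y = begin
    (x + y) ^ᶠ (3 ℕ.^ suc k)                                 ≡⟨ cube-step k (x + y) ⟩
    ((x + y) ^ᶠ (3 ℕ.^ k)) ^ 3                               ≡⟨ cong (_^ 3) (frobenius-+ k x y) ⟩
    (x ^ᶠ (3 ℕ.^ k) + y ^ᶠ (3 ℕ.^ k)) ^ 3                    ≡⟨ cube-+ _ _ ⟩
    (x ^ᶠ (3 ℕ.^ k)) ^ 3 + (y ^ᶠ (3 ℕ.^ k)) ^ 3              ≡⟨ cong₂ _+_ (sym (cube-step k x)) (sym (cube-step k y)) ⟩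
    x ^ᶠ (3 ℕ.^ suc k) + y ^ᶠ (3 ℕ.^ suc k)                  ∎ where open ≡-Reasoning

  cube-power : ∀ k x → (x ^ 3) ^ᶠ k ≡ (x ^ᶠ k) ^ 3
  cube-power zero    x = solve [] (:1 :≡ :1 :* (:1 :* (:1 :* :1)))
  cube-power (suc k) x = trans (cong (x ^ 3 *_) (cube-power k x))
    (solve (x ∷ x ^ᶠ k ∷ []) λ x y → x E.^ 3 :* y E.^ 3 :≡ (x :* y) E.^ 3)

  Tr-+ : ∀ k x y → Tr k (x + y) ≡ Tr k x + Tr k y
  Tr-+ zero    x y = sym (+-identityˡ 0#)
  Tr-+ (suc k) x y = trans (cong₂ _+_ (Tr-+ k x y) (frobenius-+ k x y))
    (solve (Tr k x ∷ Tr k y ∷ x ^ᶠ (3 ℕ.^ k) ∷ y ^ᶠ (3 ℕ.^ k) ∷ []) λ a b c d → (a :+ b) :+ (c :+ d) :≡ (a :+ c) :+ (b :+ d))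

  Tr-cube : ∀ k x → Tr k (x ^ 3) ≡ Tr k x ^ 3
  Tr-cube zero    x = solve [] (:0 :≡ :0 E.^ 3)
  Tr-cube (suc k) x = trans (cong₂ _+_ (Tr-cube k x) (cube-power (3 ℕ.^ k) x)) (sym (cube-+ _ _))

  -- Cubing moves each summand x^(3^i) one place on, so the two sums differ only at their ends. For
  -- k = n the ends agree by Fermat's theorem.
  Tr-telescope : ∀ k x → Tr k (x ^ 3) + x ≡ Tr k x + x ^ᶠ (3 ℕ.^ k)
  Tr-telescope zero    x = cong (0# +_) (sym (*-identityʳ x))
  Tr-telescope (suc k) x = begin
    Tr k (x ^ 3) + (x ^ 3) ^ᶠ (3 ℕ.^ k) + x   ≡⟨ solve (Tr k (x ^ 3) ∷ (x ^ 3) ^ᶠ (3 ℕ.^ k) ∷ x ∷ []) (λ a b c → a :+ b :+ c :≡ (a :+ c) :+ b) ⟩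
    Tr k (x ^ 3) + x + (x ^ 3) ^ᶠ (3 ℕ.^ k)   ≡⟨ cong₂ _+_ (Tr-telescope k x) (trans (cube-power (3 ℕ.^ k) x) (sym (cube-step k x))) ⟩
    Tr k x + x ^ᶠ (3 ℕ.^ k) + x ^ᶠ (3 ℕ.^ suc k) ∎ where open ≡-Reasoning

  Tr-frobenius : ∀ x → Tr n (x ^ 3) ≡ Tr n x
  Tr-frobenius x = lin₁ 1# (trans (Tr-telescope n x) (cong (Tr n x +_) (fermat x)))
    (solve (Tr n (x ^ 3) ∷ Tr n x ∷ x ∷ []) λ a b x → a :- b :≡ :1 :* ((a :+ x) :- (b :+ x)))

  Tr-0 : Tr n 0# ≡ 0#
  Tr-0 = lin₁ (- 1#) (trans (cong (Tr n) (sym (+-identityˡ 0#))) (Tr-+ n 0# 0#))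
    (solve (Tr n 0# ∷ []) λ a → a :- :0 :≡ (:- :1) :* (a :- (a :+ a)))

  Tr-neg : ∀ x → Tr n (- x) ≡ - Tr n x
  Tr-neg x = lin₂ 1# 1# (sym (Tr-+ n x (- x))) (trans (cong (Tr n) (-‿inverseʳ x)) Tr-0)
    (solve (Tr n x ∷ Tr n (- x) ∷ Tr n (x - x) ∷ []) λ a b c → b :- (:- a) :≡ :1 :* ((a :+ b) :- c) :+ :1 :* (c :- :0))

  -- The trace takes values in 𝔽₃, as it is fixed by cubing.
  Tr-values : ∀ x → Tr n x ≡ 0# ⊎ Tr n x ≡ 1# ⊎ Tr n x ≡ - 1#
  Tr-values x = case *-zero-split {Tr n x} {(Tr n x - 1#) * (Tr n x + 1#)} (lin₁ 1# (trans (sym (Tr-cube n x)) (Tr-frobenius x))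
      (solve (Tr n x ∷ []) λ t → t :* ((t :- :1) :* (t :+ :1)) :- :0 :≡ :1 :* (t E.^ 3 :- t))) of λ
    { (inj₁ h) → inj₁ h
    ; (inj₂ h) → case *-zero-split h of λ
      { (inj₁ h) → inj₂ (inj₁ (-≡0⇒≡ h))
      ; (inj₂ h) → inj₂ (inj₂ (lin₁ 1# h (solve (Tr n x ∷ []) λ t → t :- (:- :1) :≡ :1 :* ((t :+ :1) :- :0)))) } }

  private
    -- Functions that are polynomials of degree less than `d`. They show that the trace is a monic
    -- polynomial of degree 3^(n-1), which bounds the number of its zeros.
    Below : ℕ → (Carrier → Carrier) → Set
    Below d f = Σ[ c ∈ Vec Carrier d ] ∀ x → f x ≡ plain c x

    below-0 : ∀ d → Below d (λ _ → 0#)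
    below-0 zero    = [] , λ _ → refl
    below-0 (suc d) = let c , h = below-0 d in 0# ∷ c , λ x →
      trans (solve (x ∷ []) λ x → :0 :≡ :0 :+ x :* :0) (cong (λ u → 0# + x * u) (h x))

    below-power : ∀ {d} k → k ℕ.< d → Below d (_^ᶠ k)
    below-power zero    (ℕ.s≤s {n = d} _) = let c , h = below-0 d in 1# ∷ c , λ x →
      trans (solve (x ∷ []) λ x → :1 :≡ :1 :+ x :* :0) (cong (λ u → 1# + x * u) (h x))
    below-power (suc k) (ℕ.s≤s k<d) = let c , h = below-power k k<d in 0# ∷ c , λ x →
      trans (cong (x *_) (h x)) (sym (+-identityˡ _))

    plain-+ : ∀ {d} (c c′ : Vec Carrier d) x → plain c x + plain c′ x ≡ plain (Vec.zipWith _+_ c c′) x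
    plain-+ [] [] x = +-identityˡ 0#
    plain-+ (a ∷ c) (b ∷ c′) x = trans
      (solve (a ∷ b ∷ x ∷ plain c x ∷ plain c′ x ∷ []) λ a b x c d → (a :+ x :* c) :+ (b :+ x :* d) :≡ (a :+ b) :+ x :* (c :+ d))
      (cong (λ u → a + b + x * u) (plain-+ c c′ x))

    below-Tr : ∀ {d} k → (∀ {i} → i ℕ.< k → 3 ℕ.^ i ℕ.< d) → Below d (Tr k)
    below-Tr zero    h = below-0 _
    below-Tr (suc k) h =
      let c , e = below-Tr k (h ∘ ℕ.m<n⇒m<1+n)
          c′ , e′ = below-power (3 ℕ.^ k) (h ℕ.≤-refl)
      in Vec.zipWith _+_ c c′ , λ x → trans (cong₂ _+_ (e x) (e′ x)) (plain-+ c c′ x)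

    monic-Tr : ∀ k → Σ[ c ∈ Vec Carrier (3 ℕ.^ k) ] ∀ x → Tr (suc k) x ≡ monic c x
    monic-Tr k = let c , h = below-Tr {3 ℕ.^ k} k (ℕ.^-monoʳ-< 3 (ℕ.s≤s (ℕ.s≤s ℕ.z≤n))) in
      c , λ x → trans (cong (_+ x ^ᶠ (3 ℕ.^ k)) (h x)) (sym (monic-plain c x))

  -- The Artin-Schreier map, additive with kernel 𝔽₃.
  ℘ : Carrier → Carrier
  ℘ w = w ^ 3 - w

  ℘-fibre : ∀ {w v} → ℘ w ≡ ℘ v → w ≡ v ⊎ w ≡ v + 1# ⊎ w ≡ v - 1#
  ℘-fibre {w} {v} e = case *-zero-split {w - v} {(w - v - 1#) * (w - v + 1#)} (lin₁ 1# e
      (solve (w ∷ v ∷ []) λ w v → (w :- v) :* ((w :- v :- :1) :* (w :- v :+ :1)) :- :0 :≡ :1 :* ((w E.^ 3 :- w) :- (v E.^ 3 :- v)))) of λ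
    { (inj₁ h) → inj₁ (-≡0⇒≡ h)
    ; (inj₂ h) → case *-zero-split h of λ
      { (inj₁ h) → inj₂ (inj₁ (lin₁ 1# h (solve (w ∷ v ∷ []) λ w v → w :- (v :+ :1) :≡ :1 :* ((w :- v :- :1) :- :0))))
      ; (inj₂ h) → inj₂ (inj₂ (lin₁ 1# h (solve (w ∷ v ∷ []) λ w v → w :- (v :- :1) :≡ :1 :* ((w :- v :+ :1) :- :0)))) } }

  x≢x+1 : ∀ {x} → x ≢ x + 1#
  x≢x+1 {x} e = 1≢0 (lin₁ (- 1#) e (solve (x ∷ []) λ x → :1 :- :0 :≡ (:- :1) :* (x :- (x :+ :1))))

  x≢x-1 : ∀ {x} → x ≢ x - 1#
  x≢x-1 {x} e = 1≢0 (lin₁ 1# e (solve (x ∷ []) λ x → :1 :- :0 :≡ :1 :* (x :- (x :- :1))))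

  x+1≢x-1 : ∀ {x} → x + 1# ≢ x - 1#
  x+1≢x-1 {x} e = 1≢0 (lin₁ (- 1#) e (solve (x ∷ []) λ x → :1 :- :0 :≡ (:- :1) :* ((x :+ :1) :- (x :- :1))))

  ℘-fibre-card : ∀ v → Card (λ w → ℘ w ≡ ℘ v) 3
  ℘-fibre-card v = card (v ∷ v + 1# ∷ v - 1# ∷ [])
    ((x≢x+1 ∷ x≢x-1 ∷ []) ∷ (x+1≢x-1 ∷ []) ∷ [] ∷ [])
    (λ { (here refl) → refl
       ; (there (here refl)) → solve (v ∷ []) λ v → (v :+ :1) E.^ 3 :- (v :+ :1) :≡ v E.^ 3 :- v
       ; (there (there (here refl))) → solve (v ∷ []) λ v → (v :- :1) E.^ 3 :- (v :- :1) :≡ v E.^ 3 :- v })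
    (λ e → case ℘-fibre e of λ { (inj₁ h) → here h ; (inj₂ (inj₁ h)) → there (here h) ; (inj₂ (inj₂ h)) → there (there (here h)) })
    refl

  ℘-trace : ∀ {w e} → ℘ w ≡ e → Tr n e ≡ 0#
  ℘-trace {w} refl = begin
    Tr n (w ^ 3 - w)           ≡⟨ Tr-+ n (w ^ 3) (- w) ⟩
    Tr n (w ^ 3) + Tr n (- w)  ≡⟨ cong₂ _+_ (Tr-frobenius w) (Tr-neg w) ⟩
    Tr n w - Tr n w            ≡⟨ -‿inverseʳ _ ⟩
    0#                         ∎ where open ≡-Reasoning

  opaque
    -- Additive Hilbert 90 by counting. The image of `℘` lies in the kernel of the trace and has q/3
    -- elements, as `℘` is three-to-one; the kernel has at most q/3 elements, being the zero set of
    -- a polynomial of that degree.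
    trace-kernel : ∃[ K ] ∃[ M ] (Card (λ e → ∃[ w ] ℘ w ≡ e) K × Card (λ e → Tr n e ≡ 0#) M × M ≡ K × K ℕ.* 3 ≡ order)
    trace-kernel =
      let k , n≡ = n-positive
          c , h = monic-Tr k
          M , ker = card-filter all (λ e → Tr n e ≟ᶠ 0#)
          ker = card-⇔ proj₂ (tt ,_) ker
          K , im , K3 = card-fibres _≟ᶠ_ {R = λ w e → ℘ w ≡ e} {Q = λ e → ∃[ w ] ℘ w ≡ e}
             (card-bij (λ w → w , ℘ w) all (λ _ → refl) (λ _ _ e → cong proj₁ e) (λ { {w , _} refl → w , tt , refl }))
             (λ {w} e → w , e) id (λ { (w , refl) → ℘-fibre-card w })
          M≤ : M ℕ.≤ 3 ℕ.^ k
          M≤ = subst (ℕ._≤ 3 ℕ.^ k) (size ker) (roots-≤-degree c (unique ker)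
                 (All.tabulate λ {x} x∈ → trans (sym (h x)) (subst (λ n → Tr n x ≡ 0#) n≡ (sound ker x∈))))
          K≡ : K ≡ 3 ℕ.^ k
          K≡ = ℕ.*-cancelʳ-≡ K (3 ℕ.^ k) 3 (trans K3 (trans (cong (3 ℕ.^_) n≡) (ℕ.*-comm 3 (3 ℕ.^ k))))
      in K , M , im , ker , ℕ.≤-antisym (subst (M ℕ.≤_) (sym K≡) M≤) (card-≤ im ker (λ (w , e) → ℘-trace e)) , K3

    Tr≡0⇒℘ : ∀ {e} → Tr n e ≡ 0# → ∃[ w ] ℘ w ≡ e
    Tr≡0⇒℘ = let K , M , im , ker , M≡K , _ = trace-kernel in
      card-⊆-≡ _≟ᶠ_ im (subst (Card _) M≡K ker) (λ (w , e) → ℘-trace e)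

    ∃Tr≢0 : ∃[ e ] Tr n e ≢ 0#
    ∃Tr≢0 = let K , M , im , ker , M≡K , K3 = trace-kernel
                N , rest , N+M = card-∖ _≟ᶠ_ all ker _
            in go N rest (trans N+M (trans (sym K3) (cong (ℕ._* 3) (sym M≡K)))) (trans (cong (ℕ._* 3) M≡K) K3)
      where
      go : ∀ N {M} → Card (λ e → ⊤ × Tr n e ≢ 0#) N → N ℕ.+ M ≡ M ℕ.* 3 → M ℕ.* 3 ≡ order → ∃[ e ] Tr n e ≢ 0#
      go (suc N) c _ _ = let e , _ , h = card-member c in e , h
      go zero {zero} c _ z = case trans z order≡m+1 of λ ()
      go zero {suc M} c e _ = ⊥-elim (ℕ.<-irrefl (ℕ.suc-injective e) (ℕ.s≤s (ℕ.≤-trans (ℕ.m≤m*n M 3) (ℕ.n≤1+n _))))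

  square-ratio : ∀ {a s} → s ≢ 0# → IsSquare (a * (s * s)) → IsSquare a
  square-ratio {a} {s} h (t , e) = t * s ⁻¹ , lin₂ ((s ⁻¹) ^ 2) (a * (s * s ⁻¹ + 1#)) e (inverseʳ h)
    (solve (a ∷ s ∷ t ∷ s ⁻¹ ∷ []) λ a s t s′ → (t :* s′) :* (t :* s′) :- a :≡
       s′ E.^ 2 :* (t :* t :- a :* (s :* s)) :+ a :* (s :* s′ :+ :1) :* (s :* s′ :- :1))

  square-* : ∀ {a b} → IsSquare a → IsSquare b → IsSquare (a * b)
  square-* (s , refl) (t , refl) = s * t , solve (s ∷ t ∷ []) λ s t → (s :* t) :* (s :* t) :≡ (s :* s) :* (t :* t)

  nonsquare-≢0 : ∀ {a} → ¬ IsSquare a → a ≢ 0#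
  nonsquare-≢0 h refl = h (0# , zeroˡ 0#)

  square-*-nonsquare : ∀ {a b} → IsSquare a → a ≢ 0# → ¬ IsSquare b → ¬ IsSquare (a * b)
  square-*-nonsquare {a} {b} (s , refl) h nb sq = nb (square-ratio {b} {s} (≢0-left h) (subst IsSquare (*-comm _ b) sq))

  roots-of-square : ∀ {s t} → s * s ≡ t * t → s ≡ t ⊎ s ≡ - t
  roots-of-square {s} {t} e = case *-zero-split {s - t} {s + t} (lin₁ 1# e (solve (s ∷ t ∷ []) λ s t →
      (s :- t) :* (s :+ t) :- :0 :≡ :1 :* (s :* s :- t :* t))) of λ
    { (inj₁ h) → inj₁ (-≡0⇒≡ h)
    ; (inj₂ h) → inj₂ (lin₁ 1# h (solve (s ∷ t ∷ []) λ s t → s :- (:- t) :≡ :1 :* ((s :+ t) :- :0))) }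

  x≢-x : ∀ {x} → x ≢ 0# → x ≢ - x
  x≢-x {x} h e = h (lin₁ (- 1#) e (solve (x ∷ []) λ x → x :- :0 :≡ (:- :1) :* (x :- (:- x))))

  square-fibre-card : ∀ {t} → t ≢ 0# → Card (λ s → s * s ≡ t * t) 2
  square-fibre-card {t} h = card (t ∷ - t ∷ []) ((x≢-x h ∷ []) ∷ [] ∷ [])
    (λ { (here refl) → refl ; (there (here refl)) → solve (t ∷ []) λ t → (:- t) :* (:- t) :≡ t :* t })
    (λ e → case roots-of-square e of λ { (inj₁ h) → here h ; (inj₂ h) → there (here h) }) refl

  NonzeroSquare : Carrier → Set
  NonzeroSquare a = a ≢ 0# × IsSquare a

  opaque
    squares∃ : ∃[ k ] (Card NonzeroSquare k × k ℕ.* 2 ≡ m)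
    squares∃ = card-fibres _≟ᶠ_ {R = λ s a → s * s ≡ a × s ≢ 0#}
      (card-bij (λ s → s , s * s) units (λ h → refl , h) (λ _ _ e → cong proj₁ e) (λ { {s , _} (refl , h) → s , h , refl }))
      (λ { {s} (refl , h) → *-≢0 h h , s , refl }) (λ { (h , s , refl) → s , refl , ≢0-left h })
      (λ { (h , t , refl) → card-⇔ (λ e → e , λ { refl → h (trans (sym e) (zeroˡ 0#)) }) proj₁ (square-fibre-card (≢0-left h)) })

    half : ℕ
    half = proj₁ squares∃

    m≡half+half : m ≡ half ℕ.+ half
    m≡half+half = trans (sym (proj₂ (proj₂ squares∃))) (trans (ℕ.*-comm half 2) (cong (half ℕ.+_) (ℕ.+-identityʳ half)))

    squares : Card NonzeroSquare half
    squares = proj₁ (proj₂ squares∃)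

    nonsquares : Card (λ a → ¬ IsSquare a) half
    nonsquares = let N , c , e = card-∖ _≟ᶠ_ units squares proj₁ in
      subst (Card _) (ℕ.+-cancelʳ-≡ half N half (trans e m≡half+half))
        (card-⇔ (λ (h , f) sq → f (h , sq)) (λ f → nonsquare-≢0 f , f ∘ proj₂) c)

  opaque
    -- Multiplication by the nonsquare `a` maps the nonzero squares injectively to the nonsquares.
    -- Both sets have (q - 1)/2 elements, so every nonsquare `b` is reached.
    nonsquare-ratio : ∀ {a b} → ¬ IsSquare a → ¬ IsSquare b → ∃[ s ] (s ≢ 0# × a * (s * s) ≡ b)
    nonsquare-ratio {a} na nb with card-inj⇒surj _≟ᶠ_ (a *_) squares nonsquares
       (λ { {x} (h , sq) → square-*-nonsquare sq h na ∘ subst IsSquare (*-comm a x) }) (λ _ _ → *-cancelˡ (nonsquare-≢0 na)) nb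
    ... | x , (h , s , refl) , e = s , ≢0-left h , e

    nonsquare-* : ∀ {a b} → ¬ IsSquare a → ¬ IsSquare b → IsSquare (a * b)
    nonsquare-* {a} na nb with nonsquare-ratio na nb
    ... | s , _ , refl = a * s , solve (a ∷ s ∷ []) λ a s → (a :* s) :* (a :* s) :≡ a :* (a :* (s :* s))

  opaque
    ∃nonsquare : ∃[ ε ] ¬ IsSquare ε
    ∃nonsquare with half in e
    ... | zero = ⊥-elim (card-zero (subst (Card (_≢ 0#)) (trans m≡half+half (cong₂ ℕ._+_ e e)) units) 1≢0)
    ... | suc k = card-member (subst (Card (λ a → ¬ IsSquare a)) e nonsquares)

    ε : Carrier
    ε = proj₁ ∃nonsquare

    ε-nonsquare : ¬ IsSquare ε
    ε-nonsquare = proj₂ ∃nonsquare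

  ε≢0 : ε ≢ 0#
  ε≢0 = nonsquare-≢0 ε-nonsquare

  -- The difference of the two sides is (w - v)((w - v)² - ν), and (w - v)² is never the nonsquare
  -- ν. On a finite field this makes w³ - νw bijective.
  additive-injective : ∀ {ν w v} → ¬ IsSquare ν → w ^ 3 - ν * w ≡ v ^ 3 - ν * v → w ≡ v
  additive-injective {ν} {w} {v} h e = case *-zero-split {w - v} {(w - v) * (w - v) - ν} (lin₁ 1# e
      (solve (w ∷ v ∷ ν ∷ []) λ w v ν → (w :- v) :* ((w :- v) :* (w :- v) :- ν) :- :0 :≡ :1 :* ((w E.^ 3 :- ν :* w) :- (v E.^ 3 :- ν :* v)))) of λ
    { (inj₁ z) → -≡0⇒≡ z ; (inj₂ z) → ⊥-elim (h (w - v , -≡0⇒≡ z)) }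

  opaque
    additive-surjective : ∀ {ν} → ¬ IsSquare ν → ∀ e → ∃[ w ] w ^ 3 - ν * w ≡ e
    additive-surjective {ν} h e = let w , _ , eq = card-inj⇒surj _≟ᶠ_ {Q = λ _ → ⊤} (λ w → w ^ 3 - ν * w) all all _ (λ _ _ → additive-injective h) {e} tt
      in w , eq

-- The action of GL₂ on quartic forms

module Quartics (F : Field) (n : ℕ) (hs : HasSize F (3 ℕ.^ n)) where
  open FiniteFieldFacts F n hs public
  open Theory F public using (Quartic; coeffs; Nonzero; Δ; ȷ; NonDeg; _≈ₚ_; Mat; mat; det; act; _∼_)

  -1≢0 : - 1# ≢ 0#
  -1≢0 = -‿≢0 1≢0

  quotient : ∀ {r} → r ≢ 0# → ∀ p → ∃[ p′ ] r * p′ ≡ p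
  quotient {r} h p = r ⁻¹ * p , trans (sym (*-assoc r _ p)) (trans (cong (_* p) (inverseʳ h)) (*-identityˡ p))

  sc-* : ∀ a b f → sc a (sc b f) ≡ sc (a * b) f
  sc-* a b ⟨ z0 , z1 , z2 , z3 , z4 ⟩ = solveᵥ (a ∷ b ∷ z0 ∷ z1 ∷ z2 ∷ z3 ∷ z4 ∷ []) λ a b z0 z1 z2 z3 z4 →
    E.sc a (E.sc b ⟨ z0 , z1 , z2 , z3 , z4 ⟩) :≡ E.sc (a :* b) ⟨ z0 , z1 , z2 , z3 , z4 ⟩

  sc-1 : ∀ f → sc 1# f ≡ f
  sc-1 ⟨ z0 , z1 , z2 , z3 , z4 ⟩ = solveᵥ (z0 ∷ z1 ∷ z2 ∷ z3 ∷ z4 ∷ []) λ z0 z1 z2 z3 z4 →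
    E.sc :1 ⟨ z0 , z1 , z2 , z3 , z4 ⟩ :≡ ⟨ z0 , z1 , z2 , z3 , z4 ⟩

  sc-inverse : ∀ {k} → k ≢ 0# → ∀ f → sc (k ⁻¹) (sc k f) ≡ f
  sc-inverse h f = trans (sc-* _ _ f) (trans (cong (λ k → sc k f) (inverseˡ h)) (sc-1 f))

  sub-sc : ∀ p q r s k f → sub p q r s (sc k f) ≡ sc k (sub p q r s f)
  sub-sc p q r s k ⟨ z0 , z1 , z2 , z3 , z4 ⟩ = solveᵥ (p ∷ q ∷ r ∷ s ∷ k ∷ z0 ∷ z1 ∷ z2 ∷ z3 ∷ z4 ∷ []) λ p q r s k z0 z1 z2 z3 z4 →
    E.sub p q r s (E.sc k ⟨ z0 , z1 , z2 , z3 , z4 ⟩) :≡ E.sc k (E.sub p q r s ⟨ z0 , z1 , z2 , z3 , z4 ⟩)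

  sub-∘ : ∀ p q r s p′ q′ r′ s′ f → sub p q r s (sub p′ q′ r′ s′ f) ≡
          sub (p′ * p + q′ * r) (p′ * q + q′ * s) (r′ * p + s′ * r) (r′ * q + s′ * s) f
  sub-∘ p q r s p′ q′ r′ s′ ⟨ a , b , c , d , e ⟩ =
    solveᵥ (a ∷ b ∷ c ∷ d ∷ e ∷ p ∷ q ∷ r ∷ s ∷ p′ ∷ q′ ∷ r′ ∷ s′ ∷ []) λ a b c d e p q r s p′ q′ r′ s′ →
      E.sub p q r s (E.sub p′ q′ r′ s′ ⟨ a , b , c , d , e ⟩) :≡
      E.sub (p′ :* p :+ q′ :* r) (p′ :* q :+ q′ :* s) (r′ :* p :+ s′ :* r) (r′ :* q :+ s′ :* s) ⟨ a , b , c , d , e ⟩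

  sub-adjugate : ∀ p q r s f → sub s (- q) (- r) p (sub p q r s f) ≡ sc ((p * s - q * r) ^ 4) f
  sub-adjugate p q r s ⟨ a , b , c , d , e ⟩ = solveᵥ (a ∷ b ∷ c ∷ d ∷ e ∷ p ∷ q ∷ r ∷ s ∷ []) λ a b c d e p q r s →
      E.sub s (:- q) (:- r) p (E.sub p q r s ⟨ a , b , c , d , e ⟩) :≡ E.sc ((p :* s :- q :* r) E.^ 4) ⟨ a , b , c , d , e ⟩

  act-sub : ∀ a b c d f → act (mat a b c d) f ≡ coeffs (sc (det (mat a b c d) ⁻¹ ^ 4) (sub d (- b) (- c) a f))
  act-sub a b c d ⟨ z0 , z1 , z2 , z3 , z4 ⟩ =
    solveₗ (det (mat a b c d) ⁻¹ ∷ a ∷ b ∷ c ∷ d ∷ z0 ∷ z1 ∷ z2 ∷ z3 ∷ z4 ∷ []) λ κ a b c d z0 z1 z2 z3 z4 →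
      E.actL κ a b c d ⟨ z0 , z1 , z2 , z3 , z4 ⟩ :≡
      Vec.toList (E.sc (κ E.^ 4) (E.sub d (:- b) (:- c) a ⟨ z0 , z1 , z2 , z3 , z4 ⟩))

  coeffs-injective : ∀ f h → coeffs f ≡ coeffs h → f ≡ h
  coeffs-injective ⟨ _ , _ , _ , _ , _ ⟩ ⟨ _ , _ , _ , _ , _ ⟩ refl = refl

  infix 4 _≋_
  -- The relation `_∼_` expressed by a substitution: (p q; r s) is the adjugate of the acting
  -- matrix, and the factor det⁻⁴ is absorbed in the scalar.
  record _≋_ (f h : Quartic) : Set where
    constructor equivalent
    field
      p q r s    : Carrier
      invertible : p * s - q * r ≢ 0#
      scalar     : Carrier
      scalar≢0   : scalar ≢ 0#
      equation   : sub p q r s f ≡ sc scalar h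

  opaque
    ∼⇒≋ : ∀ {f h} → f ∼ h → f ≋ h
    ∼⇒≋ {f} {h} (mat a b c d , D≢0 , k , k≢0 , e) = equivalent d (- b) (- c) a
      (λ z → D≢0 (trans (solve (a ∷ b ∷ c ∷ d ∷ []) λ a b c d → a :* d :- b :* c :≡ d :* a :- (:- b) :* (:- c)) z))
      ((κ ^ 4) ⁻¹ * k) (*-≢0 (⁻¹-≢0 (^-≢0 4 κ≢0)) k≢0)
      (trans (sym (sc-inverse (^-≢0 4 κ≢0) _)) (trans (cong (sc ((κ ^ 4) ⁻¹))
        (coeffs-injective _ _ (trans (sym (act-sub a b c d f)) e))) (sc-* _ k h)))
      where
      κ : Carrier
      κ = det (mat a b c d) ⁻¹
      κ≢0 : κ ≢ 0#
      κ≢0 = ⁻¹-≢0 D≢0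

    ≋⇒∼ : ∀ {f h} → f ≋ h → f ∼ h
    ≋⇒∼ {f} {h} (equivalent p q r s D≢0 k k≢0 e) = g ,
      D′≢0 , κ ^ 4 * k , *-≢0 (^-≢0 4 κ≢0) k≢0 ,
      trans (act-sub s (- q) (- r) p f) (cong coeffs (trans (cong (sc (κ ^ 4))
        (trans (cong₂ (λ q r → sub p q r s f) (-‿involutive q) (-‿involutive r)) e)) (sc-* (κ ^ 4) k h)))
      where
      g : Mat
      g = mat s (- q) (- r) p
      D′≢0 : det g ≢ 0#
      D′≢0 z = D≢0 (trans (solve (p ∷ q ∷ r ∷ s ∷ []) λ p q r s → p :* s :- q :* r :≡ s :* p :- (:- q) :* (:- r)) z)
      κ : Carrier
      κ = det g ⁻¹
      κ≢0 : κ ≢ 0#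
      κ≢0 = ⁻¹-≢0 D′≢0

    ≋-trans : ∀ {f g h} → f ≋ g → g ≋ h → f ≋ h
    ≋-trans {f} {g} {h} (equivalent p′ q′ r′ s′ D′≢0 k′ k′≢0 e′) (equivalent p q r s D≢0 k k≢0 e) = equivalent
      (p′ * p + q′ * r) (p′ * q + q′ * s) (r′ * p + s′ * r) (r′ * q + s′ * s)
      (λ z → *-≢0 D≢0 D′≢0 (trans (solve (p ∷ q ∷ r ∷ s ∷ p′ ∷ q′ ∷ r′ ∷ s′ ∷ []) λ p q r s p′ q′ r′ s′ →
         (p :* s :- q :* r) :* (p′ :* s′ :- q′ :* r′) :≡
         (p′ :* p :+ q′ :* r) :* (r′ :* q :+ s′ :* s) :- (p′ :* q :+ q′ :* s) :* (r′ :* p :+ s′ :* r)) z))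
      (k′ * k) (*-≢0 k′≢0 k≢0)
      (trans (sym (sub-∘ p q r s p′ q′ r′ s′ f)) (trans (cong (sub p q r s) e′)
        (trans (sub-sc p q r s k′ g) (trans (cong (sc k′) e) (sc-* k′ k h)))))

    ≋-sym : ∀ {f h} → f ≋ h → h ≋ f
    ≋-sym {f} {h} (equivalent p q r s D≢0 k k≢0 e) = equivalent s (- q) (- r) p
      (λ z → D≢0 (trans (solve (p ∷ q ∷ r ∷ s ∷ []) λ p q r s → p :* s :- q :* r :≡ s :* p :- (:- q) :* (:- r)) z))
      (k ⁻¹ * (p * s - q * r) ^ 4) (*-≢0 (⁻¹-≢0 k≢0) (^-≢0 4 D≢0))
      (trans (sym (sc-inverse k≢0 _)) (trans (cong (sc (k ⁻¹)) (trans (sym (sub-sc s (- q) (- r) p k h))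
        (trans (cong (sub s (- q) (- r) p) (sym e)) (sub-adjugate p q r s f)))) (sc-* (k ⁻¹) _ f)))

    by-sub : ∀ {p q r s f h} → p * s - q * r ≢ 0# → sub p q r s f ≡ h → f ≋ h
    by-sub D≢0 e = equivalent _ _ _ _ D≢0 1# 1≢0 (trans e (sym (sc-1 _)))

  ≋-tr : ∀ t f → f ≋ tr t f
  ≋-tr t f@(⟨ a , b , c , d , e ⟩) = by-sub {1#} {t} {0#} {1#}
    (λ z → 1≢0 (trans (solve (t ∷ []) λ t → :1 :≡ :1 :* :1 :- t :* :0) z))
    (solveᵥ (a ∷ b ∷ c ∷ d ∷ e ∷ t ∷ []) λ a b c d e t → E.sub :1 t :0 :1 ⟨ a , b , c , d , e ⟩ :≡ E.tr t ⟨ a , b , c , d , e ⟩)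

  ≋-dg : ∀ {u} → u ≢ 0# → ∀ f → f ≋ dg u f
  ≋-dg {u} h f@(⟨ a , b , c , d , e ⟩) = by-sub {1#} {0#} {0#} {u}
    (λ z → h (trans (solve (u ∷ []) λ u → u :≡ :1 :* u :- :0 :* :0) z))
    (solveᵥ (a ∷ b ∷ c ∷ d ∷ e ∷ u ∷ []) λ a b c d e u → E.sub :1 :0 :0 u ⟨ a , b , c , d , e ⟩ :≡ E.dg u ⟨ a , b , c , d , e ⟩)

  ≋-sw : ∀ f → f ≋ sw f
  ≋-sw f@(⟨ a , b , c , d , e ⟩) = by-sub {0#} {1#} {1#} {0#}
    (λ z → -1≢0 (trans (solve [] (:- :1 :≡ :0 :* :0 :- :1 :* :1)) z))
    (solveᵥ (a ∷ b ∷ c ∷ d ∷ e ∷ []) λ a b c d e → E.sub :0 :1 :1 :0 ⟨ a , b , c , d , e ⟩ :≡ E.sw ⟨ a , b , c , d , e ⟩)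

  sub-id : ∀ f → sub 1# 0# 0# 1# f ≡ f
  sub-id ⟨ a , b , c , d , e ⟩ = solveᵥ (a ∷ b ∷ c ∷ d ∷ e ∷ []) λ a b c d e → E.sub :1 :0 :0 :1 ⟨ a , b , c , d , e ⟩ :≡ ⟨ a , b , c , d , e ⟩

  ≋-refl : ∀ {f} → f ≋ f
  ≋-refl {f} = by-sub {1#} {0#} {0#} {1#} (λ z → 1≢0 (trans (solve [] (:1 :≡ :1 :* :1 :- :0 :* :0)) z)) (sub-id f)

  opaque
    ≋-unsc : ∀ {k f} → k ≢ 0# → sc k f ≋ f
    ≋-unsc {k} {f} h = equivalent 1# 0# 0# 1# (λ z → 1≢0 (trans (solve [] (:1 :≡ :1 :* :1 :- :0 :* :0)) z)) k h (sub-id (sc k f))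

  ≋-sc : ∀ {k f} → k ≢ 0# → f ≋ sc k f
  ≋-sc h = ≋-sym (≋-unsc h)

  record Invariant (C : Quartic → Set) : Set where
    field
      tr-inv : ∀ t {f} → C f → C (tr t f)
      dg-inv : ∀ {u} → u ≢ 0# → ∀ {f} → C f → C (dg u f)
      sw-inv : ∀ {f} → C f → C (sw f)
      sc-inv : ∀ {k} → k ≢ 0# → ∀ {f} → C f → C (sc k f)
  open Invariant public

  -- Bruhat decomposition: the translations, dilations and the swap generate.
  opaque
    invariant : ∀ {C} → Invariant C → ∀ {f h} → f ≋ h → C f → C h
    invariant {C} I {f} {h} (equivalent p q r s D≢0 k k≢0 e) Cf = subst C (sc-inverse k≢0 h) (sc-inv I (⁻¹-≢0 k≢0) (subst C e (go p q r s f D≢0 Cf)))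
      where
      triangular : ∀ p q s f → p ≢ 0# → s ≢ 0# → C f → C (sub p q 0# s f)
      triangular p q₀ s₀ f@(⟨ a , b , c , d , e ⟩) p≢0 s≢0 Cf with quotient p≢0 q₀ | quotient p≢0 s₀
      ... | q , refl | s , refl = subst C (solveᵥ (a ∷ b ∷ c ∷ d ∷ e ∷ p ∷ q ∷ s ∷ []) λ a b c d e p q s →
              E.sc (p E.^ 4) (E.tr q (E.dg s ⟨ a , b , c , d , e ⟩)) :≡ E.sub p (p :* q) :0 (p :* s) ⟨ a , b , c , d , e ⟩)
            (sc-inv I (^-≢0 4 p≢0) (tr-inv I q (dg-inv I (≢0-right s≢0) Cf)))
      -- All entries are divided by r, at the price of the scalar r⁴. The dilation factor q - ps is
      -- then minus the determinant over r².
      big-cell : ∀ p q r s f → r ≢ 0# → p * s - q * r ≢ 0# → C f → C (sub p q r s f)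
      big-cell p₀ q₀ r s₀ f@(⟨ a , b , c , d , e ⟩) r≢0 D≢0 Cf with quotient r≢0 p₀ | quotient r≢0 q₀ | quotient r≢0 s₀
      ... | p , refl | q , refl | s , refl = subst C (solveᵥ (a ∷ b ∷ c ∷ d ∷ e ∷ r ∷ p ∷ s ∷ q ∷ []) λ a b c d e r p s q →
              E.sc (r E.^ 4) (E.tr s (E.dg (q :- p :* s) (E.sw (E.tr p ⟨ a , b , c , d , e ⟩)))) :≡
              E.sub (r :* p) (r :* q) r (r :* s) ⟨ a , b , c , d , e ⟩)
            (sc-inv I (^-≢0 4 r≢0) (tr-inv I s (dg-inv I (λ z → D≢0 (lin₁ (- (r * r)) z
               (solve (r ∷ p ∷ s ∷ q ∷ []) λ r p s q → (r :* p) :* (r :* s) :- (r :* q) :* r :- :0 :≡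
                  (:- (r :* r)) :* ((q :- p :* s) :- :0)))) (sw-inv I (tr-inv I p Cf)))))
      go : ∀ p q r s f → p * s - q * r ≢ 0# → C f → C (sub p q r s f)
      go p q r s f D≢0 Cf with r ≟ᶠ 0#
      ... | no r≢0 = big-cell p q r s f r≢0 D≢0 Cf
      ... | yes refl = triangular p q s f (≢0-left ps≢0) (≢0-right ps≢0) Cf
        where
        ps≢0 : p * s ≢ 0#
        ps≢0 z = D≢0 (trans (solve (p ∷ q ∷ s ∷ []) λ p q s → p :* s :- q :* :0 :≡ p :* s) z)

-- Invariants, and normal forms of the forms with a root

module Invariants (F : Field) (n : ℕ) (hs : HasSize F (3 ℕ.^ n)) where
  open Quartics F n hs public

  Stable : (Quartic → Set) → Set
  Stable C = ∀ {f h} → f ≋ h → C f → C h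

  stable-¬ : ∀ {C} → Stable C → Stable (λ f → ¬ C f)
  stable-¬ S e nc c = nc (S (≋-sym e) c)

  Δ-tr : ∀ t f → Δ (tr t f) ≡ Δ f
  Δ-tr t ⟨ a , b , c , d , e ⟩ = solve (a ∷ b ∷ c ∷ d ∷ e ∷ t ∷ []) λ a b c d e t →
    E.disc (E.tr t ⟨ a , b , c , d , e ⟩) :≡ E.disc ⟨ a , b , c , d , e ⟩

  Δ-dg : ∀ u f → Δ (dg u f) ≡ Δ f * (u ^ 6 * u ^ 6)
  Δ-dg u ⟨ a , b , c , d , e ⟩ = solve (a ∷ b ∷ c ∷ d ∷ e ∷ u ∷ []) λ a b c d e u →
    E.disc (E.dg u ⟨ a , b , c , d , e ⟩) :≡ E.disc ⟨ a , b , c , d , e ⟩ :* (u E.^ 6 :* u E.^ 6)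

  Δ-sc : ∀ k f → Δ (sc k f) ≡ Δ f * (k ^ 3 * k ^ 3)
  Δ-sc k ⟨ a , b , c , d , e ⟩ = solve (a ∷ b ∷ c ∷ d ∷ e ∷ k ∷ []) λ a b c d e k →
    E.disc (E.sc k ⟨ a , b , c , d , e ⟩) :≡ E.disc ⟨ a , b , c , d , e ⟩ :* (k E.^ 3 :* k E.^ 3)

  Δ-sw : ∀ f → Δ (sw f) ≡ Δ f
  Δ-sw ⟨ a , b , c , d , e ⟩ = solve (a ∷ b ∷ c ∷ d ∷ e ∷ []) λ a b c d e →
    E.disc (E.sw ⟨ a , b , c , d , e ⟩) :≡ E.disc ⟨ a , b , c , d , e ⟩

  nondeg-stable : Stable NonDeg
  nondeg-stable = invariant record
    { tr-inv = λ t {f} h z → h (trans (sym (Δ-tr t f)) z)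
    ; dg-inv = λ {u} u≢0 {f} h z → *-≢0 h (*-≢0 (^-≢0 6 u≢0) (^-≢0 6 u≢0)) (trans (sym (Δ-dg u f)) z)
    ; sw-inv = λ {f} h z → h (trans (sym (Δ-sw f)) z)
    ; sc-inv = λ {k} k≢0 {f} h z → *-≢0 h (*-≢0 (^-≢0 3 k≢0) (^-≢0 3 k≢0)) (trans (sym (Δ-sc k f)) z) }

  -- The generators multiply `Δ` only by squares: 1, u¹² and k⁶.
  Δ-square-stable : Stable (λ f → IsSquare (Δ f))
  Δ-square-stable = invariant record
    { tr-inv = λ t {f} → subst IsSquare (sym (Δ-tr t f))
    ; dg-inv = λ {u} _ {f} h → subst IsSquare (sym (Δ-dg u f)) (square-* h (u ^ 6 , refl))
    ; sw-inv = λ {f} → subst IsSquare (sym (Δ-sw f))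
    ; sc-inv = λ {k} _ {f} h → subst IsSquare (sym (Δ-sc k f)) (square-* h (k ^ 3 , refl)) }

  -- ȷ(f) = r, cleared of denominators
  J : Carrier → Quartic → Set
  J r f = mid f ^ 6 ≡ r * Δ f

  J-stable : ∀ {r} → Stable (J r)
  J-stable {r} = invariant record
    { tr-inv = λ { t {f@(⟨ a , b , c , d , e ⟩)} h → trans h (cong (r *_) (sym (Δ-tr t f))) }
    ; dg-inv = λ { {u} _ {f@(⟨ a , b , c , d , e ⟩)} h → trans (lin₁ (u ^ 12) h (solve (u ∷ c ∷ r ∷ Δ f ∷ []) λ u c r D →
         (u E.^ 2 :* c) E.^ 6 :- r :* (D :* (u E.^ 6 :* u E.^ 6)) :≡ u E.^ 12 :* (c E.^ 6 :- r :* D))) (cong (r *_) (sym (Δ-dg u f))) }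
    ; sw-inv = λ { {f@(⟨ a , b , c , d , e ⟩)} h → trans h (cong (r *_) (sym (Δ-sw f))) }
    ; sc-inv = λ { {u} _ {f@(⟨ a , b , c , d , e ⟩)} h → trans (lin₁ (u ^ 6) h (solve (u ∷ c ∷ r ∷ Δ f ∷ []) λ u c r D →
         (u :* c) E.^ 6 :- r :* (D :* (u E.^ 3 :* u E.^ 3)) :≡ u E.^ 6 :* (c E.^ 6 :- r :* D))) (cong (r *_) (sym (Δ-sc u f))) } }

  J-unique : ∀ {r r′ f} → NonDeg f → J r f → J r′ f → r ≡ r′
  J-unique {r} {r′} {f} h e e′ = *-cancelˡ h (trans (*-comm _ r) (trans (sym e) (trans e′ (*-comm r′ _))))

  ȷ-J : ∀ {r f} → NonDeg f → ȷ f ≡ r → J r f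
  ȷ-J {f = f@(⟨ a , b , c , d , e ⟩)} h refl = sym (trans (*-assoc _ _ _) (trans (cong (c ^ 6 *_) (inverseˡ h)) (*-identityʳ _)))

  J-ȷ : ∀ {r f} → NonDeg f → J r f → ȷ f ≡ r
  J-ȷ {f = f@(⟨ a , b , c , d , e ⟩)} h j = trans (cong (_* Δ f ⁻¹) j) (trans (*-assoc _ _ _) (trans (cong (_ *_) (inverseʳ h)) (*-identityʳ _)))

  J-mid≢0 : ∀ {r f} → NonDeg f → J r f → r ≢ 0# → mid f ≢ 0#
  J-mid≢0 {f = f} h j r≢0 z = *-≢0 r≢0 h (trans (sym j) (trans (cong (_^ 6) z) (zeroˡ _)))

  J-mid≡0 : ∀ {f} → J 0# f → mid f ≡ 0#
  J-mid≡0 j = ^-≡0 6 (trans j (zeroˡ _))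

  mid≡0-J : ∀ {f} → mid f ≡ 0# → J 0# f
  mid≡0-J {f} z = trans (cong (_^ 6) z) (trans (zeroˡ _) (sym (zeroˡ _)))

  lead : Quartic → Carrier
  lead ⟨ a , _ , _ , _ , _ ⟩ = a

  -- a zero in ℙ¹(F_q); f(1, 0) is the leading coefficient
  Rooted : Quartic → Set
  Rooted f = lead f ≡ 0# ⊎ ∃[ t ] ev f t ≡ 0#

  rooted? : Decidable Rooted
  rooted? f with lead f ≟ᶠ 0# | ∃? (λ t → ev f t ≟ᶠ 0#)
  ... | yes h | _ = yes (inj₁ h)
  ... | no _ | yes h = yes (inj₂ h)
  ... | no h | no h′ = no [ h , h′ ]′

  ev-tr : ∀ s f t → ev (tr s f) (t - s) ≡ ev f t
  ev-tr s ⟨ a , b , c , d , e ⟩ t = solve (a ∷ b ∷ c ∷ d ∷ e ∷ s ∷ t ∷ []) λ a b c d e s t →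
    E.ev (E.tr s ⟨ a , b , c , d , e ⟩) (t :- s) :≡ E.ev ⟨ a , b , c , d , e ⟩ t

  ev-dg : ∀ u f t → ev (dg u f) (u * t) ≡ u ^ 4 * ev f t
  ev-dg u ⟨ a , b , c , d , e ⟩ t = solve (a ∷ b ∷ c ∷ d ∷ e ∷ u ∷ t ∷ []) λ a b c d e u t →
    E.ev (E.dg u ⟨ a , b , c , d , e ⟩) (u :* t) :≡ u E.^ 4 :* E.ev ⟨ a , b , c , d , e ⟩ t

  ev-sc : ∀ u f t → ev (sc u f) t ≡ u * ev f t
  ev-sc u ⟨ a , b , c , d , e ⟩ t = solve (a ∷ b ∷ c ∷ d ∷ e ∷ u ∷ t ∷ []) λ a b c d e u t →
    E.ev (E.sc u ⟨ a , b , c , d , e ⟩) t :≡ u :* E.ev ⟨ a , b , c , d , e ⟩ t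

  times-zero : ∀ c {x} → x ≡ 0# → c * x ≡ 0#
  times-zero c e = trans (cong (c *_) e) (zeroʳ c)

  -- Multiplying f(t) by s⁴ gives the reversed polynomial at s = 1/t. The second cofactor collects
  -- the quotients of 1 - (ts)ᵏ by ts - 1.
  ev-inverse : ∀ {s t} a b c d e → t * s ≡ 1# → ev ⟨ a , b , c , d , e ⟩ t ≡ 0# → ev ⟨ e , d , c , b , a ⟩ s ≡ 0#
  ev-inverse {s} {t} a b c d e ts≡1 z = lin₂ (s ^ 4) (- (a * (t * s + 1#) * (t ^ 2 * s ^ 2 + 1#) + b * s * (t ^ 2 * s ^ 2 + t * s + 1#) + c * s ^ 2 * (t * s + 1#) + d * s ^ 3)) z ts≡1
         (solve (a ∷ b ∷ c ∷ d ∷ e ∷ s ∷ t ∷ []) λ a b c d e s t →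
           E.ev ⟨ e , d , c , b , a ⟩ s :- :0 :≡ s E.^ 4 :* (E.ev ⟨ a , b , c , d , e ⟩ t :- :0) :+
             (:- (a :* (t :* s :+ :1) :* (t E.^ 2 :* s E.^ 2 :+ :1) :+ b :* s :* (t E.^ 2 :* s E.^ 2 :+ t :* s :+ :1) :+ c :* s E.^ 2 :* (t :* s :+ :1) :+ d :* s E.^ 3)) :* (t :* s :- :1))

  rooted-stable : Stable Rooted
  rooted-stable = invariant {Rooted} record
    { tr-inv = λ { s {⟨ a , b , c , d , e ⟩} (inj₁ z) → inj₁ z
                 ; s {f} (inj₂ (t , z)) → inj₂ (t - s , trans (ev-tr s f t) z) }
    ; dg-inv = λ { _ {⟨ a , b , c , d , e ⟩} (inj₁ z) → inj₁ z
                 ; {u} _ {f} (inj₂ (t , z)) → inj₂ (u * t , trans (ev-dg u f t) (times-zero (u ^ 4) z)) }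
    ; sc-inv = λ { {k} _ {⟨ a , b , c , d , e ⟩} (inj₁ z) → inj₁ (times-zero k z)
                 ; {u} _ {f} (inj₂ (t , z)) → inj₂ (t , trans (ev-sc u f t) (times-zero u z)) }
    ; sw-inv = λ {f} → swap {f} }
    where
    swap : ∀ {f} → Rooted f → Rooted (sw f)
    swap {⟨ a , b , c , d , e ⟩} (inj₁ refl) = inj₂ (0# , solve (b ∷ c ∷ d ∷ e ∷ []) λ b c d e → E.ev ⟨ e , d , c , b , :0 ⟩ :0 :≡ :0)
    swap {⟨ a , b , c , d , e ⟩} (inj₂ (t , z)) with t ≟ᶠ 0#
    ... | yes refl = inj₁ (trans (solve (a ∷ b ∷ c ∷ d ∷ e ∷ []) λ a b c d e → e :≡ E.ev ⟨ a , b , c , d , e ⟩ :0) z)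
    ... | no h = inj₂ (t ⁻¹ , ev-inverse a b c d e (inverseʳ h) z)

  root-at-∞ : ∀ {f} → Rooted f → ∃[ h ] (f ≋ h × lead h ≡ 0#)
  root-at-∞ {f} (inj₁ z) = f , ≋-refl , z
  root-at-∞ {f@(⟨ _ , _ , _ , _ , _ ⟩)} (inj₂ (t , z)) = sw (tr t f) , ≋-trans (≋-tr t f) (≋-sw (tr t f)) , z

  -- With a root moved to infinity the form is Y times a cubic. The leading coefficient of the cubic
  -- is nonzero, since otherwise Y² would divide the form.
  cubic-form : ∀ {f} → NonDeg f → Rooted f → ∃[ c ] ∃[ b ] ∃[ e ] f ≋ ⟨ 0# , 1# , c , b , e ⟩
  cubic-form {f} nd rt with root-at-∞ {f} rt
  ... | ⟨ _ , k , c , b , e ⟩ , f≋h , refl with k ≟ᶠ 0#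
  ...   | yes refl = ⊥-elim (nondeg-stable f≋h nd (solve (c ∷ b ∷ e ∷ []) λ c b e → E.disc ⟨ :0 , :0 , c , b , e ⟩ :≡ :0))
  ...   | no k≢0 with quotient k≢0 c | quotient k≢0 b | quotient k≢0 e
  ...     | c , refl | b , refl | e , refl = c , b , e , ≋-trans (subst (f ≋_)
              (solveᵥ (k ∷ c ∷ b ∷ e ∷ []) λ k c b e → ⟨ :0 , k , k :* c , k :* b , k :* e ⟩ :≡ E.sc k ⟨ :0 , :1 , c , b , e ⟩) f≋h) (≋-unsc k≢0)

  dilate : ∀ {u} → u ≢ 0# → ∀ {f h} → dg u f ≡ sc u h → h ≋ f
  dilate h {f} e = ≋-sym (≋-trans (≋-dg h f) (subst (_≋ _) (sym e) (≋-unsc h)))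

  translate : ∀ t {f h} → tr t f ≡ h → f ≋ h
  translate t {f} refl = ≋-tr t f

  -- Y(X³ + X²Y - Y³/r). Its discriminant is 1/r, which with z₂ = 1 makes ȷ equal to r.
  rootedRep : Carrier → Quartic
  rootedRep r = ⟨ 0# , 1# , 1# , 0# , - (r ⁻¹) ⟩

  -- As ȷ ≠ 0, the coefficient c of X²Y² is nonzero. For z₀ = 0 a translation by t changes the
  -- coefficient of XY³ by -ct, so that coefficient can be cleared; a dilation makes c = 1, and ȷ =
  -- r leaves only one value for the last coefficient.
  rooted-orbit : ∀ {r f} → r ≢ 0# → NonDeg f → J r f → Rooted f → f ≋ rootedRep r
  rooted-orbit {r} {f} r≢0 nd j rt with cubic-form {f} nd rt
  ... | c , b , e , f≋ with J-mid≢0 (nondeg-stable f≋ nd) (J-stable f≋ j) r≢0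
  ... | c≢0 with quotient c≢0 b
  ... | s , refl with quotient (^-≢0 3 c≢0) (e + s ^ 3 + c * s ^ 2 + c * s * s)
  ... | e′ , eq = subst (λ e → f ≋ ⟨ 0# , 1# , 1# , 0# , e ⟩) value f≋′
    where
    f≋′ : f ≋ ⟨ 0# , 1# , 1# , 0# , e′ ⟩
    f≋′ = ≋-trans f≋ (≋-trans (translate s (solveᵥ (c ∷ s ∷ e ∷ []) λ c s e → E.tr s ⟨ :0 , :1 , c , c :* s , e ⟩ :≡
                ⟨ :0 , :1 , c , :0 , e :+ s E.^ 3 :+ c :* s E.^ 2 :+ c :* s :* s ⟩))
           (subst (λ e → ⟨ 0# , 1# , c , 0# , e ⟩ ≋ ⟨ 0# , 1# , 1# , 0# , e′ ⟩) eq (dilate c≢0 {⟨ 0# , 1# , 1# , 0# , e′ ⟩} (solveᵥ (c ∷ e′ ∷ []) λ c e →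
                E.dg c ⟨ :0 , :1 , :1 , :0 , e ⟩ :≡ E.sc c ⟨ :0 , :1 , c , :0 , c E.^ 3 :* e ⟩))))
    value : e′ ≡ - (r ⁻¹)
    value = lin₂ (r ⁻¹) (- e′) (J-stable f≋′ j) (inverseʳ r≢0) (solve (r ∷ r ⁻¹ ∷ e′ ∷ []) λ r r′ e →
       e :- (:- r′) :≡ r′ :* (:1 E.^ 6 :- r :* E.disc ⟨ :0 , :1 , :1 , :0 , e ⟩) :+ (:- e) :* (r :* r′ :- :1))

  rootedRep-J : ∀ {r} → r ≢ 0# → J r (rootedRep r)
  rootedRep-J {r} h = lin₁ (- 1#) (inverseʳ h) (solve (r ∷ r ⁻¹ ∷ []) λ r r′ →
    :1 E.^ 6 :- r :* E.disc ⟨ :0 , :1 , :1 , :0 , :- r′ ⟩ :≡ (:- :1) :* (r :* r′ :- :1))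

  rootedRep-nondeg : ∀ {r} → r ≢ 0# → NonDeg (rootedRep r)
  rootedRep-nondeg {r} h z = ⁻¹-≢0 h (trans (solve (r ⁻¹ ∷ []) λ r′ → r′ :≡ E.disc ⟨ :0 , :1 , :1 , :0 , :- r′ ⟩) z)

  -- Y times X³ - XY², X³ - εXY² and X³ - XY² + eY³. The first cubic splits over 𝔽₃, the second has
  -- the irreducible factor X² - εY², and the third has no root because e, having nonzero trace, is
  -- not in the image of `℘`.
  fourRootsRep twoRootsRep oneRootRep : Quartic
  fourRootsRep = ⟨ 0# , 1# , 0# , - 1# , 0# ⟩
  twoRootsRep  = ⟨ 0# , 1# , 0# , - ε , 0# ⟩
  oneRootRep   = ⟨ 0# , 1# , 0# , - 1# , proj₁ ∃Tr≢0 ⟩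

  private
    depressed-cubic : ∀ {f} → NonDeg f → J 0# f → Rooted f → ∃[ b ] ∃[ e ] (f ≋ ⟨ 0# , 1# , 0# , b , e ⟩ × b ≢ 0#)
    depressed-cubic {f} nd j rt with cubic-form {f} nd rt
    ... | c , b , e , f≋ with J-mid≡0 (J-stable f≋ j)
    ... | refl = b , e , f≋ , λ { refl → nondeg-stable f≋ nd (solve (e ∷ []) λ e → E.disc ⟨ :0 , :1 , :0 , :0 , e ⟩ :≡ :0) }

    cubic-Δ : ∀ b e → Δ ⟨ 0# , 1# , 0# , b , e ⟩ ≡ - b * (b * b)
    cubic-Δ b e = solve (b ∷ e ∷ []) λ b e → E.disc ⟨ :0 , :1 , :0 , b , e ⟩ :≡ :- b :* (b :* b)

  -- Here Δ = -b³ up to squares, so -b is a nonsquare, w³ + bw takes every value, and a translation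
  -- removes e. A dilation then changes -b into ε, the two differing by a square.
  twoRoots-orbit : ∀ {f} → ¬ IsSquare (Δ f) → J 0# f → Rooted f → f ≋ twoRootsRep
  twoRoots-orbit {f} ns j rt with depressed-cubic {f} (nonsquare-≢0 ns) j rt
  ... | b , e , f≋ , b≢0 = go (nonsquare-ratio ε-nonsquare -b-nonsquare) (additive-surjective -b-nonsquare (- e))
    where
    -b-nonsquare : ¬ IsSquare (- b)
    -b-nonsquare sq = stable-¬ Δ-square-stable f≋ ns (subst IsSquare (sym (cubic-Δ b e)) (square-* sq (b , refl)))
    go : ∃[ s ] (s ≢ 0# × ε * (s * s) ≡ - b) → ∃[ w ] w ^ 3 - - b * w ≡ - e → f ≋ twoRootsRep
    go (s , s≢0 , eb) (w , ew) = ≋-trans f≋ (≋-trans (translate w {h = ⟨ 0# , 1# , 0# , b , 0# ⟩}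
        (trans (solveᵥ (b ∷ e ∷ w ∷ []) λ b e w → E.tr w ⟨ :0 , :1 , :0 , b , e ⟩ :≡ ⟨ :0 , :1 , :0 , b , (w E.^ 3 :- :- b :* w) :+ e ⟩)
          (cong (λ u → ⟨ 0# , 1# , 0# , b , u ⟩) (trans (cong (_+ e) ew) (-‿inverseˡ e)))))
        (subst (λ b → ⟨ 0# , 1# , 0# , b , 0# ⟩ ≋ twoRootsRep) (trans (cong -_ eb) (-‿involutive b)) (dilate s≢0 {twoRootsRep}
          (solveᵥ (ε ∷ s ∷ []) λ ε s → E.dg s ⟨ :0 , :1 , :0 , :- ε , :0 ⟩ :≡ E.sc s ⟨ :0 , :1 , :0 , :- (ε :* (s :* s)) , :0 ⟩))))

  private
    shift : ∀ {e e′} → Tr n (e′ - e) ≡ 0# → ⟨ 0# , 1# , 0# , - 1# , e ⟩ ≋ ⟨ 0# , 1# , 0# , - 1# , e′ ⟩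
    shift {e} {e′} z = let w , ew = Tr≡0⇒℘ z in
      translate w (trans (solveᵥ (e ∷ w ∷ []) λ e w → E.tr w ⟨ :0 , :1 , :0 , :- :1 , e ⟩ :≡ ⟨ :0 , :1 , :0 , :- :1 , (w E.^ 3 :- w) :+ e ⟩)
            (cong (λ u → ⟨ 0# , 1# , 0# , - 1# , u ⟩) (trans (cong (_+ e) ew) (solve (e ∷ e′ ∷ []) λ e e′ → (e′ :- e) :+ e :≡ e′))))

    Tr-- : ∀ a b → Tr n (a - b) ≡ Tr n a - Tr n b
    Tr-- a b = trans (Tr-+ n a (- b)) (cong (Tr n a +_) (Tr-neg b))

    flip : ∀ e → ⟨ 0# , 1# , 0# , - 1# , e ⟩ ≋ ⟨ 0# , 1# , 0# , - 1# , - e ⟩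
    flip e = dilate -1≢0 {⟨ 0# , 1# , 0# , - 1# , - e ⟩} (solveᵥ (e ∷ []) λ e → E.dg (:- :1) ⟨ :0 , :1 , :0 , :- :1 , :- e ⟩ :≡ E.sc (:- :1) ⟨ :0 , :1 , :0 , :- :1 , e ⟩)

    opposite : ∀ {a b} → a ≡ 0# ⊎ a ≡ 1# ⊎ a ≡ - 1# → b ≡ 0# ⊎ b ≡ 1# ⊎ b ≡ - 1# → a ≢ 0# → b ≢ 0# → a ≢ b → b + a ≡ 0#
    opposite (inj₁ x) _ h _ _ = ⊥-elim (h x)
    opposite (inj₂ _) (inj₁ x) _ h _ = ⊥-elim (h x)
    opposite (inj₂ (inj₁ refl)) (inj₂ (inj₁ refl)) _ _ h = ⊥-elim (h refl)
    opposite (inj₂ (inj₁ refl)) (inj₂ (inj₂ refl)) _ _ _ = -‿inverseˡ 1#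
    opposite (inj₂ (inj₂ refl)) (inj₂ (inj₁ refl)) _ _ _ = -‿inverseʳ 1#
    opposite (inj₂ (inj₂ refl)) (inj₂ (inj₂ refl)) _ _ h = ⊥-elim (h refl)

    -- Translations change e by values of `℘`, so only its trace in 𝔽₃ counts. The dilation by -1
    -- changes the sign of e and identifies the traces 1 and -1.
    classify : ∀ e e₁ → Tr n e₁ ≢ 0# → ⟨ 0# , 1# , 0# , - 1# , e ⟩ ≋ ⟨ 0# , 1# , 0# , - 1# , 0# ⟩ ⊎ ⟨ 0# , 1# , 0# , - 1# , e ⟩ ≋ ⟨ 0# , 1# , 0# , - 1# , e₁ ⟩
    classify e e₁ h₁ = case Tr n e ≟ᶠ 0# of λ
      { (yes z) → inj₁ (shift (trans (Tr-- 0# e) (trans (cong₂ _-_ Tr-0 z) (-‿inverseʳ 0#))))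
      ; (no h) → inj₂ (case Tr n e ≟ᶠ Tr n e₁ of λ
        { (yes z) → shift (trans (Tr-- e₁ e) (x-x≡0 (sym z)))
        ; (no h′) → ≋-trans (flip e) (shift (trans (Tr-- e₁ (- e)) (trans (cong (_-_ (Tr n e₁)) (Tr-neg e))
                      (trans (cong (Tr n e₁ +_) (-‿involutive _)) (opposite (Tr-values e) (Tr-values e₁) h h₁ h′))))) }) }

  square-orbits : ∀ {f} → NonDeg f → IsSquare (Δ f) → J 0# f → Rooted f → f ≋ fourRootsRep ⊎ f ≋ oneRootRep
  square-orbits {f} nd sq j rt with depressed-cubic {f} nd j rt
  ... | b , e , f≋ , b≢0 with square-ratio b≢0 (subst IsSquare (cubic-Δ b e) (Δ-square-stable f≋ sq))
  ... | s , es = go (quotient (^-≢0 3 s≢0) e)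
    where
    s≢0 : s ≢ 0#
    s≢0 refl = -‿≢0 b≢0 (trans (sym es) (zeroˡ 0#))
    go : ∃[ e′ ] s ^ 3 * e′ ≡ e → f ≋ fourRootsRep ⊎ f ≋ oneRootRep
    go (e′ , ee) = Sum.map (≋-trans f≋′) (≋-trans f≋′) (classify e′ _ (proj₂ ∃Tr≢0))
      where
      f≋′ : f ≋ ⟨ 0# , 1# , 0# , - 1# , e′ ⟩
      f≋′ = ≋-trans f≋ (subst₂ (λ b e → ⟨ 0# , 1# , 0# , b , e ⟩ ≋ ⟨ 0# , 1# , 0# , - 1# , e′ ⟩) (trans (cong -_ es) (-‿involutive b)) ee (dilate s≢0 {⟨ 0# , 1# , 0# , - 1# , e′ ⟩}
          (solveᵥ (e′ ∷ s ∷ []) λ e s → E.dg s ⟨ :0 , :1 , :0 , :- :1 , e ⟩ :≡ E.sc s ⟨ :0 , :1 , :0 , :- (s :* s) , s E.^ 3 :* e ⟩)))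

-- Torus normal forms and the orbit of irreducible forms

module Tori (F : Field) (n : ℕ) (hs : HasSize F (3 ℕ.^ n)) where
  open Invariants F n hs public

  -- For z = x + √δ y and ξ = s + √δ t this says z′ξξ̄ = zξ², that is, z′/z = ξ/ξ̄. The minus signs
  -- before the terms in st are factors 2.
  Rotation : (δ x y x′ y′ s t : Carrier) → Set
  Rotation δ x y x′ y′ s t =
    x′ * nrm δ s t ≡ x * (s * s + δ * (t * t)) - δ * (y * (s * t)) ×
    y′ * nrm δ s t ≡ y * (s * s + δ * (t * t)) - x * (s * t)

  opaque
    -- For equal norms, z′/z = ξ/ξ̄ with ξ = z̄(z + z′), or ξ = √δ z̄(z′ - z) if that is not invertible.
    hilbert90 : ∀ {δ x y x′ y′} → δ ≢ 0# → nrm δ x y ≢ 0# → nrm δ x′ y′ ≡ nrm δ x y →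
                ∃[ s ] ∃[ t ] (nrm δ s t ≢ 0# × Rotation δ x y x′ y′ s t)
    hilbert90 {δ} {x} {y} {x′} {y′} δ≢0 N≢0 h = choose (A ≟ᶠ 0#)
      where
      -- A + √δ T is z̄(z + z′), whose norm is -NA. If A = 0, the other choice √δ z̄(z′ - z) is δT +
      -- √δ(A + N), as -2 = 1, and its norm is -δN².
      N A T : Carrier
      N = nrm δ x y
      A = N + x * x′ - δ * (y * y′)
      T = x * y′ - y * x′
      generic-norm : nrm δ A T ≡ 0# → N * A ≡ 0#
      generic-norm z = lin₂ (- 1#) N z h (solve (δ ∷ x ∷ y ∷ x′ ∷ y′ ∷ []) λ δ x y x′ y′ →
        let N = E.nrm δ x y ; A = N :+ x :* x′ :- δ :* (y :* y′) ; T = x :* y′ :- y :* x′ in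
        N :* A :- :0 :≡ :- :1 :* (E.nrm δ A T :- :0) :+ N :* (E.nrm δ x′ y′ :- N))
      generic : Rotation δ x y x′ y′ A T
      generic =
        lin₁ (N * (x + x′)) h (solve (δ ∷ x ∷ y ∷ x′ ∷ y′ ∷ []) λ δ x y x′ y′ →
          let N = E.nrm δ x y ; A = N :+ x :* x′ :- δ :* (y :* y′) ; T = x :* y′ :- y :* x′ in
          x′ :* E.nrm δ A T :- (x :* (A :* A :+ δ :* (T :* T)) :- δ :* (y :* (A :* T))) :≡ N :* (x :+ x′) :* (E.nrm δ x′ y′ :- N)) ,
        lin₁ (N * (y + y′)) h (solve (δ ∷ x ∷ y ∷ x′ ∷ y′ ∷ []) λ δ x y x′ y′ →
          let N = E.nrm δ x y ; A = N :+ x :* x′ :- δ :* (y :* y′) ; T = x :* y′ :- y :* x′ in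
          y′ :* E.nrm δ A T :- (y :* (A :* A :+ δ :* (T :* T)) :- x :* (A :* T)) :≡ N :* (y :+ y′) :* (E.nrm δ x′ y′ :- N))
      special-norm : A ≡ 0# → nrm δ (δ * T) (A + N) ≡ 0# → δ * (N * N) ≡ 0#
      special-norm A≡0 z = lin₃ (- 1#) (- (δ * N)) (- (δ * N)) z A≡0 h (solve (δ ∷ x ∷ y ∷ x′ ∷ y′ ∷ []) λ δ x y x′ y′ →
        let N = E.nrm δ x y ; A = N :+ x :* x′ :- δ :* (y :* y′) ; T = x :* y′ :- y :* x′ in
        δ :* (N :* N) :- :0 :≡ :- :1 :* (E.nrm δ (δ :* T) (A :+ N) :- :0) :+ :- (δ :* N) :* (A :- :0) :+ :- (δ :* N) :* (E.nrm δ x′ y′ :- N))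
      special : Rotation δ x y x′ y′ (δ * T) (A + N)
      special =
        lin₁ (- (δ * N * (x′ - x))) h (solve (δ ∷ x ∷ y ∷ x′ ∷ y′ ∷ []) λ δ x y x′ y′ →
          let N = E.nrm δ x y ; A = N :+ x :* x′ :- δ :* (y :* y′) ; T = x :* y′ :- y :* x′ ; S = δ :* T ; B = A :+ N in
          x′ :* E.nrm δ S B :- (x :* (S :* S :+ δ :* (B :* B)) :- δ :* (y :* (S :* B))) :≡ :- (δ :* N :* (x′ :- x)) :* (E.nrm δ x′ y′ :- N)) ,
        lin₁ (- (δ * N * (y′ - y))) h (solve (δ ∷ x ∷ y ∷ x′ ∷ y′ ∷ []) λ δ x y x′ y′ →
          let N = E.nrm δ x y ; A = N :+ x :* x′ :- δ :* (y :* y′) ; T = x :* y′ :- y :* x′ ; S = δ :* T ; B = A :+ N in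
          y′ :* E.nrm δ S B :- (y :* (S :* S :+ δ :* (B :* B)) :- x :* (S :* B)) :≡ :- (δ :* N :* (y′ :- y)) :* (E.nrm δ x′ y′ :- N))
      choose : Dec (A ≡ 0#) → ∃[ s ] ∃[ t ] (nrm δ s t ≢ 0# × Rotation δ x y x′ y′ s t)
      choose (no A≢0)  = A , T , (λ z → *-≢0 N≢0 A≢0 (generic-norm z)) , generic
      choose (yes A≡0) = δ * T , A + N , (λ z → *-≢0 δ≢0 (*-≢0 N≢0 N≢0) (special-norm A≡0 z)) , special

  opaque
    -- ξ = (ν + ξ)²/κ for ν² = N(ξ)
    square-root : ∀ {δ s t} → nrm δ s t ≢ 0# → IsSquare (nrm δ s t) →
                  ∃[ a ] ∃[ b ] ∃[ κ ] (κ ≢ 0# × a * a + δ * (b * b) ≡ κ * s × - (a * b) ≡ κ * t)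
    square-root {δ} {s} {t} h (ν , e) = case s + ν ≟ᶠ 0# of λ
      { (no z) → go ν e z
      -- The square roots ν and -ν cannot both equal -s, because ν ≠ 0.
      ; (yes z) → go (- ν) (trans (solve (ν ∷ []) λ ν → :- ν :* :- ν :≡ ν :* ν) e)
          (λ z′ → ν≢0 (lin₂ (- 1#) 1# z z′ (solve (s ∷ ν ∷ []) λ s ν → ν :- :0 :≡ :- :1 :* (s :+ ν :- :0) :+ :1 :* (s :- ν :- :0)))) }
      where
      ν≢0 : ν ≢ 0#
      ν≢0 refl = h (trans (sym e) (zeroˡ 0#))
      go : ∀ ν → ν * ν ≡ nrm δ s t → s + ν ≢ 0# → ∃[ a ] ∃[ b ] ∃[ κ ] (κ ≢ 0# × a * a + δ * (b * b) ≡ κ * s × - (a * b) ≡ κ * t)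
      go ν e z = s + ν , t , - (s + ν) , -‿≢0 z ,
        lin₁ 1# e (solve (δ ∷ s ∷ t ∷ ν ∷ []) λ δ s t ν →
          ((s :+ ν) :* (s :+ ν) :+ δ :* (t :* t)) :- :- (s :+ ν) :* s :≡ :1 :* (ν :* ν :- E.nrm δ s t)) ,
        solve (s ∷ t ∷ ν ∷ []) λ s t ν → :- ((s :+ ν) :* t) :≡ :- (s :+ ν) :* t

    private
      -- The substitution u ↦ ηu, v ↦ η̄v with η = a + √δ b turns z into zη⁴ and k into kN(η)².
      -- After division by N(η)² this multiplies z by η²/η̄², so ξ has to be a square up to a factor
      -- from the base field, and `square-root` provides η² = κξ.
      torus-rotate : ∀ {δ x y x′ y′ s t} k → nrm δ s t ≢ 0# → IsSquare (nrm δ s t) →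
        x′ * nrm δ s t ≡ x * (s * s + δ * (t * t)) - δ * (y * (s * t)) →
        y′ * nrm δ s t ≡ y * (s * s + δ * (t * t)) - x * (s * t) → torus δ x y k ≋ torus δ x′ y′ k
      torus-rotate {δ} {x} {y} {x′} {y′} {s} {t} k M≢0 sq ex ey =
        let a , b , κ , κ≢0 , e₁ , e₂ = square-root M≢0 sq
            μ = κ * κ * nrm δ s t
            e₃ : nrm δ (a * a + δ * (b * b)) (- (a * b)) ≡ μ
            e₃ = trans (cong₂ (nrm δ) e₁ e₂) (solve (δ ∷ κ ∷ s ∷ t ∷ []) λ δ κ s t → E.nrm δ (κ :* s) (κ :* t) :≡ κ :* κ :* E.nrm δ s t)
            μ≢0 : μ ≢ 0#
            μ≢0 = *-≢0 (*-≢0 κ≢0 κ≢0) M≢0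
        in equivalent a (δ * b) b a
             (λ z → μ≢0 (trans (sym e₃) (lin₁ (a * a - δ * (b * b)) z (solve (δ ∷ a ∷ b ∷ []) λ δ a b →
                 E.nrm δ (a :* a :+ δ :* (b :* b)) (:- (a :* b)) :- :0 :≡ (a :* a :- δ :* (b :* b)) :* (a :* a :- δ :* b :* b :- :0)))))
             μ μ≢0
             (begin
               sub a (δ * b) b a (torus δ x y k)
                 ≡⟨ solveᵥ (δ ∷ x ∷ y ∷ k ∷ a ∷ b ∷ []) (λ δ x y k a b → let p = a :* a :+ δ :* (b :* b) ; q = :- (a :* b) in
                      E.sub a (δ :* b) b a (E.torus δ x y k) :≡
                      E.torus δ (x :* (p :* p :+ δ :* (q :* q)) :- δ :* (y :* (p :* q))) (y :* (p :* p :+ δ :* (q :* q)) :- x :* (p :* q)) (k :* E.nrm δ p q)) ⟩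
               image (a * a + δ * (b * b)) (- (a * b))
                 ≡⟨ cong₂ image e₁ e₂ ⟩
               image (κ * s) (κ * t)
                 ≡⟨ cong₂ (λ u v → torus δ u v (k * nrm δ (κ * s) (κ * t)))
                      (lin₁ (- (κ * κ)) ex (solve (δ ∷ κ ∷ s ∷ t ∷ x ∷ y ∷ x′ ∷ []) λ δ κ s t x y x′ →
                         x :* ((κ :* s) :* (κ :* s) :+ δ :* ((κ :* t) :* (κ :* t))) :- δ :* (y :* ((κ :* s) :* (κ :* t))) :- κ :* κ :* E.nrm δ s t :* x′ :≡
                         :- (κ :* κ) :* (x′ :* E.nrm δ s t :- (x :* (s :* s :+ δ :* (t :* t)) :- δ :* (y :* (s :* t))))))
                      (lin₁ (- (κ * κ)) ey (solve (δ ∷ κ ∷ s ∷ t ∷ x ∷ y ∷ y′ ∷ []) λ δ κ s t x y y′ →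
                         y :* ((κ :* s) :* (κ :* s) :+ δ :* ((κ :* t) :* (κ :* t))) :- x :* ((κ :* s) :* (κ :* t)) :- κ :* κ :* E.nrm δ s t :* y′ :≡
                         :- (κ :* κ) :* (y′ :* E.nrm δ s t :- (y :* (s :* s :+ δ :* (t :* t)) :- x :* (s :* t))))) ⟩
               torus δ (μ * x′) (μ * y′) (k * nrm δ (κ * s) (κ * t))
                 ≡⟨ solveᵥ (δ ∷ κ ∷ s ∷ t ∷ x′ ∷ y′ ∷ k ∷ []) (λ δ κ s t x y k → let μ = κ :* κ :* E.nrm δ s t in
                      E.torus δ (μ :* x) (μ :* y) (k :* E.nrm δ (κ :* s) (κ :* t)) :≡ E.sc μ (E.torus δ x y k)) ⟩
               sc μ (torus δ x′ y′ k) ∎)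
        where
        open ≡-Reasoning
        image : Carrier → Carrier → Quartic
        image p q = torus δ (x * (p * p + δ * (q * q)) - δ * (y * (p * q))) (y * (p * p + δ * (q * q)) - x * (p * q)) (k * nrm δ p q)

      -- Y ↦ -Y exchanges u and v and thus conjugates z.
      torus-conjugate : ∀ {δ x y k} → torus δ x y k ≋ torus δ x (- y) k
      torus-conjugate {δ} {x} {y} {k} = ≋-trans (≋-dg -1≢0 (torus δ x y k)) (subst (_≋ torus δ x (- y) k)
        (sym (solveᵥ (δ ∷ x ∷ y ∷ k ∷ []) λ δ x y k → E.dg (:- :1) (E.torus δ x y k) :≡ E.torus δ x (:- y) k)) ≋-refl)

    -- If N(ξ) is not a square, z is conjugated beforehand: z′/z̄ = (zξ)/(z̄ξ̄), and N(zξ) =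
    -- N(z)N(ξ) is a product of two nonsquares, hence a square.
    torus-equal-norms : ∀ {δ x y x′ y′} k → δ ≢ 0# → ¬ IsSquare (nrm δ x y) → nrm δ x′ y′ ≡ nrm δ x y →
                        torus δ x y k ≋ torus δ x′ y′ k
    torus-equal-norms {δ} {x} {y} {x′} {y′} k δ≢0 ns e =
      let s , t , M≢0 , ex , ey = hilbert90 δ≢0 (nonsquare-≢0 ns) e in
      case square? (nrm δ s t) of λ
        { (yes sq) → torus-rotate k M≢0 sq ex ey
        ; (no ns′) → ≋-trans torus-conjugate (torus-rotate {δ} {x} { - y} {x′} {y′} {x * s + δ * (y * t)} {x * t + y * s} k
            (subst (_≢ 0#) (sym (multiplicative s t)) (*-≢0 (nonsquare-≢0 ns) M≢0))
            (subst IsSquare (sym (multiplicative s t)) (nonsquare-* ns ns′))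
            (lin₁ (nrm δ x y) ex (solve (δ ∷ x ∷ y ∷ s ∷ t ∷ x′ ∷ []) λ δ x y s t x′ → let S = x :* s :+ δ :* (y :* t) ; T = x :* t :+ y :* s in
               x′ :* E.nrm δ S T :- (x :* (S :* S :+ δ :* (T :* T)) :- δ :* (:- y :* (S :* T))) :≡
               E.nrm δ x y :* (x′ :* E.nrm δ s t :- (x :* (s :* s :+ δ :* (t :* t)) :- δ :* (y :* (s :* t))))))
            (lin₁ (nrm δ x y) ey (solve (δ ∷ x ∷ y ∷ s ∷ t ∷ y′ ∷ []) λ δ x y s t y′ → let S = x :* s :+ δ :* (y :* t) ; T = x :* t :+ y :* s in
               y′ :* E.nrm δ S T :- (:- y :* (S :* S :+ δ :* (T :* T)) :- x :* (S :* T)) :≡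
               E.nrm δ x y :* (y′ :* E.nrm δ s t :- (y :* (s :* s :+ δ :* (t :* t)) :- x :* (s :* t)))))) }
      where
      multiplicative : ∀ s t → nrm δ (x * s + δ * (y * t)) (x * t + y * s) ≡ nrm δ x y * nrm δ s t
      multiplicative s t = solve (δ ∷ x ∷ y ∷ s ∷ t ∷ []) λ δ x y s t →
        E.nrm δ (x :* s :+ δ :* (y :* t)) (x :* t :+ y :* s) :≡ E.nrm δ x y :* E.nrm δ s t

    torus-Δ : ∀ δ x y k → Δ (torus δ x y k) ≡ nrm δ x y * ((δ ^ 3 * (nrm δ x y - k * k)) * (δ ^ 3 * (nrm δ x y - k * k)))
    torus-Δ δ x y k = solve (δ ∷ x ∷ y ∷ k ∷ []) λ δ x y k → E.disc (E.torus δ x y k) :≡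
      E.nrm δ x y :* ((δ E.^ 3 :* (E.nrm δ x y :- k :* k)) :* (δ E.^ 3 :* (E.nrm δ x y :- k :* k)))

    torus-sc : ∀ c δ x y k → sc c (torus δ x y k) ≡ torus δ (c * x) (c * y) (c * k)
    torus-sc c δ x y k = solveᵥ (c ∷ δ ∷ x ∷ y ∷ k ∷ []) λ c δ x y k → E.sc c (E.torus δ x y k) :≡ E.torus δ (c :* x) (c :* y) (c :* k)

    nrm-sc : ∀ c δ x y → nrm δ (c * x) (c * y) ≡ nrm δ x y * (c * c)
    nrm-sc c δ x y = solve (c ∷ δ ∷ x ∷ y ∷ []) λ c δ x y → E.nrm δ (c :* x) (c :* y) :≡ E.nrm δ x y :* (c :* c)

    -- It remains to find a scalar c with k′ = ck and N′ = c²N. For ȷ ≠ 0 the first equation fixes c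
    -- and the value of ȷ forces the second; for ȷ = 0 both k and k′ vanish, and c comes from the
    -- second because N and N′ are nonsquares.
    torus-orbit : ∀ {r δ x y k x′ y′ k′} → δ ≢ 0# → ¬ IsSquare (Δ (torus δ x y k)) → ¬ IsSquare (Δ (torus δ x′ y′ k′)) →
                  J r (torus δ x y k) → J r (torus δ x′ y′ k′) → torus δ x y k ≋ torus δ x′ y′ k′
    torus-orbit {r} {δ} {x} {y} {k} {x′} {y′} {k′} δ≢0 nsΔ nsΔ′ j j′ = case r ≟ᶠ 0# of λ
      { (yes refl) →
          let k≡0 = mid-zero (J-mid≡0 j) ; k′≡0 = mid-zero (J-mid≡0 j′)
              c , c≢0 , e = nonsquare-ratio ns ns′
          in scaled c c≢0 (trans k′≡0 (sym (times-zero c k≡0))) (sym e)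
      ; (no r≢0) →
          let k≢0 = mid-nonzero (J-mid≢0 (nonsquare-≢0 nsΔ) j r≢0) ; k′≢0 = mid-nonzero (J-mid≢0 (nonsquare-≢0 nsΔ′) j′ r≢0)
              c , e = quotient k≢0 k′
              c≢0 : c ≢ 0#
              c≢0 z = k′≢0 (trans (sym e) (times-zero k z))
              e′ : k′ ≡ c * k
              e′ = trans (sym e) (*-comm k c)
          in scaled c c≢0 e′ (sym (determined r≢0 c e′)) }
      where
      N N′ : Carrier
      N  = nrm δ x y
      N′ = nrm δ x′ y′
      ns : ¬ IsSquare N
      ns sq = nsΔ (subst IsSquare (sym (torus-Δ δ x y k)) (square-* sq (_ , refl)))
      ns′ : ¬ IsSquare N′
      ns′ sq = nsΔ′ (subst IsSquare (sym (torus-Δ δ x′ y′ k′)) (square-* sq (_ , refl)))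
      mid-zero : ∀ {k} → δ * k ≡ 0# → k ≡ 0#
      mid-zero z = *-cancelˡ δ≢0 (trans z (sym (zeroʳ δ)))
      mid-nonzero : ∀ {k} → δ * k ≢ 0# → k ≢ 0#
      mid-nonzero h refl = h (zeroʳ δ)
      scaled : ∀ c → c ≢ 0# → k′ ≡ c * k → N′ ≡ N * (c * c) → torus δ x y k ≋ torus δ x′ y′ k′
      scaled c c≢0 refl e = ≋-trans (≋-sc c≢0) (subst (_≋ torus δ x′ y′ (c * k)) (sym (torus-sc c δ x y k))
        (torus-equal-norms (c * k) δ≢0 (ns ∘ square-ratio c≢0 ∘ subst IsSquare (nrm-sc c δ x y)) (trans e (sym (nrm-sc c δ x y)))))
      -- N(N - k²)² takes each value at most once at nonsquares N, since its divided difference is a square minus k²N.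
      determined : r ≢ 0# → ∀ c → k′ ≡ c * k → N * (c * c) ≡ N′
      determined r≢0 c refl = case *-zero-split (lin₂ 1# (- (c ^ 6)) eq′ eq (solve (N ∷ N′ ∷ c ∷ k ∷ r ∷ []) λ N N′ c k r →
             let M = N :* (c :* c) ; K = (c :* k) :* (c :* k) ; d = M :- N′ in
             (r :* d) :* ((d :- K) E.^ 2 :- K :* N′) :- :0 :≡
             :1 :* ((c :* k) E.^ 6 :- r :* (N′ :* (N′ :- (c :* k) :* (c :* k)) E.^ 2)) :+ :- (c E.^ 6) :* (k E.^ 6 :- r :* (N :* (N :- k :* k) E.^ 2)))) of λ
        { (inj₁ z) → -≡0⇒≡ (*-cancelˡ r≢0 (trans z (sym (zeroʳ r))))
        ; (inj₂ z) → ⊥-elim (ns′ (square-ratio ck≢0 (_ , lin₁ 1# z (solve (N ∷ N′ ∷ c ∷ k ∷ []) λ N N′ c k →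
             let M = N :* (c :* c) ; K = (c :* k) :* (c :* k) ; d = M :- N′ in
             (d :- K) :* (d :- K) :- N′ :* ((c :* k) :* (c :* k)) :≡ :1 :* ((d :- K) E.^ 2 :- K :* N′ :- :0))))) }
        where
        ck≢0 : c * k ≢ 0#
        ck≢0 = mid-nonzero (J-mid≢0 (nonsquare-≢0 nsΔ′) j′ r≢0)
        cleared : ∀ {x y k} → J r (torus δ x y k) → k ^ 6 ≡ r * (nrm δ x y * (nrm δ x y - k * k) ^ 2)
        cleared {x} {y} {k} j = *-cancelˡ (^-≢0 6 δ≢0) (lin₁ 1# (trans j (cong (r *_) (torus-Δ δ x y k)))
          (solve (δ ∷ nrm δ x y ∷ k ∷ r ∷ []) λ δ N k r → δ E.^ 6 :* k E.^ 6 :- δ E.^ 6 :* (r :* (N :* (N :- k :* k) E.^ 2)) :≡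
             :1 :* ((δ :* k) E.^ 6 :- r :* (N :* ((δ E.^ 3 :* (N :- k :* k)) :* (δ E.^ 3 :* (N :- k :* k)))))))
        eq : k ^ 6 ≡ r * (N * (N - k * k) ^ 2)
        eq = cleared j
        eq′ : (c * k) ^ 6 ≡ r * (N′ * (N′ - (c * k) * (c * k)) ^ 2)
        eq′ = cleared j′

  opaque
    -- The roots of this cubic are the squares of the sums of two roots of the depressed quartic: it
    -- is the classical resolvent P³ + 2cP² + (c² - 4b)P - a². That Δ is a nonsquare is exactly what
    -- makes the associated additive polynomial bijective.
    resolvent-root : ∀ a b c → ¬ IsSquare (Δ ⟨ 1# , 0# , c , a , b ⟩) →
                     ∃[ P ] P ^ 3 - c * P ^ 2 + (c * c - b) * P ≡ a * a
    resolvent-root a b c ns = choose (c ≟ᶠ 0#)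
      where
      -- Cubics without linear term become additive after inversion.
      generic : c ≢ 0# → ∃[ s ] c * s ≡ b - c * c → ∃[ P ] P ^ 3 - c * P ^ 2 + (c * c - b) * P ≡ a * a
      generic c≢0 (s , es) = root (additive-surjective ce-nonsquare (- (e * e)))
        where
        -- The choice of s removes the linear term: g = P - s satisfies g³ - cg² + e = 0. Inverting
        -- by v = e/g gives v³ - cev = -e², and ce is Δ up to a square.
        e : Carrier
        e = s ^ 3 + c * s ^ 2 - a * a
        Δ≡ : Δ ⟨ 1# , 0# , c , a , b ⟩ ≡ (c * e) * (c * c)
        Δ≡ = trans (cong (λ b → Δ ⟨ 1# , 0# , c , a , b ⟩) (lin₁ (- 1#) es (solve (b ∷ c ∷ s ∷ []) λ b c s →
               b :- (c :* s :+ c :* c) :≡ :- :1 :* (c :* s :- (b :- c :* c)))))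
             (solve (a ∷ c ∷ s ∷ []) λ a c s → E.disc ⟨ :1 , :0 , c , a , c :* s :+ c :* c ⟩ :≡ (c :* (s E.^ 3 :+ c :* s E.^ 2 :- a :* a)) :* (c :* c))
        ce-nonsquare : ¬ IsSquare (c * e)
        ce-nonsquare sq = ns (subst IsSquare (sym Δ≡) (square-* sq (c , refl)))
        e≢0 : e ≢ 0#
        e≢0 = ≢0-right (nonsquare-≢0 ce-nonsquare)
        root : ∃[ v ] v ^ 3 - c * e * v ≡ - (e * e) → ∃[ P ] P ^ 3 - c * P ^ 2 + (c * c - b) * P ≡ a * a
        root (v , ev) = invert (quotient v≢0 e)
          where
          v≢0 : v ≢ 0#
          v≢0 refl = *-≢0 e≢0 e≢0 (lin₁ 1# ev (solve (c ∷ e ∷ []) λ c e →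
             e :* e :- :0 :≡ :1 :* (:0 E.^ 3 :- c :* e :* :0 :- :- (e :* e))))
          invert : ∃[ g ] v * g ≡ e → ∃[ P ] P ^ 3 - c * P ^ 2 + (c * c - b) * P ≡ a * a
          invert (g , eg) = s + g , lin₂ (s + g) 1# es g-root
             (solve (a ∷ b ∷ c ∷ s ∷ g ∷ []) λ a b c s g → let P = s :+ g in
               P E.^ 3 :- c :* P E.^ 2 :+ (c :* c :- b) :* P :- a :* a :≡
               P :* (c :* s :- (b :- c :* c)) :+ :1 :* (g E.^ 3 :- c :* g E.^ 2 :+ (s E.^ 3 :+ c :* s E.^ 2 :- a :* a) :- :0))
            where
            v-value : v - c * g + g * g ≡ 0#
            v-value = *-cancelˡ (*-≢0 v≢0 v≢0) (trans (lin₂ 1# (v * g + e - c * v) ev eg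
               (solve (c ∷ e ∷ v ∷ g ∷ []) λ c e v g → v :* v :* (v :- c :* g :+ g :* g) :- :0 :≡
                  :1 :* (v E.^ 3 :- c :* e :* v :- :- (e :* e)) :+ (v :* g :+ e :- c :* v) :* (v :* g :- e))) (sym (zeroʳ (v * v))))
            g-root : g ^ 3 - c * g ^ 2 + e ≡ 0#
            g-root = lin₂ g (- 1#) v-value eg (solve (c ∷ e ∷ v ∷ g ∷ []) λ c e v g →
               g E.^ 3 :- c :* g E.^ 2 :+ e :- :0 :≡ g :* (v :- c :* g :+ g :* g :- :0) :+ :- :1 :* (v :* g :- e))
      depressed : c ≡ 0# → ∃[ P ] P ^ 3 - c * P ^ 2 + (c * c - b) * P ≡ a * a
      depressed refl = let P , e = additive-surjective b-nonsquare (a * a) in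
        P , lin₁ 1# e (solve (a ∷ b ∷ P ∷ []) λ a b P →
          P E.^ 3 :- :0 :* P E.^ 2 :+ (:0 :* :0 :- b) :* P :- a :* a :≡ :1 :* (P E.^ 3 :- b :* P :- a :* a))
        where
        b-nonsquare : ¬ IsSquare b
        b-nonsquare sq = ns (subst IsSquare (solve (a ∷ b ∷ []) λ a b → b :* (b :* b) :≡ E.disc ⟨ :1 , :0 , :0 , a , b ⟩) (square-* sq (b , refl)))
      choose : Dec (c ≡ 0#) → ∃[ P ] P ^ 3 - c * P ^ 2 + (c * c - b) * P ≡ a * a
      choose (yes z) = depressed z
      choose (no h)  = generic h (quotient h (b - c * c))

    OnTorus : Carrier → Quartic → Set
    OnTorus δ f = ∃[ x ] ∃[ y ] ∃[ k ] f ≋ torus δ x y k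

    private
      -- Up to the scalar δ² the form on the right is fixed by the involution X ↦ δY, Y ↦ X. That
      -- involution multiplies u = X + √δ Y by √δ and v = X - √δ Y by -√δ, so only u⁴, u²v² and v⁴
      -- occur. A dilation changes δ by squares, hence δ can be taken to be 1 or ε.
      on-torus : ∀ {f} c t δ → δ ≢ 0# → f ≋ ⟨ 1# , t , c , δ * t , δ * δ ⟩ → OnTorus 1# f ⊎ OnTorus ε f
      on-torus {f} c t δ δ≢0 f≋ with quotient δ≢0 c | quotient δ≢0 t
      ... | k , refl | y , refl = choose (square? δ)
        where
        f≋′ : f ≋ torus δ (k - 1#) (- y) k
        f≋′ = subst (f ≋_) (solveᵥ (δ ∷ k ∷ y ∷ []) λ δ k y →
          ⟨ :1 , δ :* y , δ :* k , δ :* (δ :* y) , δ :* δ ⟩ :≡ E.torus δ (k :- :1) (:- y) k) f≋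
        rescale : ∀ {δ₀ s} → s ≢ 0# → δ₀ * (s * s) ≡ δ → OnTorus δ₀ f
        rescale {δ₀} {s} s≢0 refl = k - 1# , s * - y , k , ≋-trans f≋′ (≋-sym (subst (torus δ₀ (k - 1#) (s * - y) k ≋_)
          (solveᵥ (δ₀ ∷ s ∷ k ∷ y ∷ []) λ δ s k y → E.dg s (E.torus δ (k :- :1) (s :* :- y) k) :≡ E.torus (δ :* (s :* s)) (k :- :1) (:- y) k)
          (≋-dg s≢0 _)))
        choose : Dec (IsSquare δ) → OnTorus 1# f ⊎ OnTorus ε f
        choose (yes (s , e)) = inj₁ (rescale (λ { refl → δ≢0 (trans (sym e) (zeroˡ 0#)) }) (trans (*-identityˡ _) e))
        choose (no ns) = let s , s≢0 , e = nonsquare-ratio ε-nonsquare ns in inj₂ (rescale s≢0 e)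

      depressed-on-torus : ∀ {f} c a b → ¬ IsSquare (Δ f) → f ≋ ⟨ 1# , 0# , c , a , b ⟩ → OnTorus 1# f ⊎ OnTorus ε f
      depressed-on-torus {f} c a b ns f≋ = choose (a ≟ᶠ 0#)
        where
        ns′ : ¬ IsSquare (Δ ⟨ 1# , 0# , c , a , b ⟩)
        ns′ = stable-¬ Δ-square-stable f≋ ns
        -- The form is fixed by Y ↦ -Y. In the coordinates of X + Y, X - Y this becomes the exchange
        -- of the variables, the involution for δ = 1.
        biquadratic : a ≡ 0# → OnTorus 1# f ⊎ OnTorus ε f
        biquadratic refl = inj₁ (c - (1# + c + b) , b - 1# , c , ≋-trans f≋ (by-sub {1#} {1#} {1#} { - 1#}
          (λ z → 1≢0 (trans (solve [] (:1 :≡ :1 :* :- :1 :- :1 :* :1)) z))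
          (solveᵥ (c ∷ b ∷ []) λ c b → E.sub :1 :1 :1 (:- :1) ⟨ :1 , :0 , c , :0 , b ⟩ :≡ E.torus :1 (c :- (:1 :+ c :+ b)) (b :- :1) c)))
        -- After translation by t = -a/P the coefficient of X³Y is t and that of XY³ is (t² - c -
        -- P)t, which defines δ. The resolvent equation then says that the coefficient of Y⁴ is δ².
        generic : ∀ {P} → P ≢ 0# → P ^ 3 - c * P ^ 2 + (c * c - b) * P ≡ a * a → ∃[ t ] P * t ≡ - a → OnTorus 1# f ⊎ OnTorus ε f
        generic {P} P≢0 eP (t , et) = on-torus c t δ δ≢0 f≋″
          where
          δ : Carrier
          δ = t * t - c - P
          a-value : a ≡ - (P * t)
          a-value = lin₁ 1# et (solve (a ∷ P ∷ t ∷ []) λ a P t → a :- :- (P :* t) :≡ :1 :* (P :* t :- :- a))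
          b-value : b ≡ P * P - c * P + c * c - P * (t * t)
          b-value = *-cancelˡ P≢0 (lin₂ (- 1#) (P * t - a) eP et (solve (a ∷ b ∷ c ∷ P ∷ t ∷ []) λ a b c P t →
            P :* b :- P :* (P :* P :- c :* P :+ c :* c :- P :* (t :* t)) :≡
            :- :1 :* (P E.^ 3 :- c :* P E.^ 2 :+ (c :* c :- b) :* P :- a :* a) :+ (P :* t :- a) :* (P :* t :- :- a)))
          f≋″ : f ≋ ⟨ 1# , t , c , δ * t , δ * δ ⟩
          f≋″ = ≋-trans f≋ (subst₂ (λ a b → ⟨ 1# , 0# , c , a , b ⟩ ≋ ⟨ 1# , t , c , δ * t , δ * δ ⟩) (sym a-value) (sym b-value)
            (translate t (solveᵥ (c ∷ P ∷ t ∷ []) λ c P t → let δ = t :* t :- c :- P in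
              E.tr t ⟨ :1 , :0 , c , :- (P :* t) , P :* P :- c :* P :+ c :* c :- P :* (t :* t) ⟩ :≡ ⟨ :1 , t , c , δ :* t , δ :* δ ⟩)))
          δ≢0 : δ ≢ 0#
          δ≢0 z = nondeg-stable f≋″ (nonsquare-≢0 ns) (trans (cong (λ δ → Δ ⟨ 1# , t , c , δ * t , δ * δ ⟩) z)
            (solve (c ∷ t ∷ []) λ c t → E.disc ⟨ :1 , t , c , :0 :* t , :0 :* :0 ⟩ :≡ :0))
        choose : Dec (a ≡ 0#) → OnTorus 1# f ⊎ OnTorus ε f
        choose (yes z) = biquadratic z
        choose (no a≢0) = let P , eP = resolvent-root a b c ns′
                              P≢0 : P ≢ 0#
                              P≢0 z = *-≢0 a≢0 a≢0 (trans (sym eP) (trans (cong (λ P → P ^ 3 - c * P ^ 2 + (c * c - b) * P) z)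
                                 (solve (b ∷ c ∷ []) λ b c → :0 E.^ 3 :- c :* :0 E.^ 2 :+ (c :* c :- b) :* :0 :≡ :0)))
                          in generic P≢0 eP (quotient P≢0 (- a))

    torus-form : ∀ {f h} → ¬ IsSquare (Δ f) → f ≋ h → lead h ≢ 0# → OnTorus 1# f ⊎ OnTorus ε f
    torus-form {f} {⟨ z , b , c , d , e ⟩} ns f≋ z≢0 with quotient z≢0 b | quotient z≢0 c | quotient z≢0 d | quotient z≢0 e
    ... | b , refl | c , refl | d , refl | e , refl = depressed-on-torus c _ _ ns (≋-trans (subst (f ≋_)
        (solveᵥ (z ∷ b ∷ c ∷ d ∷ e ∷ []) λ z b c d e → ⟨ z , z :* b , z :* c , z :* d , z :* e ⟩ :≡ E.sc z ⟨ :1 , b , c , d , e ⟩) f≋)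
      (≋-trans (≋-unsc z≢0) (translate (- b) (solveᵥ (b ∷ c ∷ d ∷ e ∷ []) λ b c d e →
         E.tr (:- b) ⟨ :1 , b , c , d , e ⟩ :≡ ⟨ :1 , :0 , c , d :+ b :* c :- b E.^ 3 , e :- b :* d :+ c :* b E.^ 2 ⟩))))

    private
      same-type : ∀ {r δ f g} → δ ≢ 0# → ¬ IsSquare (Δ f) → ¬ IsSquare (Δ g) → J r f → J r g → OnTorus δ f → OnTorus δ g → f ≋ g
      same-type δ≢0 nf ng jf jg (x , y , k , e) (x′ , y′ , k′ , e′) = ≋-trans e (≋-trans
        (torus-orbit δ≢0 (stable-¬ Δ-square-stable e nf) (stable-¬ Δ-square-stable e′ ng) (J-stable e jf) (J-stable e′ jg)) (≋-sym e′))

      -- It shows which torus class is taken by forms with a root. For r ≠ 0, z₂⁶ = rΔ(f) puts Δ(f)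
      -- in the square class of r, which is also that of Δ = 1/r for `rootedRep r`.
      rooted-witness : ∀ {r f} → ¬ IsSquare (Δ f) → J r f →
                       ∃[ g ] (¬ IsSquare (Δ g) × J r g × Rooted g × (OnTorus 1# g ⊎ OnTorus ε g))
      rooted-witness {r} {f} ns j = choose (r ≟ᶠ 0#)
        where
        choose : Dec (r ≡ 0#) → ∃[ g ] (¬ IsSquare (Δ g) × J r g × Rooted g × (OnTorus 1# g ⊎ OnTorus ε g))
        -- `torus-form` needs a nonzero leading coefficient, so the point 1 is moved to infinity:
        -- the value there is 1 - ε, which is nonzero because ε is not a square.
        choose (yes refl) = twoRootsRep , nonsquare , mid≡0-J {twoRootsRep} refl , inj₁ refl , torus-form nonsquare
          (≋-trans (≋-tr 1# twoRootsRep) (≋-sw _)) λ z → ε-nonsquare (1# , lin₁ 1# z (solve (ε ∷ []) λ ε →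
             :1 :* :1 :- ε :≡ :1 :* (:0 :* :1 E.^ 4 :+ :1 :* :1 E.^ 3 :+ :0 :* :1 E.^ 2 :+ :- ε :* :1 :+ :0 :- :0)))
          where
          nonsquare : ¬ IsSquare (Δ twoRootsRep)
          nonsquare sq = ε-nonsquare (square-ratio ε≢0 (subst IsSquare (solve (ε ∷ []) λ ε → E.disc ⟨ :0 , :1 , :0 , :- ε , :0 ⟩ :≡ ε :* (ε :* ε)) sq))
        choose (no r≢0) = rootedRep r , nonsquare , rootedRep-J r≢0 , inj₁ refl , torus-form nonsquare (≋-sw _) (-‿≢0 (⁻¹-≢0 r≢0))
          where
          Δ-value : Δ f ≡ r * ((mid f ^ 3 * r ⁻¹) * (mid f ^ 3 * r ⁻¹))
          Δ-value = lin₂ (- (r ⁻¹)) (- (mid f ^ 6 * r ⁻¹ + Δ f)) j (inverseʳ r≢0) (solve (Δ f ∷ mid f ∷ r ∷ r ⁻¹ ∷ []) λ D c r r′ →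
             D :- r :* ((c E.^ 3 :* r′) :* (c E.^ 3 :* r′)) :≡ :- r′ :* (c E.^ 6 :- r :* D) :+ :- (c E.^ 6 :* r′ :+ D) :* (r :* r′ :- :1))
          nonsquare : ¬ IsSquare (Δ (rootedRep r))
          nonsquare sq = ns (subst IsSquare (sym Δ-value) (square-* (square-ratio (⁻¹-≢0 r≢0)
            (subst IsSquare (lin₁ (- (r ⁻¹)) (inverseʳ r≢0) (solve (r ∷ r ⁻¹ ∷ []) λ r r′ →
              E.disc ⟨ :0 , :1 , :1 , :0 , :- r′ ⟩ :- r :* (r′ :* r′) :≡ :- r′ :* (r :* r′ :- :1))) sq)) (_ , refl)))

    -- There are two tori up to conjugacy; the forms with a root occupy one of the two classes.
    irreducible-orbit : ∀ {r f g} → ¬ IsSquare (Δ f) → ¬ IsSquare (Δ g) → J r f → J r g → ¬ Rooted f → ¬ Rooted g → f ≋ g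
    irreducible-orbit {r} {f} {g} nf ng jf jg f∌ g∌ =
      let h , nh , jh , h∋ , th = rooted-witness {r} {f} nf jf in
      compare nh jh h∋ th (form f nf f∌) (form g ng g∌)
      where
      form : ∀ f → ¬ IsSquare (Δ f) → ¬ Rooted f → OnTorus 1# f ⊎ OnTorus ε f
      form f nf f∌ = torus-form nf ≋-refl (f∌ ∘ inj₁)
      compare : ∀ {h} → ¬ IsSquare (Δ h) → J r h → Rooted h → OnTorus 1# h ⊎ OnTorus ε h →
                OnTorus 1# f ⊎ OnTorus ε f → OnTorus 1# g ⊎ OnTorus ε g → f ≋ g
      compare _ _ _ _ (inj₁ a) (inj₁ b) = same-type 1≢0 nf ng jf jg a b
      compare _ _ _ _ (inj₂ a) (inj₂ b) = same-type ε≢0 nf ng jf jg a b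
      compare {h} nh jh h∋ (inj₁ c) (inj₁ a) (inj₂ b) = ⊥-elim (f∌ (rooted-stable {h} {f} (≋-sym (same-type 1≢0 nf nh jf jh a c)) h∋))
      compare {h} nh jh h∋ (inj₂ c) (inj₁ a) (inj₂ b) = ⊥-elim (g∌ (rooted-stable {h} {g} (≋-sym (same-type ε≢0 ng nh jg jh b c)) h∋))
      compare {h} nh jh h∋ (inj₁ c) (inj₂ a) (inj₁ b) = ⊥-elim (g∌ (rooted-stable {h} {g} (≋-sym (same-type 1≢0 ng nh jg jh b c)) h∋))
      compare {h} nh jh h∋ (inj₂ c) (inj₂ a) (inj₁ b) = ⊥-elim (f∌ (rooted-stable {h} {f} (≋-sym (same-type ε≢0 nf nh jf jh a c)) h∋))

-- Products of two irreducible quadratics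

module Products (F : Field) (n : ℕ) (hs : HasSize F (3 ℕ.^ n)) where
  open Tori F n hs public

  Quadratic : Set
  Quadratic = Vec Carrier 3

  -- μ = D₁₂²/(D₁₁ D₂₂), an invariant of the unordered pair
  record Coupled (μ : Carrier) (p₁ p₂ : Quadratic) : Set where
    constructor coupled
    field
      irreducible₁ : ¬ IsSquare (disc₂ p₁)
      irreducible₂ : ¬ IsSquare (disc₂ p₂)
      ratio        : polar p₁ p₂ ^ 2 ≡ μ * (disc₂ p₁ * disc₂ p₂)

  record Prod (μ : Carrier) (f : Quartic) : Set where
    constructor prod
    field
      {p₁ p₂} : Quadratic
      couple  : Coupled μ p₁ p₂
      factors : f ≡ p₁ ⊙ p₂

  private
    nonsquare-scale : ∀ {x a} → a ≢ 0# → ¬ IsSquare x → ¬ IsSquare (x * (a * a))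
    nonsquare-scale h ns = ns ∘ square-ratio h

  -- Every change of variables or scale used here multiplies the discriminants by a² and b² and the
  -- polar form by ab, which leaves μ and irreducibility untouched.
  coupled-forward : ∀ {μ p₁ p₂ p₁′ p₂′ a b} → a ≢ 0# → b ≢ 0# → disc₂ p₁′ ≡ disc₂ p₁ * (a * a) → disc₂ p₂′ ≡ disc₂ p₂ * (b * b) →
                    polar p₁′ p₂′ ≡ a * b * polar p₁ p₂ → Coupled μ p₁ p₂ → Coupled μ p₁′ p₂′
  coupled-forward {μ} {p₁} {p₂} {p₁′} {p₂′} {a} {b} ha hb e₁ e₂ e (coupled i₁ i₂ r) = coupled
    (nonsquare-scale ha i₁ ∘ subst IsSquare e₁) (nonsquare-scale hb i₂ ∘ subst IsSquare e₂)
    (begin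
      polar p₁′ p₂′ ^ 2                                          ≡⟨ cong (_^ 2) e ⟩
      (a * b * polar p₁ p₂) ^ 2                                  ≡⟨ lin₁ ((a * b) ^ 2) r (solve (a ∷ b ∷ μ ∷ polar p₁ p₂ ∷ disc₂ p₁ ∷ disc₂ p₂ ∷ []) λ a b μ P D D′ →
         (a :* b :* P) E.^ 2 :- μ :* (D :* (a :* a) :* (D′ :* (b :* b))) :≡ (a :* b) E.^ 2 :* (P E.^ 2 :- μ :* (D :* D′))) ⟩
      μ * (disc₂ p₁ * (a * a) * (disc₂ p₂ * (b * b)))            ≡⟨ cong₂ (λ u v → μ * (u * v)) (sym e₁) (sym e₂) ⟩
      μ * (disc₂ p₁′ * disc₂ p₂′)                                ∎)
    where open ≡-Reasoning

  coupled-backward : ∀ {μ p₁ p₂ p₁′ p₂′ a b} → a ≢ 0# → b ≢ 0# → disc₂ p₁′ ≡ disc₂ p₁ * (a * a) → disc₂ p₂′ ≡ disc₂ p₂ * (b * b) →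
                     polar p₁′ p₂′ ≡ a * b * polar p₁ p₂ → Coupled μ p₁′ p₂′ → Coupled μ p₁ p₂
  coupled-backward {μ} {p₁} {p₂} {p₁′} {p₂′} {a} {b} ha hb e₁ e₂ e (coupled i₁ i₂ r) = coupled
    (λ sq → i₁ (subst IsSquare (sym e₁) (square-* sq (a , refl)))) (λ sq → i₂ (subst IsSquare (sym e₂) (square-* sq (b , refl))))
    (*-cancelˡ (^-≢0 2 (*-≢0 ha hb)) (begin
      (a * b) ^ 2 * polar p₁ p₂ ^ 2                      ≡⟨ solve (a ∷ b ∷ polar p₁ p₂ ∷ []) (λ a b P → (a :* b) E.^ 2 :* P E.^ 2 :≡ (a :* b :* P) E.^ 2) ⟩
      (a * b * polar p₁ p₂) ^ 2                          ≡⟨ cong (_^ 2) (sym e) ⟩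
      polar p₁′ p₂′ ^ 2                                  ≡⟨ r ⟩
      μ * (disc₂ p₁′ * disc₂ p₂′)                        ≡⟨ cong₂ (λ u v → μ * (u * v)) e₁ e₂ ⟩
      μ * (disc₂ p₁ * (a * a) * (disc₂ p₂ * (b * b)))    ≡⟨ solve (a ∷ b ∷ μ ∷ disc₂ p₁ ∷ disc₂ p₂ ∷ []) (λ a b μ D D′ →
         μ :* (D :* (a :* a) :* (D′ :* (b :* b))) :≡ (a :* b) E.^ 2 :* (μ :* (D :* D′))) ⟩
      (a * b) ^ 2 * (μ * (disc₂ p₁ * disc₂ p₂))          ∎))
    where open ≡-Reasoning

  disc₂-tr : ∀ t p → disc₂ (tr₂ t p) ≡ disc₂ p * (1# * 1#)
  disc₂-tr t ⟨ u , v , w ⟩₃ = solve (t ∷ u ∷ v ∷ w ∷ []) λ t u v w → E.disc₂ (E.tr₂ t ⟨ u , v , w ⟩₃) :≡ E.disc₂ ⟨ u , v , w ⟩₃ :* (:1 :* :1)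

  disc₂-dg : ∀ k p → disc₂ (dg₂ k p) ≡ disc₂ p * (k * k)
  disc₂-dg t ⟨ u , v , w ⟩₃ = solve (t ∷ u ∷ v ∷ w ∷ []) λ t u v w → E.disc₂ (E.dg₂ t ⟨ u , v , w ⟩₃) :≡ E.disc₂ ⟨ u , v , w ⟩₃ :* (t :* t)

  disc₂-sc : ∀ k p → disc₂ (sc₂ k p) ≡ disc₂ p * (k * k)
  disc₂-sc t ⟨ u , v , w ⟩₃ = solve (t ∷ u ∷ v ∷ w ∷ []) λ t u v w → E.disc₂ (E.sc₂ t ⟨ u , v , w ⟩₃) :≡ E.disc₂ ⟨ u , v , w ⟩₃ :* (t :* t)

  disc₂-sw : ∀ p → disc₂ (sw₂ p) ≡ disc₂ p * (1# * 1#)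
  disc₂-sw ⟨ u , v , w ⟩₃ = solve (u ∷ v ∷ w ∷ []) λ u v w → E.disc₂ (E.sw₂ ⟨ u , v , w ⟩₃) :≡ E.disc₂ ⟨ u , v , w ⟩₃ :* (:1 :* :1)

  polar-tr : ∀ t p p′ → polar (tr₂ t p) (tr₂ t p′) ≡ 1# * 1# * polar p p′
  polar-tr t ⟨ u , v , w ⟩₃ ⟨ u′ , v′ , w′ ⟩₃ = solve (t ∷ u ∷ v ∷ w ∷ u′ ∷ v′ ∷ w′ ∷ []) λ t u v w u′ v′ w′ →
    E.polar (E.tr₂ t ⟨ u , v , w ⟩₃) (E.tr₂ t ⟨ u′ , v′ , w′ ⟩₃) :≡ :1 :* :1 :* E.polar ⟨ u , v , w ⟩₃ ⟨ u′ , v′ , w′ ⟩₃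

  polar-dg : ∀ t p p′ → polar (dg₂ t p) (dg₂ t p′) ≡ t * t * polar p p′
  polar-dg t ⟨ u , v , w ⟩₃ ⟨ u′ , v′ , w′ ⟩₃ = solve (t ∷ u ∷ v ∷ w ∷ u′ ∷ v′ ∷ w′ ∷ []) λ t u v w u′ v′ w′ →
    E.polar (E.dg₂ t ⟨ u , v , w ⟩₃) (E.dg₂ t ⟨ u′ , v′ , w′ ⟩₃) :≡ t :* t :* E.polar ⟨ u , v , w ⟩₃ ⟨ u′ , v′ , w′ ⟩₃

  polar-sc : ∀ t s p p′ → polar (sc₂ t p) (sc₂ s p′) ≡ t * s * polar p p′
  polar-sc t s ⟨ u , v , w ⟩₃ ⟨ u′ , v′ , w′ ⟩₃ = solve (t ∷ s ∷ u ∷ v ∷ w ∷ u′ ∷ v′ ∷ w′ ∷ []) λ t s u v w u′ v′ w′ →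
    E.polar (E.sc₂ t ⟨ u , v , w ⟩₃) (E.sc₂ s ⟨ u′ , v′ , w′ ⟩₃) :≡ t :* s :* E.polar ⟨ u , v , w ⟩₃ ⟨ u′ , v′ , w′ ⟩₃

  polar-sw : ∀ p p′ → polar (sw₂ p) (sw₂ p′) ≡ 1# * 1# * polar p p′
  polar-sw ⟨ u , v , w ⟩₃ ⟨ u′ , v′ , w′ ⟩₃ = solve (u ∷ v ∷ w ∷ u′ ∷ v′ ∷ w′ ∷ []) λ u v w u′ v′ w′ →
    E.polar (E.sw₂ ⟨ u , v , w ⟩₃) (E.sw₂ ⟨ u′ , v′ , w′ ⟩₃) :≡ :1 :* :1 :* E.polar ⟨ u , v , w ⟩₃ ⟨ u′ , v′ , w′ ⟩₃

  tr-⊙ : ∀ t p p′ → tr t (p ⊙ p′) ≡ tr₂ t p ⊙ tr₂ t p′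
  tr-⊙ t ⟨ u , v , w ⟩₃ ⟨ u′ , v′ , w′ ⟩₃ = solveᵥ (t ∷ u ∷ v ∷ w ∷ u′ ∷ v′ ∷ w′ ∷ []) λ t u v w u′ v′ w′ →
    E.tr t (⟨ u , v , w ⟩₃ E.⊙ ⟨ u′ , v′ , w′ ⟩₃) :≡ E.tr₂ t ⟨ u , v , w ⟩₃ E.⊙ E.tr₂ t ⟨ u′ , v′ , w′ ⟩₃

  dg-⊙ : ∀ t p p′ → dg t (p ⊙ p′) ≡ dg₂ t p ⊙ dg₂ t p′
  dg-⊙ t ⟨ u , v , w ⟩₃ ⟨ u′ , v′ , w′ ⟩₃ = solveᵥ (t ∷ u ∷ v ∷ w ∷ u′ ∷ v′ ∷ w′ ∷ []) λ t u v w u′ v′ w′ →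
    E.dg t (⟨ u , v , w ⟩₃ E.⊙ ⟨ u′ , v′ , w′ ⟩₃) :≡ E.dg₂ t ⟨ u , v , w ⟩₃ E.⊙ E.dg₂ t ⟨ u′ , v′ , w′ ⟩₃

  sw-⊙ : ∀ p p′ → sw (p ⊙ p′) ≡ sw₂ p ⊙ sw₂ p′
  sw-⊙ ⟨ u , v , w ⟩₃ ⟨ u′ , v′ , w′ ⟩₃ = solveᵥ (u ∷ v ∷ w ∷ u′ ∷ v′ ∷ w′ ∷ []) λ u v w u′ v′ w′ →
    E.sw (⟨ u , v , w ⟩₃ E.⊙ ⟨ u′ , v′ , w′ ⟩₃) :≡ E.sw₂ ⟨ u , v , w ⟩₃ E.⊙ E.sw₂ ⟨ u′ , v′ , w′ ⟩₃

  sc-⊙ : ∀ s t p p′ → sc (s * t) (p ⊙ p′) ≡ sc₂ s p ⊙ sc₂ t p′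
  sc-⊙ s t ⟨ u , v , w ⟩₃ ⟨ u′ , v′ , w′ ⟩₃ = solveᵥ (s ∷ t ∷ u ∷ v ∷ w ∷ u′ ∷ v′ ∷ w′ ∷ []) λ s t u v w u′ v′ w′ →
    E.sc (s :* t) (⟨ u , v , w ⟩₃ E.⊙ ⟨ u′ , v′ , w′ ⟩₃) :≡ E.sc₂ s ⟨ u , v , w ⟩₃ E.⊙ E.sc₂ t ⟨ u′ , v′ , w′ ⟩₃

  sc₂-1 : ∀ p → sc₂ 1# p ≡ p
  sc₂-1 ⟨ u , v , w ⟩₃ = solveᵥ (u ∷ v ∷ w ∷ []) λ u v w → E.sc₂ :1 ⟨ u , v , w ⟩₃ :≡ ⟨ u , v , w ⟩₃

  ⊙-comm : ∀ p p′ → p ⊙ p′ ≡ p′ ⊙ p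
  ⊙-comm ⟨ u , v , w ⟩₃ ⟨ u′ , v′ , w′ ⟩₃ = solveᵥ (u ∷ v ∷ w ∷ u′ ∷ v′ ∷ w′ ∷ []) λ u v w u′ v′ w′ →
    ⟨ u , v , w ⟩₃ E.⊙ ⟨ u′ , v′ , w′ ⟩₃ :≡ ⟨ u′ , v′ , w′ ⟩₃ E.⊙ ⟨ u , v , w ⟩₃

  polar-comm : ∀ p p′ → polar p p′ ≡ polar p′ p
  polar-comm ⟨ u , v , w ⟩₃ ⟨ u′ , v′ , w′ ⟩₃ = solve (u ∷ v ∷ w ∷ u′ ∷ v′ ∷ w′ ∷ []) λ u v w u′ v′ w′ →
    E.polar ⟨ u , v , w ⟩₃ ⟨ u′ , v′ , w′ ⟩₃ :≡ E.polar ⟨ u′ , v′ , w′ ⟩₃ ⟨ u , v , w ⟩₃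

  coupled-sym : ∀ {μ p p′} → Coupled μ p p′ → Coupled μ p′ p
  coupled-sym {μ} {p} {p′} (coupled i i′ r) = coupled i′ i (trans (cong (_^ 2) (polar-comm p′ p)) (trans r (cong (μ *_) (*-comm _ _))))

  coupled-tr : ∀ {μ p p′} t → Coupled μ p p′ → Coupled μ (tr₂ t p) (tr₂ t p′)
  coupled-tr {p = p} {p′} t = coupled-forward 1≢0 1≢0 (disc₂-tr t p) (disc₂-tr t p′) (polar-tr t p p′)

  coupled-dg : ∀ {μ p p′ t} → t ≢ 0# → Coupled μ p p′ → Coupled μ (dg₂ t p) (dg₂ t p′)
  coupled-dg {p = p} {p′} {t} h = coupled-forward h h (disc₂-dg t p) (disc₂-dg t p′) (polar-dg t p p′)

  coupled-undg : ∀ {μ p p′ t} → t ≢ 0# → Coupled μ (dg₂ t p) (dg₂ t p′) → Coupled μ p p′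
  coupled-undg {p = p} {p′} {t} h = coupled-backward h h (disc₂-dg t p) (disc₂-dg t p′) (polar-dg t p p′)

  coupled-sc : ∀ {μ p p′ s t} → s ≢ 0# → t ≢ 0# → Coupled μ p p′ → Coupled μ (sc₂ s p) (sc₂ t p′)
  coupled-sc {p = p} {p′} {s} {t} hs ht = coupled-forward hs ht (disc₂-sc s p) (disc₂-sc t p′) (polar-sc s t p p′)

  coupled-unsc : ∀ {μ p p′ s t} → s ≢ 0# → t ≢ 0# → Coupled μ (sc₂ s p) (sc₂ t p′) → Coupled μ p p′
  coupled-unsc {p = p} {p′} {s} {t} hs ht = coupled-backward hs ht (disc₂-sc s p) (disc₂-sc t p′) (polar-sc s t p p′)

  prod-stable : ∀ {μ} → Stable (Prod μ)
  prod-stable {μ} = invariant {Prod μ} record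
    { tr-inv = λ { t (prod {p} {p′} c refl) → prod (coupled-tr t c) (tr-⊙ t p p′) }
    ; dg-inv = λ { {t} h (prod {p} {p′} c refl) → prod (coupled-dg h c) (dg-⊙ t p p′) }
    ; sw-inv = λ { (prod {p} {p′} c refl) → prod (coupled-forward 1≢0 1≢0 (disc₂-sw p) (disc₂-sw p′) (polar-sw p p′) c) (sw-⊙ p p′) }
    ; sc-inv = λ { {k} h (prod {p} {p′} c refl) → prod (coupled-sc h 1≢0 c)
        (trans (cong (λ k → sc k (p ⊙ p′)) (sym (*-identityʳ k))) (sc-⊙ k 1# p p′)) } }

  -- In characteristic 3 the resultant of two quadratics is `polar`² - DD′, so this is the product
  -- formula Δ(pp′) = DD′Res(p, p′)².
  Δ-⊙ : ∀ p p′ → Δ (p ⊙ p′) ≡ disc₂ p * disc₂ p′ * (polar p p′ ^ 2 - disc₂ p * disc₂ p′) ^ 2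
  Δ-⊙ ⟨ u , v , w ⟩₃ ⟨ u′ , v′ , w′ ⟩₃ = solve (u ∷ v ∷ w ∷ u′ ∷ v′ ∷ w′ ∷ []) λ u v w u′ v′ w′ →
    let D = E.disc₂ ⟨ u , v , w ⟩₃ ; D′ = E.disc₂ ⟨ u′ , v′ , w′ ⟩₃ in
    E.disc (⟨ u , v , w ⟩₃ E.⊙ ⟨ u′ , v′ , w′ ⟩₃) :≡ D :* D′ :* (E.polar ⟨ u , v , w ⟩₃ ⟨ u′ , v′ , w′ ⟩₃ E.^ 2 :- D :* D′) E.^ 2

  mid-⊙ : ∀ p p′ → mid (p ⊙ p′) ≡ polar p p′
  mid-⊙ ⟨ u , v , w ⟩₃ ⟨ u′ , v′ , w′ ⟩₃ = solve (u ∷ v ∷ w ∷ u′ ∷ v′ ∷ w′ ∷ []) λ u v w u′ v′ w′ →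
    E.mid (⟨ u , v , w ⟩₃ E.⊙ ⟨ u′ , v′ , w′ ⟩₃) :≡ E.polar ⟨ u , v , w ⟩₃ ⟨ u′ , v′ , w′ ⟩₃

  coupled-square : ∀ {μ p p′} → Coupled μ p p′ → IsSquare μ
  coupled-square {μ} {p} {p′} (coupled i i′ r) = root (nonsquare-* i i′)
    where
    root : IsSquare (disc₂ p * disc₂ p′) → IsSquare μ
    root (s , e) = square-ratio {μ} {s} (λ z → *-≢0 (nonsquare-≢0 i) (nonsquare-≢0 i′) (trans (sym e) (trans (cong (_* s) z) (zeroˡ s))))
      (polar p p′ , trans (cong (polar p p′ *_) (sym (*-identityʳ _))) (trans r (cong (μ *_) (sym e))))

  coupled-Δ : ∀ {μ p p′} → Coupled μ p p′ → Δ (p ⊙ p′) ≡ disc₂ p * disc₂ p′ * (((μ - 1#) * (disc₂ p * disc₂ p′)) * ((μ - 1#) * (disc₂ p * disc₂ p′)))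
  coupled-Δ {μ} {p} {p′} (coupled i i′ r) = trans (Δ-⊙ p p′) (trans (cong (λ u → D * (u - D) ^ 2) r)
    (solve (D ∷ μ ∷ []) λ D μ → D :* (μ :* D :- D) E.^ 2 :≡ D :* (((μ :- :1) :* D) :* ((μ :- :1) :* D))))
    where
    D : Carrier
    D = disc₂ p * disc₂ p′

  coupled-disc≢0 : ∀ {μ p p′} → Coupled μ p p′ → disc₂ p * disc₂ p′ ≢ 0#
  coupled-disc≢0 (coupled i i′ _) = *-≢0 (nonsquare-≢0 i) (nonsquare-≢0 i′)

  prod-Δ-square : ∀ {μ f} → Prod μ f → IsSquare (Δ f)
  prod-Δ-square (prod c@(coupled i i′ _) refl) = subst IsSquare (sym (coupled-Δ c)) (square-* (nonsquare-* i i′) (_ , refl))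

  prod-nondeg : ∀ {μ f} → μ ≢ 1# → Prod μ f → NonDeg f
  prod-nondeg {μ} h (prod c refl) z = *-≢0 (coupled-disc≢0 c) (*-≢0 μD≢0 μD≢0) (trans (sym (coupled-Δ c)) z)
    where
    μD≢0 : _
    μD≢0 = *-≢0 {μ - 1#} (λ z → h (-≡0⇒≡ z)) (coupled-disc≢0 c)

  nondeg-μ≢1 : ∀ {μ f} → NonDeg f → Prod μ f → μ ≢ 1#
  nondeg-μ≢1 nd (prod {p} {p′} c refl) refl = nd (trans (coupled-Δ c) (solve (disc₂ p * disc₂ p′ ∷ []) λ D → D :* (((:1 :- :1) :* D) :* ((:1 :- :1) :* D)) :≡ :0))

  -- With P² = μD one has P⁶ = μ³D³, while Δ = D³(μ - 1)². The first cofactor is the quotient of P⁶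
  -- - (μD)³ by P² - μD.
  prod-J : ∀ {μ f r} → Prod μ f → μ ^ 3 ≡ r * (μ - 1#) ^ 2 → J r f
  prod-J {μ} {r = r} (prod {p} {p′} c refl) e = trans (cong (_^ 6) (mid-⊙ p p′)) (trans
    (lin₂ (P ^ 4 + P ^ 2 * (μ * D) + (μ * D) ^ 2) (D ^ 3) (Coupled.ratio c) e (solve (P ∷ μ ∷ D ∷ r ∷ []) λ P μ D r →
      P E.^ 6 :- r :* (D :* (((μ :- :1) :* D) :* ((μ :- :1) :* D))) :≡
      (P E.^ 4 :+ P E.^ 2 :* (μ :* D) :+ (μ :* D) E.^ 2) :* (P E.^ 2 :- μ :* D) :+ D E.^ 3 :* (μ E.^ 3 :- r :* (μ :- :1) E.^ 2)))
    (cong (r *_) (sym (coupled-Δ c))))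
    where
    P D : Carrier
    P = polar p p′
    D = disc₂ p * disc₂ p′

  J-prod : ∀ {μ f r} → Prod μ f → J r f → μ ^ 3 ≡ r * (μ - 1#) ^ 2
  J-prod {μ} {r = r} (prod {p} {p′} c refl) j = *-cancelˡ (^-≢0 3 (coupled-disc≢0 c))
    (lin₂ (- (P ^ 4 + P ^ 2 * (μ * D) + (μ * D) ^ 2)) 1# (Coupled.ratio c) j′ (solve (P ∷ μ ∷ D ∷ r ∷ []) λ P μ D r →
      D E.^ 3 :* μ E.^ 3 :- D E.^ 3 :* (r :* (μ :- :1) E.^ 2) :≡
      :- (P E.^ 4 :+ P E.^ 2 :* (μ :* D) :+ (μ :* D) E.^ 2) :* (P E.^ 2 :- μ :* D) :+
      :1 :* (P E.^ 6 :- r :* (D :* (((μ :- :1) :* D) :* ((μ :- :1) :* D))))))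
    where
    P D : Carrier
    P = polar p p′
    D = disc₂ p * disc₂ p′
    j′ : P ^ 6 ≡ r * (D * (((μ - 1#) * D) * ((μ - 1#) * D)))
    j′ = trans (cong (_^ 6) (sym (mid-⊙ p p′))) (trans j (cong (r *_) (coupled-Δ c)))

  -- The derivative at t is 2ut + v = v - ut, and its square exceeds the discriminant by u times the
  -- value at t.
  rootless₂ : ∀ {u v w} t → ev₂ ⟨ u , v , w ⟩₃ t ≡ 0# → IsSquare (disc₂ ⟨ u , v , w ⟩₃)
  rootless₂ {u} {v} {w} t z = v - u * t , lin₁ u z (solve (u ∷ v ∷ w ∷ t ∷ []) λ u v w t →
    (v :- u :* t) :* (v :- u :* t) :- E.disc₂ ⟨ u , v , w ⟩₃ :≡ u :* (E.ev₂ ⟨ u , v , w ⟩₃ t :- :0))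

  lead≢0₂ : ∀ {u v w} → ¬ IsSquare (disc₂ ⟨ u , v , w ⟩₃) → u ≢ 0#
  lead≢0₂ {v = v} {w} h refl = h (v , solve (v ∷ w ∷ []) λ v w → v :* v :≡ E.disc₂ ⟨ :0 , v , w ⟩₃)

  prod-rootless : ∀ {μ f} → Prod μ f → ¬ Rooted f
  prod-rootless (prod {⟨ u , v , w ⟩₃} {⟨ u′ , v′ , w′ ⟩₃} (coupled i i′ _) refl) (inj₁ z) =
    *-≢0 (lead≢0₂ i) (lead≢0₂ i′) z
  prod-rootless (prod {p@(⟨ u , v , w ⟩₃)} {p′@(⟨ u′ , v′ , w′ ⟩₃)} (coupled i i′ _) refl) (inj₂ (t , z)) =
    case *-zero-split {ev₂ p t} {ev₂ p′ t} (trans (solve (u ∷ v ∷ w ∷ u′ ∷ v′ ∷ w′ ∷ t ∷ []) λ u v w u′ v′ w′ t →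
      E.ev₂ ⟨ u , v , w ⟩₃ t :* E.ev₂ ⟨ u′ , v′ , w′ ⟩₃ t :≡ E.ev (⟨ u , v , w ⟩₃ E.⊙ ⟨ u′ , v′ , w′ ⟩₃) t) z) of λ
      { (inj₁ z) → i (rootless₂ t z) ; (inj₂ z) → i′ (rootless₂ t z) }

  -- The norm form uv = X² - εY² of F_q(√ε); it is fixed up to scalars by the torus u ↦ ξu, v ↦ ξ̄v.
  base : Quadratic
  base = ⟨ 1# , 0# , - ε ⟩₃

  MonicForm : Quadratic → Set
  MonicForm p = ∃[ k ] ∃[ t ] ∃[ e ] (k ≢ 0# × e ≢ 0# × p ≡ sc₂ k (quad ε t e))

  BaseForm : Carrier → Quartic → Set
  BaseForm μ f = ∃[ x ] ∃[ y ] ∃[ c ] (Coupled μ base (conic ε x y c) × f ≋ base ⊙ conic ε x y c)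

  opaque
    monic-quad : ∀ {p} → ¬ IsSquare (disc₂ p) → MonicForm p
    monic-quad {⟨ u , v , w ⟩₃} ns with quotient (lead≢0₂ ns) v | quotient (lead≢0₂ ns) w
    ... | v , refl | w , refl = go (nonsquare-ratio ε-nonsquare ns′)
      where
      u≢0 : u ≢ 0#
      u≢0 = lead≢0₂ ns
      ns′ : ¬ IsSquare (v * v - w)
      ns′ sq = ns (subst IsSquare (solve (u ∷ v ∷ w ∷ []) λ u v w → (v :* v :- w) :* (u :* u) :≡ E.disc₂ ⟨ u , u :* v , u :* w ⟩₃) (square-* sq (u , refl)))
      go : ∃[ e ] (e ≢ 0# × ε * (e * e) ≡ v * v - w) → MonicForm ⟨ u , u * v , u * w ⟩₃
      go (e , e≢0 , h) = u , - v , e , u≢0 , e≢0 , trans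
        (cong (λ w → ⟨ u , u * v , u * w ⟩₃) (lin₁ 1# h (solve (ε ∷ e ∷ v ∷ w ∷ []) λ ε e v w →
            w :- (v :* v :- ε :* (e :* e)) :≡ :1 :* (ε :* (e :* e) :- (v :* v :- w)))))
        (solveᵥ (u ∷ v ∷ ε ∷ e ∷ []) λ u v ε e → ⟨ u , u :* v , u :* (v :* v :- ε :* (e :* e)) ⟩₃ :≡ E.sc₂ u (E.quad ε (:- v) e))

    quad-base : ∀ t e → tr₂ (- t) (quad ε t e) ≡ dg₂ e base
    quad-base t e = solveᵥ (ε ∷ t ∷ e ∷ []) λ ε t e → E.tr₂ (:- t) (E.quad ε t e) :≡ E.dg₂ e ⟨ :1 , :0 , :- ε ⟩₃

    tr₂-inverse : ∀ t p → tr₂ (- t) (tr₂ t p) ≡ p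
    tr₂-inverse t ⟨ u , v , w ⟩₃ = solveᵥ (t ∷ u ∷ v ∷ w ∷ []) λ t u v w → E.tr₂ (:- t) (E.tr₂ t ⟨ u , v , w ⟩₃) :≡ ⟨ u , v , w ⟩₃

    dg₂-surjective : ∀ {e} → e ≢ 0# → ∀ p → ∃[ p′ ] dg₂ e p′ ≡ p
    dg₂-surjective {e} h ⟨ u , v , w ⟩₃ with quotient h v | quotient (^-≢0 2 h) w
    ... | v , refl | w , refl = ⟨ u , v , w ⟩₃ , refl

    -- zu² + cuv + z̄v² runs through all quadratics. These coordinates suit a pair with `base`
    -- because the polar form with `base` is εc and the discriminant is ε(c² - N(z)).
    conic-surjective : ∀ p → ∃[ x ] ∃[ y ] ∃[ c ] conic ε x y c ≡ p
    conic-surjective ⟨ u , v , w ⟩₃ with quotient ε≢0 v | quotient ε≢0 w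
    ... | v , refl | w , refl = w + u , v , w - u , solveᵥ (ε ∷ u ∷ v ∷ w ∷ []) λ ε u v w →
      E.conic ε (w :+ u) v (w :- u) :≡ ⟨ u , ε :* v , ε :* w ⟩₃

    prod-base : ∀ {μ f} → Prod μ f → BaseForm μ f
    prod-base {μ} (prod {p₁} {p₂} c refl) = go (monic-quad (Coupled.irreducible₁ c))
      where
      go : MonicForm p₁ → BaseForm μ (p₁ ⊙ p₂)
      go (k , t , e , k≢0 , e≢0 , refl) = go′ (dg₂-surjective e≢0 (tr₂ (- t) p₂))
        where
        go′ : ∃[ p′ ] dg₂ e p′ ≡ tr₂ (- t) p₂ → BaseForm μ (sc₂ k (quad ε t e) ⊙ p₂)
        go′ (p′ , h) = go″ (conic-surjective p′)
          where
          go″ : ∃[ x ] ∃[ y ] ∃[ c ] conic ε x y c ≡ p′ → BaseForm μ (sc₂ k (quad ε t e) ⊙ p₂)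
          go″ (x , y , c′ , refl) = x , y , c′ ,
            coupled-undg e≢0 (subst₂ (Coupled μ) (quad-base t e) (sym h) (coupled-tr (- t)
              (coupled-unsc k≢0 1≢0 (subst (Coupled μ _) (sym (sc₂-1 p₂)) c)))) ,
            ≋-trans (subst (_≋ quad ε t e ⊙ p₂) (trans (sc-⊙ k 1# (quad ε t e) p₂) (cong (sc₂ k (quad ε t e) ⊙_) (sc₂-1 p₂))) (≋-unsc (*-≢0 k≢0 1≢0)))
              (≋-trans (≋-tr (- t) _) (≋-sym (subst (base ⊙ p′ ≋_) (trans (dg-⊙ e base p′)
                 (trans (cong₂ _⊙_ (sym (quad-base t e)) h) (sym (tr-⊙ (- t) (quad ε t e) p₂)))) (≋-dg e≢0 _))))

    conic-disc : ∀ x y c → disc₂ (conic ε x y c) ≡ ε * (c * c - nrm ε x y)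
    conic-disc x y c = solve (ε ∷ x ∷ y ∷ c ∷ []) λ ε x y c → E.disc₂ (E.conic ε x y c) :≡ ε :* (c :* c :- E.nrm ε x y)

    base-disc : disc₂ base ≡ ε
    base-disc = solve (ε ∷ []) λ ε → E.disc₂ ⟨ :1 , :0 , :- ε ⟩₃ :≡ ε

    conic-polar : ∀ x y c → polar base (conic ε x y c) ≡ ε * c
    conic-polar x y c = solve (ε ∷ x ∷ y ∷ c ∷ []) λ ε x y c → E.polar ⟨ :1 , :0 , :- ε ⟩₃ (E.conic ε x y c) :≡ ε :* c

    coupled-conic : ∀ {μ x y c} → Coupled μ base (conic ε x y c) → c * c ≡ μ * (c * c - nrm ε x y) × ¬ IsSquare (ε * (c * c - nrm ε x y))
    coupled-conic {μ} {x} {y} {c} (coupled _ i r) = *-cancelˡ (*-≢0 ε≢0 ε≢0) (begin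
        ε * ε * (c * c)                                ≡⟨ solve (ε ∷ c ∷ []) (λ ε c → ε :* ε :* (c :* c) :≡ (ε :* c) E.^ 2) ⟩
        (ε * c) ^ 2                                    ≡⟨ cong (_^ 2) (sym (conic-polar x y c)) ⟩
        polar base (conic ε x y c) ^ 2                 ≡⟨ r ⟩
        μ * (disc₂ base * disc₂ (conic ε x y c))       ≡⟨ cong₂ (λ u v → μ * (u * v)) base-disc (conic-disc x y c) ⟩
        μ * (ε * (ε * (c * c - nrm ε x y)))            ≡⟨ solve (ε ∷ μ ∷ c * c - nrm ε x y ∷ []) (λ ε μ u → μ :* (ε :* (ε :* u)) :≡ ε :* ε :* (μ :* u)) ⟩
        ε * ε * (μ * (c * c - nrm ε x y))              ∎) , i ∘ subst IsSquare (sym (conic-disc x y c))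
      where open ≡-Reasoning

    conic-coupled : ∀ {μ x y c} → c * c ≡ μ * (c * c - nrm ε x y) → ¬ IsSquare (ε * (c * c - nrm ε x y)) → Coupled μ base (conic ε x y c)
    conic-coupled {μ} {x} {y} {c} r i = coupled (ε-nonsquare ∘ subst IsSquare base-disc) (i ∘ subst IsSquare (conic-disc x y c)) (begin
        polar base (conic ε x y c) ^ 2                 ≡⟨ cong (_^ 2) (conic-polar x y c) ⟩
        (ε * c) ^ 2                                    ≡⟨ lin₁ (ε * ε) r (solve (ε ∷ μ ∷ c ∷ nrm ε x y ∷ []) λ ε μ c N →
           (ε :* c) E.^ 2 :- μ :* (ε :* (ε :* (c :* c :- N))) :≡ ε :* ε :* (c :* c :- μ :* (c :* c :- N))) ⟩
        μ * (ε * (ε * (c * c - nrm ε x y)))            ≡⟨ cong₂ (λ u v → μ * (u * v)) (sym base-disc) (sym (conic-disc x y c)) ⟩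
        μ * (disc₂ base * disc₂ (conic ε x y c))       ∎)
      where open ≡-Reasoning

    private
      -- The torus element ξ sends z to zξ², c to cN(ξ) and `base` to N(ξ) times itself. So z is
      -- multiplied by ξ/ξ̄ directly, and no square root of ξ is called for as in `torus-rotate`.
      conic-rotate : ∀ {x y x′ y′ s t} c → nrm ε s t ≢ 0# → Rotation ε x y x′ y′ s t → base ⊙ conic ε x y c ≋ base ⊙ conic ε x′ y′ c
      conic-rotate {x} {y} {x′} {y′} {s} {t} c M≢0 (ex , ey) = equivalent s (ε * t) t s
        (λ z → M≢0 (trans (solve (ε ∷ s ∷ t ∷ []) λ ε s t → E.nrm ε s t :≡ s :* s :- ε :* t :* t) z))
        (nrm ε s t * nrm ε s t) (*-≢0 M≢0 M≢0) (begin
          sub s (ε * t) t s (base ⊙ conic ε x y c)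
            ≡⟨ solveᵥ (ε ∷ x ∷ y ∷ c ∷ s ∷ t ∷ []) (λ ε x y c s t →
                 E.sub s (ε :* t) t s (⟨ :1 , :0 , :- ε ⟩₃ E.⊙ E.conic ε x y c) :≡
                 E.sc₂ (E.nrm ε s t) ⟨ :1 , :0 , :- ε ⟩₃ E.⊙
                   E.conic ε (x :* (s :* s :+ ε :* (t :* t)) :- ε :* (y :* (s :* t))) (y :* (s :* s :+ ε :* (t :* t)) :- x :* (s :* t)) (c :* E.nrm ε s t)) ⟩
          sc₂ M base ⊙ conic ε (x * (s * s + ε * (t * t)) - ε * (y * (s * t))) (y * (s * s + ε * (t * t)) - x * (s * t)) (c * M)
            ≡⟨ cong₂ (λ u v → sc₂ M base ⊙ conic ε u v (c * M)) (sym ex) (sym ey) ⟩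
          sc₂ M base ⊙ conic ε (x′ * M) (y′ * M) (c * M)
            ≡⟨ solveᵥ (ε ∷ x′ ∷ y′ ∷ c ∷ M ∷ []) (λ ε x y c M →
                 E.sc₂ M ⟨ :1 , :0 , :- ε ⟩₃ E.⊙ E.conic ε (x :* M) (y :* M) (c :* M) :≡ E.sc (M :* M) (⟨ :1 , :0 , :- ε ⟩₃ E.⊙ E.conic ε x y c)) ⟩
          sc (M * M) (base ⊙ conic ε x′ y′ c) ∎)
        where
        open ≡-Reasoning
        M : Carrier
        M = nrm ε s t

    nrm-≡0 : ∀ {x y} → nrm ε x y ≡ 0# → x ≡ 0# × y ≡ 0#
    nrm-≡0 {x} {y} z = choose (y ≟ᶠ 0#)
      where
      choose : Dec (y ≡ 0#) → x ≡ 0# × y ≡ 0#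
      choose (yes refl) = ^-≡0 2 (lin₁ 1# z (solve (ε ∷ x ∷ []) λ ε x → x E.^ 2 :- :0 :≡ :1 :* (E.nrm ε x :0 :- :0))) , refl
      choose (no h) = ⊥-elim (ε-nonsquare (square-ratio h (x , -≡0⇒≡ z)))

    nonzero-of-nonsquare : ∀ {u} → ¬ IsSquare (ε * u) → NonzeroSquare u
    nonzero-of-nonsquare {u} i = ≢0-right (nonsquare-≢0 i) , choose (square? u)
      where
      choose : Dec (IsSquare u) → IsSquare u
      choose (yes sq) = sq
      choose (no ns)  = ⊥-elim (i (nonsquare-* ε-nonsquare ns))

    -- With the first factor moved to `base`, the second satisfies c² = μ(c² - N). Scaling it so
    -- that both c and N agree brings two such factors into the range of Hilbert 90, which applies
    -- because μ ≠ 1 makes N nonzero.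
    prod-orbit : ∀ {μ f g} → μ ≢ 1# → Prod μ f → Prod μ g → f ≋ g
    prod-orbit {μ} {f} {g} μ≢1 Pf Pg = go (prod-base Pf) (prod-base Pg)
      where
      go : BaseForm μ f → BaseForm μ g → f ≋ g
      go (x , y , c , Cf , f≋) (x′ , y′ , c′ , Cg , g≋) = ≋-trans f≋ (≋-trans (choose (μ ≟ᶠ 0#)) (≋-sym g≋))
        where
        N N′ : Carrier
        N = nrm ε x y
        N′ = nrm ε x′ y′
        r : c * c ≡ μ * (c * c - N)
        r = proj₁ (coupled-conic Cf)
        r′ : c′ * c′ ≡ μ * (c′ * c′ - N′)
        r′ = proj₁ (coupled-conic Cg)
        i : NonzeroSquare (c * c - N)
        i = nonzero-of-nonsquare (proj₂ (coupled-conic Cf))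
        i′ : NonzeroSquare (c′ * c′ - N′)
        i′ = nonzero-of-nonsquare (proj₂ (coupled-conic Cg))
        N≢0 : N ≢ 0#
        N≢0 z = *-≢0 {μ - 1#} (μ≢1 ∘ -≡0⇒≡) (proj₁ i) (lin₂ (- 1#) 1# r z (solve (μ ∷ c ∷ N ∷ []) λ μ c N →
          (μ :- :1) :* (c :* c :- N) :- :0 :≡ :- :1 :* (c :* c :- μ :* (c :* c :- N)) :+ :1 :* (N :- :0)))
        scaled : ∀ k → k ≢ 0# → c′ ≡ k * c → N′ ≡ N * (k * k) → base ⊙ conic ε x y c ≋ base ⊙ conic ε x′ y′ c′
        scaled k k≢0 refl e =
          let s , t , M≢0 , rot = hilbert90 {ε} {k * x} {k * y} {x′} {y′} ε≢0
                (λ z → *-≢0 N≢0 (*-≢0 k≢0 k≢0) (trans (sym (nrm-sc k ε x y)) z)) (trans e (sym (nrm-sc k ε x y)))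
          in ≋-trans (≋-sc k≢0) (subst (_≋ base ⊙ conic ε x′ y′ (k * c))
               (solveᵥ (ε ∷ x ∷ y ∷ c ∷ k ∷ []) λ ε x y c k → ⟨ :1 , :0 , :- ε ⟩₃ E.⊙ E.conic ε (k :* x) (k :* y) (k :* c) :≡
                  E.sc k (⟨ :1 , :0 , :- ε ⟩₃ E.⊙ E.conic ε x y c))
               (conic-rotate (k * c) M≢0 rot))
        zero-c : μ ≡ 0# → ∀ {c u} → c * c ≡ μ * u → c ≡ 0#
        zero-c refl {c} e = ^-≡0 2 (trans (cong (c *_) (*-identityʳ c)) (trans e (zeroˡ _)))
        choose : Dec (μ ≡ 0#) → base ⊙ conic ε x y c ≋ base ⊙ conic ε x′ y′ c′
        -- For μ = 0 both c and c′ vanish and fix no scale. It is taken from square roots of -N and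
        -- -N′ instead, which exist since -εN and -εN′ are nonsquares.
        choose (yes z) = ratio (zero-c z r) (zero-c z r′) (proj₂ i) (proj₂ i′)
          where
          ratio : c ≡ 0# → c′ ≡ 0# → IsSquare (c * c - N) → IsSquare (c′ * c′ - N′) → base ⊙ conic ε x y c ≋ base ⊙ conic ε x′ y′ c′
          ratio zc zc′ (a , ea) (b , eb) = final (quotient a≢0 b)
            where
            a≢0 : a ≢ 0#
            a≢0 za = proj₁ i (trans (sym ea) (trans (cong (_* a) za) (zeroˡ a)))
            b≢0 : b ≢ 0#
            b≢0 zb = proj₁ i′ (trans (sym eb) (trans (cong (_* b) zb) (zeroˡ b)))
            final : ∃[ k ] a * k ≡ b → base ⊙ conic ε x y c ≋ base ⊙ conic ε x′ y′ c′
            final (k , ek) = scaled k (≢0-right (subst (_≢ 0#) (sym ek) b≢0)) (trans zc′ (sym (times-zero k zc)))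
              (norms (subst (λ c → a * a ≡ c * c - N) zc ea) (subst (λ c → b * b ≡ c * c - N′) zc′ eb))
              where
              norms : a * a ≡ 0# * 0# - N → b * b ≡ 0# * 0# - N′ → N′ ≡ N * (k * k)
              norms ea eb = lin₃ (- (k * k)) 1# (b + a * k) ea eb ek (solve (N ∷ N′ ∷ a ∷ b ∷ k ∷ []) λ N N′ a b k →
                N′ :- N :* (k :* k) :≡ :- (k :* k) :* (a :* a :- (:0 :* :0 :- N)) :+ :1 :* (b :* b :- (:0 :* :0 :- N′)) :+ (b :+ a :* k) :* (a :* k :- b))
        choose (no μ≢0) = final (quotient c≢0 c′)
          where
          c≢0 : c ≢ 0#
          c≢0 z = *-≢0 μ≢0 (proj₁ i) (trans (sym r) (trans (cong (_* c) z) (zeroˡ c)))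
          c′≢0 : c′ ≢ 0#
          c′≢0 z = *-≢0 μ≢0 (proj₁ i′) (trans (sym r′) (trans (cong (_* c′) z) (zeroˡ c′)))
          final : ∃[ k ] c * k ≡ c′ → base ⊙ conic ε x y c ≋ base ⊙ conic ε x′ y′ c′
          final (k , ek) = scaled k (≢0-right (subst (_≢ 0#) (sym ek) c′≢0)) (trans (sym ek) (*-comm c k))
            (*-cancelˡ μ≢0 (lin₃ (- (k * k)) 1# ((1# - μ) * (c * k + c′)) r r′ ek (solve (μ ∷ N ∷ N′ ∷ c ∷ c′ ∷ k ∷ []) λ μ N N′ c c′ k →
              μ :* N′ :- μ :* (N :* (k :* k)) :≡ :- (k :* k) :* (c :* c :- μ :* (c :* c :- N)) :+ :1 :* (c′ :* c′ :- μ :* (c′ :* c′ :- N′)) :+ ((:1 :- μ) :* (c :* k :+ c′)) :* (c :* k :- c′))))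

module ℕSolver = +-*-Solver
open ℕSolver using () renaming (_:+_ to infixl 6 _ℕ⊕_; _:*_ to infixl 7 _ℕ⊗_; _:=_ to infix 4 _ℕ≐_; con to ℕ#) public

-- Norms from the quadratic extension and the number of products

module ProductCounts (F : Field) (n : ℕ) (hs : HasSize F (3 ℕ.^ n)) where
  open Products F n hs public

  _≟²_ : DecidableEquality (Carrier × Carrier)
  _≟²_ = Product.≡-dec _≟ᶠ_ _≟ᶠ_

  _≟⁵_ : DecidableEquality Quartic
  _≟⁵_ = Vec.≡-dec _≟ᶠ_

  opaque
    -- Squares are norms of base field elements. A nonsquare is εs² = N(i√ε s) if i² = -1; if -1 is
    -- a nonsquare, then a = -s² and ε = -e², and y = s/e gives the norm s² + s² = -s².
    norm-surjective : ∀ a → ∃[ x ] ∃[ y ] nrm ε x y ≡ a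
    norm-surjective a = choose (square? a) (square? (- 1#))
      where
      choose : Dec (IsSquare a) → Dec (IsSquare (- 1#)) → ∃[ x ] ∃[ y ] nrm ε x y ≡ a
      choose (yes (s , e)) _ = s , 0# , trans (solve (ε ∷ s ∷ []) λ ε s → E.nrm ε s :0 :≡ s :* s) e
      choose (no ns) (yes (i , ei)) = let s , _ , es = nonsquare-ratio ε-nonsquare ns in
        0# , i * s , lin₂ 1# (- (ε * (s * s))) es ei (solve (ε ∷ i ∷ s ∷ a ∷ []) λ ε i s a →
          E.nrm ε :0 (i :* s) :- a :≡ :1 :* (ε :* (s :* s) :- a) :+ :- (ε :* (s :* s)) :* (i :* i :- :- :1))
      -- 1² + 1² = -1
      choose (no ns) (no ns′) =
        let s , _ , es = nonsquare-ratio ns′ ns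
            e , e≢0 , ee = nonsquare-ratio ns′ ε-nonsquare
            y , ey = quotient e≢0 s
        in s , y , lin₃ 1# (y * y) (e * y + s) es ee ey (solve (ε ∷ a ∷ s ∷ e ∷ y ∷ []) λ ε a s e y →
             E.nrm ε s y :- a :≡ :1 :* (:- :1 :* (s :* s) :- a) :+ (y :* y) :* (:- :1 :* (e :* e) :- ε) :+ (e :* y :+ s) :* (e :* y :- s))

    plane : Card {Carrier × Carrier} (λ _ → ⊤) (order ℕ.* order)
    plane = card-⇔ _ _ (card-Σ {Q = λ _ _ → ⊤} all (λ _ → all))

    -- Multiplication by an element of norm b/a, inverted by its conjugate over the norm, is a
    -- bijection between the two fibres.
    norm-fibre-transport : ∀ {a b N} → a ≢ 0# → b ≢ 0# → Card {Carrier × Carrier} (λ (x , y) → nrm ε x y ≡ a) N →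
                           Card {Carrier × Carrier} (λ (x , y) → nrm ε x y ≡ b) N
    norm-fibre-transport {a} {b} {N} a≢0 b≢0 fibre = go (quotient a≢0 b)
      where
      multiply : Carrier → Carrier → Carrier × Carrier → Carrier × Carrier
      multiply s t (x , y) = s * x + ε * (t * y) , s * y + t * x
      go : ∃[ k ] a * k ≡ b → Card {Carrier × Carrier} (λ (x , y) → nrm ε x y ≡ b) N
      go (k , refl) = go′ (norm-surjective k)
        where
        go′ : ∃[ s ] ∃[ t ] nrm ε s t ≡ k → Card {Carrier × Carrier} (λ (x , y) → nrm ε x y ≡ a * k) N
        go′ (s , t , refl) = go″ (quotient (≢0-right b≢0) 1#)
          where
          go″ : ∃[ κ ] nrm ε s t * κ ≡ 1# → Card {Carrier × Carrier} (λ (x , y) → nrm ε x y ≡ a * nrm ε s t) N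
          go″ (κ , eκ) = card-inverse (multiply s t) (multiply (κ * s) (- (κ * t))) fibre
            (λ {(x , y)} e → lin₁ (nrm ε s t) e (solve (ε ∷ s ∷ t ∷ x ∷ y ∷ a ∷ []) λ ε s t x y a →
               E.nrm ε (s :* x :+ ε :* (t :* y)) (s :* y :+ t :* x) :- a :* E.nrm ε s t :≡ E.nrm ε s t :* (E.nrm ε x y :- a)))
            (λ {(x , y)} e → lin₂ (κ * κ * nrm ε s t) (a * (nrm ε s t * κ + 1#)) e eκ (solve (ε ∷ s ∷ t ∷ x ∷ y ∷ a ∷ κ ∷ []) λ ε s t x y a κ →
               E.nrm ε (κ :* s :* x :+ ε :* (:- (κ :* t) :* y)) (κ :* s :* y :+ :- (κ :* t) :* x) :- a :≡
               (κ :* κ :* E.nrm ε s t) :* (E.nrm ε x y :- a :* E.nrm ε s t) :+ a :* (E.nrm ε s t :* κ :+ :1) :* (E.nrm ε s t :* κ :- :1)))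
            (λ {(x , y)} _ → cong₂ _,_
               (lin₁ x eκ (solve (ε ∷ s ∷ t ∷ x ∷ y ∷ κ ∷ []) λ ε s t x y κ →
                 κ :* s :* (s :* x :+ ε :* (t :* y)) :+ ε :* (:- (κ :* t) :* (s :* y :+ t :* x)) :- x :≡ x :* (E.nrm ε s t :* κ :- :1)))
               (lin₁ y eκ (solve (ε ∷ s ∷ t ∷ x ∷ y ∷ κ ∷ []) λ ε s t x y κ →
                 κ :* s :* (s :* y :+ t :* x) :+ :- (κ :* t) :* (s :* x :+ ε :* (t :* y)) :- y :≡ y :* (E.nrm ε s t :* κ :- :1))))
            (λ {(x , y)} _ → cong₂ _,_
               (lin₁ x eκ (solve (ε ∷ s ∷ t ∷ x ∷ y ∷ κ ∷ []) λ ε s t x y κ →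
                 s :* (κ :* s :* x :+ ε :* (:- (κ :* t) :* y)) :+ ε :* (t :* (κ :* s :* y :+ :- (κ :* t) :* x)) :- x :≡ x :* (E.nrm ε s t :* κ :- :1)))
               (lin₁ y eκ (solve (ε ∷ s ∷ t ∷ x ∷ y ∷ κ ∷ []) λ ε s t x y κ →
                 s :* (κ :* s :* y :+ :- (κ :* t) :* x) :+ t :* (κ :* s :* x :+ ε :* (:- (κ :* t) :* y)) :- y :≡ y :* (E.nrm ε s t :* κ :- :1))))

    private
      -- Only 0 has norm 0, so the q² - 1 nonzero elements are spread over q - 1 fibres, which are
      -- equally large.
      norm-fibre-size : ∀ {a N} → a ≢ 0# → Card {Carrier × Carrier} (λ (x , y) → nrm ε x y ≡ a) N → order ℕ.+ 1 ≡ N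
      norm-fibre-size {a} {N} a≢0 fibre = count (card-∖ _≟²_ plane (card-single (0# , 0#)) _)
        where
        cancel : ∀ m q → q ≡ suc m → m ≢ 0 → m ℕ.* N ℕ.+ 1 ≡ q ℕ.* q → q ℕ.+ 1 ≡ N
        cancel zero _ _ h _ = ⊥-elim (h refl)
        cancel (suc m) _ refl _ e = sym (ℕ.*-cancelˡ-≡ N _ (suc m) (ℕ.+-cancelʳ-≡ 1 _ _ (trans e
            (ℕSolver.solve 1 (λ m → (ℕ# 2 ℕ⊕ m) ℕ⊗ (ℕ# 2 ℕ⊕ m) ℕ≐ (ℕ# 1 ℕ⊕ m) ℕ⊗ (ℕ# 2 ℕ⊕ m ℕ⊕ ℕ# 1) ℕ⊕ ℕ# 1) refl m))))
        count : ∃[ M ] (Card {Carrier × Carrier} (λ p → ⊤ × p ≢ (0# , 0#)) M × M ℕ.+ 1 ≡ order ℕ.* order) → order ℕ.+ 1 ≡ N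
        count (M , punctured , e) = cancel m order order≡m+1 m≢0 (trans (cong (ℕ._+ 1) (sym (card-unique
            (card-bij {Q = λ (b , (x , y)) → b ≢ 0# × nrm ε x y ≡ b} (λ (x , y) → nrm ε x y , (x , y)) punctured
              (λ (_ , h) → (λ z → h (let zx , zy = nrm-≡0 z in cong₂ _,_ zx zy)) , refl) (λ _ _ → cong proj₂)
              (λ { {_ , (x , y)} (h , refl) → (x , y) , (tt , λ { refl → h (solve (ε ∷ []) λ ε → E.nrm ε :0 :0 :≡ :0) }) , refl }))
            (card-Σ {Q = λ b (x , y) → nrm ε x y ≡ b} units (λ b≢0 → norm-fibre-transport a≢0 b≢0 fibre)) id id))) e)

    norm-card : ∀ {a} → a ≢ 0# → Card {Carrier × Carrier} (λ (x , y) → nrm ε x y ≡ a) (order ℕ.+ 1)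
    norm-card {a} a≢0 = let _ , c = card-filter plane (λ (x , y) → nrm ε x y ≟ᶠ a) in
      subst (Card _) (sym (norm-fibre-size a≢0 (card-⇔ proj₂ (tt ,_) c))) (card-⇔ proj₂ (tt ,_) c)

    private
      quad-vanishes : ∀ t e p → re₄ ε (- t) e (quad ε t e ⊙ p) ≡ 0# × im₄ ε (- t) e (quad ε t e ⊙ p) ≡ 0#
      quad-vanishes t e ⟨ u , v , w ⟩₃ =
        solve (ε ∷ t ∷ e ∷ u ∷ v ∷ w ∷ []) (λ ε t e u v w → E.re₄ ε (:- t) e (E.quad ε t e E.⊙ ⟨ u , v , w ⟩₃) :≡ :0) ,
        solve (ε ∷ t ∷ e ∷ u ∷ v ∷ w ∷ []) (λ ε t e u v w → E.im₄ ε (:- t) e (E.quad ε t e E.⊙ ⟨ u , v , w ⟩₃) :≡ :0)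

      re₄-⊙ : ∀ k x y p p′ → re₄ ε x y (sc k (p ⊙ p′)) ≡ k * (re₂ ε x y p * re₂ ε x y p′ + ε * (im₂ ε x y p * im₂ ε x y p′))
      re₄-⊙ k x y ⟨ u , v , w ⟩₃ ⟨ u′ , v′ , w′ ⟩₃ = solve (ε ∷ k ∷ x ∷ y ∷ u ∷ v ∷ w ∷ u′ ∷ v′ ∷ w′ ∷ []) λ ε k x y u v w u′ v′ w′ →
        let p = ⟨ u , v , w ⟩₃ ; p′ = ⟨ u′ , v′ , w′ ⟩₃ in
        E.re₄ ε x y (E.sc k (p E.⊙ p′)) :≡ k :* (E.re₂ ε x y p :* E.re₂ ε x y p′ :+ ε :* (E.im₂ ε x y p :* E.im₂ ε x y p′))

      im₄-⊙ : ∀ k x y p p′ → im₄ ε x y (sc k (p ⊙ p′)) ≡ k * (re₂ ε x y p * im₂ ε x y p′ + im₂ ε x y p * re₂ ε x y p′)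
      im₄-⊙ k x y ⟨ u , v , w ⟩₃ ⟨ u′ , v′ , w′ ⟩₃ = solve (ε ∷ k ∷ x ∷ y ∷ u ∷ v ∷ w ∷ u′ ∷ v′ ∷ w′ ∷ []) λ ε k x y u v w u′ v′ w′ →
        let p = ⟨ u , v , w ⟩₃ ; p′ = ⟨ u′ , v′ , w′ ⟩₃ in
        E.im₄ ε x y (E.sc k (p E.⊙ p′)) :≡ k :* (E.re₂ ε x y p :* E.im₂ ε x y p′ :+ E.im₂ ε x y p :* E.re₂ ε x y p′)

      zero-product : ∀ {a b a′ b′} → a * a′ + ε * (b * b′) ≡ 0# → a * b′ + b * a′ ≡ 0# → (a ≡ 0# × b ≡ 0#) ⊎ (a′ ≡ 0# × b′ ≡ 0#)
      zero-product {a} {b} {a′} {b′} e e′ = Sum.map nrm-≡0 nrm-≡0 (*-zero-split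
        (lin₂ (a * a′ + ε * (b * b′)) (- (ε * (a * b′ + b * a′))) e e′ (solve (ε ∷ a ∷ b ∷ a′ ∷ b′ ∷ []) λ ε a b a′ b′ →
          E.nrm ε a b :* E.nrm ε a′ b′ :- :0 :≡ (a :* a′ :+ ε :* (b :* b′)) :* (a :* a′ :+ ε :* (b :* b′) :- :0) :+
            :- (ε :* (a :* b′ :+ b :* a′)) :* (a :* b′ :+ b :* a′ :- :0))))

      quad-root : ∀ {t e t′ e′} → e ≢ 0# → re₂ ε (- t) e (quad ε t′ e′) ≡ 0# × im₂ ε (- t) e (quad ε t′ e′) ≡ 0# → t ≡ t′ × e * e ≡ e′ * e′
      quad-root {t} {e} {t′} {e′} e≢0 (r , i) = t≡t′ , *-cancelˡ ε≢0 (lin₂ 1# (- (t - t′)) r t≡t′ (solve (ε ∷ t ∷ e ∷ t′ ∷ e′ ∷ []) λ ε t e t′ e′ →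
          ε :* (e :* e) :- ε :* (e′ :* e′) :≡ :1 :* (E.re₂ ε (:- t) e (E.quad ε t′ e′) :- :0) :+ :- (t :- t′) :* (t :- t′)))
        where
        t≡t′ : t ≡ t′
        t≡t′ = *-cancelˡ e≢0 (lin₁ 1# i (solve (ε ∷ t ∷ e ∷ t′ ∷ e′ ∷ []) λ ε t e t′ e′ →
          e :* t :- e :* t′ :≡ :1 :* (E.im₂ ε (:- t) e (E.quad ε t′ e′) :- :0)))

    -- Evaluation at the zero -t + √ε e of the factor on the left makes a product of two values in
    -- F_q(√ε) vanish. One of them is zero because norms are anisotropic, and equal zeros up to
    -- conjugation mean equal monic quadratics.
    unique-factorisation : ∀ {k t e t₁ e₁ t₂ e₂ p} → k ≢ 0# → e ≢ 0# → quad ε t e ⊙ p ≡ sc k (quad ε t₁ e₁ ⊙ quad ε t₂ e₂) →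
                           (t ≡ t₁ × e * e ≡ e₁ * e₁) ⊎ (t ≡ t₂ × e * e ≡ e₂ * e₂)
    unique-factorisation {k} {t} {e} {t₁} {e₁} {t₂} {e₂} {p} k≢0 e≢0 h = Sum.map (quad-root e≢0) (quad-root e≢0)
      (zero-product {re₂ ε (- t) e (quad ε t₁ e₁)} {im₂ ε (- t) e (quad ε t₁ e₁)} {re₂ ε (- t) e (quad ε t₂ e₂)} {im₂ ε (- t) e (quad ε t₂ e₂)}
        (*-cancelˡ k≢0 (trans (sym (re₄-⊙ k (- t) e _ _)) (trans (cong (re₄ ε (- t) e) (sym h)) (trans (proj₁ (quad-vanishes t e p)) (sym (zeroʳ k))))))
        (*-cancelˡ k≢0 (trans (sym (im₄-⊙ k (- t) e _ _)) (trans (cong (im₄ ε (- t) e) (sym h)) (trans (proj₂ (quad-vanishes t e p)) (sym (zeroʳ k)))))))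

  ProdQuads : Carrier → Quartic → Set
  ProdQuads μ f = ∃[ k ] ∃[ t₁ ] ∃[ e₁ ] ∃[ t₂ ] ∃[ e₂ ] (k ≢ 0# × e₁ ≢ 0# × e₂ ≢ 0# ×
    Coupled μ (quad ε t₁ e₁) (quad ε t₂ e₂) × f ≡ sc k (quad ε t₁ e₁ ⊙ quad ε t₂ e₂))

  opaque
    prod-quads : ∀ {μ f} → Prod μ f → ProdQuads μ f
    prod-quads {μ} (prod {p₁} {p₂} c refl) = go (monic-quad (Coupled.irreducible₁ c)) (monic-quad (Coupled.irreducible₂ c))
      where
      go : MonicForm p₁ → MonicForm p₂ → ProdQuads μ (p₁ ⊙ p₂)
      go (k , t , e , k≢0 , e≢0 , refl) (k′ , t′ , e′ , k′≢0 , e′≢0 , refl) =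
        k * k′ , t , e , t′ , e′ , *-≢0 k≢0 k′≢0 , e≢0 , e′≢0 , coupled-unsc k≢0 k′≢0 c , sym (sc-⊙ k k′ _ _)

    quad-≡ : ∀ {t e t′ e′} → t ≡ t′ × e * e ≡ e′ * e′ → quad ε t e ≡ quad ε t′ e′
    quad-≡ (refl , e) = cong (λ u → ⟨ 1# , - _ , _ * _ - ε * u ⟩₃) e

    coupled-scʳ : ∀ {μ p p′ k} → k ≢ 0# → Coupled μ p p′ → Coupled μ p (sc₂ k p′)
    coupled-scʳ {μ} {p} {p′} {k} h c = subst (λ p → Coupled μ p (sc₂ k p′)) (sc₂-1 p) (coupled-sc 1≢0 h c)

    quad-sc : ∀ k p p′ → p ⊙ sc₂ k p′ ≡ sc k (p ⊙ p′)
    quad-sc k ⟨ u , v , w ⟩₃ ⟨ u′ , v′ , w′ ⟩₃ = solveᵥ (k ∷ u ∷ v ∷ w ∷ u′ ∷ v′ ∷ w′ ∷ []) λ k u v w u′ v′ w′ →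
      ⟨ u , v , w ⟩₃ E.⊙ E.sc₂ k ⟨ u′ , v′ , w′ ⟩₃ :≡ E.sc k (⟨ u , v , w ⟩₃ E.⊙ ⟨ u′ , v′ , w′ ⟩₃)

    coupled-ratio-unique : ∀ {μ μ′ p p′} → Coupled μ p p′ → Coupled μ′ p p′ → μ ≡ μ′
    coupled-ratio-unique {μ} {μ′} c c′ = *-cancelˡ (coupled-disc≢0 c) (trans (*-comm _ μ) (trans (sym (Coupled.ratio c)) (trans (Coupled.ratio c′) (*-comm μ′ _))))

    coupled-self : ∀ {μ p} → Coupled μ p p → μ ≡ 1#
    coupled-self {μ} {p@(⟨ u , v , w ⟩₃)} c = *-cancelˡ (coupled-disc≢0 c) (lin₁ (- 1#) (Coupled.ratio c)
      (solve (μ ∷ u ∷ v ∷ w ∷ []) λ μ u v w → let p = ⟨ u , v , w ⟩₃ ; D = E.disc₂ p in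
        D :* D :* μ :- D :* D :* :1 :≡ :- :1 :* (E.polar p p E.^ 2 :- μ :* (D :* D))))

    -- The monic factors of the two products agree in some order, and μ is symmetric in them. If
    -- both factors of one product matched the same factor of the other, they would be equal, which
    -- gives μ′ = 1 and Δ = 0.
    prod-unique : ∀ {μ μ′ f} → NonDeg f → Prod μ f → Prod μ′ f → μ ≡ μ′
    prod-unique {μ} {μ′} {f} nd P P′ = go (prod-quads P) (prod-quads P′)
      where
      go : ProdQuads μ f → ProdQuads μ′ f → μ ≡ μ′
      go (k , t₁ , e₁ , t₂ , e₂ , k≢0 , e₁≢0 , e₂≢0 , c , h) (k′ , t₁′ , e₁′ , t₂′ , e₂′ , k′≢0 , e₁′≢0 , e₂′≢0 , c′ , h′) =
        match (unique-factorisation {p = sc₂ k′ (quad ε t₂′ e₂′)} k≢0 e₁′≢0 (trans (quad-sc k′ _ _) (trans (sym h′) h)))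
              (unique-factorisation {p = sc₂ k′ (quad ε t₁′ e₁′)} k≢0 e₂′≢0 (trans (quad-sc k′ _ _) (trans (cong (sc k′) (⊙-comm _ _)) (trans (sym h′) h))))
        where
        degenerate : quad ε t₁′ e₁′ ≡ quad ε t₂′ e₂′ → μ ≡ μ′
        degenerate e = ⊥-elim (nondeg-μ≢1 nd P′ (coupled-self (subst (λ p → Coupled μ′ p (quad ε t₂′ e₂′)) e c′)))
        match : (t₁′ ≡ t₁ × e₁′ * e₁′ ≡ e₁ * e₁) ⊎ (t₁′ ≡ t₂ × e₁′ * e₁′ ≡ e₂ * e₂) →
                (t₂′ ≡ t₁ × e₂′ * e₂′ ≡ e₁ * e₁) ⊎ (t₂′ ≡ t₂ × e₂′ * e₂′ ≡ e₂ * e₂) → μ ≡ μ′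
        match (inj₁ a) (inj₁ b) = degenerate (trans (quad-≡ a) (sym (quad-≡ b)))
        match (inj₂ a) (inj₂ b) = degenerate (trans (quad-≡ a) (sym (quad-≡ b)))
        match (inj₁ a) (inj₂ b) = coupled-ratio-unique c (subst₂ (Coupled μ′) (quad-≡ a) (quad-≡ b) c′)
        match (inj₂ a) (inj₁ b) = coupled-ratio-unique c (coupled-sym (subst₂ (Coupled μ′) (quad-≡ a) (quad-≡ b) c′))

    nonzero-square-inverse : ∀ {μ} → NonzeroSquare μ → NonzeroSquare (μ ⁻¹)
    nonzero-square-inverse {μ} (h , sq) = ⁻¹-≢0 h , subst IsSquare (lin₁ (μ ⁻¹) (inverseʳ h) (solve (μ ∷ μ ⁻¹ ∷ []) λ μ ν →
      μ :* (ν :* ν) :- ν :≡ ν :* (μ :* ν :- :1))) (square-* sq (μ ⁻¹ , refl))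

    nonsquare-of-nonzero : ∀ {u} → NonzeroSquare u → ¬ IsSquare (ε * u)
    nonsquare-of-nonzero {u} (h , sq) = square-*-nonsquare sq h ε-nonsquare ∘ subst IsSquare (*-comm ε u)

  ConicPoint : Carrier → Carrier × (Carrier × Carrier) → Set
  ConicPoint μ (c , (x , y)) = Coupled μ base (conic ε x y c)

  opaque
    -- The condition reads N(z) = c²(1 - 1/μ) with c ≠ 0, a nonzero value because μ ≠ 1: there are q
    -- - 1 choices of c and q + 1 of z. The discriminant is then εc²/μ, automatically a nonsquare.
    conic-card : ∀ {μ} → NonzeroSquare μ → μ ≢ 1# → Card (ConicPoint μ) (m ℕ.* (order ℕ.+ 1))
    conic-card {μ} sq@(μ≢0 , _) μ≢1 = card-⇔ to from (card-Σ {Q = λ c (x , y) → nrm ε x y ≡ c * c * (1# - μ ⁻¹)} units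
        (λ c≢0 → norm-card (*-≢0 (*-≢0 c≢0 c≢0) factor≢0)))
      where
      factor≢0 : 1# - μ ⁻¹ ≢ 0#
      factor≢0 z = μ≢1 (lin₂ μ 1# z (inverseʳ μ≢0) (solve (μ ∷ μ ⁻¹ ∷ []) λ μ ν → μ :- :1 :≡ μ :* (:1 :- ν :- :0) :+ :1 :* (μ :* ν :- :1)))
      to : ∀ {p} → proj₁ p ≢ 0# × nrm ε (proj₁ (proj₂ p)) (proj₂ (proj₂ p)) ≡ proj₁ p * proj₁ p * (1# - μ ⁻¹) → ConicPoint μ p
      to {c , (x , y)} (c≢0 , e) = conic-coupled
        (lin₂ μ (- (c * c)) e (inverseʳ μ≢0) (solve (μ ∷ μ ⁻¹ ∷ c ∷ nrm ε x y ∷ []) λ μ ν c N →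
          c :* c :- μ :* (c :* c :- N) :≡ μ :* (N :- c :* c :* (:1 :- ν)) :+ :- (c :* c) :* (μ :* ν :- :1)))
        (nonsquare-of-nonzero (subst NonzeroSquare (lin₁ 1# e (solve (μ ⁻¹ ∷ c ∷ nrm ε x y ∷ []) λ ν c N →
            c :* c :* ν :- (c :* c :- N) :≡ :1 :* (N :- c :* c :* (:1 :- ν))))
          (let h , s = nonzero-square-inverse sq in *-≢0 (*-≢0 c≢0 c≢0) h , square-* (c , refl) s)))
      from : ∀ {p} → ConicPoint μ p → proj₁ p ≢ 0# × nrm ε (proj₁ (proj₂ p)) (proj₂ (proj₂ p)) ≡ proj₁ p * proj₁ p * (1# - μ ⁻¹)
      from {c , (x , y)} C = let r , i = coupled-conic C in
        (λ { refl → *-≢0 μ≢0 (proj₁ (nonzero-of-nonsquare i)) (trans (sym r) (zeroˡ 0#)) }) ,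
        lin₂ (μ ⁻¹) (- (nrm ε x y - c * c)) r (inverseʳ μ≢0) (solve (μ ∷ μ ⁻¹ ∷ c ∷ nrm ε x y ∷ []) λ μ ν c N →
          N :- c :* c :* (:1 :- ν) :≡ ν :* (c :* c :- μ :* (c :* c :- N)) :+ :- (N :- c :* c) :* (μ :* ν :- :1))

    -- For μ = 0 one has c = 0, and -N(z) must be a nonzero square, one of (q - 1)/2 values. This
    -- halves the generic count and produces the size |G|/8 in place of |G|/4.
    conic-card-0 : Card (ConicPoint 0#) (half ℕ.* (order ℕ.+ 1))
    conic-card-0 = card-bij (λ (a , p) → 0# , p) (card-Σ {Q = λ a (x , y) → nrm ε x y ≡ - a} squares (λ (h , _) → norm-card (-‿≢0 h)))
      (λ { {a , (x , y)} (h , e) → conic-coupled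
          (solve (nrm ε x y ∷ []) λ N → :0 :* :0 :≡ :0 :* (:0 :* :0 :- N))
          (nonsquare-of-nonzero (subst NonzeroSquare (lin₁ 1# e (solve (a ∷ nrm ε x y ∷ []) λ a N →
             a :- (:0 :* :0 :- N) :≡ :1 :* (N :- :- a))) h)) })
      (λ { {a , (x , y)} {a′ , _} (_ , e) (_ , e′) refl → cong (_, _) (lin₂ 1# (- 1#) e e′ (solve (a ∷ a′ ∷ nrm ε x y ∷ []) λ a a′ N →
          a :- a′ :≡ :1 :* (N :- :- a) :+ :- :1 :* (N :- :- a′))) })
      (λ { {c , (x , y)} C → onto c x y (coupled-conic C) })
      where
      onto : ∀ c x y → c * c ≡ 0# * (c * c - nrm ε x y) × ¬ IsSquare (ε * (c * c - nrm ε x y)) →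
             Σ[ p ∈ Carrier × (Carrier × Carrier) ] ((NonzeroSquare (proj₁ p) × nrm ε (proj₁ (proj₂ p)) (proj₂ (proj₂ p)) ≡ - proj₁ p) × (0# , proj₂ p) ≡ (c , (x , y)))
      onto c x y (r , i) = (c * c - nrm ε x y , (x , y)) ,
        (nonzero-of-nonsquare i , lin₁ 1# r (solve (c ∷ nrm ε x y ∷ []) λ c N → N :- :- (c :* c :- N) :≡ :1 :* (c :* c :- :0 :* (c :* c :- N)))) ,
        cong (_, (x , y)) (sym (^-≡0 2 (trans (cong (c *_) (*-identityʳ c)) (trans r (zeroˡ _)))))

    prod-exists : ∀ {μ} → IsSquare μ → μ ≢ 1# → ∃[ f ] Prod μ f
    prod-exists {μ} sq μ≢1 = choose (μ ≟ᶠ 0#)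
      where
      exists : ∀ {K} → Card (ConicPoint μ) K → K ≢ 0 → ∃[ f ] Prod μ f
      exists {zero} _ h = ⊥-elim (h refl)
      exists {suc K} c _ = let (_ , (_ , _)) , C = card-member c in _ , prod C refl
      half≢0 : half ≢ 0
      half≢0 z = m≢0 (trans m≡half+half (cong₂ ℕ._+_ z z))
      nonzero : ∀ {a} b → a ≢ 0 → a ℕ.* (b ℕ.+ 1) ≢ 0
      nonzero {a} b h e = case ℕ.m*n≡0⇒m≡0∨n≡0 a e of λ
        { (inj₁ z) → h z ; (inj₂ z) → case trans (ℕ.+-comm 1 b) z of λ () }
      choose : Dec (μ ≡ 0#) → ∃[ f ] Prod μ f
      choose (yes z)  = exists (subst (λ μ → Card (ConicPoint μ) _) (sym z) conic-card-0) (nonzero order half≢0)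
      choose (no μ≢0) = exists (conic-card (μ≢0 , sq) μ≢1) (nonzero order m≢0)

    -- Each product has four flags (t, e): the two factors X² + … with both signs of e.
    prod-card : ∀ {μ K} → μ ≢ 1# → Card (ConicPoint μ) K → ∃[ N ] (Card (Prod μ) N × N ℕ.* 4 ≡ order ℕ.* m ℕ.* K)
    prod-card {μ} {K} μ≢1 conics = card-fibres _≟⁵_ {R = Flag}
        (card-⇔ (λ { {(t , e) , f} ((_ , h) , g) → h , g }) (λ { {(t , e) , f} (h , g) → (tt , h) , g })
          (card-Σ {Q = λ (t , e) f → Divides t e f} (card-Σ {Q = λ _ e → e ≢ 0#} all (λ _ → units)) (λ { {t , e} (_ , e≢0) → flags-over t e≢0 })))
        (λ { {t , e} (_ , p , c , refl) → prod c refl })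
        (λ P → let k , t₁ , e₁ , t₂ , e₂ , k≢0 , e₁≢0 , _ , c , h = prod-quads P in
          (t₁ , e₁) , e₁≢0 , sc₂ k (quad ε t₂ e₂) , coupled-scʳ k≢0 c , trans h (sym (quad-sc k _ _)))
        (λ P → flags-of (prod-quads P))
      where
      Divides : Carrier → Carrier → Quartic → Set
      Divides t e f = ∃[ p ] (Coupled μ (quad ε t e) p × f ≡ quad ε t e ⊙ p)
      Flag : Carrier × Carrier → Quartic → Set
      Flag (t , e) f = e ≢ 0# × Divides t e f
      -- A dilation by e and a translation by t carry `base` to `quad ε t e`, so the possible second
      -- factors are counted by the conics for `base`.
      flags-over : ∀ t {e} → e ≢ 0# → Card (Divides t e) K
      flags-over t {e} e≢0 = card-bij (λ (c , (x , y)) → quad ε t e ⊙ place (conic ε x y c)) conics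
          (λ { {c , (x , y)} C → place (conic ε x y c) , subst (λ p → Coupled μ p (place (conic ε x y c))) (placed t e) (coupled-tr t (coupled-dg e≢0 C)) , refl })
          (λ { {c , (x , y)} {c′ , (x′ , y′)} _ _ h → conic-injective (dg-injective _ _ (tr-injective _ _ (⊙-cancel _ _ h))) })
          (λ { (p , C , refl) → onto p C (dg₂-surjective e≢0 (tr₂ (- t) p)) })
        where
        place : Quadratic → Quadratic
        place p = tr₂ t (dg₂ e p)
        placed : ∀ t e → tr₂ t (dg₂ e base) ≡ quad ε t e
        placed t e = solveᵥ (ε ∷ t ∷ e ∷ []) λ ε t e → E.tr₂ t (E.dg₂ e ⟨ :1 , :0 , :- ε ⟩₃) :≡ E.quad ε t e
        tr₂-inverse′ : ∀ p → tr₂ t (tr₂ (- t) p) ≡ p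
        tr₂-inverse′ ⟨ u , v , w ⟩₃ = solveᵥ (t ∷ u ∷ v ∷ w ∷ []) λ t u v w → E.tr₂ t (E.tr₂ (:- t) ⟨ u , v , w ⟩₃) :≡ ⟨ u , v , w ⟩₃
        tr-injective : ∀ p p′ → tr₂ t p ≡ tr₂ t p′ → p ≡ p′
        tr-injective p p′ h = trans (sym (tr₂-inverse t p)) (trans (cong (tr₂ (- t)) h) (tr₂-inverse t p′))
        dg-injective : ∀ p p′ → dg₂ e p ≡ dg₂ e p′ → p ≡ p′
        dg-injective ⟨ u , v , w ⟩₃ ⟨ u′ , v′ , w′ ⟩₃ h = cong₃ (cong Vec.head h)
          (*-cancelˡ e≢0 (cong (Vec.head ∘ Vec.tail) h)) (*-cancelˡ (^-≢0 2 e≢0) (cong (Vec.head ∘ Vec.tail ∘ Vec.tail) h))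
          where
          cong₃ : ∀ {u v w u′ v′ w′ : Carrier} → u ≡ u′ → v ≡ v′ → w ≡ w′ → _≡_ {A = Quadratic} ⟨ u , v , w ⟩₃ ⟨ u′ , v′ , w′ ⟩₃
          cong₃ refl refl refl = refl
        ⊙-cancel : ∀ p p′ → quad ε t e ⊙ p ≡ quad ε t e ⊙ p′ → p ≡ p′
        ⊙-cancel ⟨ u , v , w ⟩₃ ⟨ u′ , v′ , w′ ⟩₃ h = go
            (trans (sym (*-identityˡ u)) (trans (cong Vec.head h) (*-identityˡ u′)))
            (cong (Vec.head ∘ Vec.tail) h) (cong (Vec.head ∘ Vec.tail ∘ Vec.tail) h)
          where
          go : u ≡ u′ → 1# * v + - t * u ≡ 1# * v′ + - t * u′ →
               1# * w + - t * v + (t * t - ε * (e * e)) * u ≡ 1# * w′ + - t * v′ + (t * t - ε * (e * e)) * u′ → _≡_ {A = Quadratic} ⟨ u , v , w ⟩₃ ⟨ u′ , v′ , w′ ⟩₃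
          go refl h₁ = go′ (lin₁ 1# h₁ (solve (v ∷ v′ ∷ t ∷ u ∷ []) λ v v′ t u → v :- v′ :≡ :1 :* ((:1 :* v :+ :- t :* u) :- (:1 :* v′ :+ :- t :* u))))
            where
            go′ : v ≡ v′ → 1# * w + - t * v + (t * t - ε * (e * e)) * u ≡ 1# * w′ + - t * v′ + (t * t - ε * (e * e)) * u → _≡_ {A = Quadratic} ⟨ u , v , w ⟩₃ ⟨ u , v′ , w′ ⟩₃
            go′ refl h₂ = cong (λ w → ⟨ u , v , w ⟩₃) (lin₁ 1# h₂ (solve (w ∷ w′ ∷ t * v ∷ (t * t - ε * (e * e)) * u ∷ t ∷ v ∷ []) λ w w′ _ b t v →
              w :- w′ :≡ :1 :* ((:1 :* w :+ :- t :* v :+ b) :- (:1 :* w′ :+ :- t :* v :+ b))))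
        conic-injective : ∀ {x y c x′ y′ c′} → conic ε x y c ≡ conic ε x′ y′ c′ → (c , (x , y)) ≡ (c′ , (x′ , y′))
        conic-injective {x} {y} {c} {x′} {y′} {c′} h = cong₂ _,_
            (lin₂ (- 1#) (- 1#) h₁ h₃ (solve (x ∷ c ∷ x′ ∷ c′ ∷ []) λ x c x′ c′ → c :- c′ :≡ :- :1 :* ((c :- x) :- (c′ :- x′)) :+ :- :1 :* ((x :+ c) :- (x′ :+ c′))))
            (cong₂ _,_ (lin₂ 1# (- 1#) h₁ h₃ (solve (x ∷ c ∷ x′ ∷ c′ ∷ []) λ x c x′ c′ → x :- x′ :≡ :1 :* ((c :- x) :- (c′ :- x′)) :+ :- :1 :* ((x :+ c) :- (x′ :+ c′))))
              (*-cancelˡ ε≢0 (cong (Vec.head ∘ Vec.tail) h)))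
          where
          h₁ : c - x ≡ c′ - x′
          h₁ = cong Vec.head h
          h₃ : x + c ≡ x′ + c′
          h₃ = *-cancelˡ ε≢0 (trans (sym (-‿involutive _)) (trans (cong (-_ ∘ Vec.head ∘ Vec.tail ∘ Vec.tail) h) (-‿involutive _)))
        onto : ∀ p → Coupled μ (quad ε t e) p → ∃[ p′ ] dg₂ e p′ ≡ tr₂ (- t) p →
               Σ[ u ∈ Carrier × (Carrier × Carrier) ] (ConicPoint μ u × quad ε t e ⊙ place (conic ε (proj₁ (proj₂ u)) (proj₂ (proj₂ u)) (proj₁ u)) ≡ quad ε t e ⊙ p)
        onto p C (p′ , h) = onto′ (conic-surjective p′)
          where
          onto′ : ∃[ x ] ∃[ y ] ∃[ c ] conic ε x y c ≡ p′ →
               Σ[ u ∈ Carrier × (Carrier × Carrier) ] (ConicPoint μ u × quad ε t e ⊙ place (conic ε (proj₁ (proj₂ u)) (proj₂ (proj₂ u)) (proj₁ u)) ≡ quad ε t e ⊙ p)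
          onto′ (x , y , c , refl) = (c , (x , y)) ,
            coupled-undg e≢0 (subst₂ (Coupled μ) (quad-base t e) (sym h) (coupled-tr (- t) C)) ,
            cong (quad ε t e ⊙_) (trans (cong (tr₂ t) h) (tr₂-inverse′ p))
      flags-of : ∀ {f} → ProdQuads μ f → Card (λ u → Flag u f) 4
      flags-of (k , t₁ , e₁ , t₂ , e₂ , k≢0 , e₁≢0 , e₂≢0 , c , refl) = card
          ((t₁ , e₁) ∷ (t₁ , - e₁) ∷ (t₂ , e₂) ∷ (t₂ , - e₂) ∷ [])
          (((λ h → x≢-x e₁≢0 (cong proj₂ h)) ∷ distinct refl refl ∷ distinct refl (neg² e₂) ∷ []) ∷
           (distinct (neg² e₁) refl ∷ distinct (neg² e₁) (neg² e₂) ∷ []) ∷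
           ((λ h → x≢-x e₂≢0 (cong proj₂ h)) ∷ []) ∷ [] ∷ [])
          (λ { (here refl) → flag₁ e₁≢0 refl
             ; (there (here refl)) → flag₁ (-‿≢0 e₁≢0) (neg² e₁)
             ; (there (there (here refl))) → flag₂ e₂≢0 refl
             ; (there (there (there (here refl)))) → flag₂ (-‿≢0 e₂≢0) (neg² e₂) })
          (λ { {t , e} (e≢0 , p , _ , h) → locate (unique-factorisation {p = p} k≢0 e≢0 (sym h)) }) refl
        where
        f : Quartic
        f = sc k (quad ε t₁ e₁ ⊙ quad ε t₂ e₂)
        neg² : ∀ e → (- e) * (- e) ≡ e * e
        neg² e = solve (e ∷ []) λ e → :- e :* :- e :≡ e :* e
        distinct : ∀ {e e′} → e * e ≡ e₁ * e₁ → e′ * e′ ≡ e₂ * e₂ → (t₁ , e) ≢ (t₂ , e′)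
        distinct {e} h h′ refl = μ≢1 (coupled-self (subst (Coupled μ (quad ε t₁ e₁)) (quad-≡ {t₁} {e₂} {t₁} {e₁} (refl , trans (sym h′) h)) c))
        scaled : Coupled μ (quad ε t₁ e₁) (sc₂ k (quad ε t₂ e₂))
        scaled = coupled-scʳ k≢0 c
        scaled′ : Coupled μ (quad ε t₂ e₂) (sc₂ k (quad ε t₁ e₁))
        scaled′ = coupled-scʳ k≢0 (coupled-sym c)
        flag₁ : ∀ {e} → e ≢ 0# → e * e ≡ e₁ * e₁ → Flag (t₁ , e) f
        flag₁ e≢0 h = e≢0 , subst (λ p → ∃[ p′ ] (Coupled μ p p′ × f ≡ p ⊙ p′)) (sym (quad-≡ (refl , h)))
          (sc₂ k (quad ε t₂ e₂) , scaled , sym (quad-sc k _ _))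
        flag₂ : ∀ {e} → e ≢ 0# → e * e ≡ e₂ * e₂ → Flag (t₂ , e) f
        flag₂ e≢0 h = e≢0 , subst (λ p → ∃[ p′ ] (Coupled μ p p′ × f ≡ p ⊙ p′)) (sym (quad-≡ (refl , h)))
          (sc₂ k (quad ε t₁ e₁) , scaled′ , trans (cong (sc k) (⊙-comm _ _)) (sym (quad-sc k _ _)))
        locate : ∀ {t e} → (t ≡ t₁ × e * e ≡ e₁ * e₁) ⊎ (t ≡ t₂ × e * e ≡ e₂ * e₂) → (t , e) ∈ ((t₁ , e₁) ∷ (t₁ , - e₁) ∷ (t₂ , e₂) ∷ (t₂ , - e₂) ∷ [])
        locate (inj₁ (refl , h)) = case roots-of-square h of λ { (inj₁ refl) → here refl ; (inj₂ refl) → there (here refl) }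
        locate (inj₂ (refl , h)) = case roots-of-square h of λ { (inj₁ refl) → there (there (here refl)) ; (inj₂ refl) → there (there (there (here refl))) }

-- Roots of forms and the number of forms with given ȷ

module FormCounts (F : Field) (n : ℕ) (hs : HasSize F (3 ℕ.^ n)) where
  open ProductCounts F n hs public

  -- the size of PGL₂(q)
  G : ℕ
  G = order ℕ.* (m ℕ.* (order ℕ.+ 1))

  Root : Quartic → Maybe Carrier → Set
  Root f nothing  = lead f ≡ 0#
  Root f (just t) = ev f t ≡ 0#

  opaque
    points : Card {Maybe Carrier} (λ _ → ⊤) (order ℕ.+ 1)
    points = card-⇔ _ (λ { {just t} _ → inj₁ (t , refl) ; {nothing} _ → inj₂ refl })
      (card-⊎ (card-bij {Q = λ p → ∃[ t ] p ≡ just t} just all (λ {t} _ → t , refl) (λ { _ _ refl → refl }) (λ { (t , refl) → t , tt , refl }))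
              (card-single nothing) λ { (t , refl) () })

    roots-stable : ∀ {i} → Stable (λ f → Card (Root f) i)
    roots-stable {i} = invariant {λ f → Card (Root f) i} record
      { tr-inv = λ { s {f@(⟨ _ , _ , _ , _ , _ ⟩)} c → card-inverse (Maybe.map (_- s)) (Maybe.map (_+ s)) c
          (λ { {nothing} z → z ; {just t} z → trans (ev-tr s f t) z })
          (λ { {nothing} z → z ; {just t} z → trans (sym (ev-tr s f (t + s))) (trans (cong (ev (tr s f)) (plus-minus t s)) z) })
          (λ { {nothing} _ → refl ; {just t} _ → cong just (minus-plus t s) })
          (λ { {nothing} _ → refl ; {just t} _ → cong just (plus-minus t s) }) }
      ; dg-inv = λ { {u} h {f@(⟨ _ , _ , _ , _ , _ ⟩)} c → card-inverse (Maybe.map (u *_)) (Maybe.map (u ⁻¹ *_)) c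
          (λ { {nothing} z → z ; {just t} z → trans (ev-dg u f t) (times-zero (u ^ 4) z) })
          (λ { {nothing} z → z ; {just t} z → *-cancelˡ (^-≢0 4 h) (trans (sym (ev-dg u f (u ⁻¹ * t)))
                 (trans (cong (ev (dg u f)) (cancel-inverse h t)) (trans z (sym (zeroʳ _))))) })
          (λ { {nothing} _ → refl ; {just t} _ → cong just (inverse-cancel h t) })
          (λ { {nothing} _ → refl ; {just t} _ → cong just (cancel-inverse h t) }) }
      ; sw-inv = λ { {f@(⟨ _ , _ , _ , _ , _ ⟩)} c → card-inverse invert invert c (λ {p} → invert-root f p) (λ {p} → invert-root (sw f) p) (λ {p} _ → invert² p) (λ {p} _ → invert² p) }
      ; sc-inv = λ { {k} h {f@(⟨ _ , _ , _ , _ , _ ⟩)} c → card-⇔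
          (λ { {nothing} z → times-zero k z ; {just t} z → trans (ev-sc k f t) (times-zero k z) })
          (λ { {nothing} z → *-cancelˡ h (trans z (sym (zeroʳ k))) ; {just t} z → *-cancelˡ h (trans (sym (ev-sc k f t)) (trans z (sym (zeroʳ k)))) }) c } }
      where
      plus-minus : ∀ t s → t + s - s ≡ t
      plus-minus t s = solve (t ∷ s ∷ []) λ t s → t :+ s :- s :≡ t
      minus-plus : ∀ t s → t - s + s ≡ t
      minus-plus t s = solve (t ∷ s ∷ []) λ t s → t :- s :+ s :≡ t
      cancel-inverse : ∀ {u} → u ≢ 0# → ∀ t → u * (u ⁻¹ * t) ≡ t
      cancel-inverse h t = trans (sym (*-assoc _ _ t)) (trans (cong (_* t) (inverseʳ h)) (*-identityˡ t))
      inverse-cancel : ∀ {u} → u ≢ 0# → ∀ t → u ⁻¹ * (u * t) ≡ t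
      inverse-cancel h t = trans (sym (*-assoc _ _ t)) (trans (cong (_* t) (inverseˡ h)) (*-identityˡ t))
      invert′ : ∀ t → Dec (t ≡ 0#) → Maybe Carrier
      invert′ t (yes _) = nothing
      invert′ t (no _)  = just (t ⁻¹)
      invert : Maybe Carrier → Maybe Carrier
      invert nothing  = just 0#
      invert (just t) = invert′ t (t ≟ᶠ 0#)
      invert-zero : invert (just 0#) ≡ nothing
      invert-zero with 0# ≟ᶠ 0#
      ... | yes _ = refl
      ... | no h = ⊥-elim (h refl)
      invert² : ∀ p → invert (invert p) ≡ p
      invert² nothing = invert-zero
      invert² (just t) with t ≟ᶠ 0#
      ... | yes refl = refl
      ... | no h with t ⁻¹ ≟ᶠ 0#
      ...   | yes z = ⊥-elim (⁻¹-≢0 h z)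
      ...   | no h′ = cong just (*-cancelˡ h′ (trans (inverseʳ h′) (sym (inverseˡ h))))
      invert-root : ∀ f p → Root f p → Root (sw f) (invert p)
      invert-root ⟨ _ , b , c , d , e ⟩ nothing refl = solve (b ∷ c ∷ d ∷ e ∷ []) λ b c d e → E.ev ⟨ e , d , c , b , :0 ⟩ :0 :≡ :0
      invert-root ⟨ a , b , c , d , e ⟩ (just t) z with t ≟ᶠ 0#
      ... | yes refl = trans (solve (a ∷ b ∷ c ∷ d ∷ e ∷ []) λ a b c d e → e :≡ E.ev ⟨ a , b , c , d , e ⟩ :0) z
      ... | no h = ev-inverse a b c d e (inverseʳ h) z

    -- Pairs of a root and a form are counted twice: every form has i roots, and each of the q + 1
    -- points of the line is a root of as many forms as infinity, since the group is transitive on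
    -- points and `Q` is invariant.
    flags : ∀ {Q : Quartic → Set} {i K} → Stable Q → (∀ {f} → Q f → Rooted f) → (∀ {f} → Q f → Card (Root f) i) →
            Card (λ f → lead f ≡ 0# × Q f) K → ∃[ N ] (Card Q N × N ℕ.* i ≡ (order ℕ.+ 1) ℕ.* K)
    flags {Q} {i} {K} S rt roots c = card-fibres _≟⁵_ {R = λ p f → Root f p × Q f}
        (card-⇔ proj₂ (tt ,_) (card-Σ {Q = λ p f → Root f p × Q f} points (λ {p} _ → over p)))
        proj₂ (λ {f} q → case rt q of λ { (inj₁ z) → nothing , z , q ; (inj₂ (t , z)) → just t , z , q })
        (λ q → card-⇔ (_, q) proj₁ (roots q))
      where
      over : ∀ p → Card (λ f → Root f p × Q f) K
      over nothing  = c
      over (just t) = card-inverse (λ g → tr (- t) (sw g)) (λ f → sw (tr t f)) c (λ {g} (z , q) → at-root g z , S (≋-trans (≋-sw g) (≋-tr (- t) (sw g))) q)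
          (λ {f} (z , q) → at-∞ f z , S (≋-trans (≋-tr t f) (≋-sw (tr t f))) q) (λ {g} _ → back g) (λ {f} _ → forth f)
        where
        at-root : ∀ g → lead g ≡ 0# → ev (tr (- t) (sw g)) t ≡ 0#
        at-root ⟨ a , b , c , d , e ⟩ z = trans (solve (a ∷ b ∷ c ∷ d ∷ e ∷ t ∷ []) λ a b c d e t →
          E.ev (E.tr (:- t) (E.sw ⟨ a , b , c , d , e ⟩)) t :≡ a) z
        at-∞ : ∀ f → ev f t ≡ 0# → lead (sw (tr t f)) ≡ 0#
        at-∞ ⟨ a , b , c , d , e ⟩ z = z
        back : ∀ g → sw (tr t (tr (- t) (sw g))) ≡ g
        back ⟨ a , b , c , d , e ⟩ = solveᵥ (a ∷ b ∷ c ∷ d ∷ e ∷ t ∷ []) λ a b c d e t →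
          E.sw (E.tr t (E.tr (:- t) (E.sw ⟨ a , b , c , d , e ⟩))) :≡ ⟨ a , b , c , d , e ⟩
        forth : ∀ f → tr (- t) (sw (sw (tr t f))) ≡ f
        forth ⟨ a , b , c , d , e ⟩ = solveᵥ (a ∷ b ∷ c ∷ d ∷ e ∷ t ∷ []) λ a b c d e t →
          E.tr (:- t) (E.sw (E.sw (E.tr t ⟨ a , b , c , d , e ⟩))) :≡ ⟨ a , b , c , d , e ⟩

    roots-with-∞ : ∀ {f i} → lead f ≡ 0# → Card (λ t → ev f t ≡ 0#) i → Card (Root f) (suc i)
    roots-with-∞ {f} z c = card-⇔
      [ (λ { refl → z }) , (λ { (t , e , refl) → e }) ]′
      (λ { {nothing} _ → inj₁ refl ; {just t} e → inj₂ (t , e , refl) })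
      (card-⊎ (card-single nothing) (card-bij {Q = λ p → ∃[ t ] (ev f t ≡ 0# × p ≡ just t)} just c (λ {t} e → t , e , refl) (λ { _ _ refl → refl }) (λ { (t , e , refl) → t , e , refl }))
        λ { refl (_ , _ , ()) })

    fourRoots-card : Card (Root fourRootsRep) 4
    fourRoots-card = roots-with-∞ {fourRootsRep} refl (card-⇔
      (λ {t} e → lin₁ 1# e (solve (t ∷ []) λ t → E.ev ⟨ :0 , :1 , :0 , :- :1 , :0 ⟩ t :- :0 :≡ :1 :* ((t E.^ 3 :- t) :- (:0 E.^ 3 :- :0))))
      (λ {t} e → lin₁ 1# e (solve (t ∷ []) λ t → (t E.^ 3 :- t) :- (:0 E.^ 3 :- :0) :≡ :1 :* (E.ev ⟨ :0 , :1 , :0 , :- :1 , :0 ⟩ t :- :0)))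
      (℘-fibre-card 0#))

    twoRoots-card : Card (Root twoRootsRep) 2
    twoRoots-card = roots-with-∞ {twoRootsRep} refl (card-⇔
      (λ { refl → solve (ε ∷ []) λ ε → E.ev ⟨ :0 , :1 , :0 , :- ε , :0 ⟩ :0 :≡ :0 })
      (λ {t} e → additive-injective ε-nonsquare (lin₁ 1# e (solve (ε ∷ t ∷ []) λ ε t →
         (t E.^ 3 :- ε :* t) :- (:0 E.^ 3 :- ε :* :0) :≡ :1 :* (E.ev ⟨ :0 , :1 , :0 , :- ε , :0 ⟩ t :- :0))))
      (card-single 0#))

    oneRoot-card : Card (Root oneRootRep) 1
    oneRoot-card = roots-with-∞ {oneRootRep} refl (card-∅ λ {t} e → proj₂ ∃Tr≢0 (℘-trace {w = - t} (lin₁ (- 1#) e (solve (t ∷ proj₁ ∃Tr≢0 ∷ []) λ t e₁ →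
      ((:- t) E.^ 3 :- :- t) :- e₁ :≡ :- :1 :* (E.ev ⟨ :0 , :1 , :0 , :- :1 , e₁ ⟩ t :- :0)))))

    -- The finite roots satisfy t³ + t² = 1/r, and y = 1/t turns this into y³ - ry = r, whose left
    -- side is additive. The extra root is the one at infinity.
    rootedRep-roots : ∀ {r i} → r ≢ 0# → Card (λ y → y ^ 3 - r * y ≡ r) i → Card (Root (rootedRep r)) (suc i)
    rootedRep-roots {r} r≢0 c = roots-with-∞ {rootedRep r} refl (card-inverse _⁻¹ _⁻¹ c
        (λ {y} e → let y≢0 = nonzero e in lin₃ (- (y ⁻¹ ^ 3 * r ⁻¹))
             ((y ⁻¹ * y) ^ 2 * r ⁻¹ + y ⁻¹ * y * r ⁻¹ + r ⁻¹ - y ⁻¹ ^ 2)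
             (- (y ⁻¹ ^ 3 + y ⁻¹ * y * y ⁻¹ ^ 2)) e (inverseˡ y≢0) (inverseʳ r≢0) (solve (r ∷ r ⁻¹ ∷ y ∷ y ⁻¹ ∷ []) λ r r′ y t →
             E.ev ⟨ :0 , :1 , :1 , :0 , :- r′ ⟩ t :- :0 :≡
             :- (t E.^ 3 :* r′) :* (y E.^ 3 :- r :* y :- r) :+
             ((t :* y) E.^ 2 :* r′ :+ t :* y :* r′ :+ r′ :- t E.^ 2) :* (t :* y :- :1) :+
             :- (t E.^ 3 :+ t :* y :* t E.^ 2) :* (r :* r′ :- :1)))
        (λ {t} e → let t≢0 = nonzero′ e in lin₃ (- (r * t ⁻¹ ^ 3)) (r * t ⁻¹ * ((t * t ⁻¹) + 1#) + r * (t ⁻¹ * t * (t * t ⁻¹) + t * t ⁻¹ + 1#)) (- (t ⁻¹ ^ 3)) e (inverseʳ t≢0) (inverseʳ r≢0)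
             (solve (r ∷ r ⁻¹ ∷ t ∷ t ⁻¹ ∷ []) λ r r′ t y →
             y E.^ 3 :- r :* y :- r :≡ :- (r :* y E.^ 3) :* (E.ev ⟨ :0 , :1 , :1 , :0 , :- r′ ⟩ t :- :0) :+
               (r :* y :* (t :* y :+ :1) :+ r :* (y :* t :* (t :* y) :+ t :* y :+ :1)) :* (t :* y :- :1) :+ (:- (y E.^ 3)) :* (r :* r′ :- :1)))
        (λ {y} e → *-cancelˡ (⁻¹-≢0 (nonzero e)) (trans (inverseʳ (⁻¹-≢0 (nonzero e))) (sym (inverseˡ (nonzero e)))))
        (λ {t} e → *-cancelˡ (⁻¹-≢0 (nonzero′ e)) (trans (inverseʳ (⁻¹-≢0 (nonzero′ e))) (sym (inverseˡ (nonzero′ e))))))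
      where
      nonzero : ∀ {y} → y ^ 3 - r * y ≡ r → y ≢ 0#
      nonzero e refl = r≢0 (trans (sym e) (solve (r ∷ []) λ r → :0 E.^ 3 :- r :* :0 :≡ :0))
      nonzero′ : ∀ {t} → ev (rootedRep r) t ≡ 0# → t ≢ 0#
      nonzero′ e refl = ⁻¹-≢0 r≢0 (lin₁ (- 1#) e (solve (r ⁻¹ ∷ []) λ r′ → r′ :- :0 :≡ :- :1 :* (E.ev ⟨ :0 , :1 , :1 , :0 , :- r′ ⟩ :0 :- :0)))

    resolvent-nonsquare : ∀ {r} → ¬ IsSquare r → Card (λ y → y ^ 3 - r * y ≡ r) 1
    resolvent-nonsquare {r} ns = let w , e = additive-surjective ns r in
      card-⇔ (λ { refl → e }) (λ e′ → additive-injective ns (trans e′ (sym e))) (card-single w)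

    -- With y = sw the left side becomes s³(w³ - w), so the trace of 1/s decides between three roots
    -- and none.
    resolvent-square : ∀ {s i} → s ≢ 0# → Card (λ w → ℘ w ≡ s ⁻¹) i → Card (λ y → y ^ 3 - s * s * y ≡ s * s) i
    resolvent-square {s} s≢0 c = card-inverse (s *_) (s ⁻¹ *_) c
      (λ {w} e → lin₂ (s ^ 3) (s * s) e (inverseʳ s≢0) (solve (s ∷ s ⁻¹ ∷ w ∷ []) λ s s′ w →
        (s :* w) E.^ 3 :- s :* s :* (s :* w) :- s :* s :≡ s E.^ 3 :* (w E.^ 3 :- w :- s′) :+ s :* s :* (s :* s′ :- :1)))
      (λ {y} e → lin₂ (s ⁻¹ ^ 3) (s ⁻¹ ^ 2 * s * y + s ⁻¹ * y + s ⁻¹ * (s * s ⁻¹ + 1#)) e (inverseʳ s≢0) (solve (s ∷ s ⁻¹ ∷ y ∷ []) λ s s′ y →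
        ((s′ :* y) E.^ 3 :- s′ :* y) :- s′ :≡ s′ E.^ 3 :* (y E.^ 3 :- s :* s :* y :- s :* s) :+
          (s′ E.^ 2 :* s :* y :+ s′ :* y :+ s′ :* (s :* s′ :+ :1)) :* (s :* s′ :- :1)))
      (λ {w} _ → trans (sym (*-assoc _ s w)) (trans (cong (_* w) (inverseˡ s≢0)) (*-identityˡ w)))
      (λ {w} _ → trans (sym (*-assoc s _ w)) (trans (cong (_* w) (inverseʳ s≢0)) (*-identityˡ w)))

    rootedRep-roots₂ : ∀ {r} → ¬ IsSquare r → Card (Root (rootedRep r)) 2
    rootedRep-roots₂ ns = rootedRep-roots (nonsquare-≢0 ns) (resolvent-nonsquare ns)

    rootedRep-roots₁ : ∀ {s} → s ≢ 0# → Tr n (s ⁻¹) ≢ 0# → Card (Root (rootedRep (s * s))) 1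
    rootedRep-roots₁ h tr≢0 = rootedRep-roots (*-≢0 h h) (resolvent-square h (card-∅ (tr≢0 ∘ ℘-trace)))

    rootedRep-roots₄ : ∀ {s} → s ≢ 0# → Tr n (s ⁻¹) ≡ 0# → Card (Root (rootedRep (s * s))) 4
    rootedRep-roots₄ h tr≡0 = let v , e = Tr≡0⇒℘ tr≡0 in
      rootedRep-roots (*-≢0 h h) (resolvent-square h (card-⇔ (λ e′ → trans e′ e) (λ e′ → trans e′ (sym e)) (℘-fibre-card v)))

    J-nondeg : ∀ {r f} → mid f ≢ 0# → J r f → NonDeg f
    J-nondeg {r} h j z = ^-≢0 6 h (trans j (times-zero r z))

    -- f = Y(bX³ + cX²Y + dXY² + eY³) with ȷ(f) = r determines e.
    rooted-at-∞-card : ∀ {r} → r ≢ 0# → Card (λ f → lead f ≡ 0# × (NonDeg f × J r f)) (m ℕ.* (m ℕ.* order))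
    rooted-at-∞-card {r} r≢0 = card-bij form
        (card-Σ {Q = λ _ (b , d) → b ≢ 0#} units (λ _ → card-⇔ proj₁ (_, tt) (card-Σ {Q = λ _ _ → ⊤} units (λ _ → all))))
        (λ { {c , (b , d)} (c≢0 , b≢0) → refl , J-nondeg {r} {form (c , (b , d))} c≢0 (satisfied c≢0 b≢0) , satisfied c≢0 b≢0 })
        (λ _ _ h → cong₂ _,_ (cong (Vec.head ∘ Vec.tail ∘ Vec.tail) h) (cong₂ _,_ (cong (Vec.head ∘ Vec.tail) h) (cong (Vec.head ∘ Vec.tail ∘ Vec.tail ∘ Vec.tail) h)))
        onto
      where
      κ : Carrier → Carrier → Carrier
      κ c b = r * (c ^ 3 * b ^ 2)
      tailCoeff : Carrier → Carrier → Carrier → Carrier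
      tailCoeff c b d = κ c b ⁻¹ * (r * ((b * d) ^ 2 * c ^ 2 - (b * d) ^ 3) - c ^ 6)
      form : Carrier × (Carrier × Carrier) → Quartic
      form (c , (b , d)) = ⟨ 0# , b , c , d , tailCoeff c b d ⟩
      κ≢0 : ∀ {c b} → c ≢ 0# → b ≢ 0# → κ c b ≢ 0#
      κ≢0 hc hb = *-≢0 r≢0 (*-≢0 (^-≢0 3 hc) (^-≢0 2 hb))
      satisfied : ∀ {c b d} → c ≢ 0# → b ≢ 0# → J r (form (c , (b , d)))
      satisfied {c} {b} {d} hc hb = lin₁ (r * ((b * d) ^ 2 * c ^ 2 - (b * d) ^ 3) - c ^ 6) (inverseʳ (κ≢0 hc hb)) (solve (r ∷ c ∷ b ∷ d ∷ κ c b ⁻¹ ∷ []) λ r c b d ι →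
        let u = r :* ((b :* d) E.^ 2 :* c E.^ 2 :- (b :* d) E.^ 3) :- c E.^ 6 in
        c E.^ 6 :- r :* E.disc ⟨ :0 , b , c , d , ι :* u ⟩ :≡ u :* (r :* (c E.^ 3 :* b E.^ 2) :* ι :- :1))
      onto : ∀ {f} → lead f ≡ 0# × (NonDeg f × J r f) → Σ[ u ∈ Carrier × (Carrier × Carrier) ] ((proj₁ u ≢ 0# × proj₁ (proj₂ u) ≢ 0#) × form u ≡ f)
      onto {⟨ _ , b , c , d , e ⟩} (refl , nd , j) = (c , (b , d)) , (c≢0 , b≢0) , cong (λ e → ⟨ 0# , b , c , d , e ⟩)
          (*-cancelˡ (κ≢0 c≢0 b≢0) (lin₂ (r * ((b * d) ^ 2 * c ^ 2 - (b * d) ^ 3) - c ^ 6) (- 1#) (inverseʳ (κ≢0 c≢0 b≢0)) j (solve (r ∷ c ∷ b ∷ d ∷ e ∷ κ c b ⁻¹ ∷ []) λ r c b d e ι →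
             let u = r :* ((b :* d) E.^ 2 :* c E.^ 2 :- (b :* d) E.^ 3) :- c E.^ 6 ; κ = r :* (c E.^ 3 :* b E.^ 2) in
             κ :* (ι :* u) :- κ :* e :≡ u :* (κ :* ι :- :1) :+ :- :1 :* (c E.^ 6 :- r :* E.disc ⟨ :0 , b , c , d , e ⟩))))
        where
        c≢0 : c ≢ 0#
        c≢0 = J-mid≢0 {r} {⟨ 0# , b , c , d , e ⟩} nd j r≢0
        b≢0 : b ≢ 0#
        b≢0 refl = nd (solve (c ∷ d ∷ e ∷ []) λ c d e → E.disc ⟨ :0 , :0 , c , d , e ⟩ :≡ :0)

    -- With z₁ = 0 and I = z₀z₄, the equation ȷ = r reads r c³ z₀ z₃² = r(I³ + I²c² + Ic⁴) - c⁶.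
    depressed-card : ∀ {r} → r ≢ 0# → Card (λ f → (lead f ≢ 0# × Vec.head (Vec.tail f) ≡ 0#) × (NonDeg f × J r f)) (m ℕ.* order ℕ.* m)
    depressed-card {r} r≢0 = card-bij proj₂ (card-Σ {Q = Solution} (card-Σ {Q = λ _ _ → ⊤} units (λ _ → all)) (λ { {c , I} (c≢0 , _) → solutions c I c≢0 }))
        (λ { {(c , I) , ⟨ z , _ , _ , a , b ⟩} ((c≢0 , _) , (z≢0 , refl , refl , _ , j)) →
             (z≢0 , refl) , J-nondeg {r} {⟨ z , 0# , c , a , b ⟩} c≢0 j , j })
        (λ { {(c , I) , ⟨ z , _ , _ , a , b ⟩} {(c′ , I′) , _} (_ , (_ , _ , refl , refl , _)) (_ , (_ , _ , refl , refl , _)) refl → refl })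
        (λ { {⟨ z , _ , c , a , b ⟩} ((z≢0 , refl) , nd , j) →
             ((c , z * b) , ⟨ z , 0# , c , a , b ⟩) , ((J-mid≢0 {r} {⟨ z , 0# , c , a , b ⟩} nd j r≢0 , tt) , (z≢0 , refl , refl , refl , j)) , refl })
      where
      Solution : Carrier × Carrier → Quartic → Set
      Solution (c , I) f@(⟨ z , z1 , c′ , a , b ⟩) = z ≢ 0# × z1 ≡ 0# × c′ ≡ c × z * b ≡ I × J r f
      H : Carrier → Carrier → Carrier
      H c I = r * (I ^ 3 + I ^ 2 * c ^ 2 + I * c ^ 4) - c ^ 6
      equation : ∀ {z c a b} → J r ⟨ z , 0# , c , a , b ⟩ → r * (c ^ 3 * (z * a ^ 2)) ≡ H c (z * b)
      equation {z} {c} {a} {b} j = lin₁ 1# j (solve (r ∷ z ∷ c ∷ a ∷ b ∷ []) λ r z c a b → let I = z :* b in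
        r :* (c E.^ 3 :* (z :* a E.^ 2)) :- (r :* (I E.^ 3 :+ I E.^ 2 :* c E.^ 2 :+ I :* c E.^ 4) :- c E.^ 6) :≡
        :1 :* (c E.^ 6 :- r :* E.disc ⟨ z , :0 , c , a , b ⟩))
      conversely : ∀ {z c a b} → r * (c ^ 3 * (z * a ^ 2)) ≡ H c (z * b) → J r ⟨ z , 0# , c , a , b ⟩
      conversely {z} {c} {a} {b} e = lin₁ 1# e (solve (r ∷ z ∷ c ∷ a ∷ b ∷ []) λ r z c a b → let I = z :* b in
        c E.^ 6 :- r :* E.disc ⟨ z , :0 , c , a , b ⟩ :≡ :1 :*
        (r :* (c E.^ 3 :* (z :* a E.^ 2)) :- (r :* (I E.^ 3 :+ I E.^ 2 :* c E.^ 2 :+ I :* c E.^ 4) :- c E.^ 6)))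
      solve-for : ∀ {z} → z ≢ 0# → ∀ I → z * (z ⁻¹ * I) ≡ I
      solve-for h I = trans (sym (*-assoc _ _ I)) (trans (cong (_* I) (inverseʳ h)) (*-identityˡ I))
      solutions : ∀ c I → c ≢ 0# → Card (Solution (c , I)) m
      solutions c I c≢0 = choose (H c I ≟ᶠ 0#)
        where
        κ≢0 : ∀ {w} → w ≢ 0# → r * (c ^ 3 * w ^ 2) ≢ 0#
        κ≢0 h = *-≢0 r≢0 (*-≢0 (^-≢0 3 c≢0) (^-≢0 2 h))
        -- Write H for the right side. H = 0 forces z₃ = 0 and leaves z₀ any unit; H ≠ 0 leaves z₃
        -- any unit and determines z₀. Both cases have q - 1 solutions.
        choose : Dec (H c I ≡ 0#) → Card (Solution (c , I)) m
        choose (yes H≡0) = card-bij (λ z → ⟨ z , 0# , c , 0# , z ⁻¹ * I ⟩) units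
          (λ {z} z≢0 → z≢0 , refl , refl , solve-for z≢0 I , conversely (trans
             (solve (r ∷ c ∷ z ∷ []) λ r c z → r :* (c E.^ 3 :* (z :* :0 E.^ 2)) :≡ :0) (sym (trans (cong (H c) (solve-for z≢0 I)) H≡0))))
          (λ _ _ → cong Vec.head)
          (λ { {⟨ z , _ , _ , a , b ⟩} (z≢0 , refl , refl , refl , j) → z , z≢0 , cong₂ (λ a b → ⟨ z , 0# , c , a , b ⟩)
             (sym (^-≡0 2 (*-cancelˡ (*-≢0 r≢0 (*-≢0 (^-≢0 3 c≢0) z≢0)) (trans (solve (r ∷ c ∷ z ∷ a ∷ []) λ r c z a →
                r :* (c E.^ 3 :* z) :* a E.^ 2 :≡ r :* (c E.^ 3 :* (z :* a E.^ 2))) (trans (equation j) (trans H≡0 (sym (zeroʳ _))))))))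
             (*-cancelˡ z≢0 (solve-for z≢0 (z * b))) })
        choose (no H≢0) = card-bij (λ a → ⟨ lc a , 0# , c , a , lc a ⁻¹ * I ⟩) units
          (λ {a} a≢0 → lc≢0 a≢0 , refl , refl , solve-for (lc≢0 a≢0) I , conversely (trans (lc-equation a≢0) (cong (H c) (sym (solve-for (lc≢0 a≢0) I)))))
          (λ _ _ → cong (Vec.head ∘ Vec.tail ∘ Vec.tail ∘ Vec.tail))
          (λ { {⟨ z , _ , _ , a , b ⟩} (z≢0 , refl , refl , refl , j) → let a′ , h , e = found z a b z≢0 H≢0 (equation j) in
             a′ , h , trans e (cong (λ b → ⟨ z , 0# , c , a , b ⟩) (*-cancelˡ z≢0 (solve-for z≢0 (z * b)))) })
          where
          lc : Carrier → Carrier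
          lc a = (r * (c ^ 3 * a ^ 2)) ⁻¹ * H c I
          lc≢0 : ∀ {a} → a ≢ 0# → lc a ≢ 0#
          lc≢0 h = *-≢0 (⁻¹-≢0 (κ≢0 h)) H≢0
          lc-equation : ∀ {a} → a ≢ 0# → r * (c ^ 3 * (lc a * a ^ 2)) ≡ H c I
          lc-equation {a} h = trans (solve (r ∷ c ∷ lc a ∷ a ∷ []) λ r c l a → r :* (c E.^ 3 :* (l :* a E.^ 2)) :≡ r :* (c E.^ 3 :* a E.^ 2) :* l) (solve-for (κ≢0 h) (H c I))
          found : ∀ z a (b : Carrier) → z ≢ 0# → H c I ≢ 0# → r * (c ^ 3 * (z * a ^ 2)) ≡ H c I → Σ[ a′ ∈ Carrier ] (a′ ≢ 0# × _≡_ {A = Quartic} ⟨ lc a′ , 0# , c , a′ , lc a′ ⁻¹ * I ⟩ ⟨ z , 0# , c , a , z ⁻¹ * I ⟩)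
          found z a b z≢0 h e = a , a≢0 , cong (λ z → ⟨ z , 0# , c , a , z ⁻¹ * I ⟩) (*-cancelˡ (κ≢0 a≢0) (trans (solve-for (κ≢0 a≢0) (H c I)) (trans (sym e)
              (solve (r ∷ c ∷ z ∷ a ∷ []) λ r c l a → r :* (c E.^ 3 :* (l :* a E.^ 2)) :≡ r :* (c E.^ 3 :* a E.^ 2) :* l))))
            where
            a≢0 : a ≢ 0#
            a≢0 refl = h (trans (sym e) (solve (r ∷ c ∷ z ∷ []) λ r c z → r :* (c E.^ 3 :* (z :* :0 E.^ 2)) :≡ :0))

    -- As 4 = 1, a form with z₀ ≠ 0 is the translate by z₁/z₀ of exactly one form with z₁ = 0, so
    -- those forms number q times the depressed ones; the forms with z₀ = 0 are added.
    total-card : ∀ {r} → r ≢ 0# → Card (λ f → NonDeg f × J r f) (m ℕ.* G)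
    total-card {r} r≢0 = subst (Card _) (arithmetic order m) (card-⇔
        [ proj₂ , proj₂ ]′ (λ {f} h → case lead f ≟ᶠ 0# of λ { (yes z) → inj₁ (z , h) ; (no nz) → inj₂ (nz , h) })
        (card-⊎ (rooted-at-∞-card r≢0) translated λ (z , _) (nz , _) → nz z))
      where
      arithmetic : ∀ q m → m ℕ.* (m ℕ.* q) ℕ.+ q ℕ.* (m ℕ.* q ℕ.* m) ≡ m ℕ.* (q ℕ.* (m ℕ.* (q ℕ.+ 1)))
      arithmetic = ℕSolver.solve 2 (λ q m → m ℕ⊗ (m ℕ⊗ q) ℕ⊕ q ℕ⊗ (m ℕ⊗ q ℕ⊗ m) ℕ≐ m ℕ⊗ (q ℕ⊗ (m ℕ⊗ (q ℕ⊕ ℕ# 1)))) refl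
      slope : Quartic → Carrier
      slope ⟨ a , b , _ , _ , _ ⟩ = a ⁻¹ * b
      slope-tr : ∀ t f → lead f ≢ 0# → Vec.head (Vec.tail f) ≡ 0# → slope (tr t f) ≡ t
      slope-tr t ⟨ a , _ , _ , _ , _ ⟩ h refl = lin₁ t (inverseʳ h) (solve (a ∷ a ⁻¹ ∷ t ∷ []) λ a a′ t → a′ :* (a :* t :+ :0) :- t :≡ t :* (a :* a′ :- :1))
      lead-tr : ∀ t f → lead (tr t f) ≡ lead f
      lead-tr t ⟨ a , _ , _ , _ , _ ⟩ = refl
      depress : ∀ f → lead f ≢ 0# → Vec.head (Vec.tail (tr (- slope f) f)) ≡ 0#
      depress ⟨ a , b , _ , _ , _ ⟩ h = lin₁ (- b) (inverseʳ h) (solve (a ∷ a ⁻¹ ∷ b ∷ []) λ a a′ b → (a :* :- (a′ :* b) :+ b) :- :0 :≡ :- b :* (a :* a′ :- :1))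
      tr-tr : ∀ t f → tr t (tr (- t) f) ≡ f
      tr-tr t ⟨ a , b , c , d , e ⟩ = solveᵥ (a ∷ b ∷ c ∷ d ∷ e ∷ t ∷ []) λ a b c d e t → E.tr t (E.tr (:- t) ⟨ a , b , c , d , e ⟩) :≡ ⟨ a , b , c , d , e ⟩
      tr-tr′ : ∀ t f → tr (- t) (tr t f) ≡ f
      tr-tr′ t ⟨ a , b , c , d , e ⟩ = solveᵥ (a ∷ b ∷ c ∷ d ∷ e ∷ t ∷ []) λ a b c d e t → E.tr (:- t) (E.tr t ⟨ a , b , c , d , e ⟩) :≡ ⟨ a , b , c , d , e ⟩
      translated : Card (λ f → lead f ≢ 0# × (NonDeg f × J r f)) (order ℕ.* (m ℕ.* order ℕ.* m))
      translated = card-bij (λ (t , f) → tr t f) (card-Σ {Q = λ _ f → (lead f ≢ 0# × Vec.head (Vec.tail f) ≡ 0#) × (NonDeg f × J r f)} all (λ _ → depressed-card r≢0))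
        (λ { {t , f} (_ , (h , _) , nd , j) → (λ z → h (trans (sym (lead-tr t f)) z)) , nondeg-stable (≋-tr t f) nd , J-stable (≋-tr t f) j })
        (λ { {t , f} {t′ , f′} (_ , (h , z) , _) (_ , (h′ , z′) , _) e → inj t t′ (trans (sym (slope-tr t f h z)) (trans (cong slope e) (slope-tr t′ f′ h′ z′))) e })
        (λ { {f} (h , nd , j) → (slope f , tr (- slope f) f) ,
             (tt , ((λ z → h (trans (sym (lead-tr (- slope f) f)) z)) , depress f h) , nondeg-stable (≋-tr _ f) nd , J-stable (≋-tr _ f) j) , tr-tr (slope f) f })
        where
        inj : ∀ t t′ {f f′} → t ≡ t′ → tr t f ≡ tr t′ f′ → (t , f) ≡ (t′ , f′)
        inj t _ {f} {f′} refl e = cong (t ,_) (trans (sym (tr-tr′ t f)) (trans (cong (tr (- t)) e) (tr-tr′ t f′)))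

  -- Forms without X²Y² term are 2 × 2 matrices with rows (z₀, z₁) and (z₃, z₄), and Δ is the cube of the determinant.
  matrix : Quartic → Carrier
  matrix ⟨ a , b , _ , d , e ⟩ = a * e - b * d

  opaque
    matrix-Δ : ∀ {f} → mid f ≡ 0# → Δ f ≡ matrix f * (matrix f * matrix f)
    matrix-Δ {⟨ a , b , _ , d , e ⟩} refl = solve (a ∷ b ∷ d ∷ e ∷ []) λ a b d e → let D = a :* e :- b :* d in E.disc ⟨ a , b , :0 , d , e ⟩ :≡ D :* (D :* D)

    matrix-square : ∀ {f} → mid f ≡ 0# → IsSquare (matrix f) → IsSquare (Δ f)
    matrix-square {f} z sq = subst IsSquare (sym (matrix-Δ {f} z)) (square-* sq (_ , refl))

    square-matrix : ∀ {f} → mid f ≡ 0# → NonDeg f → IsSquare (Δ f) → IsSquare (matrix f)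
    square-matrix {f} z nd sq = square-ratio (≢0-left (subst (_≢ 0#) (matrix-Δ {f} z) nd)) (subst IsSquare (matrix-Δ {f} z) sq)

    matrix≢0 : ∀ {f} → mid f ≡ 0# → NonDeg f → matrix f ≢ 0#
    matrix≢0 {f} z nd = ≢0-left (subst (_≢ 0#) (matrix-Δ {f} z) nd)

    nondeg-matrix : ∀ {f} → mid f ≡ 0# → matrix f ≢ 0# → NonDeg f
    nondeg-matrix {f} z h = subst (_≢ 0#) (sym (matrix-Δ {f} z)) (*-≢0 h (*-≢0 h h))

    private
      solve-for : ∀ {z} → z ≢ 0# → ∀ I → z * (z ⁻¹ * I) ≡ I
      solve-for h I = trans (sym (*-assoc _ _ I)) (trans (cong (_* I) (inverseʳ h)) (*-identityˡ I))

    matrix-at-∞-card : ∀ {S : Carrier → Set} {k} → (∀ {d} → S d → d ≢ 0#) → Card S k →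
                       Card (λ f → lead f ≡ 0# × (mid f ≡ 0# × S (matrix f))) (m ℕ.* (k ℕ.* order))
    matrix-at-∞-card {S} S≢0 c = card-bij (λ (b , (d , e)) → ⟨ 0# , b , 0# , b ⁻¹ * - d , e ⟩) (card-Σ {Q = λ _ (d , _) → S d} units (λ _ → card-⇔ proj₁ (_, tt) (card-Σ {Q = λ _ _ → ⊤} c (λ _ → all))))
        (λ { {b , (d , e)} (h , s) → refl , refl , subst S (sym (value h)) s })
        (λ { {b , (d , e)} {b′ , (d′ , e′)} (h , _) (h′ , _) eq → cong₂ _,_ (cong (Vec.head ∘ Vec.tail) eq) (cong₂ _,_
             (trans (sym (value {b} {d} {e} h)) (trans (cong matrix eq) (value {b′} {d′} {e′} h′)))
             (cong (Vec.head ∘ Vec.tail ∘ Vec.tail ∘ Vec.tail ∘ Vec.tail) eq)) })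
        (λ { {⟨ _ , b , _ , d , e ⟩} (refl , refl , s) → let b≢0 = nonzero b d e (S≢0 s) in
             (b , (0# * e - b * d , e)) , (b≢0 , s) , cong (λ d → ⟨ 0# , b , 0# , d , e ⟩) (*-cancelˡ b≢0 (trans (solve-for b≢0 _)
               (solve (b ∷ d ∷ e ∷ []) λ b d e → :- (:0 :* e :- b :* d) :≡ b :* d))) })
      where
      nonzero : ∀ b d e → 0# * e - b * d ≢ 0# → b ≢ 0#
      nonzero b d e h refl = h (solve (d ∷ e ∷ []) λ d e → :0 :* e :- :0 :* d :≡ :0)
      value : ∀ {b d e} → b ≢ 0# → 0# * e - b * (b ⁻¹ * - d) ≡ d
      value {b} {d} {e} h = trans (cong (λ u → 0# * e - u) (solve-for h (- d))) (solve (d ∷ e ∷ []) λ d e → :0 :* e :- :- d :≡ d)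

    -- Each nonzero determinant belongs to |SL₂(q)| = q³ - q = `G` matrices. The set `S` of
    -- determinants is a parameter because units, squares and nonsquares are all needed.
    matrix-card : ∀ {S : Carrier → Set} {k} → (∀ {d} → S d → d ≢ 0#) → Card S k → Card (λ f → mid f ≡ 0# × S (matrix f)) (k ℕ.* G)
    matrix-card {S} {k} S≢0 c = subst (Card _) (arithmetic k order m) (card-⇔
        [ proj₂ , proj₂ ]′ (λ {f} h → case lead f ≟ᶠ 0# of λ { (yes z) → inj₁ (z , h) ; (no nz) → inj₂ (nz , h) })
        (card-⊎ (matrix-at-∞-card S≢0 c) generic λ (z , _) (nz , _) → nz z))
      where
      arithmetic : ∀ k q m → m ℕ.* (k ℕ.* q) ℕ.+ m ℕ.* (k ℕ.* (q ℕ.* q)) ≡ k ℕ.* (q ℕ.* (m ℕ.* (q ℕ.+ 1)))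
      arithmetic = ℕSolver.solve 3 (λ k q m → m ℕ⊗ (k ℕ⊗ q) ℕ⊕ m ℕ⊗ (k ℕ⊗ (q ℕ⊗ q)) ℕ≐ k ℕ⊗ (q ℕ⊗ (m ℕ⊗ (q ℕ⊕ ℕ# 1)))) refl
      value : ∀ {a b d D} → a ≢ 0# → a * (a ⁻¹ * (D + b * d)) - b * d ≡ D
      value {a} {b} {d} {D} h = trans (cong (λ u → u - b * d) (solve-for h _)) (solve (b * d ∷ D ∷ []) λ u D → D :+ u :- u :≡ D)
      generic : Card (λ f → lead f ≢ 0# × (mid f ≡ 0# × S (matrix f))) (m ℕ.* (k ℕ.* (order ℕ.* order)))
      generic = card-bij (λ (a , (D , (b , d))) → ⟨ a , b , 0# , d , a ⁻¹ * (D + b * d) ⟩)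
        (card-Σ {Q = λ _ (D , _) → S D} units (λ _ → card-⇔ proj₁ (_, tt) (card-Σ {Q = λ _ _ → ⊤} c (λ _ → plane))))
        (λ { {a , (D , (b , d))} (h , s) → h , refl , subst S (sym (value h)) s })
        (λ { {a , (D , (b , d))} {a′ , (D′ , (b′ , d′))} (h , _) (h′ , _) eq → cong₂ _,_ (cong Vec.head eq) (cong₂ _,_
             (trans (sym (value {a} {b} {d} {D} h)) (trans (cong matrix eq) (value {a′} {b′} {d′} {D′} h′)))
             (cong₂ _,_ (cong (Vec.head ∘ Vec.tail) eq) (cong (Vec.head ∘ Vec.tail ∘ Vec.tail ∘ Vec.tail) eq))) })
        (λ { {⟨ a , b , _ , d , e ⟩} (h , refl , s) → (a , (a * e - b * d , (b , d))) , (h , s) , cong (λ e → ⟨ a , b , 0# , d , e ⟩)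
             (*-cancelˡ h (trans (solve-for h _) (solve (a ∷ b ∷ d ∷ e ∷ []) λ a b d e → a :* e :- b :* d :+ b :* d :≡ a :* e))) })

-- Sizes of the classes and exhaustion

module ClassSizes (F : Field) (n : ℕ) (hs : HasSize F (3 ℕ.^ n)) where
  open FormCounts F n hs public

  -- C consists of (q - 1)|G|/i vectors
  Size : (Quartic → Set) → ℕ → Set
  Size C i = ∃[ N ] (Card C N × N ℕ.* i ≡ m ℕ.* G)

  private
    arithmetic₁ : ∀ {N} i → N ℕ.* i ≡ (order ℕ.+ 1) ℕ.* (m ℕ.* (m ℕ.* order)) → N ℕ.* i ≡ m ℕ.* G
    arithmetic₁ _ e = trans e (ℕSolver.solve 2 (λ q m → (q ℕ⊕ ℕ# 1) ℕ⊗ (m ℕ⊗ (m ℕ⊗ q)) ℕ≐ m ℕ⊗ (q ℕ⊗ (m ℕ⊗ (q ℕ⊕ ℕ# 1)))) refl order m)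

    rearrange : ∀ {N K} i j → N ℕ.* i ≡ (order ℕ.+ 1) ℕ.* K → K ℕ.* j ≡ m ℕ.* (m ℕ.* order) → N ℕ.* (i ℕ.* j) ≡ m ℕ.* G
    rearrange {N} {K} i j e h = arithmetic₁ {N} (i ℕ.* j) (trans (sym (ℕ.*-assoc N i j)) (trans (cong (ℕ._* j) e) (trans (ℕ.*-assoc (order ℕ.+ 1) K j) (cong ((order ℕ.+ 1) ℕ.*_) h))))

    half-factor : m ℕ.* (half ℕ.* order) ℕ.* 2 ≡ m ℕ.* (m ℕ.* order)
    half-factor = trans (ℕSolver.solve 3 (λ m k q → m ℕ⊗ (k ℕ⊗ q) ℕ⊗ ℕ# 2 ℕ≐ m ℕ⊗ ((k ℕ⊕ k) ℕ⊗ q)) refl m half order) (cong (λ u → m ℕ.* (u ℕ.* order)) (sym m≡half+half))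

  RootedClass : Carrier → Quartic → Set
  RootedClass r f = NonDeg f × J r f × Rooted f

  TwoRoots : Quartic → Set
  TwoRoots f = mid f ≡ 0# × ¬ IsSquare (Δ f) × Rooted f

  mid≡0-stable : Stable (λ f → mid f ≡ 0#)
  mid≡0-stable {f} {h} e z = J-mid≡0 {h} (J-stable e (mid≡0-J {f} z))

  twoRoots-stable : Stable TwoRoots
  twoRoots-stable {f} {h} e (z , ns , rt) = mid≡0-stable {f} {h} e z , stable-¬ Δ-square-stable e ns , rooted-stable {f} {h} e rt

  rootedClass-stable : ∀ {r} → Stable (RootedClass r)
  rootedClass-stable {r} {f} {h} e (nd , j , rt) = nondeg-stable e nd , J-stable e j , rooted-stable {f} {h} e rt

  opaque
    rooted-size : ∀ {r i} → r ≢ 0# → Card (Root (rootedRep r)) i → Size (RootedClass r) i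
    rooted-size {r} {i} r≢0 c = let N , c′ , e = flags {RootedClass r} {i} rootedClass-stable (proj₂ ∘ proj₂)
                                        (λ (nd , j , rt) → roots-stable (≋-sym (rooted-orbit r≢0 nd j rt)) c)
                                        (card-⇔ (λ (z , nd , j) → z , nd , j , inj₁ z) (λ (z , nd , j , _) → z , nd , j) (rooted-at-∞-card r≢0))
                                in N , c′ , arithmetic₁ {N} i e

    twoRoots-size : Size TwoRoots 4
    twoRoots-size = let N , c , e = flags {TwoRoots} {2} twoRoots-stable (proj₂ ∘ proj₂)
                          (λ {f} (z , ns , rt) → roots-stable (≋-sym (twoRoots-orbit {f} ns (mid≡0-J {f} z) rt)) twoRoots-card)
                          (card-⇔ (λ {f} (z , z′ , ns) → z , z′ , ns ∘ square-matrix {f} z′ (nondeg-matrix {f} z′ (nonsquare-≢0 ns)) , inj₁ z)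
                                  (λ {f} (z , z′ , ns , _) → z , z′ , ns ∘ matrix-square {f} z′) (matrix-at-∞-card nonsquare-≢0 nonsquares))
                    in N , c , rearrange {N} 2 2 e half-factor

  -- Y times b(X - sY)(X - (s + μ)Y)(X - (s - μ)Y). In characteristic 3 the roots of a cubic without
  -- quadratic term have sum zero, so three rational ones are equally spaced.
  splitCubic : Carrier × (Carrier × Carrier) → Quartic
  splitCubic (b , (μ , s)) = ⟨ 0# , b , 0# , - (b * (μ * μ)) , b * (μ * μ * s - s ^ 3) ⟩

  opaque
    splitCubic-orbit : ∀ {b μ s} → b ≢ 0# → μ ≢ 0# → splitCubic (b , (μ , s)) ≋ fourRootsRep
    splitCubic-orbit {b} {μ} {s} hb hμ = ≋-trans (translate s (solveᵥ (b ∷ μ ∷ s ∷ []) λ b μ s →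
        E.tr s ⟨ :0 , b , :0 , :- (b :* (μ :* μ)) , b :* (μ :* μ :* s :- s E.^ 3) ⟩ :≡ E.sc b ⟨ :0 , :1 , :0 , :- (μ :* μ) , :0 ⟩))
      (≋-trans (≋-unsc hb) (dilate hμ {fourRootsRep} (solveᵥ (μ ∷ []) λ μ → E.dg μ ⟨ :0 , :1 , :0 , :- :1 , :0 ⟩ :≡ E.sc μ ⟨ :0 , :1 , :0 , :- (μ :* μ) , :0 ⟩)))

    finite-root : ∀ {f i} → Card (Root f) (suc (suc i)) → ∃[ t ] ev f t ≡ 0#
    finite-root {f} c = case ∃? (λ t → ev f t ≟ᶠ 0#) of λ
      { (yes h) → h
      ; (no h) → case card-≤ c (card-single nothing) (λ { {nothing} _ → refl ; {just t} z → ⊥-elim (h (t , z)) }) of λ { (ℕ.s≤s ()) } }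

    fourRoots-Δ : IsSquare (Δ fourRootsRep)
    fourRoots-Δ = 1# , solve [] (:1 :* :1 :≡ E.disc ⟨ :0 , :1 , :0 , :- :1 , :0 ⟩)

    fourRoots-nondeg : NonDeg fourRootsRep
    fourRoots-nondeg z = 1≢0 (trans (solve [] (:1 :≡ E.disc ⟨ :0 , :1 , :0 , :- :1 , :0 ⟩)) z)

    oneRoot-Δ : IsSquare (Δ oneRootRep)
    oneRoot-Δ = 1# , solve (proj₁ ∃Tr≢0 ∷ []) λ e → :1 :* :1 :≡ E.disc ⟨ :0 , :1 , :0 , :- :1 , e ⟩

    oneRoot-nondeg : NonDeg oneRootRep
    oneRoot-nondeg z = 1≢0 (trans (solve (proj₁ ∃Tr≢0 ∷ []) λ e → :1 :≡ E.disc ⟨ :0 , :1 , :0 , :- :1 , e ⟩) z)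

    private
      depressed-values : ∀ {b d e u μ s} → b ≢ 0# → b * μ ≡ u → u * u ≡ 0# * e - b * d → ev ⟨ 0# , b , 0# , d , e ⟩ s ≡ 0# →
                         - (b * (μ * μ)) ≡ d × b * (μ * μ * s - s ^ 3) ≡ e
      depressed-values {b} {d} {e} {u} {μ} {s} b≢0 eμ eu es = d-value , lin₂ (- s) (- 1#) d-value es (solve (b ∷ d ∷ e ∷ μ ∷ s ∷ []) λ b d e μ s →
          b :* (μ :* μ :* s :- s E.^ 3) :- e :≡ :- s :* (:- (b :* (μ :* μ)) :- d) :+ :- :1 :* (E.ev ⟨ :0 , b , :0 , d , e ⟩ s :- :0))
        where
        d-value : - (b * (μ * μ)) ≡ d
        d-value = *-cancelˡ b≢0 (lin₂ (- (b * μ + u)) (- 1#) eμ eu (solve (b ∷ d ∷ e ∷ μ ∷ u ∷ []) λ b d e μ u →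
          b :* :- (b :* (μ :* μ)) :- b :* d :≡ :- (b :* μ :+ u) :* (b :* μ :- u) :+ :- :1 :* (u :* u :- (:0 :* e :- b :* d))))

      assemble : ∀ b d e → 0# * e - b * d ≢ 0# → IsSquare (0# * e - b * d) → ∃[ s ] ev ⟨ 0# , b , 0# , d , e ⟩ s ≡ 0# →
                 Σ[ p ∈ Carrier × (Carrier × Carrier) ] ((proj₁ p ≢ 0# × proj₁ (proj₂ p) ≢ 0#) × splitCubic p ≡ ⟨ 0# , b , 0# , d , e ⟩)
      assemble b d e bd≢0 (u , eu) (s , es) = (b , (μ , s)) , (b≢0 , μ≢0) ,
          cong₂ {A = Carrier} {B = Carrier} {C = Quartic} (λ d e → ⟨ 0# , b , 0# , d , e ⟩) (proj₁ values) (proj₂ values)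
        where
        b≢0 : b ≢ 0#
        b≢0 refl = bd≢0 (solve (d ∷ e ∷ []) λ d e → :0 :* e :- :0 :* d :≡ :0)
        μ : Carrier
        μ = proj₁ (quotient b≢0 u)
        eμ : b * μ ≡ u
        eμ = proj₂ (quotient b≢0 u)
        μ≢0 : μ ≢ 0#
        μ≢0 z = bd≢0 (trans (sym eu) (trans (cong (u *_) (trans (sym eμ) (times-zero b z))) (zeroʳ u)))
        values : - (b * (μ * μ)) ≡ d × b * (μ * μ * s - s ^ 3) ≡ e
        values = depressed-values {b} {d} {e} {u} {μ} {s} b≢0 eμ eu es

    -- For z₀ = z₂ = 0 the square class of Δ is that of -z₁z₃ = b²μ², which provides μ; one finite
    -- root provides s, and it exists because four roots cannot all be at infinity.
    split-form : ∀ {f} → lead f ≡ 0# → f ≋ fourRootsRep → Σ[ p ∈ Carrier × (Carrier × Carrier) ] ((proj₁ p ≢ 0# × proj₁ (proj₂ p) ≢ 0#) × splitCubic p ≡ f)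
    split-form {f@(⟨ _ , b , c , d , e ⟩)} refl h = go c h (mid≡0-stable {fourRootsRep} {f} (≋-sym h) refl)
      where
      go : ∀ c → ⟨ 0# , b , c , d , e ⟩ ≋ fourRootsRep → c ≡ 0# →
           Σ[ p ∈ Carrier × (Carrier × Carrier) ] ((proj₁ p ≢ 0# × proj₁ (proj₂ p) ≢ 0#) × splitCubic p ≡ ⟨ 0# , b , c , d , e ⟩)
      go _ h refl = assemble b d e (matrix≢0 {g} refl nd) (square-matrix {g} refl nd (Δ-square-stable (≋-sym h) fourRoots-Δ))
                      (finite-root {g} (roots-stable (≋-sym h) fourRoots-card))
        where
        g : Quartic
        g = ⟨ 0# , b , 0# , d , e ⟩
        nd : NonDeg g
        nd = nondeg-stable (≋-sym h) fourRoots-nondeg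

    -- Each form arises from six triples (b, μ, s): two signs of μ and three choices of the root s.
    fourRoots-at-∞-card : ∃[ K ] (Card (λ f → lead f ≡ 0# × f ≋ fourRootsRep) K × K ℕ.* 6 ≡ m ℕ.* (m ℕ.* order))
    fourRoots-at-∞-card = card-fibres _≟⁵_ {R = λ p f → (proj₁ p ≢ 0# × proj₁ (proj₂ p) ≢ 0#) × splitCubic p ≡ f}
        (card-bij (λ p → p , splitCubic p) (card-Σ {Q = λ _ (μ , _) → μ ≢ 0#} units (λ _ → card-⇔ proj₁ (_, tt) (card-Σ {Q = λ _ _ → ⊤} units (λ _ → all))))
          (λ h → h , refl) (λ _ _ → cong proj₁) (λ { {p , _} (h , refl) → p , h , refl }))
        (λ { {b , (μ , s)} ((hb , hμ) , refl) → refl , splitCubic-orbit hb hμ })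
        (λ (z , h) → split-form z h)
        (λ (z , h) → fibre (split-form z h))
      where
      fibre : ∀ {f} → Σ[ p ∈ Carrier × (Carrier × Carrier) ] ((proj₁ p ≢ 0# × proj₁ (proj₂ p) ≢ 0#) × splitCubic p ≡ f) →
              Card (λ p → (proj₁ p ≢ 0# × proj₁ (proj₂ p) ≢ 0#) × splitCubic p ≡ f) 6
      fibre ((b , (μ , s)) , (hb , hμ) , refl) = card-bij (b ,_)
          (card-Σ {Q = λ μ′ s′ → s′ ^ 3 - μ * μ * s′ ≡ s ^ 3 - μ * μ * s} (square-fibre-card hμ) (λ _ → shifts))
          (λ { {μ′ , s′} (e , e′) → (hb , λ { refl → *-≢0 hμ hμ (trans (sym e) (zeroˡ 0#)) }) ,
             cong₂ (λ d e → ⟨ 0# , b , 0# , d , e ⟩) (cong (λ u → - (b * u)) e) (lin₂ (b * s′) (- b) e e′ (solve (b ∷ μ ∷ s ∷ μ′ ∷ s′ ∷ []) λ b μ s μ′ s′ →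
               b :* (μ′ :* μ′ :* s′ :- s′ E.^ 3) :- b :* (μ :* μ :* s :- s E.^ 3) :≡ b :* s′ :* (μ′ :* μ′ :- μ :* μ) :+ :- b :* ((s′ E.^ 3 :- μ :* μ :* s′) :- (s E.^ 3 :- μ :* μ :* s)))) })
          (λ { _ _ refl → refl })
          (λ { {b′ , (μ′ , s′)} ((hb′ , hμ′) , e) → conv b′ μ′ s′ (cong (Vec.head ∘ Vec.tail) e)
                (cong (Vec.head ∘ Vec.tail ∘ Vec.tail ∘ Vec.tail) e) (cong (Vec.head ∘ Vec.tail ∘ Vec.tail ∘ Vec.tail ∘ Vec.tail) e) })
        where
        conv : ∀ b′ μ′ s′ → b′ ≡ b → - (b′ * (μ′ * μ′)) ≡ - (b * (μ * μ)) → b′ * (μ′ * μ′ * s′ - s′ ^ 3) ≡ b * (μ * μ * s - s ^ 3) →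
               Σ[ u ∈ Carrier × Carrier ] ((proj₁ u * proj₁ u ≡ μ * μ × proj₂ u ^ 3 - μ * μ * proj₂ u ≡ s ^ 3 - μ * μ * s) × (b , u) ≡ (b′ , (μ′ , s′)))
        conv _ μ′ s′ refl h₁ h₂ = (μ′ , s′) ,
          (*-cancelˡ hb (lin₁ (- 1#) h₁ (solve (b ∷ μ ∷ μ′ ∷ []) λ b μ μ′ → b :* (μ′ :* μ′) :- b :* (μ :* μ) :≡ :- :1 :* (:- (b :* (μ′ :* μ′)) :- :- (b :* (μ :* μ))))) ,
           *-cancelˡ hb (lin₂ (- s′) (- 1#) h₁ h₂ (solve (b ∷ μ ∷ μ′ ∷ s ∷ s′ ∷ []) λ b μ μ′ s s′ →
             b :* (s′ E.^ 3 :- μ :* μ :* s′) :- b :* (s E.^ 3 :- μ :* μ :* s) :≡ :- s′ :* (:- (b :* (μ′ :* μ′)) :- :- (b :* (μ :* μ))) :+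
               :- :1 :* (b :* (μ′ :* μ′ :* s′ :- s′ E.^ 3) :- b :* (μ :* μ :* s :- s E.^ 3))))) , refl
        shifts : Card (λ s′ → s′ ^ 3 - μ * μ * s′ ≡ s ^ 3 - μ * μ * s) 3
        shifts = shift-by (quotient hμ s)
          where
          shift-by : ∃[ v ] μ * v ≡ s → Card (λ s′ → s′ ^ 3 - μ * μ * s′ ≡ s ^ 3 - μ * μ * s) 3
          shift-by (v , refl) = card-bij (μ *_) (℘-fibre-card v)
            (λ {w} e → lin₁ (μ ^ 3) e (solve (μ ∷ w ∷ v ∷ []) λ μ w v → ((μ :* w) E.^ 3 :- μ :* μ :* (μ :* w)) :- ((μ :* v) E.^ 3 :- μ :* μ :* (μ :* v)) :≡
               μ E.^ 3 :* ((w E.^ 3 :- w) :- (v E.^ 3 :- v))))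
            (λ _ _ → *-cancelˡ hμ)
            (λ {s′} e → case quotient hμ s′ of λ { (w , refl) → w , *-cancelˡ (^-≢0 3 hμ) (lin₁ 1# e (solve (μ ∷ w ∷ v ∷ []) λ μ w v →
               μ E.^ 3 :* (w E.^ 3 :- w) :- μ E.^ 3 :* (v E.^ 3 :- v) :≡ :1 :* (((μ :* w) E.^ 3 :- μ :* μ :* (μ :* w)) :- ((μ :* v) E.^ 3 :- μ :* μ :* (μ :* v))))) , refl })

    fourRoots≉oneRoot : ¬ fourRootsRep ≋ oneRootRep
    fourRoots≉oneRoot e = case card-unique (roots-stable e fourRoots-card) oneRoot-card id id of λ ()

    fourRoots-rooted : ∀ {f} → f ≋ fourRootsRep → Rooted f
    fourRoots-rooted {f} e = rooted-stable {fourRootsRep} {f} (≋-sym e) (inj₁ refl)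

    oneRoot-rooted : ∀ {f} → f ≋ oneRootRep → Rooted f
    oneRoot-rooted {f} e = rooted-stable {oneRootRep} {f} (≋-sym e) (inj₁ refl)

    fourRoots-size : Size (_≋ fourRootsRep) 24
    fourRoots-size = let K , c , e = fourRoots-at-∞-card
                         N , c′ , e′ = flags {_≋ fourRootsRep} {4} (λ e h → ≋-trans (≋-sym e) h) fourRoots-rooted (λ e → roots-stable (≋-sym e) fourRoots-card) c
                     in N , c′ , rearrange {N} 4 6 e′ e

    -- A complement: in units of (q - 1)²q, the forms with root at infinity, z₂ = 0 and nonzero
    -- square determinant make up 1/2, and those with four roots 1/6, which leaves 1/3.
    oneRoot-at-∞-card : ∃[ K ] (Card (λ f → lead f ≡ 0# × f ≋ oneRootRep) K × K ℕ.* 3 ≡ m ℕ.* (m ℕ.* order))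
    oneRoot-at-∞-card =
      let K , c , e = fourRoots-at-∞-card
          K′ , c′ , e′ = card-∖ _≟⁵_ (matrix-at-∞-card (proj₁ {B = λ _ → _}) squares) c
                           (λ {f} (z , h) → let z′ = mid≡0-stable {fourRootsRep} {f} (≋-sym h) refl ; nd = nondeg-stable (≋-sym h) fourRoots-nondeg in
                              z , z′ , matrix≢0 {f} z′ nd , square-matrix {f} z′ nd (Δ-square-stable (≋-sym h) fourRoots-Δ))
      in K′ , card-⇔ (λ {f} ((z , z′ , h , sq) , not-four) → z ,
                       [ (λ four → ⊥-elim (not-four (z , four))) , id ]′ (square-orbits {f} (nondeg-matrix {f} z′ h) (matrix-square {f} z′ sq) (mid≡0-J {f} z′) (inj₁ z)))
                     (λ {f} (z , h) → let z′ = mid≡0-stable {oneRootRep} {f} (≋-sym h) refl ; nd = nondeg-stable (≋-sym h) oneRoot-nondeg in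
                       (z , z′ , matrix≢0 {f} z′ nd , square-matrix {f} z′ nd (Δ-square-stable (≋-sym h) oneRoot-Δ)) ,
                       λ (_ , h′) → fourRoots≉oneRoot (≋-trans (≋-sym h′) h)) c′ ,
         arithmetic K K′ _ (m ℕ.* (half ℕ.* order)) e e′ half-factor
      where
      arithmetic : ∀ K K′ X H → K ℕ.* 6 ≡ X → K′ ℕ.+ K ≡ H → H ℕ.* 2 ≡ X → K′ ℕ.* 3 ≡ X
      arithmetic K K′ _ _ refl refl h = trans (cong (ℕ._* 3) (ℕ.*-cancelʳ-≡ K′ (K ℕ.* 2) 2 (ℕ.+-cancelʳ-≡ (K ℕ.* 2) (K′ ℕ.* 2) (K ℕ.* 2 ℕ.* 2)
        (trans (ℕSolver.solve 2 (λ K K′ → K′ ℕ⊗ ℕ# 2 ℕ⊕ K ℕ⊗ ℕ# 2 ℕ≐ (K′ ℕ⊕ K) ℕ⊗ ℕ# 2) refl K K′)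
          (trans h (ℕSolver.solve 1 (λ K → K ℕ⊗ ℕ# 6 ℕ≐ K ℕ⊗ ℕ# 2 ℕ⊗ ℕ# 2 ℕ⊕ K ℕ⊗ ℕ# 2) refl K))))))
        (ℕ.*-assoc K 2 3)

    oneRoot-size : Size (_≋ oneRootRep) 3
    oneRoot-size = let K , c , e = oneRoot-at-∞-card
                       N , c′ , e′ = flags {_≋ oneRootRep} {1} (λ e h → ≋-trans (≋-sym e) h) oneRoot-rooted (λ e → roots-stable (≋-sym e) oneRoot-card) c
                   in N , c′ , rearrange {N} 1 3 e′ e

    prod-size : ∀ {μ} → NonzeroSquare μ → μ ≢ 1# → Size (Prod μ) 4
    prod-size sq h = let N , c , e = prod-card h (conic-card sq h) in N , c ,
      trans e (ℕSolver.solve 2 (λ q m → q ℕ⊗ m ℕ⊗ (m ℕ⊗ (q ℕ⊕ ℕ# 1)) ℕ≐ m ℕ⊗ (q ℕ⊗ (m ℕ⊗ (q ℕ⊕ ℕ# 1)))) refl order m)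

    prod-size-0 : Size (Prod 0#) 8
    prod-size-0 = let N , c , e = prod-card 0≢1 conic-card-0 in N , c ,
      trans (sym (ℕ.*-assoc N 4 2)) (trans (cong (ℕ._* 2) e)
        (trans (ℕSolver.solve 3 (λ q m k → q ℕ⊗ m ℕ⊗ (k ℕ⊗ (q ℕ⊕ ℕ# 1)) ℕ⊗ ℕ# 2 ℕ≐ (k ℕ⊕ k) ℕ⊗ (q ℕ⊗ (m ℕ⊗ (q ℕ⊕ ℕ# 1)))) refl order m half)
          (cong (ℕ._* G) (sym m≡half+half))))

  Irreducible-J : Carrier → Quartic → Set
  Irreducible-J r f = J r f × ¬ IsSquare (Δ f) × ¬ Rooted f

  opaque
    J-Δ-nonsquare : ∀ {r f} → ¬ IsSquare r → NonDeg f → J r f → ¬ IsSquare (Δ f)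
    J-Δ-nonsquare {r} {f} ns nd j sq = square-*-nonsquare sq nd ns (subst IsSquare (trans j (*-comm r _))
      (mid f ^ 3 , solve (mid f ∷ []) λ c → c E.^ 3 :* c E.^ 3 :≡ c E.^ 6))

    -- The forms with a root, two roots each, take half of all forms with ȷ = r. The rest is this
    -- class.
    irreducible-size : ∀ {r} → ¬ IsSquare r → Size (Irreducible-J r) 2
    irreducible-size {r} ns =
      let r≢0 = nonsquare-≢0 ns
          N , c , e = rooted-size r≢0 (rootedRep-roots₂ ns)
          N′ , c′ , e′ = card-∖ _≟⁵_ (total-card r≢0) c (λ (nd , j , _) → nd , j)
      in N′ , card-⇔ (λ {f} ((nd , j) , nr) → j , J-Δ-nonsquare {r} {f} ns nd j , λ rt → nr (nd , j , rt))
                     (λ (j , nsΔ , nr) → (nonsquare-≢0 nsΔ , j) , λ (_ , _ , rt) → nr rt) c′ ,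
         ℕ.+-cancelʳ-≡ (N ℕ.* 2) _ _ (trans (sym (ℕ.*-distribʳ-+ 2 N′ N)) (trans (cong (ℕ._* 2) e′)
           (trans (ℕSolver.solve 1 (λ x → x ℕ⊗ ℕ# 2 ℕ≐ x ℕ⊕ x) refl (m ℕ.* G)) (cong (m ℕ.* G ℕ.+_) (sym e)))))

    irreducible-size-0 : Size (Irreducible-J 0#) 4
    irreducible-size-0 =
      let N , c , e = twoRoots-size
          N′ , c′ , e′ = card-∖ _≟⁵_ (matrix-card nonsquare-≢0 nonsquares) c
            (λ {f} (z , ns , _) → z , ns ∘ matrix-square {f} z)
      in N′ , card-⇔ (λ {f} ((z , ns) , nr) → let nsΔ = ns ∘ square-matrix {f} z (nondeg-matrix {f} z (nonsquare-≢0 ns)) in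
                        mid≡0-J {f} z , nsΔ , λ rt → nr (z , nsΔ , rt))
                     (λ {f} (j , nsΔ , nr) → (J-mid≡0 {f} j , nsΔ ∘ matrix-square {f} (J-mid≡0 {f} j)) , λ (_ , _ , rt) → nr rt) c′ ,
         ℕ.+-cancelʳ-≡ (N ℕ.* 4) _ _ (trans (sym (ℕ.*-distribʳ-+ 4 N′ N)) (trans (cong (ℕ._* 4) e′)
           (trans (ℕSolver.solve 2 (λ k g → k ℕ⊗ g ℕ⊗ ℕ# 4 ℕ≐ (k ℕ⊕ k) ℕ⊗ g ℕ⊕ (k ℕ⊕ k) ℕ⊗ g) refl half G)
             (trans (cong (λ u → u ℕ.* G ℕ.+ u ℕ.* G) (sym m≡half+half)) (cong (m ℕ.* G ℕ.+_) (sym e))))))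

    -- The three known orbits already account for all forms of square discriminant.
    square-exhaustion : ∀ {f} → J 0# f → NonDeg f → IsSquare (Δ f) → Rooted f ⊎ Prod 0# f
    square-exhaustion {f} j nd sq =
      let N₄ , c₄ , e₄ = fourRoots-size
          N₁ , c₁ , e₁ = oneRoot-size
          N₀ , c₀ , e₀ = prod-size-0
          union = card-⊎ (card-⊎ c₄ c₁ (λ h h′ → fourRoots≉oneRoot (≋-trans (≋-sym h) h′))) c₀
                    (λ { (inj₁ h) P → prod-rootless P (fourRoots-rooted h) ; (inj₂ h) P → prod-rootless P (oneRoot-rooted h) })
          z = J-mid≡0 {f} j
      in case card-⊆-≡ _≟⁵_ (subst (Card _) (count N₄ N₁ N₀ e₄ e₁ e₀) union) (matrix-card (proj₁ {B = λ _ → _}) squares) included (z , matrix≢0 {f} z nd , square-matrix {f} z nd sq) of λ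
        { (inj₁ (inj₁ h)) → inj₁ (fourRoots-rooted h) ; (inj₁ (inj₂ h)) → inj₁ (oneRoot-rooted h) ; (inj₂ P) → inj₂ P }
      where
      included : ∀ {f} → (f ≋ fourRootsRep ⊎ f ≋ oneRootRep) ⊎ Prod 0# f → mid f ≡ 0# × NonzeroSquare (matrix f)
      included {f} (inj₁ (inj₁ h)) = let z = mid≡0-stable {fourRootsRep} {f} (≋-sym h) refl ; nd = nondeg-stable (≋-sym h) fourRoots-nondeg in
        z , matrix≢0 {f} z nd , square-matrix {f} z nd (Δ-square-stable (≋-sym h) fourRoots-Δ)
      included {f} (inj₁ (inj₂ h)) = let z = mid≡0-stable {oneRootRep} {f} (≋-sym h) refl ; nd = nondeg-stable (≋-sym h) oneRoot-nondeg in
        z , matrix≢0 {f} z nd , square-matrix {f} z nd (Δ-square-stable (≋-sym h) oneRoot-Δ)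
      included {f} (inj₂ P) = let z = J-mid≡0 {f} (prod-J P (solve [] (:0 E.^ 3 :≡ :0 :* (:0 :- :1) E.^ 2))) ; nd = prod-nondeg 0≢1 P in
        z , matrix≢0 {f} z nd , square-matrix {f} z nd (prod-Δ-square P)
      -- 1/24 + 1/3 + 1/8 = 1/2, and `half` is (q - 1)/2.
      count : ∀ N₄ N₁ N₀ → N₄ ℕ.* 24 ≡ m ℕ.* G → N₁ ℕ.* 3 ≡ m ℕ.* G → N₀ ℕ.* 8 ≡ m ℕ.* G → N₄ ℕ.+ N₁ ℕ.+ N₀ ≡ half ℕ.* G
      count N₄ N₁ N₀ e₄ e₁ e₀ = ℕ.*-cancelʳ-≡ _ _ 24 (trans (ℕSolver.solve 3 (λ a b c → (a ℕ⊕ b ℕ⊕ c) ℕ⊗ ℕ# 24 ℕ≐ a ℕ⊗ ℕ# 24 ℕ⊕ b ℕ⊗ ℕ# 3 ℕ⊗ ℕ# 8 ℕ⊕ c ℕ⊗ ℕ# 8 ℕ⊗ ℕ# 3) refl N₄ N₁ N₀)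
        (trans (cong₂ ℕ._+_ (cong₂ ℕ._+_ e₄ (cong (ℕ._* 8) e₁)) (cong (ℕ._* 3) e₀))
          (trans (cong (λ u → u ℕ.* G ℕ.+ u ℕ.* G ℕ.* 8 ℕ.+ u ℕ.* G ℕ.* 3) m≡half+half)
            (ℕSolver.solve 2 (λ k g → (k ℕ⊕ k) ℕ⊗ g ℕ⊕ (k ℕ⊕ k) ℕ⊗ g ℕ⊗ ℕ# 8 ℕ⊕ (k ℕ⊕ k) ℕ⊗ g ℕ⊗ ℕ# 3 ℕ≐ k ℕ⊗ g ℕ⊗ ℕ# 24) refl half G))))

    -- With a single root per form the rooted class has (q - 1)|G| vectors, the number of all forms
    -- with this ȷ.
    J₁-exhaustion : ∀ {r} → r ≢ 0# → Card (Root (rootedRep r)) 1 → ∀ {f} → NonDeg f → J r f → Rooted f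
    J₁-exhaustion {r} r≢0 c {f} nd j = let N , c′ , e = rooted-size r≢0 c in
      proj₂ (proj₂ (card-⊆-≡ _≟⁵_ (subst (Card (RootedClass r)) (trans (sym (ℕ.*-identityʳ N)) e) c′) (total-card r≢0) (λ (nd , j , _) → nd , j) {f} (nd , j)))

  Ratio : Carrier → Carrier → Set
  Ratio r μ = μ ^ 3 ≡ r * (μ - 1#) ^ 2

  opaque
    -- μ = 1 + 1/(sw) turns the equation into w³ - w = -1/s³
    ratio-card : ∀ {s} → s ≢ 0# → Tr n (s ⁻¹) ≡ 0# → Card (Ratio (s * s)) 3
    ratio-card {s} s≢0 tr≡0 = from-root (Tr≡0⇒℘ { - (s ⁻¹ ^ 3)} (trans (Tr-neg _) (trans (cong -_ (trans (Tr-frobenius (s ⁻¹)) tr≡0)) -0#≈0#)))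
      where
      σ : Carrier
      σ = s ⁻¹
      sσ : s * σ ≡ 1#
      sσ = inverseʳ s≢0
      Target : Carrier → Set
      Target w = ℘ w ≡ - (σ ^ 3)
      w≢0 : ∀ {w} → Target w → w ≢ 0#
      w≢0 e refl = ^-≢0 3 (⁻¹-≢0 s≢0) (lin₁ 1# e (solve (σ ∷ []) λ σ → σ E.^ 3 :- :0 :≡ :1 :* ((:0 E.^ 3 :- :0) :- :- (σ E.^ 3))))
      μ≢1 : ∀ {μ} → Ratio (s * s) μ → μ - 1# ≢ 0#
      μ≢1 {μ} e z = 1≢0 (lin₂ 1# (s * s * (μ - 1#) - (μ * μ + μ + 1#)) e z (solve (s ∷ μ ∷ []) λ s μ →
        :1 :- :0 :≡ :1 :* (μ E.^ 3 :- s :* s :* (μ :- :1) E.^ 2) :+ (s :* s :* (μ :- :1) :- (μ :* μ :+ μ :+ :1)) :* (μ :- :1 :- :0)))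
      from-root : ∃[ w ] Target w → Card (Ratio (s * s)) 3
      from-root (v , ev) = card-inverse (λ w → 1# + σ * w ⁻¹) (λ μ → σ * (μ - 1#) ⁻¹)
        (card-⇔ (λ e → trans e ev) (λ e → trans e (sym ev)) (℘-fibre-card v))
        (λ {w} e → lin₃ (w ⁻¹ ^ 3) (w ⁻¹ ^ 2 - (w ^ 2 * w ⁻¹ ^ 2 + w * w ⁻¹ + 1#)) (- (w ⁻¹ ^ 2 * (s * σ + 1#))) e (inverseʳ (w≢0 e)) sσ
          (solve (s ∷ σ ∷ w ∷ w ⁻¹ ∷ []) λ s σ w x → let μ = :1 :+ σ :* x in
            μ E.^ 3 :- s :* s :* (μ :- :1) E.^ 2 :≡ x E.^ 3 :* ((w E.^ 3 :- w) :- :- (σ E.^ 3)) :+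
              (x E.^ 2 :- (w E.^ 2 :* x E.^ 2 :+ w :* x :+ :1)) :* (w :* x :- :1) :+ :- (x E.^ 2 :* (s :* σ :+ :1)) :* (s :* σ :- :1)))
        (λ {μ} e → let t = μ - 1# ; y = t ⁻¹ in lin₃ (σ ^ 3 * y ^ 3) (σ * y * (s * σ * (t * y) + 1#) - σ ^ 3 * (t ^ 2 * y ^ 2 + t * y + 1#)) (σ * y * (s * σ * (t * y) + 1#) * (t * y)) e (inverseʳ (μ≢1 e)) sσ
          (solve (s ∷ σ ∷ μ ∷ y ∷ []) λ s σ μ y → let t = μ :- :1 in
            ((σ :* y) E.^ 3 :- σ :* y) :- :- (σ E.^ 3) :≡ (σ E.^ 3 :* y E.^ 3) :* (μ E.^ 3 :- s :* s :* t E.^ 2) :+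
              (σ :* y :* (s :* σ :* (t :* y) :+ :1) :- σ E.^ 3 :* (t E.^ 2 :* y E.^ 2 :+ t :* y :+ :1)) :* (t :* y :- :1) :+
              (σ :* y :* (s :* σ :* (t :* y) :+ :1) :* (t :* y)) :* (s :* σ :- :1)))
        (λ {w} e → let T = 1# + σ * w ⁻¹ - 1# ; T≢0 = T-nonzero w (w≢0 e) in
          *-cancelˡ T≢0 (lin₂ σ (- σ) (inverseʳ T≢0) (inverseʳ (w≢0 e)) (solve (σ ∷ w ∷ w ⁻¹ ∷ T ⁻¹ ∷ []) λ σ w x T′ → let T = :1 :+ σ :* x :- :1 in
            T :* (σ :* T′) :- T :* w :≡ σ :* (T :* T′ :- :1) :+ :- σ :* (w :* x :- :1))))
        (λ {μ} e → let u = σ * (μ - 1#) ⁻¹ ; u≢0 = *-≢0 (⁻¹-≢0 s≢0) (⁻¹-≢0 (μ≢1 e)) in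
          *-cancelˡ u≢0 (lin₂ σ (- σ) (inverseʳ u≢0) (inverseʳ (μ≢1 e)) (solve (σ ∷ μ ∷ (μ - 1#) ⁻¹ ∷ u ⁻¹ ∷ []) λ σ μ y u′ → let u = σ :* y in
            u :* (:1 :+ σ :* u′) :- u :* μ :≡ σ :* (u :* u′ :- :1) :+ :- σ :* ((μ :- :1) :* y :- :1))))
        where
        T-nonzero : ∀ w → w ≢ 0# → 1# + σ * w ⁻¹ - 1# ≢ 0#
        T-nonzero w h z = *-≢0 (⁻¹-≢0 s≢0) (⁻¹-≢0 h) (trans (solve (σ ∷ w ⁻¹ ∷ []) λ σ x → σ :* x :≡ :1 :+ σ :* x :- :1) z)

    ratio-≢0 : ∀ {r μ} → r ≢ 0# → Ratio r μ → μ ≢ 0#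
    ratio-≢0 {r} r≢0 e refl = r≢0 (lin₁ (- 1#) e (solve (r ∷ []) λ r → r :- :0 :≡ :- :1 :* (:0 E.^ 3 :- r :* (:0 :- :1) E.^ 2)))

    ratio-≢1 : ∀ {r μ} → Ratio r μ → μ ≢ 1#
    ratio-≢1 {r} e refl = 1≢0 (lin₁ 1# e (solve (r ∷ []) λ r → :1 :- :0 :≡ :1 :* (:1 E.^ 3 :- r :* (:1 :- :1) E.^ 2)))

    ratio-square : ∀ {s μ} → s ≢ 0# → Ratio (s * s) μ → IsSquare μ
    ratio-square {s} {μ} s≢0 e = square-ratio (ratio-≢0 (*-≢0 s≢0 s≢0) e) (s * (μ - 1#) , lin₁ (- 1#) e (solve (s ∷ μ ∷ []) λ s μ →
      (s :* (μ :- :1)) :* (s :* (μ :- :1)) :- μ :* (μ :* μ) :≡ :- :1 :* (μ E.^ 3 :- s :* s :* (μ :- :1) E.^ 2)))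

    -- The rooted class takes a quarter of the forms and each of the three solutions μ another
    -- quarter; distinct μ give disjoint classes by `prod-unique`.
    J₄-exhaustion : ∀ {s} → s ≢ 0# → Tr n (s ⁻¹) ≡ 0# → ∀ {f} → NonDeg f → J (s * s) f → Rooted f ⊎ ∃[ μ ] (Ratio (s * s) μ × Prod μ f)
    J₄-exhaustion {s} s≢0 tr≡0 {f} nd j =
      let r≢0 = *-≢0 s≢0 s≢0
          N , c , e = rooted-size r≢0 (rootedRep-roots₄ s≢0 tr≡0)
          flagged = card-Σ {Q = λ μ f → Prod μ f} (ratio-card s≢0 tr≡0) (λ {μ} h → fibre {N} e (prod-size (ratio-≢0 r≢0 h , ratio-square s≢0 h) (ratio-≢1 h)))
          products = card-bij {Q = λ f → ∃[ μ ] (Ratio (s * s) μ × Prod μ f)} proj₂ flagged (λ {u} h → proj₁ u , h)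
            (λ { {μ , f} {μ′ , _} (h , P) (_ , P′) refl → cong (_, f) (prod-unique (prod-nondeg (ratio-≢1 h) P) P P′) })
            (λ { {f} (μ , h) → (μ , f) , h , refl })
          union = card-⊎ c products (λ { (_ , _ , rt) (_ , _ , P) → prod-rootless P rt })
      in Sum.map₁ (λ (_ , _ , rt) → rt) (card-⊆-≡ _≟⁵_
           (subst (Card _) (trans (ℕSolver.solve 1 (λ N → N ℕ⊕ ℕ# 3 ℕ⊗ N ℕ≐ N ℕ⊗ ℕ# 4) refl N) e) union) (total-card r≢0)
           (λ { (inj₁ (nd , j , _)) → nd , j ; (inj₂ (μ , h , P)) → prod-nondeg (ratio-≢1 h) P , prod-J P h }) {f} (nd , j))
      where
      fibre : ∀ {N μ} → N ℕ.* 4 ≡ m ℕ.* G → Size (Prod μ) 4 → Card (Prod μ) N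
      fibre {N} e (N′ , c , e′) = subst (Card _) (ℕ.*-cancelʳ-≡ N′ N 4 (trans e′ (sym e))) c

-- Factorisation types, recognised by roots and the square class of Δ

module FactorTypes (F : Field) (n : ℕ) (hs : HasSize F (3 ℕ.^ n)) where
  open ClassSizes F n hs public
  open Theory F public using (Irreducible; 𝓕₁; 𝓕₂; 𝓕₄; 𝓕₂′; 𝓕₄′) renaming (_⊗_ to infixr 7 _⊗ˡ_)

  private
    Poly : Set
    Poly = List Carrier


    length₂ : ∀ {l : Poly} → length l ≡ 2 → ∃[ a ] ∃[ b ] l ≡ ⟨ a , b ⟩₂
    length₂ {⟨ a , b ⟩₂} refl = a , b , refl

    length₃ : ∀ {l : Poly} → length l ≡ 3 → ∃[ a ] ∃[ b ] ∃[ c ] l ≡ ⟨ a , b , c ⟩₃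
    length₃ {⟨ a , b , c ⟩₃} refl = a , b , c , refl

    length₄ : ∀ {l : Poly} → length l ≡ 4 → ∃[ a ] ∃[ b ] ∃[ c ] ∃[ d ] l ≡ ⟨ a , b , c , d ⟩₄
    length₄ {⟨ a , b , c , d ⟩₄} refl = a , b , c , d , refl

  NonzeroPair : Carrier → Carrier → Set
  NonzeroPair a b = ¬ (a ≡ 0# × b ≡ 0#)

  Root₁ : Carrier → Carrier → Maybe Carrier → Set
  Root₁ a b nothing  = a ≡ 0#
  Root₁ a b (just t) = a * t + b ≡ 0#

  Root₃ : Carrier → Carrier → Carrier → Carrier → Maybe Carrier → Set
  Root₃ a b c d nothing  = a ≡ 0#
  Root₃ a b c d (just t) = a * t ^ 3 + b * t ^ 2 + c * t + d ≡ 0#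

  _·_ : Carrier × Carrier → Carrier × Carrier → Quadratic
  (a , b) · (c , d) = ⟨ a * c , a * d + b * c , b * d ⟩₃

  opaque
    root₁ : ∀ {a b} → NonzeroPair a b → ∃[ P ] (Root₁ a b P × (∀ P′ → Root₁ a b P′ → P′ ≡ P))
    root₁ {a} {b} nz = choose (a ≟ᶠ 0#)
      where
      choose : Dec (a ≡ 0#) → ∃[ P ] (Root₁ a b P × (∀ P′ → Root₁ a b P′ → P′ ≡ P))
      choose (yes refl) = nothing , refl , λ { nothing _ → refl ; (just t) z → ⊥-elim (nz (refl ,
        lin₁ 1# z (solve (b ∷ t ∷ []) λ b t → b :- :0 :≡ :1 :* (:0 :* t :+ b :- :0)))) }
      choose (no h) = go (quotient h (- b))
        where
        go : ∃[ t ] a * t ≡ - b → ∃[ P ] (Root₁ a b P × (∀ P′ → Root₁ a b P′ → P′ ≡ P))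
        go (t , e) = just t , trans (cong (_+ b) e) (-‿inverseˡ b) , λ { nothing z → ⊥-elim (h z) ; (just t′) z → cong just (*-cancelˡ h
          (lin₂ 1# (- 1#) z e (solve (a ∷ b ∷ t ∷ t′ ∷ []) λ a b t t′ → a :* t′ :- a :* t :≡ :1 :* (a :* t′ :+ b :- :0) :+ :- :1 :* (a :* t :- :- b)))) }

    common-root : ∀ {a b c d P} → Root₁ a b P → Root₁ c d P → a * d - b * c ≡ 0#
    common-root {b = b} {d = d} {P = nothing} refl refl = solve (b ∷ d ∷ []) λ b d → :0 :* d :- b :* :0 :≡ :0
    common-root {a} {b} {c} {d} {just t} z z′ = lin₂ (- c) a z z′ (solve (a ∷ b ∷ c ∷ d ∷ t ∷ []) λ a b c d t →
      a :* d :- b :* c :- :0 :≡ :- c :* (a :* t :+ b :- :0) :+ a :* (c :* t :+ d :- :0))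

    root-product : ∀ {f a b c d e g} → coeffs f ≡ ⟨ a , b ⟩₂ ⊗ˡ ⟨ c , d , e , g ⟩₄ → ∀ P → Root f P → Root₁ a b P ⊎ Root₃ c d e g P
    root-product {⟨ _ , _ , _ , _ , _ ⟩} {a} {b} {c} {d} {e} {g} refl nothing z = *-zero-split (trans (sym (+-identityʳ _)) z)
    root-product {⟨ _ , _ , _ , _ , _ ⟩} {a} {b} {c} {d} {e} {g} refl (just t) z = *-zero-split (trans
      (solve (a ∷ b ∷ c ∷ d ∷ e ∷ g ∷ t ∷ []) λ a b c d e g t → (a :* t :+ b) :* (c :* t E.^ 3 :+ d :* t E.^ 2 :+ e :* t :+ g) :≡
        E.ev (⟨ a :* c :+ :0 , a :* d :+ (b :* c :+ :0) , a :* e :+ b :* d , a :* g :+ b :* e , b :* g ⟩) t) z)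

    product-root : ∀ {f a b c d e g} → coeffs f ≡ ⟨ a , b ⟩₂ ⊗ˡ ⟨ c , d , e , g ⟩₄ → ∀ P → Root₁ a b P ⊎ Root₃ c d e g P → Root f P
    product-root {⟨ _ , _ , _ , _ , _ ⟩} {a} {b} {c} {d} {e} {g} refl nothing z = trans (+-identityʳ _) ([ (λ h → trans (cong (_* c) h) (zeroˡ c)) , times-zero a ]′ z)
    product-root {⟨ _ , _ , _ , _ , _ ⟩} {a} {b} {c} {d} {e} {g} refl (just t) z = trans
      (solve (a ∷ b ∷ c ∷ d ∷ e ∷ g ∷ t ∷ []) λ a b c d e g t →
        E.ev (⟨ a :* c :+ :0 , a :* d :+ (b :* c :+ :0) , a :* e :+ b :* d , a :* g :+ b :* e , b :* g ⟩) t :≡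
        (a :* t :+ b) :* (c :* t E.^ 3 :+ d :* t E.^ 2 :+ e :* t :+ g))
      ([ (λ h → trans (cong (_* (c * t ^ 3 + d * t ^ 2 + e * t + g)) h) (zeroˡ _)) , times-zero (a * t + b) ]′ z)

    divide₄ : ∀ {f} P → Root f P → ∃[ a ] ∃[ b ] ∃[ c ] ∃[ d ] ∃[ e ] ∃[ g ] (NonzeroPair a b × coeffs f ≡ ⟨ a , b ⟩₂ ⊗ˡ ⟨ c , d , e , g ⟩₄)
    divide₄ {⟨ _ , z1 , z2 , z3 , z4 ⟩} nothing refl = 0# , 1# , z1 , z2 , z3 , z4 , (λ (_ , z) → 1≢0 z) ,
      solveₗ (z1 ∷ z2 ∷ z3 ∷ z4 ∷ []) λ z1 z2 z3 z4 → (:0 ∷ z1 ∷ z2 ∷ z3 ∷ z4 ∷ []) :≡ (:0 ∷ :1 ∷ []) E.⊗ (z1 ∷ z2 ∷ z3 ∷ z4 ∷ [])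
    divide₄ {⟨ z0 , z1 , z2 , z3 , z4 ⟩} (just t) z = 1# , - t , z0 , z1 + t * z0 , z2 + t * (z1 + t * z0) , z3 + t * (z2 + t * (z1 + t * z0)) , (λ (z , _) → 1≢0 z) ,
      trans (cong (λ u → z0 ∷ z1 ∷ z2 ∷ z3 ∷ u ∷ []) (lin₁ 1# z (solve (z0 ∷ z1 ∷ z2 ∷ z3 ∷ z4 ∷ t ∷ []) λ z0 z1 z2 z3 z4 t →
          z4 :- :- t :* (z3 :+ t :* (z2 :+ t :* (z1 :+ t :* z0))) :≡ :1 :* (E.ev ⟨ z0 , z1 , z2 , z3 , z4 ⟩ t :- :0))))
        (solveₗ (z0 ∷ z1 ∷ z2 ∷ z3 ∷ t ∷ []) λ z0 z1 z2 z3 t → let c = z3 :+ t :* (z2 :+ t :* (z1 :+ t :* z0)) in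
          (z0 ∷ z1 ∷ z2 ∷ z3 ∷ :- t :* c ∷ []) :≡ (:1 ∷ :- t ∷ []) E.⊗ (z0 ∷ z1 :+ t :* z0 ∷ z2 :+ t :* (z1 :+ t :* z0) ∷ c ∷ []))

    divide₃ : ∀ {z0 z1 z2 z3} P → Root₃ z0 z1 z2 z3 P → ∃[ a ] ∃[ b ] ∃[ c ] ∃[ d ] ∃[ e ] (NonzeroPair a b × ⟨ z0 , z1 , z2 , z3 ⟩₄ ≡ ⟨ a , b ⟩₂ ⊗ˡ ⟨ c , d , e ⟩₃)
    divide₃ {_} {z1} {z2} {z3} nothing refl = 0# , 1# , z1 , z2 , z3 , (λ (_ , z) → 1≢0 z) ,
      solveₗ (z1 ∷ z2 ∷ z3 ∷ []) λ z1 z2 z3 → (:0 ∷ z1 ∷ z2 ∷ z3 ∷ []) :≡ (:0 ∷ :1 ∷ []) E.⊗ (z1 ∷ z2 ∷ z3 ∷ [])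
    divide₃ {z0} {z1} {z2} {z3} (just t) z = 1# , - t , z0 , z1 + t * z0 , z2 + t * (z1 + t * z0) , (λ (z , _) → 1≢0 z) ,
      trans (cong (λ u → z0 ∷ z1 ∷ z2 ∷ u ∷ []) (lin₁ 1# z (solve (z0 ∷ z1 ∷ z2 ∷ z3 ∷ t ∷ []) λ z0 z1 z2 z3 t →
          z3 :- :- t :* (z2 :+ t :* (z1 :+ t :* z0)) :≡ :1 :* (z0 :* t E.^ 3 :+ z1 :* t E.^ 2 :+ z2 :* t :+ z3 :- :0))))
        (solveₗ (z0 ∷ z1 ∷ z2 ∷ t ∷ []) λ z0 z1 z2 t → let c = z2 :+ t :* (z1 :+ t :* z0) in
          (z0 ∷ z1 ∷ z2 ∷ :- t :* c ∷ []) :≡ (:1 ∷ :- t ∷ []) E.⊗ (z0 ∷ z1 :+ t :* z0 ∷ c ∷ []))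

    -- For u ≠ 0 the factors are uX + (s - v)Y and X - ((v + s)/u)Y, the quadratic formula with 1/2
    -- = -1.
    divide₂ : ∀ {u v w} → IsSquare (disc₂ ⟨ u , v , w ⟩₃) → ∃[ a ] ∃[ b ] ∃[ c ] ∃[ d ] ⟨ u , v , w ⟩₃ ≡ ⟨ a , b ⟩₂ ⊗ˡ ⟨ c , d ⟩₂
    divide₂ {u} {v} {w} (s , es) = choose (u ≟ᶠ 0#)
      where
      choose : Dec (u ≡ 0#) → ∃[ a ] ∃[ b ] ∃[ c ] ∃[ d ] ⟨ u , v , w ⟩₃ ≡ ⟨ a , b ⟩₂ ⊗ˡ ⟨ c , d ⟩₂
      choose (yes refl) = 0# , 1# , v , w , solveₗ (v ∷ w ∷ []) λ v w → (:0 ∷ v ∷ w ∷ []) :≡ (:0 ∷ :1 ∷ []) E.⊗ (v ∷ w ∷ [])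
      choose (no h) = go (quotient h (- v + s)) (quotient h (- v - s))
        where
        go : ∃[ x ] u * x ≡ - v + s → ∃[ y ] u * y ≡ - v - s → ∃[ a ] ∃[ b ] ∃[ c ] ∃[ d ] ⟨ u , v , w ⟩₃ ≡ ⟨ a , b ⟩₂ ⊗ˡ ⟨ c , d ⟩₂
        go (x , ex) (y , ey) = u , u * x , 1# , y , trans (cong₂ (λ v w → u ∷ v ∷ w ∷ [])
            (lin₂ (- 1#) (- 1#) ex ey (solve (u ∷ v ∷ x ∷ y ∷ s ∷ []) λ u v x y s → v :- (u :* x :+ u :* y) :≡ :- :1 :* (u :* x :- (:- v :+ s)) :+ :- :1 :* (u :* y :- (:- v :- s))))
            (*-cancelˡ h (lin₃ (- (u * y)) (v - s) 1# ex ey es (solve (u ∷ v ∷ w ∷ x ∷ y ∷ s ∷ []) λ u v w x y s →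
               u :* w :- u :* (u :* x :* y) :≡ :- (u :* y) :* (u :* x :- (:- v :+ s)) :+ (v :- s) :* (u :* y :- (:- v :- s)) :+ :1 :* (s :* s :- E.disc₂ ⟨ u , v , w ⟩₃)))))
          (solveₗ (u ∷ x ∷ y ∷ []) λ u x y → (u ∷ u :* x :+ u :* y ∷ u :* x :* y ∷ []) :≡ (u ∷ u :* x ∷ []) E.⊗ (:1 ∷ y ∷ []))

    disc₂-· : ∀ a b c d → disc₂ ((a , b) · (c , d)) ≡ (a * d - b * c) * (a * d - b * c)
    disc₂-· a b c d = solve (a ∷ b ∷ c ∷ d ∷ []) λ a b c d → E.disc₂ ⟨ a :* c , a :* d :+ b :* c , b :* d ⟩₃ :≡ (a :* d :- b :* c) :* (a :* d :- b :* c)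

    linear-list : ∀ a b c d → ⟨ a , b ⟩₂ ⊗ˡ ⟨ c , d ⟩₂ ≡ Vec.toList ((a , b) · (c , d))
    linear-list a b c d = solveₗ (a ∷ b ∷ c ∷ d ∷ []) λ a b c d → (a ∷ b ∷ []) E.⊗ (c ∷ d ∷ []) :≡ (a :* c ∷ a :* d :+ b :* c ∷ b :* d ∷ [])

    quadratic-list : ∀ u v w u′ v′ w′ → ⟨ u , v , w ⟩₃ ⊗ˡ ⟨ u′ , v′ , w′ ⟩₃ ≡ coeffs (⟨ u , v , w ⟩₃ ⊙ ⟨ u′ , v′ , w′ ⟩₃)
    quadratic-list u v w u′ v′ w′ = solveₗ (u ∷ v ∷ w ∷ u′ ∷ v′ ∷ w′ ∷ []) λ u v w u′ v′ w′ →
      (u ∷ v ∷ w ∷ []) E.⊗ (u′ ∷ v′ ∷ w′ ∷ []) :≡ Vec.toList (⟨ u , v , w ⟩₃ E.⊙ ⟨ u′ , v′ , w′ ⟩₃)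

    mixed-list : ∀ a b c d u v w → ⟨ a , b ⟩₂ ⊗ˡ (⟨ c , d ⟩₂ ⊗ˡ ⟨ u , v , w ⟩₃) ≡ coeffs (((a , b) · (c , d)) ⊙ ⟨ u , v , w ⟩₃)
    mixed-list a b c d u v w = solveₗ (a ∷ b ∷ c ∷ d ∷ u ∷ v ∷ w ∷ []) λ a b c d u v w →
      (a ∷ b ∷ []) E.⊗ ((c ∷ d ∷ []) E.⊗ (u ∷ v ∷ w ∷ [])) :≡ Vec.toList (⟨ a :* c , a :* d :+ b :* c , b :* d ⟩₃ E.⊙ ⟨ u , v , w ⟩₃)

    quadratic-irreducible : ∀ {u v w} → ¬ IsSquare (disc₂ ⟨ u , v , w ⟩₃) → Irreducible 2 ⟨ u , v , w ⟩₃
    quadratic-irreducible {u} {v} {w} ns = refl , (λ { (z ∷ _) → lead≢0₂ ns z }) , no-factors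
      where
      no-factors : ∀ a b (g h : Poly) → 1 ℕ.≤ a → 1 ℕ.≤ b → a ℕ.+ b ≡ 2 → length g ≡ suc a → length h ≡ suc b → g ⊗ˡ h ≢ ⟨ u , v , w ⟩₃
      no-factors (suc zero) (suc zero) g h _ _ _ lg lh e with length₂ {g} lg | length₂ {h} lh
      ... | a , b , refl | c , d , refl = ns (_ , trans (sym (disc₂-· a b c d)) (cong disc₂ (toList-injective (trans (sym (linear-list a b c d)) e))))
        where
        toList-injective : ∀ {p : Quadratic} → Vec.toList p ≡ ⟨ u , v , w ⟩₃ → p ≡ ⟨ u , v , w ⟩₃
        toList-injective {⟨ _ , _ , _ ⟩₃} refl = refl
      no-factors (suc (suc a)) (suc zero) _ _ _ _ e = case trans (ℕ.+-comm 1 a) (ℕ.suc-injective (ℕ.suc-injective e)) of λ ()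
      no-factors (suc zero) (suc (suc b)) _ _ _ _ ()
      no-factors (suc (suc a)) (suc (suc b)) _ _ _ _ e = case trans (sym (ℕ.+-suc a (suc b))) (ℕ.suc-injective (ℕ.suc-injective e)) of λ ()

    irreducible-quadratic : ∀ {u v w} → Irreducible 2 ⟨ u , v , w ⟩₃ → ¬ IsSquare (disc₂ ⟨ u , v , w ⟩₃)
    irreducible-quadratic (_ , _ , no-factors) sq with divide₂ sq
    ... | a , b , c , d , e = no-factors 1 1 ⟨ a , b ⟩₂ ⟨ c , d ⟩₂ (ℕ.s≤s ℕ.z≤n) (ℕ.s≤s ℕ.z≤n) refl refl refl (sym e)

    linear-irreducible : ∀ {a b} → NonzeroPair a b → Irreducible 1 ⟨ a , b ⟩₂
    linear-irreducible nz = refl , (λ { (z ∷ z′ ∷ []) → nz (z , z′) }) ,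
      λ { (suc zero) zero _ _ _ () ; (suc zero) (suc _) _ _ _ _ () ; (suc (suc _)) _ _ _ _ _ () }

    irreducible-linear : ∀ {l} → Irreducible 1 l → ∃[ a ] ∃[ b ] (l ≡ ⟨ a , b ⟩₂ × NonzeroPair a b)
    irreducible-linear {l} (len , nz , _) with length₂ {l} len
    ... | a , b , refl = a , b , refl , λ (z , z′) → nz (z ∷ z′ ∷ [])

    cubic-irreducible : ∀ {a b c d} → (∀ P → ¬ Root₃ a b c d P) → Irreducible 3 ⟨ a , b , c , d ⟩₄
    cubic-irreducible {a} {b} {c} {d} rootless = refl , (λ { (z ∷ _) → rootless nothing z }) , no-factors
      where
      linear-factor : ∀ x y u v w → ⟨ x , y ⟩₂ ⊗ˡ ⟨ u , v , w ⟩₃ ≢ ⟨ a , b , c , d ⟩₄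
      linear-factor x y u v w refl with x ≟ᶠ 0#
      ... | yes refl = rootless nothing (solve (u ∷ []) λ u → :0 :* u :+ :0 :≡ :0)
      ... | no h with root₁ {x} {y} (h ∘ proj₁)
      ...   | nothing , z , _ = h z
      ...   | just t , z , _ = rootless (just t) (lin₁ (u * t ^ 2 + v * t + w) z (solve (x ∷ y ∷ u ∷ v ∷ w ∷ t ∷ []) λ x y u v w t →
                (x :* u :+ :0) :* t E.^ 3 :+ (x :* v :+ (y :* u :+ :0)) :* t E.^ 2 :+ (x :* w :+ y :* v) :* t :+ y :* w :- :0 :≡
                (u :* t E.^ 2 :+ v :* t :+ w) :* (x :* t :+ y :- :0)))
      no-factors : ∀ i j (g h : Poly) → 1 ℕ.≤ i → 1 ℕ.≤ j → i ℕ.+ j ≡ 3 → length g ≡ suc i → length h ≡ suc j → g ⊗ˡ h ≢ ⟨ a , b , c , d ⟩₄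
      no-factors (suc zero) (suc (suc zero)) g h _ _ _ lg lh e with length₂ {g} lg | length₃ {h} lh
      ... | x , y , refl | u , v , w , refl = linear-factor x y u v w e
      no-factors (suc (suc zero)) (suc zero) g h _ _ _ lg lh e with length₃ {g} lg | length₂ {h} lh
      ... | u , v , w , refl | x , y , refl = linear-factor x y u v w (trans (solveₗ (x ∷ y ∷ u ∷ v ∷ w ∷ []) λ x y u v w →
              (x ∷ y ∷ []) E.⊗ (u ∷ v ∷ w ∷ []) :≡ (u ∷ v ∷ w ∷ []) E.⊗ (x ∷ y ∷ [])) e)
      no-factors (suc zero) (suc zero) _ _ _ _ ()
      no-factors (suc zero) (suc (suc (suc _))) _ _ _ _ ()
      no-factors (suc (suc zero)) (suc (suc _)) _ _ _ _ ()
      no-factors (suc (suc (suc i))) (suc j) _ _ _ _ e = case trans (sym (ℕ.+-suc i j)) (ℕ.suc-injective (ℕ.suc-injective (ℕ.suc-injective e))) of λ ()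

    irreducible-cubic : ∀ {a b c d} → Irreducible 3 ⟨ a , b , c , d ⟩₄ → ∀ P → ¬ Root₃ a b c d P
    irreducible-cubic (_ , _ , no-factors) P z with divide₃ P z
    ... | x , y , u , v , w , _ , e = no-factors 1 2 ⟨ x , y ⟩₂ ⟨ u , v , w ⟩₃ (ℕ.s≤s ℕ.z≤n) (ℕ.s≤s ℕ.z≤n) refl refl refl (sym e)

    rooted-point : ∀ {f} → Rooted f → ∃[ P ] Root f P
    rooted-point (inj₁ z) = nothing , z
    rooted-point (inj₂ (t , z)) = just t , z

    point-rooted : ∀ {f} P → Root f P → Rooted f
    point-rooted nothing  z = inj₁ z
    point-rooted (just t) z = inj₂ (t , z)

    Δ-factors : ∀ p p′ → NonDeg (p ⊙ p′) → disc₂ p ≢ 0# × disc₂ p′ ≢ 0#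
    Δ-factors p p′ nd = ≢0-left DD≢0 , ≢0-right DD≢0
      where
      DD≢0 : disc₂ p * disc₂ p′ ≢ 0#
      DD≢0 = ≢0-left (subst (_≢ 0#) (Δ-⊙ p p′) nd)

    Δ-square-class : ∀ p p′ → ∃[ s ] Δ (p ⊙ p′) ≡ disc₂ p * disc₂ p′ * (s * s)
    Δ-square-class p p′ = s , trans (Δ-⊙ p p′) (cong (λ u → disc₂ p * disc₂ p′ * (s * u)) (*-identityʳ s))
      where
      s : Carrier
      s = polar p p′ ^ 2 - disc₂ p * disc₂ p′

    lists-⊙ : ∀ {f} p p′ → coeffs f ≡ coeffs (p ⊙ p′) → f ≡ p ⊙ p′
    lists-⊙ p p′ e = coeffs-injective _ _ e

    root₃? : ∀ a b c d → Dec (∃[ P ] Root₃ a b c d P)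
    root₃? a b c d = choose (a ≟ᶠ 0#) (∃? λ t → a * t ^ 3 + b * t ^ 2 + c * t + d ≟ᶠ 0#)
      where
      choose : Dec (a ≡ 0#) → Dec (∃[ t ] a * t ^ 3 + b * t ^ 2 + c * t + d ≡ 0#) → Dec (∃[ P ] Root₃ a b c d P)
      choose (yes z) _ = yes (nothing , z)
      choose (no _) (yes (t , z)) = yes (just t , z)
      choose (no h) (no h′) = no λ { (nothing , z) → h z ; (just t , z) → h′ (t , z) }

    -- Linear factors are split off while roots remain, and a last quadratic is judged by its
    -- discriminant. The discriminant divides Δ, so it is nonzero, and this keeps the linear factors
    -- of a split quadratic nonzero.
    rooted-trichotomy : ∀ {f} → NonDeg f → Rooted f → 𝓕₁ f ⊎ 𝓕₂ f ⊎ 𝓕₄ f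
    rooted-trichotomy {f} nd rt = quartic (rooted-point rt)
      where
      quadratic : ∀ a b c d u v w → NonzeroPair a b → NonzeroPair c d → coeffs f ≡ ⟨ a , b ⟩₂ ⊗ˡ (⟨ c , d ⟩₂ ⊗ˡ ⟨ u , v , w ⟩₃) → 𝓕₁ f ⊎ 𝓕₂ f ⊎ 𝓕₄ f
      quadratic a b c d u v w nz nz′ e = choose (square? (disc₂ ⟨ u , v , w ⟩₃))
        where
        disc≢0 : disc₂ ⟨ u , v , w ⟩₃ ≢ 0#
        disc≢0 = proj₂ (Δ-factors ((a , b) · (c , d)) ⟨ u , v , w ⟩₃ (subst NonDeg (lists-⊙ _ _ (trans e (mixed-list a b c d u v w))) nd))
        choose : Dec (IsSquare (disc₂ ⟨ u , v , w ⟩₃)) → 𝓕₁ f ⊎ 𝓕₂ f ⊎ 𝓕₄ f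
        choose (no ns) = inj₂ (inj₁ (⟨ a , b ⟩₂ , ⟨ c , d ⟩₂ , ⟨ u , v , w ⟩₃ , linear-irreducible nz , linear-irreducible nz′ , quadratic-irreducible ns , e))
        choose (yes sq) = go (divide₂ sq)
          where
          go : ∃[ x ] ∃[ y ] ∃[ z ] ∃[ t ] ⟨ u , v , w ⟩₃ ≡ ⟨ x , y ⟩₂ ⊗ˡ ⟨ z , t ⟩₂ → 𝓕₁ f ⊎ 𝓕₂ f ⊎ 𝓕₄ f
          go (x , y , z , t , refl) = inj₂ (inj₂ (⟨ a , b ⟩₂ , ⟨ c , d ⟩₂ , ⟨ x , y ⟩₂ , ⟨ z , t ⟩₂ , linear-irreducible nz , linear-irreducible nz′ ,
              linear-irreducible (λ { (refl , refl) → disc≢0 (solve (z ∷ t ∷ []) λ z t → E.disc₂ ⟨ :0 :* z :+ :0 , :0 :* t :+ (:0 :* z :+ :0) , :0 :* t ⟩₃ :≡ :0) }) ,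
              linear-irreducible (λ { (refl , refl) → disc≢0 (solve (x ∷ y ∷ []) λ x y → E.disc₂ ⟨ x :* :0 :+ :0 , x :* :0 :+ (y :* :0 :+ :0) , y :* :0 ⟩₃ :≡ :0) }) , e))
      cubic : ∀ a b c d e g → NonzeroPair a b → coeffs f ≡ ⟨ a , b ⟩₂ ⊗ˡ ⟨ c , d , e , g ⟩₄ → 𝓕₁ f ⊎ 𝓕₂ f ⊎ 𝓕₄ f
      cubic a b c d e g nz eq = choose (root₃? c d e g)
        where
        choose : Dec (∃[ P ] Root₃ c d e g P) → 𝓕₁ f ⊎ 𝓕₂ f ⊎ 𝓕₄ f
        choose (no h) = inj₁ (⟨ a , b ⟩₂ , ⟨ c , d , e , g ⟩₄ , linear-irreducible nz , cubic-irreducible (λ P z → h (P , z)) , eq)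
        choose (yes (P , z)) = let a′ , b′ , u , v , w , nz′ , eq′ = divide₃ P z in
          quadratic a b a′ b′ u v w nz nz′ (trans eq (cong (⟨ a , b ⟩₂ ⊗ˡ_) eq′))
      quartic : ∃[ P ] Root f P → 𝓕₁ f ⊎ 𝓕₂ f ⊎ 𝓕₄ f
      quartic (P , z) = let a , b , c , d , e , g , nz , eq = divide₄ {f} P z in cubic a b c d e g nz eq

    𝓕₁-unique-root : ∀ {f} → 𝓕₁ f → ∃[ P ] (Root f P × (∀ P′ → Root f P′ → P′ ≡ P))
    𝓕₁-unique-root {f} (l , p , il , ip , e) = go (irreducible-linear il) (length₄ {p} (proj₁ ip))
      where
      go : ∃[ a ] ∃[ b ] (l ≡ ⟨ a , b ⟩₂ × NonzeroPair a b) → ∃[ c ] ∃[ d ] ∃[ e ] ∃[ g ] p ≡ ⟨ c , d , e , g ⟩₄ → ∃[ P ] (Root f P × (∀ P′ → Root f P′ → P′ ≡ P))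
      go (a , b , refl , nz) (c , d , e′ , g , refl) = let P , z , unique = root₁ nz in
        P , product-root {f} e P (inj₁ z) , λ P′ z′ → [ unique P′ , (λ h → ⊥-elim (irreducible-cubic ip P′ h)) ]′ (root-product {f} e P′ z′)

    𝓕₂-product : ∀ {f} → 𝓕₂ f → ∃[ a ] ∃[ b ] ∃[ c ] ∃[ d ] ∃[ u ] ∃[ v ] ∃[ w ]
                 (NonzeroPair a b × ¬ IsSquare (disc₂ ⟨ u , v , w ⟩₃) × coeffs f ≡ ⟨ a , b ⟩₂ ⊗ˡ (⟨ c , d ⟩₂ ⊗ˡ ⟨ u , v , w ⟩₃))
    𝓕₂-product (l , l′ , p , il , il′ , ip , e) with irreducible-linear il | irreducible-linear il′ | length₃ {p} (proj₁ ip)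
    ... | a , b , refl , nz | c , d , refl , _ | u , v , w , refl = a , b , c , d , u , v , w , nz , irreducible-quadratic ip , e

    𝓕₂-rooted : ∀ {f} → 𝓕₂ f → Rooted f
    𝓕₂-rooted {f} h with 𝓕₂-product h
    ... | a , b , c , d , u , v , w , nz , _ , e with root₁ nz
    ...   | P , z , _ = point-rooted {f} P (product-root {f} e P (inj₁ z))

    -- By the product formula Δ is, up to squares, the product of the discriminants of two quadratic
    -- factors: here (ad - bc)² and a nonsquare.
    𝓕₂-Δ : ∀ {f} → NonDeg f → 𝓕₂ f → ¬ IsSquare (Δ f)
    𝓕₂-Δ {f} nd h sq = go (𝓕₂-product h)
      where
      go : ∃[ a ] ∃[ b ] ∃[ c ] ∃[ d ] ∃[ u ] ∃[ v ] ∃[ w ]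
           (NonzeroPair a b × ¬ IsSquare (disc₂ ⟨ u , v , w ⟩₃) × coeffs f ≡ ⟨ a , b ⟩₂ ⊗ˡ (⟨ c , d ⟩₂ ⊗ˡ ⟨ u , v , w ⟩₃)) → ⊥
      go (a , b , c , d , u , v , w , _ , ns , e) = square-*-nonsquare (s * x , refl) (≢0-right (subst (_≢ 0#) Δ≡ nd)) ns
          (subst IsSquare (trans Δ≡ (*-comm D _)) sq)
        where
        D x s : Carrier
        D = disc₂ ⟨ u , v , w ⟩₃
        x = a * d - b * c
        s = proj₁ (Δ-square-class ((a , b) · (c , d)) ⟨ u , v , w ⟩₃)
        Δ≡ : Δ f ≡ D * ((s * x) * (s * x))
        Δ≡ = trans (cong Δ (lists-⊙ {f} _ _ (trans e (mixed-list a b c d u v w)))) (trans (proj₂ (Δ-square-class ((a , b) · (c , d)) ⟨ u , v , w ⟩₃))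
          (trans (cong (λ y → y * D * (s * s)) (disc₂-· a b c d)) (solve (x ∷ D ∷ s ∷ []) λ x D s → x :* x :* D :* (s :* s) :≡ D :* ((s :* x) :* (s :* x)))))

    𝓕₄-product : ∀ {f} → 𝓕₄ f → ∃[ a ] ∃[ b ] ∃[ c ] ∃[ d ] ∃[ a′ ] ∃[ b′ ] ∃[ c′ ] ∃[ d′ ]
                 (NonzeroPair a b × NonzeroPair c d × coeffs f ≡ ⟨ a , b ⟩₂ ⊗ˡ (⟨ c , d ⟩₂ ⊗ˡ (⟨ a′ , b′ ⟩₂ ⊗ˡ ⟨ c′ , d′ ⟩₂)))
    𝓕₄-product (_ , _ , _ , _ , i₁ , i₂ , i₃ , i₄ , e) with irreducible-linear i₁ | irreducible-linear i₂ | irreducible-linear i₃ | irreducible-linear i₄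
    ... | a , b , refl , nz | c , d , refl , nz′ | a′ , b′ , refl , _ | c′ , d′ , refl , _ = a , b , c , d , a′ , b′ , c′ , d′ , nz , nz′ , e

    𝓕₄-Δ : ∀ {f} → 𝓕₄ f → IsSquare (Δ f)
    𝓕₄-Δ {f} h with 𝓕₄-product h
    ... | a , b , c , d , a′ , b′ , c′ , d′ , _ , _ , e = subst IsSquare (sym (trans
        (cong Δ (lists-⊙ {f} p p′ (trans e (trans (cong (λ l → ⟨ a , b ⟩₂ ⊗ˡ (⟨ c , d ⟩₂ ⊗ˡ l)) (linear-list a′ b′ c′ d′)) (mixed-list a b c d _ _ _)))))
        (proj₂ (Δ-square-class p p′)))) (square-* (square-* (_ , sym (disc₂-· a b c d)) (_ , sym (disc₂-· a′ b′ c′ d′))) (_ , refl))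
      where
      p p′ : Quadratic
      p = (a , b) · (c , d)
      p′ = (a′ , b′) · (c′ , d′)

    -- If two of the linear factors shared a zero, their product would have discriminant zero, and
    -- so would the form.
    𝓕₄-distinct-roots : ∀ {f} → NonDeg f → 𝓕₄ f → ∃[ P ] ∃[ P′ ] (Root f P × Root f P′ × P ≢ P′)
    𝓕₄-distinct-roots {f} nd h with 𝓕₄-product h
    ... | a , b , c , d , a′ , b′ , c′ , d′ , nz , nz′ , e with root₁ nz | root₁ nz′
    ...   | P , z , _ | P′ , z′ , _ = P , P′ , product-root {f} e P (inj₁ z) ,
          product-root {f} (trans e (solveₗ (a ∷ b ∷ c ∷ d ∷ a′ ∷ b′ ∷ c′ ∷ d′ ∷ []) λ a b c d a′ b′ c′ d′ → let l = (a′ ∷ b′ ∷ []) E.⊗ (c′ ∷ d′ ∷ []) in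
             (a ∷ b ∷ []) E.⊗ ((c ∷ d ∷ []) E.⊗ l) :≡ (c ∷ d ∷ []) E.⊗ ((a ∷ b ∷ []) E.⊗ l))) P′ (inj₁ z′) ,
          λ { refl → proj₁ (Δ-factors p ((a′ , b′) · (c′ , d′)) (subst NonDeg (lists-⊙ {f} _ _
               (trans e (trans (cong (λ l → ⟨ a , b ⟩₂ ⊗ˡ (⟨ c , d ⟩₂ ⊗ˡ l)) (linear-list a′ b′ c′ d′)) (mixed-list a b c d _ _ _)))) nd))
               (trans (disc₂-· a b c d) (trans (cong (_* (a * d - b * c)) (common-root {P = P} z z′)) (zeroˡ _))) }
      where
      p : Quadratic
      p = (a , b) · (c , d)

    𝓕₄-rooted : ∀ {f} → NonDeg f → 𝓕₄ f → Rooted f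
    𝓕₄-rooted {f} nd h = let P , _ , z , _ = 𝓕₄-distinct-roots {f} nd h in point-rooted {f} P z

    𝓕₁-rooted : ∀ {f} → 𝓕₁ f → Rooted f
    𝓕₁-rooted {f} h = let P , z , _ = 𝓕₁-unique-root {f} h in point-rooted {f} P z

    prod-𝓕₄′ : ∀ {μ f} → Prod μ f → 𝓕₄′ f
    prod-𝓕₄′ (prod {⟨ u , v , w ⟩₃} {⟨ u′ , v′ , w′ ⟩₃} (coupled i i′ _) refl) =
      ⟨ u , v , w ⟩₃ , ⟨ u′ , v′ , w′ ⟩₃ , quadratic-irreducible i , quadratic-irreducible i′ , sym (quadratic-list u v w u′ v′ w′)

    𝓕₄′-prod : ∀ {f} → 𝓕₄′ f → ∃[ μ ] Prod μ f
    𝓕₄′-prod {f} (p , p′ , i , i′ , e) with length₃ {p} (proj₁ i) | length₃ {p′} (proj₁ i′)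
    ... | u , v , w , refl | u′ , v′ , w′ , refl = polar P P′ ^ 2 * (disc₂ P * disc₂ P′) ⁻¹ ,
        prod {p₁ = P} {P′} (coupled (irreducible-quadratic i) (irreducible-quadratic i′)
          (sym (trans (*-assoc _ _ _) (trans (cong (polar P P′ ^ 2 *_) (inverseˡ (*-≢0 (nonsquare-≢0 (irreducible-quadratic i)) (nonsquare-≢0 (irreducible-quadratic i′))))) (*-identityʳ _)))))
          (lists-⊙ {f} P P′ (trans e (quadratic-list u v w u′ v′ w′)))
      where
      P P′ : Quadratic
      P = ⟨ u , v , w ⟩₃
      P′ = ⟨ u′ , v′ , w′ ⟩₃

    𝓕₂′-rootless : ∀ {f} → 𝓕₂′ f → ¬ Rooted f
    𝓕₂′-rootless {f} (_ , _ , no-factors) rt with rooted-point rt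
    ... | P , z with divide₄ {f} P z
    ...   | a , b , c , d , e , g , _ , eq = no-factors 1 3 ⟨ a , b ⟩₂ ⟨ c , d , e , g ⟩₄ (ℕ.s≤s ℕ.z≤n) (ℕ.s≤s ℕ.z≤n) refl refl refl (sym eq)

    𝓕₂′-not-prod : ∀ {μ f} → 𝓕₂′ f → ¬ Prod μ f
    𝓕₂′-not-prod (_ , _ , no-factors) (prod {⟨ u , v , w ⟩₃} {⟨ u′ , v′ , w′ ⟩₃} _ refl) =
      no-factors 2 2 ⟨ u , v , w ⟩₃ ⟨ u′ , v′ , w′ ⟩₃ (ℕ.s≤s ℕ.z≤n) (ℕ.s≤s ℕ.z≤n) refl refl refl (quadratic-list u v w u′ v′ w′)

    -- A linear factor has a root, and a quadratic factor with square discriminant contains a linear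
    -- one. Two quadratics with nonsquare discriminants would make Δ a square.
    rootless-𝓕₂′ : ∀ {f} → ¬ IsSquare (Δ f) → ¬ Rooted f → 𝓕₂′ f
    rootless-𝓕₂′ {f@(⟨ z0 , z1 , z2 , z3 , z4 ⟩)} ns rootless = refl , (λ { (z ∷ _) → rootless (inj₁ z) }) , no-factors
      where
      linear-factor : ∀ a b c d e g → ⟨ a , b ⟩₂ ⊗ˡ ⟨ c , d , e , g ⟩₄ ≢ coeffs f
      linear-factor a b c d e g eq = let P , z , _ = root₁ {a} {b} nz in rootless (point-rooted {f} P (product-root {f} (sym eq) P (inj₁ z)))
        where
        nz : NonzeroPair a b
        nz (refl , refl) = rootless (product-lead eq)
          where
          product-lead : ⟨ 0# , 0# ⟩₂ ⊗ˡ ⟨ c , d , e , g ⟩₄ ≡ coeffs f → Rooted f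
          product-lead refl = inj₁ (trans (+-identityʳ _) (zeroˡ c))
      quadratic-factors : ∀ u v w u′ v′ w′ → ⟨ u , v , w ⟩₃ ⊗ˡ ⟨ u′ , v′ , w′ ⟩₃ ≢ coeffs f
      quadratic-factors u v w u′ v′ w′ eq = choose (square? (disc₂ p)) (square? (disc₂ p′))
        where
        p p′ : Quadratic
        p = ⟨ u , v , w ⟩₃
        p′ = ⟨ u′ , v′ , w′ ⟩₃
        split : ∀ {u v w u′ v′ w′} → ⟨ u , v , w ⟩₃ ⊗ˡ ⟨ u′ , v′ , w′ ⟩₃ ≡ coeffs f → IsSquare (disc₂ ⟨ u , v , w ⟩₃) → ⊥
        split {u′ = u′} {v′} {w′} eq sq with divide₂ sq
        ... | a , b , c , d , refl = linear-factor a b (c * u′ + 0#) (c * v′ + (d * u′ + 0#)) (c * w′ + d * v′) (d * w′) (trans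
              (solveₗ (a ∷ b ∷ c ∷ d ∷ u′ ∷ v′ ∷ w′ ∷ []) λ a b c d u v w → (a ∷ b ∷ []) E.⊗ (c :* u :+ :0 ∷ c :* v :+ (d :* u :+ :0) ∷ c :* w :+ d :* v ∷ d :* w ∷ []) :≡
                 ((a ∷ b ∷ []) E.⊗ (c ∷ d ∷ [])) E.⊗ (u ∷ v ∷ w ∷ [])) eq)
        choose : Dec (IsSquare (disc₂ p)) → Dec (IsSquare (disc₂ p′)) → ⊥
        choose (yes sq) _ = split eq sq
        choose _ (yes sq) = split (trans (trans (quadratic-list u′ v′ w′ u v w) (trans (cong coeffs (⊙-comm p′ p)) (sym (quadratic-list u v w u′ v′ w′)))) eq) sq
        choose (no i) (no i′) = ns (subst IsSquare (sym (trans (cong Δ (lists-⊙ {f} p p′ (trans (sym eq) (quadratic-list u v w u′ v′ w′)))) (proj₂ (Δ-square-class p p′))))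
          (square-* (nonsquare-* i i′) (_ , refl)))
      no-factors : ∀ i j (g h : Poly) → 1 ℕ.≤ i → 1 ℕ.≤ j → i ℕ.+ j ≡ 4 → length g ≡ suc i → length h ≡ suc j → g ⊗ˡ h ≢ coeffs f
      no-factors (suc zero) (suc (suc (suc zero))) g h _ _ _ lg lh e with length₂ {g} lg | length₄ {h} lh
      ... | a , b , refl | c , d , x , y , refl = linear-factor a b c d x y e
      no-factors (suc (suc zero)) (suc (suc zero)) g h _ _ _ lg lh e with length₃ {g} lg | length₃ {h} lh
      ... | u , v , w , refl | u′ , v′ , w′ , refl = quadratic-factors u v w u′ v′ w′ e
      no-factors (suc (suc (suc zero))) (suc zero) g h _ _ _ lg lh e with length₄ {g} lg | length₂ {h} lh
      ... | c , d , x , y , refl | a , b , refl = linear-factor a b c d x y (trans (solveₗ (a ∷ b ∷ c ∷ d ∷ x ∷ y ∷ []) λ a b c d x y →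
              (a ∷ b ∷ []) E.⊗ (c ∷ d ∷ x ∷ y ∷ []) :≡ (c ∷ d ∷ x ∷ y ∷ []) E.⊗ (a ∷ b ∷ [])) e)
      no-factors (suc zero) (suc zero) _ _ _ _ ()
      no-factors (suc zero) (suc (suc zero)) _ _ _ _ ()
      no-factors (suc zero) (suc (suc (suc (suc _)))) _ _ _ _ ()
      no-factors (suc (suc zero)) (suc zero) _ _ _ _ ()
      no-factors (suc (suc zero)) (suc (suc (suc _))) _ _ _ _ ()
      no-factors (suc (suc (suc zero))) (suc (suc _)) _ _ _ _ ()
      no-factors (suc (suc (suc (suc i)))) (suc j) _ _ _ _ e = case trans (sym (ℕ.+-suc i j)) (ℕ.suc-injective (ℕ.suc-injective (ℕ.suc-injective (ℕ.suc-injective e)))) of λ ()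

-- Counting equivalence classes

module _ {A : Set} {R : A → A → Set} where

  classReps-⇔ : ∀ {P Q : A → Set} {xs} → (∀ {x} → P x → Q x) → (∀ {x} → Q x → P x) → ClassReps R P xs → ClassReps R Q xs
  classReps-⇔ f g (a , d , c) = All.map f a , d , λ x → c x ∘ g

  classReps-++ : ∀ {P Q : A → Set} {xs ys} → (∀ {x y} → R x y → Q y → Q x) → (∀ {x} → P x → Q x → ⊥) →
                 ClassReps R P xs → ClassReps R Q ys → ClassReps R (λ x → P x ⊎ Q x) (xs ++ ys)
  classReps-++ {xs = xs} S disj (a , d , c) (a′ , d′ , c′) =
    All.++⁺ (All.map inj₁ a) (All.map inj₂ a′) ,
    AllPairs.++⁺ d d′ (All.map (λ p → All.map (λ q r → disj p (S r q)) a′) a) ,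
    λ { x (inj₁ p) → Any.++⁺ˡ (c x p) ; x (inj₂ q) → Any.++⁺ʳ xs (c′ x q) }

  classCount-⇔ : ∀ {P Q : A → Set} {k} → (∀ {x} → P x → Q x) → (∀ {x} → Q x → P x) → ClassCount R P k → ClassCount R Q k
  classCount-⇔ f g (xs , c , l) = xs , classReps-⇔ f g c , l

  classCount-⊎ : ∀ {P Q : A → Set} {k l} → (∀ {x y} → R x y → Q y → Q x) → (∀ {x} → P x → Q x → ⊥) →
                 ClassCount R P k → ClassCount R Q l → ClassCount R (λ x → P x ⊎ Q x) (k ℕ.+ l)
  classCount-⊎ S disj (xs , c , refl) (ys , c′ , refl) = xs ++ ys , classReps-++ S disj c c′ , List.length-++ xs

  -- One class for every index. The disjointness hypothesis says that the index is an invariant, as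
  -- r and μ are in the applications.
  classCount-family : ∀ {I : Set} {P : I → Set} {C : I → A → Set} {N} → Card P N → (∀ {i} → P i → ClassCount R (C i) 1) →
                      (∀ {i} → P i → ∀ {x y} → R x y → C i y → C i x) → (∀ {i j x} → P i → P j → C i x → C j x → i ≡ j) →
                      ClassCount R (λ x → ∃[ i ] (P i × C i x)) N
  classCount-family {I} {P} {C} p count S disj = subst (ClassCount R _) (size p)
      (classCount-⇔ (λ (i , i∈ , c) → i , sound p i∈ , c) (λ (i , Pi , c) → i , complete p Pi , c) (go (elems p) (unique p) (sound p)))
    where
    go : ∀ is → Unique is → (∀ {i} → i ∈ is → P i) → ClassCount R (λ x → ∃[ i ] (i ∈ is × C i x)) (length is)
    go [] _ _ = [] , ([] , [] , λ { _ (_ , () , _) }) , refl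
    go (i ∷ is) (i∉ ∷ u) s = classCount-⇔ [ (λ c → i , here refl , c) , (λ (j , j∈ , c) → j , there j∈ , c) ]′
      (λ { (_ , here refl , c) → inj₁ c ; (j , there j∈ , c) → inj₂ (j , j∈ , c) })
      (classCount-⊎ (λ { r (j , j∈ , c) → j , j∈ , S (s (there j∈)) r c })
        (λ { c (j , j∈ , c′) → All.lookup i∉ j∈ (disj (s (here refl)) (s (there j∈)) c c′) })
        (count (s (here refl))) (go is u (s ∘ there)))

-- The orbits, their sizes and their number

module Classification (F : Field) (n : ℕ) (hs : HasSize F (3 ℕ.^ n)) where
  open FactorTypes F n hs public
  open Theory F public using (OrbitSize; OrbitSizeDiv; OrbitIn; J₁; J₂; J₄)

  private
    -- The value 0 is taken only at the zero vector, which a nonzero discriminant excludes.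
    leading : ∀ {k} → Vec Carrier k → Carrier
    leading [] = 0#
    leading (x ∷ xs) with x ≟ᶠ 0#
    ... | yes _ = leading xs
    ... | no _  = x

    leading-sc : ∀ {k} c → c ≢ 0# → (f : Vec Carrier k) → leading (Vec.map (c *_) f) ≡ c * leading f
    leading-sc c h [] = sym (zeroʳ c)
    leading-sc c h (x ∷ xs) with x ≟ᶠ 0# | c * x ≟ᶠ 0#
    ... | yes _ | yes _ = leading-sc c h xs
    ... | no _  | no _  = refl
    ... | yes refl | no h′ = ⊥-elim (h′ (zeroʳ c))
    ... | no h′ | yes z = ⊥-elim (*-≢0 h h′ z)

    leading≢0 : ∀ f → NonDeg f → leading f ≢ 0#
    leading≢0 f@(⟨ a , b , c , d , e ⟩) nd z = nd (trans (cong Δ (zero-vector f z)) (solve [] (E.disc ⟨ :0 , :0 , :0 , :0 , :0 ⟩ :≡ :0)))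
      where
      zero-vector : ∀ {k} (f : Vec Carrier k) → leading f ≡ 0# → f ≡ Vec.replicate k 0#
      zero-vector [] _ = refl
      zero-vector (x ∷ xs) z with x ≟ᶠ 0#
      ... | yes refl = cong (0# ∷_) (zero-vector xs z)
      ... | no h = ⊥-elim (h z)

    ≢0-cancel : ∀ {a b c} → a ≢ 0 → a ℕ.* b ≡ a ℕ.* c → b ≡ c
    ≢0-cancel {zero} h _ = ⊥-elim (h refl)
    ≢0-cancel {suc a} _ e = ℕ.*-cancelˡ-≡ _ _ (suc a) e

    nonzero : ∀ {f} → NonDeg f → Nonzero f
    nonzero {⟨ a , b , c , d , e ⟩} nd (refl ∷ refl ∷ refl ∷ refl ∷ refl ∷ []) = nd (solve [] (E.disc ⟨ :0 , :0 , :0 , :0 , :0 ⟩ :≡ :0))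

  opaque
    -- The points of a projective class are represented by the vectors with first nonzero coefficient 1.
    projective-count : ∀ {C N} → Stable C → (∀ {f} → C f → NonDeg f) → Card C N → ∃[ s ] (ClassCount _≈ₚ_ C s × N ≡ m ℕ.* s)
    projective-count {C} {N} S nd c = count (card-filter c (λ f → leading f ≟ᶠ 1#))
      where
      normalise : Quartic → Quartic
      normalise f = sc (leading f ⁻¹) f
      normalised : ∀ {f} → C f → C (normalise f) × leading (normalise f) ≡ 1#
      normalised {f} h = S (≋-sc (⁻¹-≢0 l≢0)) h , trans (leading-sc _ (⁻¹-≢0 l≢0) f) (inverseˡ l≢0)
        where
        l≢0 : leading f ≢ 0#
        l≢0 = leading≢0 f (nd h)
      denormalise : ∀ {f} → C f → sc (leading f) (normalise f) ≡ f
      denormalise {f} h = trans (sc-* _ _ f) (trans (cong (λ k → sc k f) (inverseʳ (leading≢0 f (nd h)))) (sc-1 f))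
      leading-of : ∀ {k h} → k ≢ 0# → leading h ≡ 1# → leading (sc k h) ≡ k
      leading-of {k} {h} k≢0 e = trans (leading-sc k k≢0 h) (trans (cong (k *_) e) (*-identityʳ k))
      pairs : ∀ {xs} → Unique xs → (∀ {f} → f ∈ xs → leading f ≡ 1#) → AllPairs (λ f h → ¬ f ≈ₚ h) xs
      pairs [] _ = []
      pairs {f ∷ xs} (f∉ ∷ u) one = All.tabulate (λ { {h} h∈ (k , k≢0 , e) → All.lookup f∉ h∈ (trans e (trans (cong (λ k → sc k h)
          (trans (sym (leading-of {k} {h} k≢0 (one (there h∈)))) (trans (cong leading (sym e)) (one (here refl))))) (sc-1 h))) }) ∷ pairs u (one ∘ there)
      count : ∃[ M ] Card (λ f → C f × leading f ≡ 1#) M → ∃[ s ] (ClassCount _≈ₚ_ C s × N ≡ m ℕ.* s)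
      count (M , r) = M , (elems r , (All.tabulate (λ f∈ → proj₁ (sound r f∈)) , pairs (unique r) (λ f∈ → proj₂ (sound r f∈)) ,
          λ f h → lose (complete r (normalised h)) (leading f , leading≢0 f (nd h) , sym (denormalise h))) , size r) ,
        -- Every vector of the class is a unit times exactly one normalised vector, hence the factor
        -- q - 1.
        card-unique c (card-bij (λ (k , h) → sc k h) (card-Σ {Q = λ _ h → C h × leading h ≡ 1#} units (λ _ → r))
          (λ { {k , h} (k≢0 , Ch , _) → S (≋-sc k≢0) Ch })
          (λ { {k , h} {k′ , h′} (k≢0 , _ , e) (k′≢0 , _ , e′) eq → inj k≢0 (trans (sym (leading-of {k} {h} k≢0 e)) (trans (cong leading eq) (leading-of {k′} {h′} k′≢0 e′))) eq })
          (λ {f} h → (leading f , normalise f) , (leading≢0 f (nd h) , normalised h) , denormalise h)) id id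
        where
        inj : ∀ {k k′ h h′} → k ≢ 0# → k ≡ k′ → sc k h ≡ sc k′ h′ → (k , h) ≡ (k′ , h′)
        inj {k} {_} {h} {h′} k≢0 refl eq = cong (k ,_) (trans (sym (sc-inverse k≢0 h)) (trans (cong (sc (k ⁻¹)) eq) (sc-inverse k≢0 h′)))

    G≢0 : m ℕ.* G ≢ 0
    G≢0 e = case ℕ.m*n≡0⇒m≡0∨n≡0 m e of λ
      { (inj₁ z) → m≢0 z
      ; (inj₂ z) → case ℕ.m*n≡0⇒m≡0∨n≡0 order z of λ
        { (inj₁ z) → case trans (sym order≡m+1) z of λ ()
        ; (inj₂ z) → case ℕ.m*n≡0⇒m≡0∨n≡0 m z of λ { (inj₁ z) → m≢0 z ; (inj₂ z) → case trans (ℕ.+-comm 1 order) z of λ () } } }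

    ∣PGL₂∣≡G : ∣PGL₂∣ order ≡ G
    ∣PGL₂∣≡G = trans (cong (ℕ._∸ order) (go order m order≡m+1)) (ℕ.m+n∸n≡m G order)
      where
      go : ∀ q m → q ≡ suc m → q ℕ.^ 3 ≡ q ℕ.* (m ℕ.* (q ℕ.+ 1)) ℕ.+ q
      go _ m refl = ℕSolver.solve 1 (λ m → let q = ℕ# 1 ℕ⊕ m in q ℕ⊗ (q ℕ⊗ (q ℕ⊗ ℕ# 1)) ℕ≐ q ℕ⊗ (m ℕ⊗ (q ℕ⊕ ℕ# 1)) ℕ⊕ q) refl m

  -- The sizes are known for invariant predicates, so an orbit is given by its predicate and not as
  -- the class of a chosen form.
  record Orbit (C : Quartic → Set) : Set where
    field
      {rep}  : Quartic
      member : C rep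
      stable : Stable C
      single : ∀ {f h} → C f → C h → f ≋ h
      nondeg : ∀ {f} → C f → NonDeg f
  open Orbit public

  ∼-stable : ∀ {C} → Stable C → ∀ {f h} → f ∼ h → C h → C f
  ∼-stable S {f} {h} e = S (≋-sym (∼⇒≋ {f} {h} e))

  orbit-reps : ∀ {C} (O : Orbit C) → ClassReps _∼_ C (rep O ∷ [])
  orbit-reps O = (member O ∷ []) , ([] ∷ []) , λ f h → here (≋⇒∼ (single O h (member O)))

  orbit-count : ∀ {C} → Orbit C → ClassCount _∼_ C 1
  orbit-count O = _ , orbit-reps O , refl

  -- `Size` counts vectors: N = (q - 1)s for s projective points, and cancelling q - 1 in Ni = (q -
  -- 1)|G| gives si = |G|.
  orbit-size : ∀ {C i f} → Orbit C → Size C i → C f → OrbitSizeDiv order f i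
  orbit-size {C} {i} {f} O (N , c , e) h = let s , cc , N≡ = projective-count (stable O) (nondeg O) c in
    s , classCount-⇔ (λ {g} Cg → nonzero {g} (nondeg O Cg) , ≋⇒∼ (single O h Cg)) (λ {g} (_ , r) → stable O (∼⇒≋ {f} {g} r) h) cc ,
    trans (ℕ.*-comm i s) (trans (≢0-cancel m≢0 (trans (sym (ℕ.*-assoc m s i)) (trans (cong (ℕ._* i) (sym N≡)) e))) (sym ∣PGL₂∣≡G))

  -- Since `C` is invariant, it suffices to recognise the type of each single form in it; membership
  -- of the whole orbit in `T` follows.
  type-count : ∀ {C T r k} → Stable C → (∀ {f} → C f → NonDeg f × J r f) → (∀ {f} → C f → T f) → (∀ {f} → NonDeg f → J r f → T f → C f) →
               ClassCount _∼_ C k → ClassCount _∼_ (λ f → NonDeg f × ȷ f ≡ r × OrbitIn T f) k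
  type-count {C} {T} {r} S j to from = classCount-⇔
    (λ {f} c → proj₁ (j c) , J-ȷ {r} {f} (proj₁ (j c)) (proj₂ (j c)) , λ h e → to (S (∼⇒≋ {f} {h} e) c))
    (λ {f} (nd , e , t) → from nd (ȷ-J {r} {f} nd e) (t f (≋⇒∼ ≋-refl)))

  rootedOrbit : ∀ {r} → r ≢ 0# → Orbit (RootedClass r)
  rootedOrbit {r} h = record
    { member = rootedRep-nondeg h , rootedRep-J h , inj₁ refl
    ; stable = rootedClass-stable
    ; single = λ (nd , j , rt) (nd′ , j′ , rt′) → ≋-trans (rooted-orbit h nd j rt) (≋-sym (rooted-orbit h nd′ j′ rt′))
    ; nondeg = proj₁ }

  twoRootsOrbit : Orbit TwoRoots
  twoRootsOrbit = record
    { rep = twoRootsRep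
    ; member = refl , nonsquare , inj₁ refl
    ; stable = twoRoots-stable
    ; single = λ {f} {h} (z , ns , rt) (z′ , ns′ , rt′) → ≋-trans (twoRoots-orbit {f} ns (mid≡0-J {f} z) rt) (≋-sym (twoRoots-orbit {h} ns′ (mid≡0-J {h} z′) rt′))
    ; nondeg = λ (_ , ns , _) → nonsquare-≢0 ns }
    where
    nonsquare : ¬ IsSquare (Δ twoRootsRep)
    nonsquare sq = ε-nonsquare (square-ratio ε≢0 (subst IsSquare (solve (ε ∷ []) λ ε → E.disc ⟨ :0 , :1 , :0 , :- ε , :0 ⟩ :≡ ε :* (ε :* ε)) sq))

  fourRootsOrbit : Orbit (_≋ fourRootsRep)
  fourRootsOrbit = record
    { member = ≋-refl ; stable = λ e h → ≋-trans (≋-sym e) h ; single = λ h h′ → ≋-trans h (≋-sym h′)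
    ; nondeg = λ h → nondeg-stable (≋-sym h) fourRoots-nondeg }

  oneRootOrbit : Orbit (_≋ oneRootRep)
  oneRootOrbit = record
    { member = ≋-refl ; stable = λ e h → ≋-trans (≋-sym e) h ; single = λ h h′ → ≋-trans h (≋-sym h′)
    ; nondeg = λ h → nondeg-stable (≋-sym h) oneRoot-nondeg }

  prodOrbit : ∀ {μ} → IsSquare μ → μ ≢ 1# → Orbit (Prod μ)
  prodOrbit sq h = record
    { member = proj₂ (prod-exists sq h) ; stable = prod-stable ; single = prod-orbit h ; nondeg = prod-nondeg h }

  irreducible-stable : ∀ {r} → Stable (Irreducible-J r)
  irreducible-stable {r} e (j , ns , nr) = J-stable e j , stable-¬ Δ-square-stable e ns , stable-¬ {Rooted} (λ {f} {h} → rooted-stable {f} {h}) e nr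

  -- No irreducible form is written down: the class has a member because its size is not zero.
  irreducibleOrbit : ∀ {r i} → Size (Irreducible-J r) i → Orbit (Irreducible-J r)
  irreducibleOrbit {r} {i} s = record
    { rep = proj₁ (witness s) ; member = proj₂ (witness s) ; stable = irreducible-stable
    ; single = λ {f} {h} (j , ns , nr) (j′ , ns′ , nr′) → irreducible-orbit {r} {f} {h} ns ns′ j j′ nr nr′
    ; nondeg = λ (_ , ns , _) → nonsquare-≢0 ns }
    where
    witness : Size (Irreducible-J r) i → ∃ (Irreducible-J r)
    witness (zero , _ , e) = ⊥-elim (G≢0 (sym e))
    witness (suc N , c , _) = card-member c

  opaque
    coupled-mid : ∀ {μ f} → μ ≢ 0# → Prod μ f → mid f ≢ 0#
    coupled-mid h (prod {p} {p′} c refl) z = *-≢0 h (coupled-disc≢0 c) (trans (sym (Coupled.ratio c))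
      (trans (cong (_^ 2) (trans (sym (mid-⊙ p p′)) z)) (zeroˡ _)))

    nonzero-mid : ∀ {r f} → r ≢ 0# → NonDeg f → J r f → mid f ≢ 0#
    nonzero-mid {r} {f} h nd j = J-mid≢0 {r} {f} nd j h

    J-square : ∀ {s f} → s ≢ 0# → J (s * s) f → IsSquare (Δ f)
    J-square {s} {f} h j = square-ratio {Δ f} {s} h (mid f ^ 3 , trans (solve (mid f ∷ []) λ c → c E.^ 3 :* c E.^ 3 :≡ c E.^ 6) (trans j (*-comm _ (Δ f))))

    square-J : ∀ {r f} → NonDeg f → J r f → IsSquare (Δ f) → IsSquare r
    square-J {r} {f} nd j (s , e) = square-ratio {r} {s} (λ z → nd (trans (sym e) (trans (cong (_* s) z) (zeroˡ s))))
      (mid f ^ 3 , trans (solve (mid f ∷ []) λ c → c E.^ 3 :* c E.^ 3 :≡ c E.^ 6) (trans j (cong (r *_) (sym e))))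

    square-root≢0 : ∀ {r s} → r ≢ 0# → s * s ≡ r → s ≢ 0#
    square-root≢0 h refl refl = h (zeroˡ 0#)

  Five : Quartic → Set
  Five f = f ≋ oneRootRep ⊎ TwoRoots f ⊎ Irreducible-J 0# f ⊎ Prod 0# f ⊎ f ≋ fourRootsRep

  irreducible₀Orbit : Orbit (Irreducible-J 0#)
  irreducible₀Orbit = irreducibleOrbit irreducible-size-0

  prod₀Orbit : Orbit (Prod 0#)
  prod₀Orbit = prodOrbit (0# , zeroˡ 0#) 0≢1

  opaque
    oneRoot-square : ∀ {f} → f ≋ oneRootRep → IsSquare (Δ f)
    oneRoot-square h = Δ-square-stable (≋-sym h) oneRoot-Δ

    fourRoots-square : ∀ {f} → f ≋ fourRootsRep → IsSquare (Δ f)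
    fourRoots-square h = Δ-square-stable (≋-sym h) fourRoots-Δ

    prod₀-J : ∀ {f} → Prod 0# f → J 0# f
    prod₀-J P = prod-J P (solve [] (:0 E.^ 3 :≡ :0 :* (:0 :- :1) E.^ 2))

    five-J : ∀ {f} → Five f → NonDeg f × J 0# f
    five-J {f} (inj₁ h) = nondeg oneRootOrbit h , mid≡0-J {f} (mid≡0-stable {oneRootRep} {f} (≋-sym h) refl)
    five-J {f} (inj₂ (inj₁ h@(z , _))) = nondeg twoRootsOrbit {f} h , mid≡0-J {f} z
    five-J {f} (inj₂ (inj₂ (inj₁ h@(j , _)))) = nondeg irreducible₀Orbit {f} h , j
    five-J {f} (inj₂ (inj₂ (inj₂ (inj₁ P)))) = prod-nondeg 0≢1 P , prod₀-J P
    five-J {f} (inj₂ (inj₂ (inj₂ (inj₂ h)))) = nondeg fourRootsOrbit h , mid≡0-J {f} (mid≡0-stable {fourRootsRep} {f} (≋-sym h) refl)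

    -- Having a root and the square class of Δ give four cases, each a single orbit except that with
    -- a root and square Δ, which holds two.
    J-five : ∀ {f} → NonDeg f → J 0# f → Five f
    J-five {f} nd j = choose (rooted? f) (square? (Δ f))
      where
      choose : Dec (Rooted f) → Dec (IsSquare (Δ f)) → Five f
      choose (yes rt) (no ns) = inj₂ (inj₁ (J-mid≡0 {f} j , ns , rt))
      choose (yes rt) (yes sq) = [ (λ h → inj₂ (inj₂ (inj₂ (inj₂ h)))) , inj₁ ]′ (square-orbits {f} nd sq j rt)
      choose (no nr) (no ns) = inj₂ (inj₂ (inj₁ (j , ns , nr)))
      choose (no nr) (yes sq) = [ (λ rt → ⊥-elim (nr rt)) , (λ P → inj₂ (inj₂ (inj₂ (inj₁ P)))) ]′ (square-exhaustion {f} j nd sq)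

    five-reps : ClassReps _∼_ (λ f → NonDeg f × J 0# f) (oneRootRep ∷ twoRootsRep ∷ rep irreducible₀Orbit ∷ rep prod₀Orbit ∷ fourRootsRep ∷ [])
    five-reps = classReps-⇔ (λ {f} → five-J {f}) (λ {f} (nd , j) → J-five {f} nd j)
      (classReps-++ (λ {x} {y} → ∼-stable {λ f → TwoRoots f ⊎ Irreducible-J 0# f ⊎ Prod 0# f ⊎ f ≋ fourRootsRep}
            (stable-⊎ {TwoRoots} (λ {f} {h} → twoRoots-stable {f} {h}) (stable-⊎ {Irreducible-J 0#} (λ {f} {h} → irreducible-stable {0#} {f} {h}) (stable-⊎ prod-stable (stable fourRootsOrbit)))) {x} {y})
          (λ { h (inj₁ (_ , ns , _)) → ns (oneRoot-square h)
             ; h (inj₂ (inj₁ (_ , ns , _))) → ns (oneRoot-square h)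
             ; h (inj₂ (inj₂ (inj₁ P))) → prod-rootless P (oneRoot-rooted h)
             ; h (inj₂ (inj₂ (inj₂ h′))) → fourRoots≉oneRoot (≋-trans (≋-sym h′) h) })
          (orbit-reps oneRootOrbit)
        (classReps-++ (λ {x} {y} → ∼-stable {λ f → Irreducible-J 0# f ⊎ Prod 0# f ⊎ f ≋ fourRootsRep}
              (stable-⊎ {Irreducible-J 0#} (λ {f} {h} → irreducible-stable {0#} {f} {h}) (stable-⊎ prod-stable (stable fourRootsOrbit))) {x} {y})
            (λ { (_ , ns , rt) (inj₁ (_ , _ , nr)) → nr rt
               ; (_ , ns , rt) (inj₂ (inj₁ P)) → prod-rootless P rt
               ; (_ , ns , rt) (inj₂ (inj₂ h)) → ns (fourRoots-square h) })
            (orbit-reps twoRootsOrbit)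
          (classReps-++ (λ {x} {y} → ∼-stable {λ f → Prod 0# f ⊎ f ≋ fourRootsRep} (stable-⊎ prod-stable (stable fourRootsOrbit)) {x} {y})
              (λ { (_ , ns , _) (inj₁ P) → ns (prod-Δ-square P) ; (_ , ns , _) (inj₂ h) → ns (fourRoots-square h) })
              (orbit-reps irreducible₀Orbit)
            (classReps-++ (λ {x} {y} → ∼-stable {_≋ fourRootsRep} (stable fourRootsOrbit) {x} {y})
              (λ P h → prod-rootless P (fourRoots-rooted h)) (orbit-reps prod₀Orbit) (orbit-reps fourRootsOrbit)))))
      where
      stable-⊎ : ∀ {C D} → Stable C → Stable D → Stable (λ f → C f ⊎ D f)
      stable-⊎ S T e = Sum.map (S e) (T e)

  opaque
    -- Each of the q - 1 nonzero values of ȷ has (q - 1)|G| forms, and so has ȷ = 0, where they are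
    -- the invertible matrices.
    nondeg-card : Card NonDeg (m ℕ.* (order ℕ.* G))
    nondeg-card = subst (Card NonDeg) arithmetic (card-⇔
        (λ {f} → [ (λ { (_ , _ , nd , _) → nd }) , (λ (z , h) → nondeg-matrix {f} z h) ]′)
        (λ {f} nd → case mid f ≟ᶠ 0# of λ { (yes z) → inj₂ (z , matrix≢0 {f} z nd)
           ; (no h) → inj₁ (ȷ f , (λ z → h (J-mid≡0 {f} (ȷ-J {0#} {f} nd z))) , nd , ȷ-J {ȷ f} {f} nd refl) })
        (card-⊎ (card-bij {Q = λ f → ∃[ r ] (r ≢ 0# × NonDeg f × J r f)} proj₂ (card-Σ {Q = λ r f → NonDeg f × J r f} units total-card)
            (λ { {r , f} (h , nd , j) → r , h , nd , j })
            (λ { {r , f} {r′ , _} (_ , nd , j) (_ , _ , j′) refl → cong (_, f) (J-unique {r} {r′} {f} nd j j′) })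
            (λ { {f} (r , h , nd , j) → (r , f) , (h , nd , j) , refl }))
          (matrix-card id units) λ { {f} (r , h , nd , j) (z , _) → nonzero-mid {r} {f} h nd j z }))
      where
      arithmetic : m ℕ.* (m ℕ.* G) ℕ.+ m ℕ.* G ≡ m ℕ.* (order ℕ.* G)
      arithmetic = trans (ℕSolver.solve 2 (λ m g → m ℕ⊗ (m ℕ⊗ g) ℕ⊕ m ℕ⊗ g ℕ≐ m ℕ⊗ ((ℕ# 1 ℕ⊕ m) ℕ⊗ g)) refl m G) (cong (λ q → m ℕ.* (q ℕ.* G)) (sym order≡m+1))

    forms-count : ClassCount _≈ₚ_ NonDeg (order ℕ.^ 4 ℕ.∸ order ℕ.^ 2)
    forms-count = let s , c , e = projective-count nondeg-stable id nondeg-card in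
      subst (ClassCount _≈ₚ_ NonDeg) (trans (≢0-cancel m≢0 (sym e)) (sym (trans (cong (ℕ._∸ order ℕ.^ 2) (go order m order≡m+1)) (ℕ.m+n∸n≡m _ (order ℕ.^ 2))))) c
      where
      go : ∀ q m → q ≡ suc m → q ℕ.^ 4 ≡ q ℕ.* (q ℕ.* (m ℕ.* (q ℕ.+ 1))) ℕ.+ q ℕ.^ 2
      go _ m refl = ℕSolver.solve 1 (λ m → let q = ℕ# 1 ℕ⊕ m in q ℕ⊗ (q ℕ⊗ (q ℕ⊗ (q ℕ⊗ ℕ# 1))) ℕ≐ q ℕ⊗ (q ℕ⊗ (m ℕ⊗ (q ℕ⊕ ℕ# 1))) ℕ⊕ q ℕ⊗ (q ℕ⊗ ℕ# 1)) refl m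

  RootedFamily ProdFamily IrreducibleFamily : Quartic → Set
  RootedFamily f = ∃[ r ] (r ≢ 0# × RootedClass r f)
  ProdFamily f = ∃[ μ ] ((NonzeroSquare μ × μ ≢ 1#) × Prod μ f)
  IrreducibleFamily f = ∃[ r ] (¬ IsSquare r × Irreducible-J r f)

  opaque
    family-of : ∀ {f} → NonDeg f → ((RootedFamily f ⊎ ProdFamily f) ⊎ IrreducibleFamily f) ⊎ (NonDeg f × J 0# f)
    family-of {f} nd = choose (r ≟ᶠ 0#) (rooted? f) (square? (Δ f))
      where
      r : Carrier
      r = ȷ f
      j : J r f
      j = ȷ-J {r} {f} nd refl
      product : r ≢ 0# → ¬ Rooted f → IsSquare r → ProdFamily f
      product r≢0 nr (s , e) = go (Tr n (s ⁻¹) ≟ᶠ 0#)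
        where
        s≢0 : s ≢ 0#
        s≢0 = square-root≢0 r≢0 e
        j′ : J (s * s) f
        j′ = subst (λ r → J r f) (sym e) j
        go : Dec (Tr n (s ⁻¹) ≡ 0#) → ProdFamily f
        go (yes z) = [ (λ rt → ⊥-elim (nr rt)) , (λ (μ , h , P) → μ , ((ratio-≢0 (*-≢0 s≢0 s≢0) h , ratio-square s≢0 h) , ratio-≢1 h) , P) ]′
          (J₄-exhaustion s≢0 z {f} nd j′)
        go (no h) = ⊥-elim (nr (J₁-exhaustion (*-≢0 s≢0 s≢0) (rootedRep-roots₁ s≢0 h) {f} nd j′))
      choose : Dec (r ≡ 0#) → Dec (Rooted f) → Dec (IsSquare (Δ f)) → ((RootedFamily f ⊎ ProdFamily f) ⊎ IrreducibleFamily f) ⊎ (NonDeg f × J 0# f)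
      choose (yes z) _ _ = inj₂ (nd , subst (λ r → J r f) z j)
      choose (no r≢0) (yes rt) _ = inj₁ (inj₁ (inj₁ (r , r≢0 , nd , j , rt)))
      choose (no r≢0) (no nr) (yes sq) = inj₁ (inj₁ (inj₂ (product r≢0 nr (square-J {r} {f} nd j sq))))
      choose (no r≢0) (no nr) (no ns) = inj₁ (inj₂ (r , (λ { (s , e) → ns (J-square {s} {f} (square-root≢0 r≢0 e) (subst (λ r → J r f) (sym e) j)) }) , j , ns , nr))

    -- For ȷ ≠ 0 there are q - 1 rooted orbits, one for each r, (q - 1)/2 irreducible ones, and the
    -- products. The latter are indexed by μ instead of r: nonzero squares other than 1, that is (q
    -- - 1)/2 - 1 of them. With the five orbits of ȷ = 0 the sum is 2q + 2.
    orbits-count : ClassCount _∼_ NonDeg (2 ℕ.* order ℕ.+ 2)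
    orbits-count = go (card-∖ _≟ᶠ_ squares (card-single 1#) (λ { refl → 1≢0 , 1# , *-identityˡ 1# }))
      where
      five-stable : ∀ {x y} → x ∼ y → NonDeg y × J 0# y → NonDeg x × J 0# x
      five-stable {x} {y} = ∼-stable {λ f → NonDeg f × J 0# f} (λ e (nd , j) → nondeg-stable e nd , J-stable e j) {x} {y}
      prod-family-stable : Stable ProdFamily
      prod-family-stable e (μ , h , P) = μ , h , prod-stable e P
      irreducible-family-stable : Stable IrreducibleFamily
      irreducible-family-stable {f} {h} e (r , ns , i) = r , ns , irreducible-stable {r} {f} {h} e i
      go : ∃[ K ] (Card (λ μ → NonzeroSquare μ × μ ≢ 1#) K × K ℕ.+ 1 ≡ half) → ClassCount _∼_ NonDeg (2 ℕ.* order ℕ.+ 2)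
      go (K , c , e) = subst (ClassCount _∼_ NonDeg) (arithmetic K e) (classCount-⇔
          [ [ [ (λ (_ , _ , nd , _) → nd) , (λ (_ , (_ , h) , P) → prod-nondeg h P) ]′ , (λ (_ , _ , _ , ns , _) → nonsquare-≢0 ns) ]′ , proj₁ ]′
          (λ {f} → family-of {f})
          (classCount-⊎ (λ {x} {y} → five-stable {x} {y})
              (λ {f} → λ { (inj₁ (inj₁ (r , h , nd , j , _))) (_ , j₀) → nonzero-mid {r} {f} h nd j (J-mid≡0 {f} j₀)
                 ; (inj₁ (inj₂ (_ , ((h , _) , _) , P))) (_ , j₀) → coupled-mid h P (J-mid≡0 {f} j₀)
                 ; (inj₂ (r , ns , j , nsΔ , _)) (_ , j₀) → nonzero-mid {r} {f} (nonsquare-≢0 ns) (nonsquare-≢0 nsΔ) j (J-mid≡0 {f} j₀) })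
            (classCount-⊎ (λ {x} {y} → ∼-stable {IrreducibleFamily} (λ {f} {h} → irreducible-family-stable {f} {h}) {x} {y})
                (λ { (inj₁ (_ , _ , _ , _ , rt)) (_ , _ , _ , _ , nr) → nr rt ; (inj₂ (_ , _ , P)) (_ , _ , _ , ns , _) → ns (prod-Δ-square P) })
              (classCount-⊎ (λ {x} {y} → ∼-stable {ProdFamily} prod-family-stable {x} {y})
                  (λ { (_ , _ , _ , _ , rt) (_ , _ , P) → prod-rootless P rt })
                (classCount-family units (λ h → orbit-count (rootedOrbit h))
                   (λ {r} h {x} {y} → ∼-stable {RootedClass r} (stable (rootedOrbit h)) {x} {y})
                   (λ { {r} {r′} {f} _ _ (nd , j , _) (_ , j′ , _) → J-unique {r} {r′} {f} nd j j′ }))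
                (classCount-family c (λ ((_ , sq) , h) → orbit-count (prodOrbit sq h)) (λ {μ} _ {x} {y} → ∼-stable {Prod μ} prod-stable {x} {y})
                   (λ (_ , h) _ P P′ → prod-unique (prod-nondeg h P) P P′)))
              (classCount-family nonsquares (λ ns → orbit-count (irreducibleOrbit (irreducible-size ns)))
                 (λ {r} _ {x} {y} → ∼-stable {Irreducible-J r} (λ {f} {h} → irreducible-stable {r} {f} {h}) {x} {y})
                 (λ { {r} {r′} {f} _ _ (j , ns , _) (j′ , _) → J-unique {r} {r′} {f} (nonsquare-≢0 ns) j j′ })))
            (_ , five-reps , refl)))
        where
        arithmetic : ∀ K → K ℕ.+ 1 ≡ half → m ℕ.+ K ℕ.+ half ℕ.+ 5 ≡ 2 ℕ.* order ℕ.+ 2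
        arithmetic K e = trans (ℕSolver.solve 3 (λ m K h → m ℕ⊕ K ℕ⊕ h ℕ⊕ ℕ# 5 ℕ≐ m ℕ⊕ ((K ℕ⊕ ℕ# 1) ℕ⊕ h) ℕ⊕ ℕ# 4) refl m K half)
          (trans (cong (λ u → m ℕ.+ u ℕ.+ 4) (trans (cong (ℕ._+ half) e) (sym m≡half+half)))
            (trans (ℕSolver.solve 1 (λ m → m ℕ⊕ m ℕ⊕ ℕ# 4 ℕ≐ ℕ# 2 ℕ⊗ (ℕ# 1 ℕ⊕ m) ℕ⊕ ℕ# 2) refl m) (cong (λ q → 2 ℕ.* q ℕ.+ 2) (sym order≡m+1))))

  opaque
    not-𝓕₁ : ∀ {f i} → Card (Root f) (suc (suc i)) → ¬ 𝓕₁ f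
    not-𝓕₁ {f} c h = let P , _ , unique = 𝓕₁-unique-root {f} h in
      case card-≤ c (card-single P) (λ {P′} z → unique P′ z) of λ { (ℕ.s≤s ()) }

    not-𝓕₄ : ∀ {f} → NonDeg f → Card (Root f) 1 → ¬ 𝓕₄ f
    not-𝓕₄ {f} nd c h = let P , P′ , z , z′ , P≢P′ = 𝓕₄-distinct-roots {f} nd h in
      case card-≤ {P = λ x → x ≡ P ⊎ x ≡ P′} (card (P ∷ P′ ∷ []) ((P≢P′ ∷ []) ∷ [] ∷ []) (λ { (here refl) → inj₁ refl ; (there (here refl)) → inj₂ refl })
                     (λ { (inj₁ e) → here e ; (inj₂ e) → there (here e) }) refl) c
             (λ { (inj₁ refl) → z ; (inj₂ refl) → z′ }) of λ { (ℕ.s≤s ()) }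

    -- Two data separate the types of forms with a root: Δ is a nonsquare for `𝓕₂` and a square for
    -- `𝓕₄`, and having only one root distinguishes `𝓕₁` from `𝓕₄`.
    is-𝓕₁ : ∀ {f} → NonDeg f → Rooted f → IsSquare (Δ f) → Card (Root f) 1 → 𝓕₁ f
    is-𝓕₁ {f} nd rt sq c = [ id , [ (λ h → ⊥-elim (𝓕₂-Δ {f} nd h sq)) , (λ h → ⊥-elim (not-𝓕₄ {f} nd c h)) ]′ ]′ (rooted-trichotomy {f} nd rt)

    is-𝓕₂ : ∀ {f i} → NonDeg f → Rooted f → ¬ IsSquare (Δ f) → Card (Root f) (suc (suc i)) → 𝓕₂ f
    is-𝓕₂ {f} nd rt ns c = [ (λ h → ⊥-elim (not-𝓕₁ {f} c h)) , [ id , (λ h → ⊥-elim (ns (𝓕₄-Δ {f} h))) ]′ ]′ (rooted-trichotomy {f} nd rt)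

    is-𝓕₄ : ∀ {f i} → NonDeg f → Rooted f → IsSquare (Δ f) → Card (Root f) (suc (suc i)) → 𝓕₄ f
    is-𝓕₄ {f} nd rt sq c = [ (λ h → ⊥-elim (not-𝓕₁ {f} c h)) , [ (λ h → ⊥-elim (𝓕₂-Δ {f} nd h sq)) , id ]′ ]′ (rooted-trichotomy {f} nd rt)

    rootedClass-roots : ∀ {r i f} → r ≢ 0# → Card (Root (rootedRep r)) i → RootedClass r f → Card (Root f) i
    rootedClass-roots h c (nd , j , rt) = roots-stable (≋-sym (rooted-orbit h nd j rt)) c

  opaque
    J₁-case : ∀ r → J₁ n r → ClassCount _∼_ (λ f → NonDeg f × ȷ f ≡ r) 1 × (∀ f → NonDeg f → ȷ f ≡ r → OrbitSizeDiv order f 1)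
    J₁-case r (r≢0 , s , refl , h) =
        classCount-⇔ (λ {f} (nd , j , _) → nd , J-ȷ {r} {f} nd j) (λ {f} (nd , e) → class f nd e) (orbit-count (rootedOrbit r≢0)) ,
        λ f nd e → orbit-size {f = f} (rootedOrbit r≢0) (rooted-size r≢0 roots) (class f nd e)
      where
      roots : Card (Root (rootedRep r)) 1
      roots = rootedRep-roots₁ (square-root≢0 r≢0 refl) h
      class : ∀ f → NonDeg f → ȷ f ≡ r → RootedClass r f
      class f nd e = let j = ȷ-J {r} {f} nd e in nd , j , J₁-exhaustion r≢0 roots {f} nd j

    J₂-case : ∀ r → J₂ r →
         ClassCount _∼_ (λ f → NonDeg f × ȷ f ≡ r) 2
         × (∀ f → NonDeg f → ȷ f ≡ r → OrbitSizeDiv order f 2)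
         × ClassCount _∼_ (λ f → NonDeg f × ȷ f ≡ r × OrbitIn 𝓕₂ f) 1
         × ClassCount _∼_ (λ f → NonDeg f × ȷ f ≡ r × OrbitIn 𝓕₂′ f) 1
    J₂-case r (r≢0 , ns) =
        classCount-⇔ (λ {f} → [ (λ (nd , j , _) → nd , J-ȷ {r} {f} nd j) , (λ (j , nsΔ , _) → nonsquare-≢0 nsΔ , J-ȷ {r} {f} (nonsquare-≢0 nsΔ) j) ]′)
          (λ {f} (nd , e) → class f nd e)
          (classCount-⊎ (λ {x} {y} → ∼-stable {Irreducible-J r} (λ {f} {h} → irreducible-stable {r} {f} {h}) {x} {y}) (λ (_ , _ , rt) (_ , _ , nr) → nr rt)
            (orbit-count (rootedOrbit r≢0)) (orbit-count irreducibles)) ,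
        (λ f nd e → [ orbit-size {f = f} (rootedOrbit r≢0) (rooted-size r≢0 roots) , orbit-size {f = f} irreducibles (irreducible-size ns) ]′ (class f nd e)) ,
        type-count {RootedClass r} {𝓕₂} rootedClass-stable (λ (nd , j , _) → nd , j)
          (λ {f} h@(nd , j , rt) → is-𝓕₂ {f} nd rt (J-Δ-nonsquare {r} {f} ns nd j) (rootedClass-roots r≢0 roots h))
          (λ {f} nd j h → nd , j , 𝓕₂-rooted {f} h) (orbit-count (rootedOrbit r≢0)) ,
        type-count {Irreducible-J r} {𝓕₂′} (λ {f} {h} → irreducible-stable {r} {f} {h}) (λ (j , nsΔ , _) → nonsquare-≢0 nsΔ , j)
          (λ {f} (_ , nsΔ , nr) → rootless-𝓕₂′ {f} nsΔ nr)
          (λ {f} nd j h → j , J-Δ-nonsquare {r} {f} ns nd j , 𝓕₂′-rootless {f} h) (orbit-count irreducibles)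
      where
      roots : Card (Root (rootedRep r)) 2
      roots = rootedRep-roots₂ ns
      irreducibles : Orbit (Irreducible-J r)
      irreducibles = irreducibleOrbit (irreducible-size ns)
      class : ∀ f → NonDeg f → ȷ f ≡ r → RootedClass r f ⊎ Irreducible-J r f
      class f nd e = let j = ȷ-J {r} {f} nd e in case rooted? f of λ { (yes rt) → inj₁ (nd , j , rt) ; (no nr) → inj₂ (j , J-Δ-nonsquare {r} {f} ns nd j , nr) }

    J₄-case : ∀ r → J₄ n r →
         ClassCount _∼_ (λ f → NonDeg f × ȷ f ≡ r) 4
         × (∀ f → NonDeg f → ȷ f ≡ r → OrbitSizeDiv order f 4)
         × ClassCount _∼_ (λ f → NonDeg f × ȷ f ≡ r × OrbitIn 𝓕₄ f) 1
         × ClassCount _∼_ (λ f → NonDeg f × ȷ f ≡ r × OrbitIn 𝓕₄′ f) 3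
    J₄-case r (r≢0 , s , refl , tr≡0) =
        classCount-⇔ (λ {f} → [ (λ (nd , j , _) → nd , J-ȷ {r} {f} nd j) , (λ h → let nd , j = product-J {f} h in nd , J-ȷ {r} {f} nd j) ]′)
          (λ {f} (nd , e) → class f nd (ȷ-J {r} {f} nd e))
          (classCount-⊎ (λ {x} {y} → ∼-stable {Products} products-stable {x} {y}) (λ (_ , _ , rt) (_ , _ , P) → prod-rootless P rt)
            (orbit-count (rootedOrbit r≢0)) products) ,
        (λ f nd e → [ orbit-size {f = f} (rootedOrbit r≢0) (rooted-size r≢0 roots) ,
                      (λ (μ , h , P) → orbit-size {f = f} (prodOrbit (ratio-square s≢0 h) (ratio-≢1 h)) (prod-size (ratio-≢0 r≢0 h , ratio-square s≢0 h) (ratio-≢1 h)) P) ]′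
                    (class f nd (ȷ-J {r} {f} nd e))) ,
        type-count {RootedClass r} {𝓕₄} rootedClass-stable (λ (nd , j , _) → nd , j)
          (λ {f} h@(nd , j , rt) → is-𝓕₄ {f} nd rt (J-square {s} {f} s≢0 j) (rootedClass-roots r≢0 roots h))
          (λ {f} nd j h → nd , j , 𝓕₄-rooted {f} nd h) (orbit-count (rootedOrbit r≢0)) ,
        type-count {Products} {𝓕₄′} products-stable (λ {f} → product-J {f}) (λ (_ , _ , P) → prod-𝓕₄′ P)
          (λ {f} nd j h → let μ , P = 𝓕₄′-prod {f} h in μ , J-prod P j , P) products
      where
      s≢0 : s ≢ 0#
      s≢0 = square-root≢0 r≢0 refl
      roots : Card (Root (rootedRep r)) 4
      roots = rootedRep-roots₄ s≢0 tr≡0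
      Products : Quartic → Set
      Products f = ∃[ μ ] (Ratio r μ × Prod μ f)
      products-stable : Stable Products
      products-stable e (μ , h , P) = μ , h , prod-stable e P
      product-J : ∀ {f} → Products f → NonDeg f × J r f
      product-J (μ , h , P) = prod-nondeg (ratio-≢1 h) P , prod-J P h
      products : ClassCount _∼_ Products 3
      products = classCount-family (ratio-card s≢0 tr≡0) (λ h → orbit-count (prodOrbit (ratio-square s≢0 h) (ratio-≢1 h)))
        (λ {μ} _ {x} {y} → ∼-stable {Prod μ} prod-stable {x} {y}) (λ h _ P P′ → prod-unique (prod-nondeg (ratio-≢1 h) P) P P′)
      class : ∀ f → NonDeg f → J r f → RootedClass r f ⊎ Products f
      class f nd j = Sum.map₁ (λ rt → nd , j , rt) (J₄-exhaustion s≢0 tr≡0 {f} nd j)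

    -- `five-reps` lists the orbits in the order of the divisors 3, 4, 4, 8, 24, so the permutation
    -- is the identity.
    zero-case : Σ[ reps ∈ List Quartic ] Σ[ ds ∈ List ℕ ]
         (ClassReps _∼_ (λ f → NonDeg f × ȷ f ≡ 0#) reps
          × ds ↭ (3 ∷ 4 ∷ 4 ∷ 8 ∷ 24 ∷ [])
          × Pointwise (λ f i → OrbitSizeDiv order f i) reps ds)
    zero-case = _ , _ , classReps-⇔ (λ {f} (nd , j) → nd , J-ȷ {0#} {f} nd j) (λ {f} (nd , e) → nd , ȷ-J {0#} {f} nd e) five-reps , ↭-refl ,
      orbit-size oneRootOrbit oneRoot-size ≋-refl ∷
      orbit-size {f = twoRootsRep} twoRootsOrbit twoRoots-size (member twoRootsOrbit) ∷
      orbit-size {f = rep irreducible₀Orbit} irreducible₀Orbit irreducible-size-0 (member irreducible₀Orbit) ∷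
      orbit-size prod₀Orbit prod-size-0 (member prod₀Orbit) ∷
      orbit-size fourRootsOrbit fourRoots-size ≋-refl ∷ []

    zero-𝓕₁ : ClassCount _∼_ (λ f → NonDeg f × ȷ f ≡ 0# × OrbitIn 𝓕₁ f) 1
    zero-𝓕₁ = type-count {_≋ oneRootRep} {𝓕₁} (stable oneRootOrbit) (λ {f} h → five-J {f} (inj₁ h))
      (λ {f} h → is-𝓕₁ {f} (nondeg oneRootOrbit h) (oneRoot-rooted h) (oneRoot-square h) (roots-stable (≋-sym h) oneRoot-card))
      (λ {f} nd j h → from f h (𝓕₁-rooted {f} h) (J-five {f} nd j)) (orbit-count oneRootOrbit)
      where
      from : ∀ f → 𝓕₁ f → Rooted f → Five f → f ≋ oneRootRep
      from f h rt (inj₁ e) = e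
      from f h rt (inj₂ (inj₁ (z , ns , _))) = ⊥-elim (not-𝓕₁ {f} (roots-stable (≋-sym (twoRoots-orbit {f} ns (mid≡0-J {f} z) rt)) twoRoots-card) h)
      from f h rt (inj₂ (inj₂ (inj₁ (_ , _ , nr)))) = ⊥-elim (nr rt)
      from f h rt (inj₂ (inj₂ (inj₂ (inj₁ P)))) = ⊥-elim (prod-rootless P rt)
      from f h rt (inj₂ (inj₂ (inj₂ (inj₂ e)))) = ⊥-elim (not-𝓕₁ {f} (roots-stable (≋-sym e) fourRoots-card) h)

    zero-𝓕₂ : ClassCount _∼_ (λ f → NonDeg f × ȷ f ≡ 0# × OrbitIn 𝓕₂ f) 1
    zero-𝓕₂ = type-count {TwoRoots} {𝓕₂} (λ {f} {h} → twoRoots-stable {f} {h}) (λ {f} h → five-J {f} (inj₂ (inj₁ h)))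
      (λ {f} (z , ns , rt) → is-𝓕₂ {f} (nonsquare-≢0 ns) rt ns (roots-stable (≋-sym (twoRoots-orbit {f} ns (mid≡0-J {f} z) rt)) twoRoots-card))
      (λ {f} nd j h → J-mid≡0 {f} j , 𝓕₂-Δ {f} nd h , 𝓕₂-rooted {f} h) (orbit-count twoRootsOrbit)

    zero-𝓕₄ : ClassCount _∼_ (λ f → NonDeg f × ȷ f ≡ 0# × OrbitIn 𝓕₄ f) 1
    zero-𝓕₄ = type-count {_≋ fourRootsRep} {𝓕₄} (stable fourRootsOrbit) (λ {f} h → five-J {f} (inj₂ (inj₂ (inj₂ (inj₂ h)))))
      (λ {f} h → is-𝓕₄ {f} (nondeg fourRootsOrbit h) (fourRoots-rooted h) (fourRoots-square h) (roots-stable (≋-sym h) fourRoots-card))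
      (λ {f} nd j h → [ id , (λ e → ⊥-elim (not-𝓕₄ {f} nd (roots-stable (≋-sym e) oneRoot-card) h)) ]′ (square-orbits {f} nd (𝓕₄-Δ {f} h) j (𝓕₄-rooted {f} nd h)))
      (orbit-count fourRootsOrbit)

    zero-𝓕₂′ : ClassCount _∼_ (λ f → NonDeg f × ȷ f ≡ 0# × OrbitIn 𝓕₂′ f) 1
    zero-𝓕₂′ = type-count {Irreducible-J 0#} {𝓕₂′} (λ {f} {h} → irreducible-stable {0#} {f} {h}) (λ (j , ns , _) → nonsquare-≢0 ns , j)
      (λ {f} (_ , ns , nr) → rootless-𝓕₂′ {f} ns nr)
      (λ {f} nd j h → j , (λ sq → [ 𝓕₂′-rootless {f} h , 𝓕₂′-not-prod {0#} {f} h ]′ (square-exhaustion {f} j nd sq)) , 𝓕₂′-rootless {f} h)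
      (orbit-count irreducible₀Orbit)

    zero-𝓕₄′ : ClassCount _∼_ (λ f → NonDeg f × ȷ f ≡ 0# × OrbitIn 𝓕₄′ f) 1
    zero-𝓕₄′ = type-count {Prod 0#} {𝓕₄′} prod-stable (λ P → prod-nondeg 0≢1 P , prod₀-J P) prod-𝓕₄′
      (λ {f} nd j h → [ (λ rt → ⊥-elim (prod-rootless (proj₂ (𝓕₄′-prod {f} h)) rt)) , id ]′ (square-exhaustion {f} j nd (prod-Δ-square (proj₂ (𝓕₄′-prod {f} h)))))
      (orbit-count prod₀Orbit)

open import Data.Nat using (_+_; _*_; _^_; _∸_)

theorem1p5 : (F : Field) (n : ℕ) → HasSize F (3 ^ n) →
  let open Field F using (0#)
      open Theory F
      q = 3 ^ n
  in
  -- the projective quartic forms with Δ ≠ 0: q⁴ - q² of them, 2q + 2 orbits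
  ClassCount _≈ₚ_ NonDeg (q ^ 4 ∸ q ^ 2)
  × ClassCount _∼_ NonDeg (2 * q + 2)
  -- (i), i = 1
  × (∀ r → J₁ n r →
       ClassCount _∼_ (λ f → NonDeg f × ȷ f ≡ r) 1
       × (∀ f → NonDeg f → ȷ f ≡ r → OrbitSizeDiv q f 1))
  -- (i), i = 2
  × (∀ r → J₂ r →
       ClassCount _∼_ (λ f → NonDeg f × ȷ f ≡ r) 2
       × (∀ f → NonDeg f → ȷ f ≡ r → OrbitSizeDiv q f 2)
       × ClassCount _∼_ (λ f → NonDeg f × ȷ f ≡ r × OrbitIn 𝓕₂ f) 1
       × ClassCount _∼_ (λ f → NonDeg f × ȷ f ≡ r × OrbitIn 𝓕₂′ f) 1)
  -- (i), i = 4
  × (∀ r → J₄ n r →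
       ClassCount _∼_ (λ f → NonDeg f × ȷ f ≡ r) 4
       × (∀ f → NonDeg f → ȷ f ≡ r → OrbitSizeDiv q f 4)
       × ClassCount _∼_ (λ f → NonDeg f × ȷ f ≡ r × OrbitIn 𝓕₄ f) 1
       × ClassCount _∼_ (λ f → NonDeg f × ȷ f ≡ r × OrbitIn 𝓕₄′ f) 3)
  -- (ii), ȷ = 0: five orbits with sizes |G|/3, |G|/4, |G|/4, |G|/8, |G|/24
  × (Σ[ reps ∈ List Quartic ] Σ[ ds ∈ List ℕ ]
       (ClassReps _∼_ (λ f → NonDeg f × ȷ f ≡ 0#) reps
        × ds ↭ (3 ∷ 4 ∷ 4 ∷ 8 ∷ 24 ∷ [])
        × Pointwise (λ f i → OrbitSizeDiv q f i) reps ds))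
  × ClassCount _∼_ (λ f → NonDeg f × ȷ f ≡ 0# × OrbitIn 𝓕₁ f) 1
  × ClassCount _∼_ (λ f → NonDeg f × ȷ f ≡ 0# × OrbitIn 𝓕₂ f) 1
  × ClassCount _∼_ (λ f → NonDeg f × ȷ f ≡ 0# × OrbitIn 𝓕₄ f) 1
  × ClassCount _∼_ (λ f → NonDeg f × ȷ f ≡ 0# × OrbitIn 𝓕₂′ f) 1
  × ClassCount _∼_ (λ f → NonDeg f × ȷ f ≡ 0# × OrbitIn 𝓕₄′ f) 1
theorem1p5 F n hs =
    forms-count , orbits-count , J₁-case , J₂-case , J₄-case , zero-case ,
    zero-𝓕₁ , zero-𝓕₂ , zero-𝓕₄ , zero-𝓕₂′ , zero-𝓕₄′
  where open Classification F n hs
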